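{- Let $G$ be a weighted graph (the communication network) and $T\subseteq G$ a rooted spanning tree of $G$ consisting of a root $r$ and two descending paths $P$ and $Q$. There exists a deterministic $\tilde O(1)$-round Minor-Aggregation algorithm on $G$ that computes the minimum of the 1-respecting cut values $\min_{e\in E(P)\cup E(Q)}\mathrm{Cut}_{T,G}(e)$ and the 2-respecting cut values $\min_{e\in E(P),f\in E(Q)}\mathrm{Cut}_{T,G}(e,f)$.
   Context: Minor-Aggregation model. The communication network is a connected undirected graph $G=(V,E)$ with $n=|V|$ nodes; both nodes and edges are computational units with private memory. Initially nodes know only their unique $\tilde O(1)$-bit ID (and inputs) and edges know the IDs of their endpoints. Computation proceeds in synchronous rounds, each of three steps: (i) Contraction: each edge $e$ chooses $c_e\in\{\bot,\top\}$, defining the minor $G'=G/\{e:c_e=\top\}$ (self-loops removed), whose vertices (supernodes) are identified with the sets of nodes they contain. (ii) Consensus: each node $v$ chooses an $\tilde O(1)$-bit value $x_v$; for each supernode $s$ all nodes of $s$ learn $y_s=\bigoplus_{v\in s}x_v$ for a predefined aggregation operator $\bigoplus$. (iii) Aggregation: each edge $e$ of $G'$ joining supernodes $a,b$ learns $y_a,y_b$ and chooses $\tilde O(1)$-bit values $z_{e,a},z_{e,b}$; all nodes of each supernode $s$ learn the same aggregate $\bigotimes_{e \text{ incident to } s} z_{e,s}$ for a predefined aggregation operator $\bigotimes$. An aggregation operator maps two $B$-bit messages ($B=\tilde O(1)$) to one $B$-bit message, applied pairwise in arbitrary order to aggregate several messages. $\tilde O(\cdot)$ hides $\mathrm{poly}(\log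 n)$ factors. Inputs are distributedly stored: each edge knows its weight (positive integers bounded by $\mathrm{poly}(n)$) and whether it is in $T$, and each tree edge knows which endpoint is closer to the root; the output is learned by all nodes. A descending path is a path $(v_1,\dots,v_k)$ in the rooted tree with each $v_{i+1}$ a child of $v_i$. For tree edges $e,f$: $\mathrm{Cut}_{T,G}(e)$ is the total weight of edges $\{u,v\}\in E(G)$ whose unique $u$–$v$ path in $T$ contains $e$; $\mathrm{Cut}_{T,G}(e,f)$ is the total weight of edges $\{u,v\}\in E(G)$ whose unique $u$–$v$ path in $T$ contains exactly one of $e,f$. -}

module Defs where

open import Data.Nat using (ℕ; zero; suc; _+_; _*_; _^_; _≤_; _<_)
open import Data.Nat.Logarithm using (⌊log₂_⌋)
open import Data.Fin using (Fin)
open import Data.Bool using (Bool; true; false; if_then_else_)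
open import Data.List using (List; []; _∷_; _++_; map; allFin)
open import Data.Nat.ListAction using (sum)
open import Data.List.Membership.Propositional using (_∈_)
open import Data.List.Relation.Unary.Unique.Propositional using (Unique)
open import Data.List.Relation.Binary.Permutation.Propositional using (_↭_)
open import Data.Maybe using (Maybe; just; nothing)
open import Data.Product using (Σ; ∃; _×_; _,_; proj₁; proj₂)
open import Data.Sum using (_⊎_)
open import Relation.Nullary using (¬_)
open import Relation.Binary.PropositionalEquality using (_≡_; _≢_)
open import Relation.Binary.Construct.Closure.ReflexiveTransitive using (Star)
open import Function.Bundles using (_⇔_)
open import Function.Definitions using (Injective)

data Consec {A : Set} (x y : A) : List A → Set where
  here  : ∀ {zs} → Consec x y (x ∷ y ∷ zs)
  there : ∀ {z zs} → Consec x y zs → Consec x y (z ∷ zs)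

data IsWalk {A : Set} (R : A → A → Set) : A → A → List A → Set where
  single : ∀ {x} → IsWalk R x x (x ∷ [])
  step   : ∀ {x y z xs} → R x y → IsWalk R y z (y ∷ xs) → IsWalk R x z (x ∷ y ∷ xs)

Xor : Set → Set → Set
Xor A B = (A × ¬ B) ⊎ (¬ A × B)

plog : ℕ → ℕ → ℕ
plog c n = c * (suc ⌊log₂ n ⌋) ^ c

-- Aggregation of a nonempty multiset of messages by a binary operator,
-- applied pairwise in ARBITRARY order (any bracketing, any permutation).
-- AggR op xs y : y is one possible outcome.

data AggR (op : ℕ → ℕ → ℕ) : List ℕ → ℕ → Set where
  leaf : ∀ x → AggR op (x ∷ []) x
  node : ∀ {xs ys zs a b} → xs ↭ ys ++ zs →
         AggR op ys a → AggR op zs b → AggR op xs (op a b)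

data AggM (op : ℕ → ℕ → ℕ) : List ℕ → Maybe ℕ → Set where
  none : AggM op [] nothing
  some : ∀ {xs y} → AggR op xs y → AggM op xs (just y)

record Edge (n : ℕ) : Set where
  field
    end₁ end₂ : Fin n   -- for tree edges, end₁ is the parent (closer to the root)
    weight    : ℕ
    inTree    : Bool

record Instance : Set where
  field
    n m   : ℕ
    ident : Fin n → ℕ
    edge  : Fin m → Edge n

module InstanceDefs (I : Instance) where
  open Instance I public
  open Edge

  e₁ e₂ : Fin m → Fin n
  e₁ e = end₁ (edge e)
  e₂ e = end₂ (edge e)

  w : Fin m → ℕ
  w e = weight (edge e)

  IsTree : Fin m → Set
  IsTree e = inTree (edge e) ≡ true

  Joins : Fin m → Fin n → Fin n → Set
  Joins e u v = (e₁ e ≡ u × e₂ e ≡ v) ⊎ (e₁ e ≡ v × e₂ e ≡ u)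

  Valid : ℕ → Set
  Valid d = (2 ≤ n)
          × Injective _≡_ _≡_ ident
          × (∀ v → ident v < 2 ^ plog d n)
          × (∀ e → e₁ e ≢ e₂ e)
          × (∀ e f → e ≢ f → ¬ Joins f (e₁ e) (e₂ e))
          × (∀ e → 1 ≤ w e × w e ≤ n ^ d)

  TreeAdj : Fin n → Fin n → Set
  TreeAdj u v = ∃ λ e → IsTree e × Joins e u v

  TreePath : Fin n → Fin n → List (Fin n) → Set
  TreePath u v L = IsWalk TreeAdj u v L × Unique L

  OnPath : Fin m → Fin n → Fin n → Set
  OnPath e u v = ∃ λ L → TreePath u v L × (Consec (e₁ e) (e₂ e) L ⊎ Consec (e₂ e) (e₁ e) L)

  wsum : (Fin m → Bool) → ℕ
  wsum χ = sum (map (λ g → if χ g then w g else 0) (allFin m))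

  Cut₁ : Fin m → ℕ → Set
  Cut₁ e x = Σ (Fin m → Bool) λ χ →
    (∀ g → (χ g ≡ true) ⇔ OnPath e (e₁ g) (e₂ g)) × x ≡ wsum χ

  Cut₂ : Fin m → Fin m → ℕ → Set
  Cut₂ e f x = Σ (Fin m → Bool) λ χ →
    (∀ g → (χ g ≡ true) ⇔ Xor (OnPath e (e₁ g) (e₂ g)) (OnPath f (e₁ g) (e₂ g))) × x ≡ wsum χ

  Descending : List (Fin n) → Set
  Descending L = ∀ x y → Consec x y L → ∃ λ e → IsTree e × e₁ e ≡ x × e₂ e ≡ y

  PathEdge : List (Fin n) → Fin m → Set
  PathEdge L e = IsTree e × Consec (e₁ e) (e₂ e) L

  Spider : Fin n → List (Fin n) → List (Fin n) → Set
  Spider r ps qs = Descending (r ∷ ps) × Descending (r ∷ qs)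
                 × Unique (r ∷ ps ++ qs)
                 × (∀ v → v ∈ r ∷ ps ++ qs)
                 × (∀ e → IsTree e → PathEdge (r ∷ ps) e ⊎ PathEdge (r ∷ qs) e)

  IsAnswer : Fin n → List (Fin n) → List (Fin n) → ℕ → Set
  IsAnswer r ps qs x =
      (∀ e → PathEdge (r ∷ ps) e ⊎ PathEdge (r ∷ qs) e → ∀ y → Cut₁ e y → x ≤ y)
    × (∀ e f → PathEdge (r ∷ ps) e → PathEdge (r ∷ qs) f → ∀ y → Cut₂ e f y → x ≤ y)
    × ((∃ λ e → (PathEdge (r ∷ ps) e ⊎ PathEdge (r ∷ qs) e) × Cut₁ e x)
       ⊎ (∃ λ e → ∃ λ f → PathEdge (r ∷ ps) e × PathEdge (r ∷ qs) f × Cut₂ e f x))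

-- Deterministic Minor-Aggregation algorithms.
-- Local states are arbitrary (unbounded private memory); all local
-- computations are functions of the local state and the round number.

record Algorithm : Set₁ where
  field
    NState EState : Set
    initN    : ℕ → NState                      -- node knows its ID
    initE    : ℕ → ℕ → ℕ → Bool → EState       -- ID of end₁ (parent if tree edge), ID of end₂, weight, in T
    contract : ℕ → EState → Bool
    consMsg  : ℕ → NState → ℕ
    opC      : ℕ → ℕ → ℕ → ℕ                   -- predefined ⊕ (per round)
    updE     : ℕ → EState → Maybe (ℕ × ℕ) → EState   -- edge of G' learns (y_a , y_b)
    aggMsg   : ℕ → EState → ℕ × ℕ              -- (iii) (z_{e,a} , z_{e,b}), a ∋ end₁, b ∋ end₂
    opA      : ℕ → ℕ → ℕ → ℕ                   -- predefined ⊗ (per round)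
    updN     : ℕ → NState → ℕ → Maybe ℕ → NState   -- node learns y_s and the aggregate
    output   : NState → Maybe ℕ

module ExecDefs (A : Algorithm) (I : Instance) where
  open Algorithm A
  open InstanceDefs I

  Contr : (ℕ → Fin m → EState) → ℕ → Fin m → Set
  Contr est t e = contract t (est t e) ≡ true

  Super : (ℕ → Fin m → EState) → ℕ → Fin n → Fin n → Set
  Super est t = Star (λ u v → ∃ λ e → Contr est t e × Joins e u v)

  InMinor : (ℕ → Fin m → EState) → ℕ → Fin m → Set
  InMinor est t e = (contract t (est t e) ≡ false) × ¬ Super est t (e₁ e) (e₂ e)

  pickEnd : Fin m → Bool → Fin n
  pickEnd e b = if b then e₁ e else e₂ e

  record Execution : Set where
    field
      nst : ℕ → Fin n → NState
      est : ℕ → Fin m → EState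
      yv  : ℕ → Fin n → ℕ
      gv  : ℕ → Fin n → Maybe ℕ
      init-n : ∀ v → nst 0 v ≡ initN (ident v)
      init-e : ∀ e → est 0 e ≡ initE (ident (e₁ e)) (ident (e₂ e)) (w e) (Edge.inTree (edge e))
      consensus : ∀ t v → Σ (List (Fin n)) λ L →
        (Unique L × (∀ u → (u ∈ L) ⇔ Super est t v u))
        × AggR (opC t) (map (λ u → consMsg t (nst t u)) L) (yv t v)
      consensus-same : ∀ t u v → Super est t u v → yv t u ≡ yv t v
      edge-learn : ∀ t e →
          (InMinor est t e → est (suc t) e ≡ updE t (est t e) (just (yv t (e₁ e) , yv t (e₂ e))))
        × (¬ InMinor est t e → est (suc t) e ≡ updE t (est t e) nothing)
      aggregation : ∀ t v → Σ (List (Fin m × Bool)) λ L →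
        (Unique L × (∀ e b → ((e , b) ∈ L) ⇔ (InMinor est t e × Super est t v (pickEnd e b))))
        × AggM (opA t)
               (map (λ p → if proj₂ p then proj₁ (aggMsg t (est (suc t) (proj₁ p)))
                                      else proj₂ (aggMsg t (est (suc t) (proj₁ p)))) L)
               (gv t v)
      aggregation-same : ∀ t u v → Super est t u v → gv t u ≡ gv t v
      node-update : ∀ t v → nst (suc t) v ≡ updN t (nst t v) (yv t v) (gv t v)

  BitBounded : ℕ → Execution → Set
  BitBounded b ex = (∀ t v → consMsg t (nst t v) < 2 ^ b)
    × (∀ t e → InMinor est t e → proj₁ (aggMsg t (est (suc t) e)) < 2 ^ b
                                × proj₂ (aggMsg t (est (suc t) e)) < 2 ^ b)
    × (∀ t x y → x < 2 ^ b → y < 2 ^ b → opC t x y < 2 ^ b × opA t x y < 2 ^ b)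
    where open Execution ex

  Solves : (ℕ → Set) → ℕ → Execution → Set
  Solves Ans R ex = (∀ t v x → output (nst t v) ≡ just x → Ans x)
    × (Σ ℕ λ t → t ≤ R × (∀ v → Σ ℕ λ x → output (nst t v) ≡ just x))
    where open Execution ex

{-# OPTIONS --safe #-}

-- Number the edges of each leg by their distance from its end. With X the values of single
-- cuts and W p q the weight between the lowest p nodes of leg 1 and the lowest q nodes of
-- leg 2, the value of a pair is C i j = X i + X j − 2 W (i , j), and W is supermodular. So if
-- j* is the best column for a row p, a pair (i , j) with i, j on opposite sides of (p , j*) is
-- no better than (i , j*): a rectangle of candidate pairs splits at a pivot row into two, and
-- a rectangle not met by any edge of G can be dropped.
--
-- Balanced pivots come from ranking the leg edges. Segments of contracted edges start as
-- single nodes; looking at the binary digits of their maximal identifiers, one digit at a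
-- time, every segment is merged with a neighbour within O(log n) steps, so O(log n) phases and
-- O(log² n) ranks suffice. Between two edges of equal rank there is one of larger rank, so
-- running through the ranks downwards visits every row as a pivot, and contracting edges in
-- the order of their ranks computes all suffix sums along the legs. All rectangles of a
-- level are processed at once, each as one supernode.

module Submission where

open import Defs
open import Data.Nat using (ℕ; zero; suc; _+_; _*_; _∸_; _^_; _≤_; _<_; _⊔_; _⊓_; z≤n; s≤s; ⌊_/2⌋; NonZero; _≡ᵇ_; _≤ᵇ_; _/_; _%_)
open import Data.Nat.Properties
open import Data.Nat.DivMod using ([m+kn]%n≡m%n; m<n⇒m%n≡m; +-distrib-/; m<n⇒m/n≡0; m*n/n≡m; m*n%n≡0)
open import Data.Nat.Logarithm using (⌊log₂_⌋; ⌊log₂⌋-mono-≤; ⌊log₂[2^n]⌋≡n; ⌊log₂⌊n/2⌋⌋≡⌊log₂n⌋∸1)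
open import Data.Nat.Induction using (<-rec)
open import Data.Nat.ListAction using (sum)
open import Data.Nat.ListAction.Properties using (sum-++; sum-↭)
open import Data.Nat.Solver using (module +-*-Solver)
open import Data.Fin using (Fin; zero; suc; fromℕ<; combine)
import Data.Fin.Properties as F
import Data.Bool as Bool
open import Data.Bool using (Bool; true; false; if_then_else_; not; _∧_; _∨_) renaming (T to So)
open import Data.List using (List; []; _∷_; _++_; map; allFin; filter; tabulate; cartesianProduct; length)
open import Data.List.Properties using (map-++; map-tabulate; map-cong; map-∘; length-++)
open import Data.List.Membership.Propositional using (_∈_)
import Data.List.Membership.DecPropositional as DecMembership
open import Data.List.Membership.Propositional.Properties using (∈-map⁻; ∈-map⁺; ∈-allFin; ∈-filter⁺; ∈-filter⁻; ∈-cartesianProduct⁺; ∈-++⁻; ∈-++⁺ˡ; ∈-++⁺ʳ)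
open import Data.List.Membership.Propositional.Properties.WithK using (unique∧set⇒bag)
open import Data.List.Relation.Binary.BagAndSetEquality using (∼bag⇒↭)
open import Data.List.Relation.Unary.Any using (here; there)
open import Data.List.Relation.Unary.All using (All; []; _∷_)
import Data.List.Relation.Unary.All as All
import Data.List.Relation.Unary.All.Properties as AllP
import Data.List.Relation.Unary.AllPairs as AP
open import Data.List.Relation.Unary.Unique.Propositional using (Unique)
import Data.List.Relation.Unary.Unique.Propositional.Properties as UniqueP
open import Data.List.Relation.Binary.Permutation.Propositional using (_↭_; ↭-sym)
open import Data.List.Relation.Binary.Permutation.Propositional.Properties using (All-resp-↭; ∈-resp-↭) renaming (map⁺ to ↭-map⁺)
open import Data.Maybe using (Maybe; just; nothing)
open import Data.Product using (Σ; ∃; _×_; _,_; proj₁; proj₂)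
open import Data.Sum using (_⊎_; inj₁; inj₂; [_,_]′)
open import Data.Unit using (⊤; tt)
open import Data.Empty using (⊥; ⊥-elim)
open import Relation.Nullary using (¬_; Dec; yes; no; does)
open import Relation.Nullary.Decidable using (_×-dec_; _⊎-dec_; _→-dec_; ¬?; map′)
open import Relation.Binary.PropositionalEquality
open import Relation.Binary.Construct.Closure.ReflexiveTransitive using (Star; ε; _◅_; _◅◅_; gmap)
open import Function.Bundles using (_⇔_; mk⇔; Equivalence)
open import Function using (_∘_; case_of_; id)
open import Relation.Binary.Definitions using (Tri; tri<; tri≈; tri>)
open Equivalence using (to; from)

-- Powers of two and saturating addition

-- The main obstacle is simultaneity. Rectangles can be treated at once only if each is connected by
-- itself, and in `T` its rows meet its columns only through the root, which different rectangles
-- cannot share. The connection has to be an edge of `G` from a row to a column of the rectangle.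
-- Where there is none, the rectangle is finished: the defect of modularity of `W` on a rectangle is
-- the weight of the edges inside it (`monge`), so without such edges the comparison made in the
-- pivot row holds in its other rows too, and their pairs with `j*` have been recorded. The second
-- obstacle is that nodes do not know `n` and that operators may depend on the round only. The
-- maximal identifier `M`, found in the first round, bounds `n` and has polylogarithmic length.
-- Register width and schedule are functions of `M`, and summands carry a leading bit that shows the
-- operator their width. Ranks come before positions and cut values because these are themselves
-- suffix sums.

n<2^sL : ∀ n → n < 2 ^ suc ⌊log₂ n ⌋
n<2^sL n = ≰⇒> λ le → <-irrefl refl
  (subst (_≤ ⌊log₂ n ⌋) (⌊log₂[2^n]⌋≡n (suc ⌊log₂ n ⌋)) (⌊log₂⌋-mono-≤ le))

2*⌊/2⌋≤ : ∀ n → 2 * ⌊ n /2⌋ ≤ n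
2*⌊/2⌋≤ zero = z≤n
2*⌊/2⌋≤ (suc zero) = z≤n
2*⌊/2⌋≤ (suc (suc n)) = subst (_≤ suc (suc n)) (sym (cong suc (+-suc ⌊ n /2⌋ (⌊ n /2⌋ + 0)))) (s≤s (s≤s (2*⌊/2⌋≤ n)))

2^L≤n : ∀ n → 1 ≤ n → 2 ^ ⌊log₂ n ⌋ ≤ n
2^L≤n = <-rec _ go
  where
  go : ∀ n → (∀ {k} → k < n → 1 ≤ k → 2 ^ ⌊log₂ k ⌋ ≤ k) → 1 ≤ n → 2 ^ ⌊log₂ n ⌋ ≤ n
  go (suc zero) rec le = ≤-refl
  go n@(suc (suc k)) rec le = aux ⌊log₂ n ⌋ refl
    where
    aux : ∀ l → ⌊log₂ n ⌋ ≡ l → 2 ^ l ≤ n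
    aux zero eq = s≤s z≤n
    aux (suc l) eq = ≤-trans (*-monoʳ-≤ 2 (subst (λ x → 2 ^ x ≤ ⌊ n /2⌋) eq' (rec (⌊n/2⌋<n (suc k)) (s≤s z≤n)))) (2*⌊/2⌋≤ n)
      where
      eq' : ⌊log₂ ⌊ n /2⌋ ⌋ ≡ l
      eq' = trans (⌊log₂⌊n/2⌋⌋≡⌊log₂n⌋∸1 n) (cong (_∸ 1) eq)

1≤2^ : ∀ k → 1 ≤ 2 ^ k
1≤2^ k = m^n>0 2 k

2^-mono : ∀ a b → a ≤ b → 2 ^ a ≤ 2 ^ b
2^-mono a b le = ^-monoʳ-≤ 2 le

log-unique : ∀ K a → a < 2 ^ K → ⌊log₂ (2 ^ K + a) ⌋ ≡ K
log-unique K a a< = ≤-antisym (≤-pred up) lo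
  where
  lo : K ≤ ⌊log₂ (2 ^ K + a) ⌋
  lo = subst (_≤ ⌊log₂ (2 ^ K + a) ⌋) (⌊log₂[2^n]⌋≡n K) (⌊log₂⌋-mono-≤ {2 ^ K} {2 ^ K + a} (m≤m+n _ a))
  up : ⌊log₂ (2 ^ K + a) ⌋ < suc K
  up = ≰⇒> λ le → <-irrefl refl (begin-strict
      2 ^ K + a             <⟨ +-monoʳ-< (2 ^ K) a< ⟩
      2 ^ K + 2 ^ K         ≡⟨ cong (2 ^ K +_) (sym (+-identityʳ _)) ⟩
      2 ^ suc K             ≤⟨ ^-monoʳ-≤ 2 le ⟩
      2 ^ ⌊log₂ (2 ^ K + a) ⌋ ≤⟨ 2^L≤n _ (≤-trans (1≤2^ K) (m≤m+n _ a)) ⟩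
      2 ^ K + a             ∎)
    where open ≤-Reasoning

cap : ℕ → ℕ → ℕ
cap K x = x ⊓ (2 ^ K ∸ 1)

cap< : ∀ K x → cap K x < 2 ^ K
cap< K x = ≤-<-trans (m⊓n≤n x _) (≤-reflexive (trans (+-comm 1 _) (m∸n+n≡m (1≤2^ K))))

cap-id : ∀ K {x} → x < 2 ^ K → cap K x ≡ x
cap-id K lt = m≤n⇒m⊓n≡m (∸-monoˡ-≤ 1 lt)

cap-cap : ∀ K x → cap K (cap K x) ≡ cap K x
cap-cap K x = cap-id K (cap< K x)

-- Once one summand is clipped, the total is clipped as well. Partial sums may therefore be clipped
-- under any bracketing without changing the clipped total.
cap-+ : ∀ K a b → cap K (cap K a + cap K b) ≡ cap K (a + b)
cap-+ K a b with ≤-total a (2 ^ K ∸ 1) | ≤-total b (2 ^ K ∸ 1)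
... | inj₁ p | inj₁ q = cong (cap K) (cong₂ _+_ (m≤n⇒m⊓n≡m p) (m≤n⇒m⊓n≡m q))
... | inj₂ p | _ = trans (m≥n⇒m⊓n≡n (≤-trans (≤-reflexive (sym (m≥n⇒m⊓n≡n p))) (m≤m+n _ _)))
                         (sym (m≥n⇒m⊓n≡n (≤-trans p (m≤m+n _ _))))
... | inj₁ _ | inj₂ q = trans (m≥n⇒m⊓n≡n (≤-trans (≤-reflexive (sym (m≥n⇒m⊓n≡n q))) (m≤n+m _ _)))
                         (sym (m≥n⇒m⊓n≡n (≤-trans q (m≤n+m _ _))))

-- On operands 2 ^ K + a and 2 ^ K + b with a , b < 2 ^ K this adds a and b and
-- saturates below 2 ^ K; it never increases the bit length of its operands,
-- whatever K is, so it is a legal aggregation operator without knowing n.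
satAdd : ℕ → ℕ → ℕ
satAdd x y = (x + (y ∸ p)) ⊓ (2 * p ∸ 1)
  where p = 2 ^ ⌊log₂ (x ⊔ y) ⌋

-- The result stays below the first power of two above the larger operand, and `2 ^ b` is at least
-- that power. The cases with zeros are separate because `2^L≤n` wants a positive argument.
satAdd< : ∀ b x y → x < 2 ^ b → y < 2 ^ b → satAdd x y < 2 ^ b
satAdd< b zero zero _ _ = 1≤2^ b
satAdd< b x@(suc _) y x< y< = satAdd<' b x y (≤-trans (s≤s z≤n) (m≤m⊔n x y)) x< y<
  where
  satAdd<' : ∀ b x y → 1 ≤ x ⊔ y → x < 2 ^ b → y < 2 ^ b → satAdd x y < 2 ^ b
  satAdd<' b x y pos x< y< = <-≤-trans (≤-<-trans (m⊓n≤n (x + _) _) lt) le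
    where
    p = 2 ^ ⌊log₂ (x ⊔ y) ⌋
    lt : 2 * p ∸ 1 < 2 * p
    lt = ≤-reflexive (trans (+-comm 1 _) (m∸n+n≡m (1≤2^ (suc ⌊log₂ (x ⊔ y) ⌋))))
    le : 2 * p ≤ 2 ^ b
    le = 2^-mono (suc ⌊log₂ (x ⊔ y) ⌋) b (≰⇒> λ b≤ → <-irrefl refl
           (<-≤-trans (⊔-lub x< y<) (≤-trans (2^-mono b ⌊log₂ (x ⊔ y) ⌋ b≤) (2^L≤n _ pos))))
satAdd< b zero y@(suc _) x< y< = <-≤-trans (≤-<-trans (m⊓n≤n (y ∸ p) _) lt) le
  where
  p = 2 ^ ⌊log₂ y ⌋
  lt : 2 * p ∸ 1 < 2 * p
  lt = ≤-reflexive (trans (+-comm 1 _) (m∸n+n≡m (1≤2^ (suc ⌊log₂ y ⌋))))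
  le : 2 * p ≤ 2 ^ b
  le = 2^-mono (suc ⌊log₂ y ⌋) b (≰⇒> λ b≤ → <-irrefl refl
         (<-≤-trans y< (≤-trans (2^-mono b ⌊log₂ y ⌋ b≤) (2^L≤n _ (s≤s z≤n)))))

-- The logarithm of the larger operand reveals `K`. Removing the mark of one operand leaves exactly
-- one mark in the result.
satAdd-marked : ∀ K a b → a < 2 ^ K → b < 2 ^ K →
  satAdd (2 ^ K + a) (2 ^ K + b) ≡ 2 ^ K + cap K (a + b)
satAdd-marked K a b a< b< = begin
  (2 ^ K + a + (2 ^ K + b ∸ 2 ^ l)) ⊓ (2 * 2 ^ l ∸ 1)
    ≡⟨ cong (λ l → (2 ^ K + a + (2 ^ K + b ∸ 2 ^ l)) ⊓ (2 * 2 ^ l ∸ 1)) l≡K ⟩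
  (2 ^ K + a + (2 ^ K + b ∸ 2 ^ K)) ⊓ (2 * 2 ^ K ∸ 1)
    ≡⟨ cong₂ _⊓_ (trans (cong (2 ^ K + a +_) (m+n∸m≡n (2 ^ K) b)) (+-assoc (2 ^ K) a b))
        (trans (cong (_∸ 1) (cong (2 ^ K +_) (+-identityʳ _))) (+-∸-assoc (2 ^ K) (1≤2^ K))) ⟩
  (2 ^ K + (a + b)) ⊓ (2 ^ K + (2 ^ K ∸ 1))
    ≡⟨ sym (+-distribˡ-⊓ (2 ^ K) (a + b) _) ⟩
  2 ^ K + cap K (a + b) ∎
  where
  open ≡-Reasoning
  l = ⌊log₂ ((2 ^ K + a) ⊔ (2 ^ K + b)) ⌋
  l≡K : l ≡ K
  l≡K = trans (cong ⌊log₂_⌋ (sym (+-distribˡ-⊔ (2 ^ K) a b))) (log-unique K (a ⊔ b) (⊔-lub a< b<))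

-- Aggregates in arbitrary order.

∈-split : ∀ {A : Set} {x : A} {xs} ys {zs} → xs ↭ ys ++ zs → x ∈ xs → x ∈ ys ⊎ x ∈ zs
∈-split ys p x∈ = ∈-++⁻ ys (∈-resp-↭ p x∈)

AggR-max : ∀ {xs y} → AggR _⊔_ xs y → (∀ x → x ∈ xs → x ≤ y) × (y ∈ xs)
AggR-max (leaf x) = (λ { x' (here refl) → ≤-refl }) , here refl
AggR-max (node {xs} {ys} {zs} {a} {b} p l r) with AggR-max l | AggR-max r
... | la , a∈ | rb , b∈ = bound , mem
  where
  bound : ∀ x → x ∈ xs → x ≤ a ⊔ b
  bound x x∈ with ∈-split ys p x∈
  ... | inj₁ q = ≤-trans (la x q) (m≤m⊔n a b)
  ... | inj₂ q = ≤-trans (rb x q) (m≤n⊔m a b)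
  mem : a ⊔ b ∈ xs
  mem with ⊔-sel a b
  ... | inj₁ e = ∈-resp-↭ (↭-sym p) (∈-++⁺ˡ (subst (_∈ ys) (sym e) a∈))
  ... | inj₂ e = ∈-resp-↭ (↭-sym p) (∈-++⁺ʳ ys (subst (_∈ zs) (sym e) b∈))

Marked : ℕ → ℕ → Set
Marked K x = Σ ℕ λ a → a < 2 ^ K × x ≡ 2 ^ K + a

-- Induction on the bracketing: `cap-+` joins the clipped halves, and the permutation at each node
-- does not affect a sum.
AggR-satAdd : ∀ K {xs y} → AggR satAdd xs y → All (Marked K) xs →
  y ≡ 2 ^ K + cap K (sum (map (_∸ 2 ^ K) xs))
AggR-satAdd K (leaf x) ((a , a< , refl) ∷ []) = cong (2 ^ K +_) (sym
  (trans (cong (cap K) (trans (+-identityʳ _) (m+n∸m≡n (2 ^ K) a))) (cap-id K a<)))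
AggR-satAdd K (node {xs} {ys} {zs} {a} {b} p l r) ms = begin
  satAdd a b ≡⟨ cong₂ satAdd (AggR-satAdd K l (AllP.++⁻ˡ ys ms')) (AggR-satAdd K r (AllP.++⁻ʳ ys ms')) ⟩
  satAdd (2 ^ K + cap K (s ys)) (2 ^ K + cap K (s zs)) ≡⟨ satAdd-marked K _ _ (cap< K _) (cap< K _) ⟩
  2 ^ K + cap K (cap K (s ys) + cap K (s zs)) ≡⟨ cong (2 ^ K +_) (cap-+ K (s ys) (s zs)) ⟩
  2 ^ K + cap K (s ys + s zs) ≡⟨ cong (λ z → 2 ^ K + cap K z) (sym (trans (cong sum (map-++ (_∸ 2 ^ K) ys zs)) (sum-++ (map (_∸ 2 ^ K) ys) _))) ⟩
  2 ^ K + cap K (s (ys ++ zs)) ≡⟨ cong (λ z → 2 ^ K + cap K z) (sym (sum-↭ (↭-map⁺ (_∸ 2 ^ K) p))) ⟩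
  2 ^ K + cap K (s xs) ∎
  where
  open ≡-Reasoning
  s : List ℕ → ℕ
  s = λ l → sum (map (_∸ 2 ^ K) l)
  ms' = All-resp-↭ p ms

-- Finite sums

∑ : ∀ {n} → (Fin n → ℕ) → ℕ
∑ {n} f = sum (map f (allFin n))

infixr 4 _▷_
_▷_ : Bool → ℕ → ℕ
b ▷ x = if b then x else 0

∑-suc : ∀ {n} (f : Fin (suc n) → ℕ) → ∑ f ≡ f zero + ∑ (f ∘ suc)
∑-suc {n} f = cong (λ l → f zero + sum l)
  (trans (map-tabulate suc f) (sym (map-tabulate id (f ∘ suc))))

∑-cong : ∀ {n} {f g : Fin n → ℕ} → (∀ i → f i ≡ g i) → ∑ f ≡ ∑ g
∑-cong {n} eq = cong sum (map-cong eq (allFin n))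

∑-zero : ∀ {n} {f : Fin n → ℕ} → (∀ i → f i ≡ 0) → ∑ f ≡ 0
∑-zero {zero} eq = refl
∑-zero {suc n} {f} eq = trans (∑-suc f) (cong₂ _+_ (eq zero) (∑-zero (eq ∘ suc)))

∑-+ : ∀ {n} (f g : Fin n → ℕ) → ∑ (λ i → f i + g i) ≡ ∑ f + ∑ g
∑-+ {zero} f g = refl
∑-+ {suc n} f g = begin
  ∑ (λ i → f i + g i) ≡⟨ ∑-suc (λ i → f i + g i) ⟩
  f zero + g zero + ∑ (λ i → f (suc i) + g (suc i)) ≡⟨ cong (f zero + g zero +_) (∑-+ (f ∘ suc) (g ∘ suc)) ⟩
  f zero + g zero + (∑ (f ∘ suc) + ∑ (g ∘ suc)) ≡⟨ solve 4 (λ a b c d → a :+ b :+ (c :+ d) := (a :+ c) :+ (b :+ d)) refl (f zero) (g zero) (∑ (f ∘ suc)) (∑ (g ∘ suc)) ⟩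
  (f zero + ∑ (f ∘ suc)) + (g zero + ∑ (g ∘ suc)) ≡⟨ cong₂ _+_ (sym (∑-suc f)) (sym (∑-suc g)) ⟩
  ∑ f + ∑ g ∎
  where
  open ≡-Reasoning
  open +-*-Solver

∑-≤ : ∀ {n} {f g : Fin n → ℕ} → (∀ i → f i ≤ g i) → ∑ f ≤ ∑ g
∑-≤ {zero} le = z≤n
∑-≤ {suc n} {f} {g} le = subst₂ _≤_ (sym (∑-suc f)) (sym (∑-suc g)) (+-mono-≤ (le zero) (∑-≤ (le ∘ suc)))

∑-swap : ∀ {n m} (f : Fin n → Fin m → ℕ) → ∑ (λ i → ∑ (f i)) ≡ ∑ (λ j → ∑ (λ i → f i j))
∑-swap {zero} {m} f = sym (∑-zero {m} (λ _ → refl))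
∑-swap {suc n} {m} f = begin
  ∑ (λ i → ∑ (f i)) ≡⟨ ∑-suc (λ i → ∑ (f i)) ⟩
  ∑ (f zero) + ∑ (λ i → ∑ (f (suc i))) ≡⟨ cong (∑ (f zero) +_) (∑-swap (f ∘ suc)) ⟩
  ∑ (f zero) + ∑ (λ j → ∑ (λ i → f (suc i) j)) ≡⟨ sym (∑-+ (f zero) _) ⟩
  ∑ (λ j → f zero j + ∑ (λ i → f (suc i) j)) ≡⟨ ∑-cong (λ j → sym (∑-suc (λ i → f i j))) ⟩
  ∑ (λ j → ∑ (λ i → f i j)) ∎
  where open ≡-Reasoning

∑-const : ∀ n c → ∑ {n} (λ _ → c) ≡ n * c
∑-const zero c = refl
∑-const (suc n) c = trans (∑-suc {n} (λ _ → c)) (cong (c +_) (∑-const n c))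

∑-point : ∀ {n} (j : Fin n) {f : Fin n → ℕ} → (∀ i → i ≢ j → f i ≡ 0) → ∑ f ≡ f j
∑-point zero {f} z = trans (∑-suc f) (trans (cong (f zero +_) (∑-zero (λ i → z (suc i) λ ()))) (+-identityʳ _))
∑-point (suc j) {f} z = trans (∑-suc f) (cong₂ _+_ (z zero λ ()) (∑-point j (λ i ne → z (suc i) (ne ∘ F.suc-injective))))

term≤∑ : ∀ {n} (f : Fin n → ℕ) j → f j ≤ ∑ f
term≤∑ f zero = subst (f zero ≤_) (sym (∑-suc f)) (m≤m+n _ _)
term≤∑ f (suc j) = subst (f (suc j) ≤_) (sym (∑-suc f)) (≤-trans (term≤∑ (f ∘ suc) j) (m≤n+m _ _))

∑-*ˡ : ∀ {n} c (f : Fin n → ℕ) → ∑ (λ i → c * f i) ≡ c * ∑ f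
∑-*ˡ {zero} c f = sym (*-zeroʳ c)
∑-*ˡ {suc n} c f = begin
  ∑ (λ i → c * f i) ≡⟨ ∑-suc (λ i → c * f i) ⟩
  c * f zero + ∑ (λ i → c * f (suc i)) ≡⟨ cong (c * f zero +_) (∑-*ˡ c (f ∘ suc)) ⟩
  c * f zero + c * ∑ (f ∘ suc) ≡⟨ sym (*-distribˡ-+ c (f zero) _) ⟩
  c * (f zero + ∑ (f ∘ suc)) ≡⟨ cong (c *_) (sym (∑-suc f)) ⟩
  c * ∑ f ∎
  where open ≡-Reasoning

true-ext : ∀ {a b : Bool} → (a ≡ true → b ≡ true) → (b ≡ true → a ≡ true) → a ≡ b
true-ext {true} {true} f g = refl
true-ext {true} {false} f g = sym (f refl)
true-ext {false} {true} f g = g refl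
true-ext {false} {false} f g = refl

∑-filter : ∀ {A : Set} (χ : A → Bool) (f : A → ℕ) (d : ∀ x → Dec (χ x ≡ true)) xs →
  sum (map f (filter d xs)) ≡ sum (map (λ x → χ x ▷ f x) xs)
∑-filter χ f d [] = refl
∑-filter χ f d (x ∷ xs) with χ x | d x
... | true  | yes p = cong (f x +_) (∑-filter χ f d xs)
... | false | yes ()
... | true  | no p = ⊥-elim (p refl)
... | false | no p = ∑-filter χ f d xs

_≟true : ∀ b → Dec (b ≡ true)
true ≟true = yes refl
false ≟true = no λ ()

-- The model lists a supernode in an unspecified order. Duplicate-free lists with the same members
-- are permutations of each other, so a sum over such a list becomes a sum over a fixed enumeration
-- with an indicator.
sum-over : ∀ {A : Set} (E : List A) → Unique E → (∀ x → x ∈ E) →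
  (L : List A) → Unique L → (χ : A → Bool) → (∀ x → (x ∈ L) ⇔ (χ x ≡ true)) →
  (f : A → ℕ) → sum (map f L) ≡ sum (map (λ x → χ x ▷ f x) E)
sum-over E uE allE L uL χ eqv f = trans (sum-↭ (↭-map⁺ f p)) (∑-filter χ f (λ x → χ x ≟true) E)
  where
  p : L ↭ filter (λ x → χ x ≟true) E
  p = ∼bag⇒↭ (unique∧set⇒bag uL (UniqueP.filter⁺ (λ x → χ x ≟true) uE)
        (mk⇔ (λ x∈ → ∈-filter⁺ (λ x → χ x ≟true) (allE _) (to (eqv _) x∈))
             (λ x∈ → from (eqv _) (proj₂ (∈-filter⁻ (λ x → χ x ≟true) {xs = E} x∈)))))

sum-over-Fin : ∀ {n} (L : List (Fin n)) → Unique L → (χ : Fin n → Bool) →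
  (∀ x → (x ∈ L) ⇔ (χ x ≡ true)) → (f : Fin n → ℕ) → sum (map f L) ≡ ∑ (λ x → χ x ▷ f x)
sum-over-Fin {n} = sum-over (allFin n) (UniqueP.allFin⁺ n) ∈-allFin

sum-over-ends : ∀ {m} (L : List (Fin m × Bool)) → Unique L → (χ : Fin m → Bool → Bool) →
  (∀ e b → ((e , b) ∈ L) ⇔ (χ e b ≡ true)) → (f : Fin m × Bool → ℕ) →
  sum (map f L) ≡ ∑ (λ e → (χ e true ▷ f (e , true)) + (χ e false ▷ f (e , false)))
sum-over-ends {m} L uL χ eqv f = trans
  (sum-over (cartesianProduct (allFin m) bs) (UniqueP.cartesianProduct⁺ (UniqueP.allFin⁺ m) ubs)
    (λ { (e , b) → ∈-cartesianProduct⁺ (∈-allFin e) (∈bs b) }) L uL (λ p → χ (proj₁ p) (proj₂ p)) (λ { (e , b) → eqv e b }) f)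
  (collect (allFin m))
  where
  bs = true ∷ false ∷ []
  ubs : Unique bs
  ubs = ((λ ()) ∷ []) AP.∷ ([] AP.∷ AP.[])
  ∈bs : ∀ b → b ∈ bs
  ∈bs true = here refl
  ∈bs false = there (here refl)
  F : Fin m × Bool → ℕ
  F p = χ (proj₁ p) (proj₂ p) ▷ f p
  collect : ∀ es → sum (map F (cartesianProduct es bs)) ≡ sum (map (λ e → F (e , true) + F (e , false)) es)
  collect [] = refl
  collect (e ∷ es) = trans (sym (+-assoc (F (e , true)) _ _)) (cong (F (e , true) + F (e , false) +_) (collect es))

_∈?_ : ∀ {n} (x : Fin n) xs → Dec (x ∈ xs)
_∈?_ {n} = DecMembership._∈?_ (F._≟_ {n})

does⇔ : ∀ {P : Set} (d : Dec P) → P ⇔ (does d ≡ true)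
does⇔ (yes p) = mk⇔ (λ _ → refl) (λ _ → p)
does⇔ (no p) = mk⇔ (λ q → ⊥-elim (p q)) (λ ())

fromMaybe : Maybe ℕ → ℕ
fromMaybe (just x) = x
fromMaybe nothing = 0

AggM-max : ∀ {xs y} → AggM _⊔_ xs y → (∀ x → x ∈ xs → x ≤ fromMaybe y) × (fromMaybe y ≡ 0 ⊎ fromMaybe y ∈ xs)
AggM-max none = (λ _ ()) , inj₁ refl
AggM-max (some a) = proj₁ (AggR-max a) , inj₂ (proj₂ (AggR-max a))

-- A node without incident edges in the minor hears nothing. Reading this as `0` agrees with the
-- empty sum, since truncated subtraction of the mark gives `0` again.
AggM-satAdd : ∀ K {xs y} → AggM satAdd xs y → All (Marked K) xs →
  fromMaybe y ∸ 2 ^ K ≡ cap K (sum (map (_∸ 2 ^ K) xs))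
AggM-satAdd K none _ = 0∸n≡0 (2 ^ K)
AggM-satAdd K (some a) ms = trans (cong (_∸ 2 ^ K) (AggR-satAdd K a ms)) (m+n∸m≡n (2 ^ K) _)

map-cong-∈ : ∀ {A : Set} {f g : A → ℕ} L → (∀ x → x ∈ L → f x ≡ g x) → map f L ≡ map g L
map-cong-∈ [] eq = refl
map-cong-∈ (x ∷ L) eq = cong₂ _∷_ (eq x (here refl)) (map-cong-∈ L (λ y y∈ → eq y (there y∈)))

¬true⇒false : ∀ {b} → ¬ (b ≡ true) → b ≡ false
¬true⇒false {true} ne = ⊥-elim (ne refl)
¬true⇒false {false} ne = refl

∧-true : ∀ {a b} → a ∧ b ≡ true → a ≡ true × b ≡ true
∧-true {true} p = refl , p

not-true : ∀ {a} → not a ≡ true → ¬ (a ≡ true)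
not-true {false} p ()

¬true-not : ∀ {a} → ¬ (a ≡ true) → not a ≡ true
¬true-not p = cong not (¬true⇒false p)

-- Positional encoding of lists of digits

enc : ℕ → List ℕ → ℕ
enc b [] = 0
enc b (x ∷ xs) = x + enc b xs * b

dec : ∀ b .{{_ : NonZero b}} → ℕ → ℕ → List ℕ
dec b zero z = []
dec b (suc k) z = z % b ∷ dec b k (z / b)

dec-enc : ∀ b .{{_ : NonZero b}} xs → All (_< b) xs → dec b (length xs) (enc b xs) ≡ xs
dec-enc b [] [] = refl
dec-enc b (x ∷ xs) (x< ∷ xs<) = cong₂ _∷_
  (trans ([m+kn]%n≡m%n x (enc b xs) b) (m<n⇒m%n≡m x<))
  (trans (cong (dec b (length xs)) quot) (dec-enc b xs xs<))
  where
  quot : (x + enc b xs * b) / b ≡ enc b xs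
  quot = trans (+-distrib-/ x _ (subst (_< b)
            (sym (trans (cong₂ _+_ (m<n⇒m%n≡m x<) (m*n%n≡0 (enc b xs) b)) (+-identityʳ x))) x<))
          (cong₂ _+_ (m<n⇒m/n≡0 x<) (m*n/n≡m (enc b xs) b))

enc< : ∀ b xs → All (_< b) xs → enc b xs < b ^ length xs
enc< b [] [] = s≤s z≤n
enc< b (x ∷ xs) (x< ∷ xs<) = begin-strict
  x + enc b xs * b     <⟨ +-monoˡ-< (enc b xs * b) x< ⟩
  suc (enc b xs) * b   ≤⟨ *-monoˡ-≤ b (enc< b xs xs<) ⟩
  b ^ length xs * b    ≡⟨ *-comm (b ^ length xs) b ⟩
  b * b ^ length xs    ∎
  where open ≤-Reasoning

-- Node programs

-- `tmp` is scratch space and finally the output; `val` holds the summand of a node and `acc` its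
-- suffix sum; `cut` is `X`. `pvP` and `pvQ` are the positions of the pivot row and of its best
-- column, `cQ` is the `X` of that column, and `ofs` is the middle block in `total-W`. `act` is
-- nonzero while the rectangle of the node is alive.
record Mem : Set where
  constructor mem
  field
    nid leg rk tmp pos val acc cut bP bQ kap act pvP pvQ cQ best ofs : ℕ
open Mem public

regs : ℕ
regs = 17

toL : Mem → List ℕ
toL (mem a b c d e f g h i j k l m n o p q) =
  a ∷ b ∷ c ∷ d ∷ e ∷ f ∷ g ∷ h ∷ i ∷ j ∷ k ∷ l ∷ m ∷ n ∷ o ∷ p ∷ q ∷ []

mem₀ : ℕ → Mem
mem₀ x = mem x 0 0 0 0 0 0 0 0 0 0 0 0 0 0 0 0

fromL : List ℕ → Mem
fromL (a ∷ b ∷ c ∷ d ∷ e ∷ f ∷ g ∷ h ∷ i ∷ j ∷ k ∷ l ∷ m ∷ n ∷ o ∷ p ∷ q ∷ []) =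
  mem a b c d e f g h i j k l m n o p q
fromL _ = mem₀ 0

capM : ℕ → Mem → Mem
capM K (mem a b c d e f g h i j k l m n o p q) =
  mem (cap K a) (cap K b) (cap K c) (cap K d) (cap K e) (cap K f) (cap K g) (cap K h) (cap K i)
      (cap K j) (cap K k) (cap K l) (cap K m) (cap K n) (cap K o) (cap K p) (cap K q)

capM-capM : ∀ K m → capM K (capM K m) ≡ capM K m
capM-capM K m = cong fromL digits
  where
  digits : map (cap K) (map (cap K) (toL m)) ≡ map (cap K) (toL m)
  digits = trans (sym (map-∘ {g = cap K} {f = cap K} (toL m))) (map-cong (cap-cap K) (toL m))

toL< : ∀ K m → capM K m ≡ m → All (_< 2 ^ K) (toL m)
toL< K m eq = subst (All (_< 2 ^ K) ∘ toL) eq (AllP.map⁺ (All.universal (cap< K) (toL m)))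

unpack : ℕ → ℕ → Mem
unpack K z = fromL (dec (2 ^ K) {{m^n≢0 2 K}} regs z)

data Kind : Set where
  byMax bySum : Kind

_≡ₖ_ : Kind → Kind → Bool
byMax ≡ₖ byMax = true
bySum ≡ₖ bySum = true
_     ≡ₖ _     = false

record Instr : Set where
  field
    kind : Kind
    con  : ℕ → Bool → Mem → Mem → Bool
    cons : Mem → ℕ
    agg  : ℕ → Bool → Mem → Mem → ℕ → ℕ → ℕ × ℕ
    upd  : Mem → ℕ → ℕ → Mem
open Instr public

noop : Instr
noop = record { kind = byMax ; con = λ _ _ _ _ → false ; cons = λ _ → 0 ; agg = λ _ _ _ _ _ _ → 0 , 0 ; upd = λ m _ _ → m }

nth : List Instr → ℕ → Instr
nth [] _ = noop
nth (i ∷ is) zero = i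
nth (i ∷ is) (suc k) = nth is k

-- In `learn` the whole spanning tree is contracted, so all nodes obtain the maximal identifier. No
-- edge survives in that minor, hence a second round `tell` is spent on informing the edges.
data Round : Set where
  learn tell : Round
  refresh sumR maxR : ℕ → Round

next : Round → Round
next learn = tell
next tell = refresh 0
next (refresh τ) = sumR τ
next (sumR τ) = maxR τ
next (maxR τ) = refresh (suc τ)

round : ℕ → Round
round zero = learn
round (suc t) = next (round t)

-- The round in which an instruction starts; the offset `2` pays for `learn` and `tell`.
base : ℕ → ℕ
base zero = 2
base (suc τ) = suc (suc (suc (base τ)))

round-base : ∀ τ → round (base τ) ≡ refresh τ
round-base zero = refl
round-base (suc τ) = cong (next ∘ next ∘ next) (round-base τ)

data NState : Set where
  start : ℕ → NState
  run   : (M clk : ℕ) → Mem → NState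

record EState : Set where
  constructor est-
  field
    wt : ℕ
    tr : Bool
    maxId : ℕ
    mA mB : Mem
    yA yB : ℕ
open EState

memOf : NState → Mem
memOf (start x) = mem₀ x
memOf (run _ _ s) = s

-- An instruction takes three rounds: one in which every edge learns the memories of
-- its ends, one whose operators are satAdd and one whose operators are maxima. The
-- operators may depend on the round only, so an instruction idles in one of the last two.
module Compile (Kf : ℕ → ℕ) (sched : ℕ → List Instr) where

  at : ℕ → ℕ → Instr
  at M τ = nth (sched M) τ

  isKind : Kind → Instr → Bool
  isKind k i = k ≡ₖ kind i

  conE : Kind → ℕ → EState → Bool
  conE k τ s = isKind k (at (maxId s) τ) ∧ con (at (maxId s) τ) (wt s) (tr s) (mA s) (mB s)

  contractR : Round → EState → Bool
  contractR learn s = tr s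
  contractR tell s = false
  contractR (refresh τ) s = false
  contractR (sumR τ) s = conE bySum τ s
  contractR (maxR τ) s = conE byMax τ s

  consR : Round → NState → ℕ
  consR learn (start x) = x
  consR r (start x) = 0
  consR learn (run M clk m) = 0
  consR tell (run M clk m) = M
  consR (refresh τ) (run M clk m) = enc (2 ^ Kf M) (toL m)
  consR (sumR τ) (run M clk m) = 2 ^ Kf M + cap (Kf M) (cons (at M τ) m)
  consR (maxR τ) (run M clk m) = cap (Kf M) (cons (at M τ) m)

  opR : Round → ℕ → ℕ → ℕ
  opR (sumR _) = satAdd
  opR _ = _⊔_

  updER : Round → EState → Maybe (ℕ × ℕ) → EState
  updER r s nothing = s
  updER learn s (just _) = s
  updER tell s (just (a , b)) = record s { maxId = a }
  updER (refresh τ) s (just (a , b)) = record s { mA = unpack (Kf (maxId s)) a ; mB = unpack (Kf (maxId s)) b }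
  updER (sumR τ) s (just (a , b)) = record s { yA = a ∸ 2 ^ Kf (maxId s) ; yB = b ∸ 2 ^ Kf (maxId s) }
  updER (maxR τ) s (just (a , b)) = record s { yA = a ; yB = b }

  zE : ℕ → EState → ℕ × ℕ
  zE τ s = let z = agg (at (maxId s) τ) (wt s) (tr s) (mA s) (mB s) (yA s) (yB s)
           in cap (Kf (maxId s)) (proj₁ z) , cap (Kf (maxId s)) (proj₂ z)

  aggR : Round → EState → ℕ × ℕ
  aggR learn s = 0 , 0
  aggR tell s = 0 , 0
  aggR (refresh τ) s = 0 , 0
  aggR (sumR τ) s = 2 ^ Kf (maxId s) + proj₁ (zE τ s) , 2 ^ Kf (maxId s) + proj₂ (zE τ s)
  aggR (maxR τ) s = zE τ s

  exec : Kind → ℕ → ℕ → Mem → ℕ → ℕ → Mem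
  exec k M τ m y g = if isKind k (at M τ) then capM (Kf M) (upd (at M τ) m y g) else m

  updNR : Round → NState → ℕ → Maybe ℕ → NState
  updNR learn (start x) y g = run y 0 (capM (Kf y) (mem₀ x))
  updNR r (start x) y g = start x
  updNR learn s@(run M clk m) y g = s
  updNR tell s@(run M clk m) y g = s
  updNR (refresh τ) s@(run M clk m) y g = s
  updNR (sumR τ) (run M clk m) y g = run M clk (exec bySum M τ m (y ∸ 2 ^ Kf M) (fromMaybe g ∸ 2 ^ Kf M))
  updNR (maxR τ) (run M clk m) y g = run M (suc clk) (exec byMax M τ m y (fromMaybe g))

  -- `clk` counts completed instructions, so no node answers before the whole schedule has been
  -- executed.
  out : NState → Maybe ℕ
  out (start _) = nothing
  out (run M clk m) = if length (sched M) ≤ᵇ clk then just (tmp m) else nothing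

  algorithm : Algorithm
  algorithm = record
    { NState = NState ; EState = EState
    ; initN = start
    ; initE = λ _ _ w b → est- w b 0 (mem₀ 0) (mem₀ 0) 0 0
    ; contract = λ t → contractR (round t)
    ; consMsg = λ t → consR (round t)
    ; opC = λ t → opR (round t)
    ; updE = λ t → updER (round t)
    ; aggMsg = λ t → aggR (round t)
    ; opA = λ t → opR (round t)
    ; updN = λ t → updNR (round t)
    ; output = out }

-- Meaning of a single instruction

module Semantics (I : Instance) where
  open InstanceDefs I

  tree : Fin m → Bool
  tree e = Edge.inTree (edge e)

  State : Set
  State = Fin n → Mem

  Contracted : Instr → State → Fin m → Set
  Contracted i s e = con i (w e) (tree e) (s (e₁ e)) (s (e₂ e)) ≡ true

  Comp : Instr → State → Fin n → Fin n → Set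
  Comp i s = Star (λ u v → ∃ λ e → Contracted i s e × Joins e u v)

  zz : Instr → State → (Fin n → ℕ) → Fin m → ℕ × ℕ
  zz i s Y e = agg i (w e) (tree e) (s (e₁ e)) (s (e₂ e)) (Y (e₁ e)) (Y (e₂ e))

  -- A sum is determined by the components, hence `Y` and `G` are formulas. The Boolean `same`
  -- exists so that the components can occur as indicators inside them.
  record SumSem (K : ℕ) (i : Instr) (s s' : State) : Set where
    field
      same : Fin n → Fin n → Bool
      same⇔ : ∀ u v → (same u v ≡ true) ⇔ Comp i s u v
    Y : Fin n → ℕ
    Y v = cap K (∑ λ u → same v u ▷ cap K (cons i (s u)))
    G : Fin n → ℕ
    G v = cap K (∑ λ e → (not (same (e₁ e) (e₂ e)) ∧ same v (e₁ e) ▷ cap K (proj₁ (zz i s Y e)))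
                        + (not (same (e₁ e) (e₂ e)) ∧ same v (e₂ e) ▷ cap K (proj₂ (zz i s Y e))))
    field
      result : ∀ v → s' v ≡ capM K (upd i (s v) (Y v) (G v))

  -- A maximum is described as an upper bound that is attained. For `G` the value `0` is also
  -- possible, being what a node reads when it has no incident edge in the minor.
  record MaxSem (K : ℕ) (i : Instr) (s s' : State) : Set where
    field
      Y G : Fin n → ℕ
      Y-ub : ∀ v u → Comp i s v u → cap K (cons i (s u)) ≤ Y v
      Y-at : ∀ v → ∃ λ u → Comp i s v u × Y v ≡ cap K (cons i (s u))
      G-ub₁ : ∀ v e → ¬ Comp i s (e₁ e) (e₂ e) → Comp i s v (e₁ e) → cap K (proj₁ (zz i s Y e)) ≤ G v
      G-ub₂ : ∀ v e → ¬ Comp i s (e₁ e) (e₂ e) → Comp i s v (e₂ e) → cap K (proj₂ (zz i s Y e)) ≤ G v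
      G-at : ∀ v → G v ≡ 0 ⊎ ∃ λ e → ¬ Comp i s (e₁ e) (e₂ e) ×
        ((Comp i s v (e₁ e) × G v ≡ cap K (proj₁ (zz i s Y e))) ⊎
         (Comp i s v (e₂ e) × G v ≡ cap K (proj₂ (zz i s Y e))))
      result : ∀ v → s' v ≡ capM K (upd i (s v) (Y v) (G v))

  SemOf : Kind → ℕ → Instr → State → State → Set
  SemOf byMax = MaxSem
  SemOf bySum = SumSem

  Sem : ℕ → Instr → State → State → Set
  Sem K i = SemOf (kind i) K i

  data Run (K : ℕ) : List Instr → State → State → Set where
    []  : ∀ {s} → Run K [] s s
    _∷_ : ∀ {i is s s' s''} → Sem K i s s' → Run K is s' s'' → Run K (i ∷ is) s s''

  Run-++ : ∀ {K} is {js s s''} → Run K (is ++ js) s s'' → ∃ λ s' → Run K is s s' × Run K js s' s''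
  Run-++ [] r = _ , [] , r
  Run-++ (i ∷ is) (x ∷ r) with Run-++ is r
  ... | s' , r₁ , r₂ = s' , x ∷ r₁ , r₂

  Joins-sym : ∀ {e u v} → Joins e u v → Joins e v u
  Joins-sym (inj₁ p) = inj₂ p
  Joins-sym (inj₂ p) = inj₁ p

  Comp-sym : ∀ i s {u v} → Comp i s u v → Comp i s v u
  Comp-sym i s ε = ε
  Comp-sym i s ((e , c , j) ◅ r) = Comp-sym i s r ◅◅ ((e , c , Joins-sym {e} j) ◅ ε)

-- From executions to runs of instructions.

module TraceDefs (Kf : ℕ → ℕ) (sched : ℕ → List Instr) (I : Instance) where
  open InstanceDefs I
  open Compile Kf sched

  Super : (ℕ → Fin m → EState) → ℕ → Fin n → Fin n → Set
  Super est t = Star (λ u v → ∃ λ e → (contractR (round t) (est t e) ≡ true) × Joins e u v)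

  InMinor : (ℕ → Fin m → EState) → ℕ → Fin m → Set
  InMinor est t e = (contractR (round t) (est t e) ≡ false) × ¬ Super est t (e₁ e) (e₂ e)

  pickEnd : Fin m → Bool → Fin n
  pickEnd e b = if b then e₁ e else e₂ e

  -- `Execution` with the fields of the compiled algorithm unfolded, so that types mention the round
  -- functions themselves. `fromExecution` holds by computation.
  record Trace : Set where
    field
      nst : ℕ → Fin n → NState
      est : ℕ → Fin m → EState
      yv  : ℕ → Fin n → ℕ
      gv  : ℕ → Fin n → Maybe ℕ
      init-n : ∀ v → nst 0 v ≡ start (ident v)
      init-e : ∀ e → est 0 e ≡ est- (w e) (Edge.inTree (edge e)) 0 (mem₀ 0) (mem₀ 0) 0 0
      consensus : ∀ t v → Σ (List (Fin n)) λ L →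
        (Unique L × (∀ u → (u ∈ L) ⇔ Super est t v u))
        × AggR (opR (round t)) (map (λ u → consR (round t) (nst t u)) L) (yv t v)
      consensus-same : ∀ t u v → Super est t u v → yv t u ≡ yv t v
      edge-learn : ∀ t e →
          (InMinor est t e → est (suc t) e ≡ updER (round t) (est t e) (just (yv t (e₁ e) , yv t (e₂ e))))
        × (¬ InMinor est t e → est (suc t) e ≡ updER (round t) (est t e) nothing)
      aggregation : ∀ t v → Σ (List (Fin m × Bool)) λ L →
        (Unique L × (∀ e b → ((e , b) ∈ L) ⇔ (InMinor est t e × Super est t v (pickEnd e b))))
        × AggM (opR (round t))
               (map (λ p → if proj₂ p then proj₁ (aggR (round t) (est (suc t) (proj₁ p)))
                                      else proj₂ (aggR (round t) (est (suc t) (proj₁ p)))) L)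
               (gv t v)
      node-update : ∀ t v → nst (suc t) v ≡ updNR (round t) (nst t v) (yv t v) (gv t v)

  fromExecution : ExecDefs.Execution algorithm I → Trace
  fromExecution ex = record
    { nst = nst ; est = est ; yv = yv ; gv = gv ; init-n = init-n ; init-e = init-e ; consensus = consensus
    ; consensus-same = consensus-same ; edge-learn = edge-learn ; aggregation = aggregation ; node-update = node-update }
    where open ExecDefs.Execution ex

module Execute (Kf : ℕ → ℕ) (sched : ℕ → List Instr) (I : Instance)
  (loopfree : ∀ e → InstanceDefs.e₁ I e ≢ InstanceDefs.e₂ I e)
  (conn : ∀ u v → Star (InstanceDefs.TreeAdj I) u v)
  (v₀ : Fin (Instance.n I))
  (ex : TraceDefs.Trace Kf sched I) where
  open InstanceDefs I
  open Compile Kf sched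
  open TraceDefs Kf sched I
  open Trace ex
  open Semantics I

  M : ℕ
  M = yv 0 v₀
  K : ℕ
  K = Kf M

  opR-max : ∀ t → (∀ τ → round t ≢ sumR τ) → opR (round t) ≡ _⊔_
  opR-max t ne with round t
  ... | learn = refl
  ... | tell = refl
  ... | refresh τ = refl
  ... | sumR τ = ⊥-elim (ne τ refl)
  ... | maxR τ = refl

  maxY : ∀ t → (∀ τ → round t ≢ sumR τ) → ∀ v →
    (∀ u → Super est t v u → consR (round t) (nst t u) ≤ yv t v)
    × (∃ λ u → Super est t v u × yv t v ≡ consR (round t) (nst t u))
  maxY t ne v = (λ u p → proj₁ mx _ (∈-map⁺ f (from (eqv u) p))) , attained (∈-map⁻ f (proj₂ mx))
    where
    f : Fin n → ℕ
    f u = consR (round t) (nst t u)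
    L = proj₁ (consensus t v)
    eqv : ∀ u → (u ∈ L) ⇔ Super est t v u
    eqv = proj₂ (proj₁ (proj₂ (consensus t v)))
    mx : (∀ x → x ∈ map f L → x ≤ yv t v) × yv t v ∈ map f L
    mx = AggR-max (subst (λ o → AggR o (map f L) (yv t v)) (opR-max t ne) (proj₂ (proj₂ (consensus t v))))
    attained : (∃ λ u → u ∈ L × yv t v ≡ f u) → ∃ λ u → Super est t v u × yv t v ≡ f u
    attained (u , u∈ , eq) = u , to (eqv u) u∈ , eq

  superFalse : ∀ t → (∀ e → contractR (round t) (est t e) ≡ false) → ∀ {u v} → Super est t u v → u ≡ v
  superFalse t f ε = refl
  superFalse t f ((e , c , j) ◅ p) with trans (sym c) (f e)
  ... | ()

  -- Without contraction each supernode is a single node, so no edge disappears and each one reads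
  -- the messages of its own ends.
  quietEdge : ∀ t → (∀ e → contractR (round t) (est t e) ≡ false) → (∀ τ → round t ≢ sumR τ) → ∀ e →
    est (suc t) e ≡ updER (round t) (est t e) (just (consR (round t) (nst t (e₁ e)) , consR (round t) (nst t (e₂ e))))
  quietEdge t f ne e = trans (proj₁ (edge-learn t e) (f e , λ p → loopfree e (superFalse t f p)))
    (cong₂ (λ a b → updER (round t) (est t e) (just (a , b))) (yeq (e₁ e)) (yeq (e₂ e)))
    where
    yeq : ∀ v → yv t v ≡ consR (round t) (nst t v)
    yeq v with maxY t ne v
    ... | _ , u , p , eq = trans eq (cong (λ u → consR (round t) (nst t u)) (sym (superFalse t f p)))

  -- Round `0` contracts every tree edge and the tree spans, which leaves one supernode; this makes
  -- `M` common knowledge.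
  super₀ : ∀ {u v} → Star TreeAdj u v → Super est 0 u v
  super₀ = gmap id λ { (e , tr , j) → e , trans (cong tr' (init-e e)) tr , j }
    where
    tr' : EState → Bool
    tr' = EState.tr

  yv₀ : ∀ v → yv 0 v ≡ M
  yv₀ v = consensus-same 0 v v₀ (super₀ (conn v v₀))

  ident≤M : ∀ v → ident v ≤ M
  ident≤M v = subst (_≤ M) (cong (consR learn) (init-n v)) (proj₁ (maxY 0 (λ _ ()) v₀) v (super₀ (conn v₀ v)))

  M-ident : ∃ λ v → M ≡ ident v
  M-ident with proj₂ (maxY 0 (λ _ ()) v₀)
  ... | u , _ , eq = u , trans eq (cong (consR learn) (init-n u))

  record Knows (t : ℕ) (e : Fin m) : Set where
    constructor knows
    field
      kw : wt (est t e) ≡ w e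
      kt : EState.tr (est t e) ≡ tree e
      kM : maxId (est t e) ≡ M

  record Sees (t : ℕ) (s : State) (e : Fin m) : Set where
    constructor sees
    field
      sw : wt (est t e) ≡ w e
      st : EState.tr (est t e) ≡ tree e
      sM : maxId (est t e) ≡ M
      sA : mA (est t e) ≡ s (e₁ e)
      sB : mB (est t e) ≡ s (e₂ e)

  ms : ℕ → State
  ms τ v = memOf (nst (base τ) v)

  -- Nothing is claimed about the memories that edges remember: between instructions these copies
  -- are stale, and `refresh` renews them.
  record Inv (τ : ℕ) : Set where
    field
      nodes : ∀ v → nst (base τ) v ≡ run M τ (ms τ v)
      capped : ∀ v → capM K (ms τ v) ≡ ms τ v
      edges : ∀ e → Knows (base τ) e

  keeps : ∀ r s a b → wt (updER r s (just (a , b))) ≡ wt s × EState.tr (updER r s (just (a , b))) ≡ EState.tr s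
  keeps learn s a b = refl , refl
  keeps tell s a b = refl , refl
  keeps (refresh x) s a b = refl , refl
  keeps (sumR x) s a b = refl , refl
  keeps (maxR x) s a b = refl , refl

  nst₁ : ∀ v → nst 1 v ≡ run M 0 (capM K (mem₀ (ident v)))
  nst₁ v = begin
    nst 1 v ≡⟨ node-update 0 v ⟩
    updNR learn (nst 0 v) (yv 0 v) (gv 0 v) ≡⟨ cong (λ x → updNR learn x (yv 0 v) (gv 0 v)) (init-n v) ⟩
    run (yv 0 v) 0 (capM (Kf (yv 0 v)) (mem₀ (ident v))) ≡⟨ cong (λ M → run M 0 (capM (Kf M) (mem₀ (ident v)))) (yv₀ v) ⟩
    run M 0 (capM K (mem₀ (ident v))) ∎
    where open ≡-Reasoning

  nst₂ : ∀ v → nst 2 v ≡ run M 0 (capM K (mem₀ (ident v)))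
  nst₂ v = trans (node-update 1 v) (cong (λ x → updNR tell x (yv 1 v) (gv 1 v)) (nst₁ v))

  est₁ : ∀ e → wt (est 1 e) ≡ w e × EState.tr (est 1 e) ≡ tree e
  est₁ e = cong wt eq , cong EState.tr eq
    where
    -- With everything contracted each edge is a self-loop and learns nothing.
    absent : ¬ InMinor est 0 e
    absent (_ , ns) = ns (super₀ (conn (e₁ e) (e₂ e)))
    eq : est 1 e ≡ est- (w e) (tree e) 0 (mem₀ 0) (mem₀ 0) 0 0
    eq = trans (proj₂ (edge-learn 0 e) absent) (init-e e)

  est₂ : ∀ e → est 2 e ≡ updER tell (est 1 e) (just (consR tell (nst 1 (e₁ e)) , consR tell (nst 1 (e₂ e))))
  est₂ = quietEdge 1 (λ _ → refl) (λ _ ())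

  knows₂ : ∀ e → Knows 2 e
  knows₂ e = knows (trans (cong wt (est₂ e)) (proj₁ (est₁ e))) (trans (cong EState.tr (est₂ e)) (proj₂ (est₁ e)))
                   (trans (cong maxId (est₂ e)) (cong (consR tell) (nst₁ (e₁ e))))

  inv₀ : Inv 0
  inv₀ = record
    { nodes = λ v → trans (nst₂ v) (cong (run M 0) (sym (cong memOf (nst₂ v))))
    ; capped = λ v → subst (λ x → capM K (memOf x) ≡ memOf x) (sym (nst₂ v)) (capM-capM K (mem₀ (ident v)))
    ; edges = knows₂ }

  ms₀ : ∀ v → ms 0 v ≡ capM K (mem₀ (ident v))
  ms₀ v = cong memOf (nst₂ v)

  decode : ∀ s → capM K s ≡ s → unpack K (enc (2 ^ K) (toL s)) ≡ s
  decode s c = subst (λ l → fromL l ≡ s) (sym (dec-enc (2 ^ K) {{m^n≢0 2 K}} (toL s) (toL< K s c))) refl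

  seesAfter : ∀ {t s r} e → Sees t s e → (∀ x a b → mA (updER r x (just (a , b))) ≡ mA x × mB (updER r x (just (a , b))) ≡ mB x × maxId (updER r x (just (a , b))) ≡ maxId x) →
    ∀ y → est (suc t) e ≡ updER r (est t e) y → Sees (suc t) s e
  seesAfter {r = r} e (sees a b c d f) keep nothing eq = sees (trans (cong wt eq) a) (trans (cong EState.tr eq) b) (trans (cong maxId eq) c) (trans (cong mA eq) d) (trans (cong mB eq) f)
  seesAfter {t} {r = r} e (sees a b c d f) keep (just (y₁ , y₂)) eq with keep (est t e) y₁ y₂ | keeps r (est t e) y₁ y₂
  ... | k₁ , k₂ , k₃ | k₄ , k₅ = sees (trans (cong wt eq) (trans k₄ a)) (trans (cong EState.tr eq) (trans k₅ b)) (trans (cong maxId eq) (trans k₃ c)) (trans (cong mA eq) (trans k₁ d)) (trans (cong mB eq) (trans k₂ f))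

  -- The list that enumerates the supernode of one end makes connectivity decidable.
  decInMinor : ∀ t e → Dec (InMinor est t e)
  decInMinor t e = (contractR (round t) (est t e) Bool.≟ false) ×-dec ¬? (map′ (to eqv) (from eqv) (e₂ e ∈? proj₁ (consensus t (e₁ e))))
    where
    eqv : (e₂ e ∈ proj₁ (consensus t (e₁ e))) ⇔ Super est t (e₁ e) (e₂ e)
    eqv = proj₂ (proj₁ (proj₂ (consensus t (e₁ e)))) (e₂ e)

  edgeStep : ∀ t e → ∃ λ y → est (suc t) e ≡ updER (round t) (est t e) y
  edgeStep t e = aux (decInMinor t e)
    where
    aux : Dec (InMinor est t e) → ∃ λ y → est (suc t) e ≡ updER (round t) (est t e) y
    aux (yes p) = just (yv t (e₁ e) , yv t (e₂ e)) , proj₁ (edge-learn t e) p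
    aux (no p) = nothing , proj₂ (edge-learn t e) p

  module Step (τ : ℕ) (inv : Inv τ) where
    open Inv inv
    t : ℕ
    t = base τ
    i : Instr
    i = at M τ
    s : State
    s = ms τ

    rt : round t ≡ refresh τ
    rt = round-base τ
    rt₁ : round (suc t) ≡ sumR τ
    rt₁ = cong next rt
    rt₂ : round (suc (suc t)) ≡ maxR τ
    rt₂ = cong next rt₁

    sees₁ : ∀ e → Sees (suc t) s e
    sees₁ e = sees (trans (cong wt eq) (Knows.kw k)) (trans (cong EState.tr eq) (Knows.kt k)) (trans (cong maxId eq) kM)
                   (trans (cong mA eq) (dcd (e₁ e))) (trans (cong mB eq) (dcd (e₂ e)))
      where
      k = edges e
      open Knows k using (kM)
      q : ∀ r → r ≡ refresh τ → ∀ x → contractR r x ≡ false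
      q r refl x = refl
      ne : ∀ τ' → round t ≢ sumR τ'
      ne τ' eq = case trans (sym rt) eq of λ ()
      msg : ∀ v → consR (refresh τ) (nst t v) ≡ enc (2 ^ K) (toL (s v))
      msg v = cong (consR (refresh τ)) (nodes v)
      eq : est (suc t) e ≡ updER (refresh τ) (est t e) (just (enc (2 ^ K) (toL (s (e₁ e))) , enc (2 ^ K) (toL (s (e₂ e)))))
      eq = trans (subst (λ r → est (suc t) e ≡ updER r (est t e) (just (consR r (nst t (e₁ e)) , consR r (nst t (e₂ e))))) rt
              (quietEdge t (λ e → q _ rt _) ne e))
              (cong₂ (λ a b → updER (refresh τ) (est t e) (just (a , b))) (msg (e₁ e)) (msg (e₂ e)))
      dcd : ∀ v → unpack (Kf (maxId (est t e))) (enc (2 ^ K) (toL (s v))) ≡ s v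
      dcd v = trans (cong (λ M → unpack (Kf M) (enc (2 ^ K) (toL (s v)))) kM) (decode (s v) (capped v))

    nodes₁ : ∀ v → nst (suc t) v ≡ run M τ (s v)
    nodes₁ v = trans (node-update t v) (trans (cong (λ r → updNR r (nst t v) (yv t v) (gv t v)) rt)
      (cong (λ x → updNR (refresh τ) x (yv t v) (gv t v)) (nodes v)))

    module Work (k : Kind) (r : ℕ → Round) (t' : ℕ) (rt' : round t' ≡ r τ)
                (conEq : ∀ x → contractR (r τ) x ≡ conE k τ x)
                (see : ∀ e → Sees t' s e) (is : isKind k i ≡ true) where

      contr : ∀ e → contractR (round t') (est t' e) ≡ con i (w e) (tree e) (s (e₁ e)) (s (e₂ e))
      contr e = trans (cong (λ r → contractR r (est t' e)) rt') (trans (conEq (est t' e))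
              (trans (cong (λ M → isKind k (at M τ) ∧ con (at M τ) (wt (est t' e)) (EState.tr (est t' e)) (mA (est t' e)) (mB (est t' e))) sM)
              (trans (cong (_∧ con i (wt (est t' e)) (EState.tr (est t' e)) (mA (est t' e)) (mB (est t' e))) is)
              (trans (cong₂ (λ a b → con i a b (mA (est t' e)) (mB (est t' e))) sw st)
                     (cong₂ (con i (w e) (tree e)) sA sB)))))
        where open Sees (see e)

      comp→ : ∀ {u v} → Super est t' u v → Comp i s u v
      comp→ = gmap id λ { (e , c , j) → e , trans (sym (contr e)) c , j }
      comp← : ∀ {u v} → Comp i s u v → Super est t' u v
      comp← = gmap id λ { (e , c , j) → e , trans (contr e) c , j }

      minor : ∀ e → ¬ Comp i s (e₁ e) (e₂ e) → InMinor est t' e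
      minor e nc = ¬true⇒false (λ c → nc ((e , trans (sym (contr e)) c , inj₁ (refl , refl)) ◅ ε)) , λ p → nc (comp→ p)

    module SumRound (is : isKind bySum i ≡ true) where
      open Work bySum sumR (suc t) rt₁ (λ x → refl) sees₁ is

      same : Fin n → Fin n → Bool
      same v u = does (u ∈? proj₁ (consensus (suc t) v))

      inL : ∀ v u → (u ∈ proj₁ (consensus (suc t) v)) ⇔ (same v u ≡ true)
      inL v u = does⇔ (u ∈? proj₁ (consensus (suc t) v))

      same⇔ : ∀ u v → (same u v ≡ true) ⇔ Comp i s u v
      same⇔ u v = mk⇔ (λ p → comp→ (to (mem⇔ v) (from (inL u v) p))) (λ p → to (inL u v) (from (mem⇔ v) (comp← p)))
        where mem⇔ = proj₂ (proj₁ (proj₂ (consensus (suc t) u)))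

      Y : Fin n → ℕ
      Y v = cap K (∑ λ u → same v u ▷ cap K (cons i (s u)))

      msg : ∀ u → consR (round (suc t)) (nst (suc t) u) ≡ 2 ^ K + cap K (cons i (s u))
      msg u = trans (cong (λ r → consR r (nst (suc t) u)) rt₁) (cong (consR (sumR τ)) (nodes₁ u))

      yEq : ∀ v → yv (suc t) v ≡ 2 ^ K + Y v
      yEq v = trans
          (AggR-satAdd K (subst₂ (λ o l → AggR o l (yv (suc t) v)) (cong opR rt₁) (map-cong msg L) a)
            (AllP.map⁺ (All.universal (λ u → cap K (cons i (s u)) , cap< K _ , refl) L)))
          (cong (λ x → 2 ^ K + cap K x) (trans (cong sum (trans (sym (map-∘ L)) (map-cong (λ u → m+n∸m≡n (2 ^ K) _) L)))
            (sum-over-Fin L (proj₁ (proj₁ (proj₂ (consensus (suc t) v)))) (same v) (inL v) (λ u → cap K (cons i (s u))))))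
        where
        L = proj₁ (consensus (suc t) v)
        a = proj₂ (proj₂ (consensus (suc t) v))

      learned : ∀ e → InMinor est (suc t) e → zE τ (est (suc (suc t)) e) ≡ (cap K (proj₁ (zz i s Y e)) , cap K (proj₂ (zz i s Y e))) × maxId (est (suc (suc t)) e) ≡ M
      learned e p = trans (cong (zE τ) eq) (cong-z sw st sM sA sB) , trans (cong maxId eq) sM
        where
        open Sees (sees₁ e)
        σ = est (suc t) e
        eq : est (suc (suc t)) e ≡ record σ { yA = Y (e₁ e) ; yB = Y (e₂ e) }
        eq = trans (proj₁ (edge-learn (suc t) e) p) (trans (cong (λ r → updER r σ (just (yv (suc t) (e₁ e) , yv (suc t) (e₂ e)))) rt₁)
               (cong₂ (λ a b → record σ { yA = a ; yB = b }) (sub (e₁ e)) (sub (e₂ e))))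
          where
          sub : ∀ v → yv (suc t) v ∸ 2 ^ Kf (maxId σ) ≡ Y v
          sub v = trans (cong₂ (λ a b → a ∸ 2 ^ Kf b) (yEq v) sM) (m+n∸m≡n (2 ^ K) (Y v))
        cong-z : ∀ {a b c d f} → a ≡ w e → b ≡ tree e → c ≡ M → d ≡ s (e₁ e) → f ≡ s (e₂ e) →
          zE τ (est- a b c d f (Y (e₁ e)) (Y (e₂ e))) ≡ (cap K (proj₁ (zz i s Y e)) , cap K (proj₂ (zz i s Y e)))
        cong-z refl refl refl refl refl = refl

      χ : Fin n → Fin m → Bool → Bool
      χ v e b = not (same (e₁ e) (e₂ e)) ∧ same v (pickEnd e b)

      χ⇔ : ∀ v e b → (InMinor est (suc t) e × Super est (suc t) v (pickEnd e b)) ⇔ (χ v e b ≡ true)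
      χ⇔ v e b = mk⇔ f g
        where
        f : InMinor est (suc t) e × Super est (suc t) v (pickEnd e b) → χ v e b ≡ true
        f ((_ , ns) , p) = cong₂ _∧_ (¬true-not (λ q → ns (comp← (to (same⇔ _ _) q)))) (from (same⇔ _ _) (comp→ p))
        g : χ v e b ≡ true → InMinor est (suc t) e × Super est (suc t) v (pickEnd e b)
        g p = minor e (λ c → not-true (proj₁ (∧-true p)) (from (same⇔ _ _) c)) , comp← (to (same⇔ _ _) (proj₂ (∧-true {not (same (e₁ e) (e₂ e))} p)))

      z : Fin m × Bool → ℕ
      z (e , b) = if b then cap K (proj₁ (zz i s Y e)) else cap K (proj₂ (zz i s Y e))

      G : Fin n → ℕ
      G v = cap K (∑ λ e → (χ v e true ▷ z (e , true)) + (χ v e false ▷ z (e , false)))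

      zmsg : ∀ e b → InMinor est (suc t) e →
        (if b then proj₁ (aggR (round (suc t)) (est (suc (suc t)) e)) else proj₂ (aggR (round (suc t)) (est (suc (suc t)) e)))
        ≡ 2 ^ K + z (e , b)
      zmsg e true p = trans (cong (λ r → proj₁ (aggR r (est (suc (suc t)) e))) rt₁) (cong₂ (λ a b → 2 ^ Kf a + proj₁ b) (proj₂ (learned e p)) (proj₁ (learned e p)))
      zmsg e false p = trans (cong (λ r → proj₂ (aggR r (est (suc (suc t)) e))) rt₁) (cong₂ (λ a b → 2 ^ Kf a + proj₂ b) (proj₂ (learned e p)) (proj₁ (learned e p)))

      z< : ∀ p → z p < 2 ^ K
      z< (e , true) = cap< K _
      z< (e , false) = cap< K _

      gEq : ∀ v → fromMaybe (gv (suc t) v) ∸ 2 ^ K ≡ G v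
      gEq v = trans (AggM-satAdd K agg' (AllP.map⁺ (All.universal (λ p → z p , z< p , refl) L)))
          (cong (cap K) (trans (cong sum (trans (sym (map-∘ L)) (map-cong (λ p → m+n∸m≡n (2 ^ K) (z p)) L))) total))
        where
        L = proj₁ (aggregation (suc t) v)
        uL = proj₁ (proj₁ (proj₂ (aggregation (suc t) v)))
        eqv = proj₂ (proj₁ (proj₂ (aggregation (suc t) v)))
        agg' : AggM satAdd (map (λ p → 2 ^ K + z p) L) (gv (suc t) v)
        agg' = subst₂ (λ o l → AggM o l (gv (suc t) v)) (cong opR rt₁)
                 (map-cong-∈ L (λ { (e , b) e∈ → zmsg e b (proj₁ (to (eqv e b) e∈)) })) (proj₂ (proj₂ (aggregation (suc t) v)))
        total : sum (map z L) ≡ ∑ λ e → (χ v e true ▷ z (e , true)) + (χ v e false ▷ z (e , false))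
        total = sum-over-ends L uL (χ v) (λ e b → mk⇔ (λ p → to (χ⇔ v e b) (to (eqv e b) p)) (λ p → from (eqv e b) (from (χ⇔ v e b) p))) z
      resultS : ∀ v → nst (suc (suc t)) v ≡ run M τ (capM K (upd i (s v) (Y v) (G v)))
      resultS v = trans (node-update (suc t) v) (trans (cong (λ r → updNR r (nst (suc t) v) (yv (suc t) v) (gv (suc t) v)) rt₁)
        (trans (cong (λ x → updNR (sumR τ) x (yv (suc t) v) (gv (suc t) v)) (nodes₁ v)) (cong (run M τ)
        (trans (cong₂ (exec bySum M τ (s v)) (trans (cong (_∸ 2 ^ K) (yEq v)) (m+n∸m≡n (2 ^ K) (Y v))) (gEq v))
        (cong (λ b → if b then capM K (upd i (s v) (Y v) (G v)) else s v) is)))))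

      sem : ∀ s' → (∀ v → s' v ≡ capM K (upd i (s v) (Y v) (G v))) → SumSem K i s s'
      sem s' eq = record { same = same ; same⇔ = same⇔ ; result = eq }

    sees₂ : ∀ e → Sees (suc (suc t)) s e
    sees₂ e = seesAfter {r = sumR τ} e (sees₁ e) (λ x a b → refl , refl , refl) y (trans (proj₂ (edgeStep (suc t) e)) (cong (λ r → updER r (est (suc t) e) y) rt₁))
      where y = proj₁ (edgeStep (suc t) e)

    sees₃ : ∀ e → Sees (suc (suc (suc t))) s e
    sees₃ e = seesAfter {r = maxR τ} e (sees₂ e) (λ x a b → refl , refl , refl) y (trans (proj₂ (edgeStep (suc (suc t)) e)) (cong (λ r → updER r (est (suc (suc t)) e) y) rt₂))
      where y = proj₁ (edgeStep (suc (suc t)) e)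

    module MaxRound (is : isKind byMax i ≡ true) (nodes₂ : ∀ v → nst (suc (suc t)) v ≡ run M τ (s v)) where
      open Work byMax maxR (suc (suc t)) rt₂ (λ x → refl) sees₂ is
      t₂ : ℕ
      t₂ = suc (suc t)

      Y : Fin n → ℕ
      Y v = yv t₂ v

      msg : ∀ u → consR (round t₂) (nst t₂ u) ≡ cap K (cons i (s u))
      msg u = trans (cong (λ r → consR r (nst t₂ u)) rt₂) (cong (consR (maxR τ)) (nodes₂ u))

      ne : ∀ τ' → round t₂ ≢ sumR τ'
      ne τ' eq = case trans (sym rt₂) eq of λ ()

      learned : ∀ e → InMinor est t₂ e → zE τ (est (suc t₂) e) ≡ (cap K (proj₁ (zz i s Y e)) , cap K (proj₂ (zz i s Y e)))
      learned e p = trans (cong (zE τ) eq) (cong-z sw st sM sA sB)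
        where
        open Sees (sees₂ e)
        σ = est t₂ e
        eq : est (suc t₂) e ≡ record σ { yA = Y (e₁ e) ; yB = Y (e₂ e) }
        eq = trans (proj₁ (edge-learn t₂ e) p) (cong (λ r → updER r σ (just (yv t₂ (e₁ e) , yv t₂ (e₂ e)))) rt₂)
        cong-z : ∀ {a b c d f} → a ≡ w e → b ≡ tree e → c ≡ M → d ≡ s (e₁ e) → f ≡ s (e₂ e) →
          zE τ (est- a b c d f (Y (e₁ e)) (Y (e₂ e))) ≡ (cap K (proj₁ (zz i s Y e)) , cap K (proj₂ (zz i s Y e)))
        cong-z refl refl refl refl refl = refl

      zmsg : Fin m × Bool → ℕ
      zmsg p = if proj₂ p then proj₁ (aggR (round t₂) (est (suc t₂) (proj₁ p))) else proj₂ (aggR (round t₂) (est (suc t₂) (proj₁ p)))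

      zmsg₁ : ∀ e → InMinor est t₂ e → zmsg (e , true) ≡ cap K (proj₁ (zz i s Y e))
      zmsg₁ e p = trans (cong (λ r → proj₁ (aggR r (est (suc t₂) e))) rt₂) (cong proj₁ (learned e p))
      zmsg₂ : ∀ e → InMinor est t₂ e → zmsg (e , false) ≡ cap K (proj₂ (zz i s Y e))
      zmsg₂ e p = trans (cong (λ r → proj₂ (aggR r (est (suc t₂) e))) rt₂) (cong proj₂ (learned e p))

      G : Fin n → ℕ
      G v = fromMaybe (gv t₂ v)

      Gspec : ∀ v → (∀ e b → InMinor est t₂ e → Super est t₂ v (pickEnd e b) → zmsg (e , b) ≤ G v)
        × (G v ≡ 0 ⊎ ∃ λ e → ∃ λ b → InMinor est t₂ e × Super est t₂ v (pickEnd e b) × G v ≡ zmsg (e , b))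
      Gspec v = (λ e b p q → proj₁ mx _ (∈-map⁺ zmsg (from (eqv e b) (p , q)))) , attained (proj₂ mx)
        where
        L = proj₁ (aggregation t₂ v)
        eqv = proj₂ (proj₁ (proj₂ (aggregation t₂ v)))
        mx : (∀ x → x ∈ map zmsg L → x ≤ G v) × (G v ≡ 0 ⊎ G v ∈ map zmsg L)
        mx = AggM-max (subst (λ o → AggM o (map zmsg L) (gv t₂ v)) (cong opR rt₂) (proj₂ (proj₂ (aggregation t₂ v))))
        attained : G v ≡ 0 ⊎ G v ∈ map zmsg L →
          G v ≡ 0 ⊎ ∃ λ e → ∃ λ b → InMinor est t₂ e × Super est t₂ v (pickEnd e b) × G v ≡ zmsg (e , b)
        attained (inj₁ p) = inj₁ p
        attained (inj₂ p) = let ((e , b) , e∈ , eq) = ∈-map⁻ zmsg p; (im , su) = to (eqv e b) e∈ in inj₂ (e , b , im , su , eq)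

      resultS : ∀ v → nst (suc t₂) v ≡ run M (suc τ) (capM K (upd i (s v) (Y v) (G v)))
      resultS v = trans (node-update t₂ v) (trans (cong (λ r → updNR r (nst t₂ v) (yv t₂ v) (gv t₂ v)) rt₂)
        (trans (cong (λ x → updNR (maxR τ) x (yv t₂ v) (gv t₂ v)) (nodes₂ v)) (cong (run M (suc τ))
        (cong (λ b → if b then capM K (upd i (s v) (Y v) (G v)) else s v) is))))

      sem : ∀ s' → (∀ v → s' v ≡ capM K (upd i (s v) (Y v) (G v))) → MaxSem K i s s'
      sem s' eq = record
        { Y = Y ; G = G
        ; Y-ub = λ v u p → subst (_≤ Y v) (msg u) (proj₁ (maxY t₂ ne v) u (comp← p))
        ; Y-at = λ v → let (u , p , q) = proj₂ (maxY t₂ ne v) in u , comp→ p , trans q (msg u)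
        ; G-ub₁ = λ v e nc p → subst (_≤ G v) (zmsg₁ e (minor e nc)) (proj₁ (Gspec v) e true (minor e nc) (comp← p))
        ; G-ub₂ = λ v e nc p → subst (_≤ G v) (zmsg₂ e (minor e nc)) (proj₁ (Gspec v) e false (minor e nc) (comp← p))
        ; G-at = λ v → gat v (proj₂ (Gspec v))
        ; result = eq }
        where
        gat : ∀ v → (G v ≡ 0 ⊎ ∃ λ e → ∃ λ b → InMinor est t₂ e × Super est t₂ v (pickEnd e b) × G v ≡ zmsg (e , b)) →
          G v ≡ 0 ⊎ ∃ λ e → ¬ Comp i s (e₁ e) (e₂ e) ×
          ((Comp i s v (e₁ e) × G v ≡ cap K (proj₁ (zz i s Y e))) ⊎ (Comp i s v (e₂ e) × G v ≡ cap K (proj₂ (zz i s Y e))))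
        gat v (inj₁ p) = inj₁ p
        gat v (inj₂ (e , true , im , p , q)) = inj₂ (e , (λ c → proj₂ im (comp← c)) , inj₁ (comp→ p , trans q (zmsg₁ e im)))
        gat v (inj₂ (e , false , im , p , q)) = inj₂ (e , (λ c → proj₂ im (comp← c)) , inj₂ (comp→ p , trans q (zmsg₂ e im)))

    idle : ∀ k → isKind k i ≡ false → ∀ v y g → exec k M τ (s v) y g ≡ s v
    idle k eq v y g = cong (λ b → if b then capM K (upd i (s v) y g) else s v) eq

    finish : ∀ (f : Fin n → Mem) → (∀ v → capM K (f v) ≡ f v) → (∀ v → nst (suc (suc (suc t))) v ≡ run M (suc τ) (f v)) → Inv (suc τ)
    finish f cf eq = record
      { nodes = λ v → trans (eq v) (cong (run M (suc τ)) (sym (cong memOf (eq v))))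
      ; capped = λ v → subst (λ x → capM K (memOf x) ≡ memOf x) (sym (eq v)) (cf v)
      ; edges = λ e → let q = sees₃ e in knows (Sees.sw q) (Sees.st q) (Sees.sM q) }

    nodes₂ : kind i ≡ byMax → ∀ v → nst (suc (suc t)) v ≡ run M τ (s v)
    nodes₂ eq v = trans (node-update (suc t) v) (trans (cong (λ r → updNR r (nst (suc t) v) (yv (suc t) v) (gv (suc t) v)) rt₁)
      (trans (cong (λ x → updNR (sumR τ) x (yv (suc t) v) (gv (suc t) v)) (nodes₁ v))
      (cong (run M τ) (idle bySum (cong (bySum ≡ₖ_) eq) v _ _))))

    advance : Sem K i s (ms (suc τ)) × Inv (suc τ)
    advance = go (kind i) refl
      where
      go : ∀ k → kind i ≡ k → SemOf k K i s (ms (suc τ)) × Inv (suc τ)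
      go bySum eq = sem _ (λ v → cong memOf (r₃ v)) , finish _ (λ v → capM-capM K (upd i (s v) (Y v) (G v))) r₃
        where
        open SumRound (cong (bySum ≡ₖ_) eq)
        x : Fin n → Mem
        x v = capM K (upd i (s v) (Y v) (G v))
        r₃ : ∀ v → nst (suc (suc (suc t))) v ≡ run M (suc τ) (capM K (upd i (s v) (Y v) (G v)))
        r₃ v = trans (node-update (suc (suc t)) v) (trans (cong (λ r → updNR r (nst (suc (suc t)) v) (yv (suc (suc t)) v) (gv (suc (suc t)) v)) rt₂)
          (trans (cong (λ x → updNR (maxR τ) x (yv (suc (suc t)) v) (gv (suc (suc t)) v)) (resultS v))
          (cong (λ b → run M (suc τ) (if b then capM K (upd i (x v) (yv (suc (suc t)) v) (fromMaybe (gv (suc (suc t)) v))) else x v)) (cong (byMax ≡ₖ_) eq))))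
      go byMax eq = sem _ (λ v → cong memOf (resultS v)) , finish _ (λ v → capM-capM K (upd i (s v) (Y v) (G v))) resultS
        where
        open MaxRound (cong (byMax ≡ₖ_) eq) (nodes₂ eq)

  inv : ∀ τ → Inv τ
  inv zero = inv₀
  inv (suc τ) = proj₂ (Step.advance τ (inv τ))

  semAt : ∀ τ → Sem K (at M τ) (ms τ) (ms (suc τ))
  semAt τ = proj₁ (Step.advance τ (inv τ))

  runFrom : ∀ is τ → (∀ k → nth is k ≡ at M (k + τ)) → Run K is (ms τ) (ms (length is + τ))
  runFrom [] τ eq = []
  runFrom (i ∷ is) τ eq = subst (λ i → Sem K i (ms τ) (ms (suc τ))) (sym (eq 0)) (semAt τ) ∷
    subst (λ x → Run K is (ms (suc τ)) (ms x)) (+-suc (length is) τ)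
      (runFrom is (suc τ) (λ k → trans (eq (suc k)) (cong (at M) (sym (+-suc k τ)))))

  runAll : Run K (sched M) (ms 0) (ms (length (sched M)))
  runAll = subst (λ x → Run K (sched M) (ms 0) (ms x)) (+-identityʳ _)
    (runFrom (sched M) 0 (λ k → cong (at M) (sym (+-identityʳ k))))

  len : ℕ
  len = length (sched M)

  nth-noop : ∀ is k → length is ≤ k → nth is k ≡ noop
  nth-noop [] k _ = refl
  nth-noop (i ∷ is) (suc k) (s≤s le) = nth-noop is k le

  -- Past the end of the schedule `nth` yields `noop`, which only clips memories that are clipped
  -- already. Results are therefore frozen.
  ms-noop : ∀ τ → at M τ ≡ noop → ∀ v → ms (suc τ) v ≡ ms τ v
  ms-noop τ eq v = trans (MaxSem.result (subst (λ i → Sem K i (ms τ) (ms (suc τ))) eq (semAt τ)) v) (Inv.capped (inv τ) v)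

  ms-late : ∀ k v → ms (k + len) v ≡ ms len v
  ms-late zero v = refl
  ms-late (suc k) v = trans (ms-noop (k + len) (nth-noop (sched M) (k + len) (m≤n+m len k)) v) (ms-late k v)

  late : ∀ τ v → len ≤ τ → ms τ v ≡ ms len v
  late τ v le = subst (λ x → ms x v ≡ ms len v) (m∸n+n≡m le) (ms-late (τ ∸ len) v)

  phase : ∀ t → ∃ λ τ → (2 + t ≡ base τ) ⊎ (2 + t ≡ suc (base τ)) ⊎ (2 + t ≡ suc (suc (base τ)))
  phase zero = 0 , inj₁ refl
  phase (suc t) = aux (phase t)
    where
    aux : (∃ λ τ → (2 + t ≡ base τ) ⊎ (2 + t ≡ suc (base τ)) ⊎ (2 + t ≡ suc (suc (base τ)))) →
      ∃ λ τ → (3 + t ≡ base τ) ⊎ (3 + t ≡ suc (base τ)) ⊎ (3 + t ≡ suc (suc (base τ)))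
    aux (τ , inj₁ eq) = τ , inj₂ (inj₁ (cong suc eq))
    aux (τ , inj₂ (inj₁ eq)) = τ , inj₂ (inj₂ (cong suc eq))
    aux (τ , inj₂ (inj₂ eq)) = suc τ , inj₁ (cong suc eq)

  out-run : ∀ M' clk s x → out (run M' clk s) ≡ just x → length (sched M') ≤ clk × tmp s ≡ x
  out-run M' clk s x eq = aux (length (sched M') ≤ᵇ clk) refl eq
    where
    aux : ∀ b → (length (sched M') ≤ᵇ clk) ≡ b → (if b then just (tmp s) else nothing) ≡ just x → length (sched M') ≤ clk × tmp s ≡ x
    aux true le refl = ≤ᵇ⇒≤ _ _ (subst So (sym le) _) , refl

  -- An answer must be correct whenever it is visible, also in the middle of an instruction. Right
  -- after a sum round the memory could already have changed, but a visible answer shows that the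
  -- schedule is over; the instruction is then `noop`, which idles in that round.
  out-sound : ∀ t v x → out (nst t v) ≡ just x → tmp (ms len v) ≡ x
  out-sound zero v x eq = case trans (sym (cong out (init-n v))) eq of λ ()
  out-sound (suc zero) v x eq = trans (cong tmp (trans (sym (late 0 v (proj₁ o))) (ms₀ v))) (proj₂ o)
    where o = out-run M 0 (capM K (mem₀ (ident v))) x (trans (sym (cong out (nst₁ v))) eq)
  out-sound (suc (suc t)) v x eq = aux (phase t)
    where
    done : ∀ τ → len ≤ τ → kind (at M τ) ≡ byMax
    done τ le = cong kind (nth-noop (sched M) τ le)
    fin : ∀ τ → out (run M τ (ms τ v)) ≡ just x → tmp (ms len v) ≡ x
    fin τ eq' = let o = out-run M τ (ms τ v) x eq' in trans (cong tmp (sym (late τ v (proj₁ o)))) (proj₂ o)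
    clock : ∀ τ → ∃ λ s → nst (suc (suc (base τ))) v ≡ run M τ s
    clock τ = _ , trans (node-update (suc (base τ)) v) (trans (cong (λ r → updNR r (nst (suc (base τ)) v) (yv (suc (base τ)) v) (gv (suc (base τ)) v)) (Step.rt₁ τ (inv τ)))
      (cong (λ x → updNR (sumR τ) x (yv (suc (base τ)) v) (gv (suc (base τ)) v)) (Step.nodes₁ τ (inv τ) v)))
    aux : (∃ λ τ → (2 + t ≡ base τ) ⊎ (2 + t ≡ suc (base τ)) ⊎ (2 + t ≡ suc (suc (base τ)))) → tmp (ms len v) ≡ x
    aux (τ , inj₁ teq) = fin τ (trans (sym (cong out (Inv.nodes (inv τ) v))) (subst (λ k → out (nst k v) ≡ just x) teq eq))
    aux (τ , inj₂ (inj₁ teq)) = fin τ (trans (sym (cong out (Step.nodes₁ τ (inv τ) v))) (subst (λ k → out (nst k v) ≡ just x) teq eq))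
    aux (τ , inj₂ (inj₂ teq)) = fin τ (trans (sym (cong out (Step.nodes₂ τ (inv τ) (done τ over) v))) eq')
      where
      eq' = subst (λ k → out (nst k v) ≡ just x) teq eq
      over : len ≤ τ
      over = proj₁ (out-run M τ (proj₁ (clock τ)) x (trans (sym (cong out (proj₂ (clock τ)))) eq'))

  out-final : ∀ v → out (nst (base len) v) ≡ just (tmp (ms len v))
  out-final v = trans (cong out (Inv.nodes (inv len) v))
    (cong (λ b → if b then just (tmp (ms len v)) else nothing) (So⇒true (≤⇒≤ᵇ (≤-refl {len}))))
    where
    So⇒true : ∀ {b} → So b → b ≡ true
    So⇒true {true} _ = refl

  base≡ : ∀ τ → base τ ≡ 2 + 3 * τ
  base≡ zero = refl
  base≡ (suc τ) = trans (cong (3 +_) (base≡ τ)) (cong (2 +_) (sym (*-suc 3 τ)))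

  data Running (v : Fin n) (x : NState) : Set where
    running : ∀ clk s → capM K s ≡ s → x ≡ run M clk s → Running v x

  updNR-running : ∀ v r clk s y g → capM K s ≡ s → Running v (updNR r (run M clk s) y g)
  updNR-running v learn clk s y g c = running clk s c refl
  updNR-running v tell clk s y g c = running clk s c refl
  updNR-running v (refresh τ) clk s y g c = running clk s c refl
  updNR-running v (sumR τ) clk s y g c = running clk (exec bySum M τ s (y ∸ 2 ^ K) (fromMaybe g ∸ 2 ^ K)) (aux (isKind bySum (at M τ))) refl
    where
    aux : ∀ b {x} → capM K (if b then capM K x else s) ≡ (if b then capM K x else s)
    aux true {x} = capM-capM K x
    aux false = c
  updNR-running v (maxR τ) clk s y g c = running (suc clk) (exec byMax M τ s y (fromMaybe g)) (aux (isKind byMax (at M τ))) refl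
    where
    aux : ∀ b {x} → capM K (if b then capM K x else s) ≡ (if b then capM K x else s)
    aux true {x} = capM-capM K x
    aux false = c

  isRunning : ∀ t v → Running v (nst (suc t) v)
  isRunning zero v = running 0 (capM K (mem₀ (ident v))) (capM-capM K (mem₀ (ident v))) (nst₁ v)
  isRunning (suc t) v = aux (isRunning t v)
    where
    aux : Running v (nst (suc t) v) → Running v (nst (suc (suc t)) v)
    aux (running clk s c eq) = subst (Running v) (sym (trans (node-update (suc t) v) (cong (λ x → updNR (round (suc t)) x (yv (suc t) v) (gv (suc t) v)) eq)))
      (updNR-running v (round (suc t)) clk s (yv (suc t) v) (gv (suc t) v) c)

  -- `tell` happens only once, and no other round writes `maxId`.
  tops : ∀ t e → maxId (est (2 + t) e) ≡ M
  tops zero e = Knows.kM (knows₂ e)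
  tops (suc t) e = trans (cong maxId (proj₂ (edgeStep (2 + t) e))) (trans (keep (round (2 + t)) (λ eq → never t eq) (proj₁ (edgeStep (2 + t) e))) (tops t e))
    where
    never : ∀ t → round (2 + t) ≢ tell
    never zero ()
    never (suc t) eq = next≢tell (round (2 + t)) (later t) eq
      where
      later : ∀ t → round (2 + t) ≢ learn
      later t eq = next≢learn (round (1 + t)) eq
        where
        next≢learn : ∀ r → next r ≢ learn
        next≢learn learn ()
        next≢learn tell ()
        next≢learn (refresh _) ()
        next≢learn (sumR _) ()
        next≢learn (maxR _) ()
      next≢tell : ∀ r → r ≢ learn → next r ≢ tell
      next≢tell learn ne _ = ne refl
      next≢tell tell ne ()
      next≢tell (refresh _) ne ()
      next≢tell (sumR _) ne ()
      next≢tell (maxR _) ne ()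
    keep : ∀ r → r ≢ tell → ∀ y → maxId (updER r (est (2 + t) e) y) ≡ maxId (est (2 + t) e)
    keep r ne nothing = refl
    keep learn ne (just _) = refl
    keep tell ne (just _) = ⊥-elim (ne refl)
    keep (refresh _) ne (just _) = refl
    keep (sumR _) ne (just _) = refl
    keep (maxR _) ne (just _) = refl

  -- Message sizes.

  module Bits (b : ℕ) (M< : M < 2 ^ b) (K< : regs * K ≤ b) (K<' : suc K ≤ b) where

    cap<b : ∀ x → cap K x < 2 ^ b
    cap<b x = <-≤-trans (cap< K x) (2^-mono K b (≤-trans (n≤1+n K) K<'))

    marked<b : ∀ x → 2 ^ K + cap K x < 2 ^ b
    marked<b x = <-≤-trans (+-monoʳ-< (2 ^ K) (cap< K x))
      (≤-trans (≤-reflexive (cong (2 ^ K +_) (sym (+-identityʳ _)))) (2^-mono (suc K) b K<'))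

    enc<b : ∀ s → capM K s ≡ s → enc (2 ^ K) (toL s) < 2 ^ b
    enc<b s c = <-≤-trans (enc< (2 ^ K) (toL s) (toL< K s c))
      (≤-trans (≤-reflexive (trans (^-*-assoc 2 K regs) (cong (2 ^_) (*-comm K regs)))) (2^-mono (regs * K) b K<))

    consBound : ∀ t v → consR (round t) (nst t v) < 2 ^ b
    consBound zero v = subst (_< 2 ^ b) (sym (cong (consR learn) (init-n v))) (≤-<-trans (ident≤M v) M<)
    consBound (suc t) v = aux (isRunning t v)
      where
      bound : ∀ r clk s → capM K s ≡ s → consR r (run M clk s) < 2 ^ b
      bound learn clk s c = 1≤2^ b
      bound tell clk s c = M<
      bound (refresh τ) clk s c = enc<b s c
      bound (sumR τ) clk s c = marked<b _
      bound (maxR τ) clk s c = cap<b _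
      aux : Running v (nst (suc t) v) → consR (round (suc t)) (nst (suc t) v) < 2 ^ b
      aux (running clk s c eq) = subst (λ x → consR (round (suc t)) x < 2 ^ b) (sym eq) (bound (round (suc t)) clk s c)

    aggBound : ∀ t e → proj₁ (aggR (round t) (est (suc t) e)) < 2 ^ b × proj₂ (aggR (round t) (est (suc t) e)) < 2 ^ b
    aggBound zero e = 1≤2^ b , 1≤2^ b
    aggBound (suc t) e = bound (round (suc t)) (est (2 + t) e) (tops t e)
      where
      bound : ∀ r x → maxId x ≡ M → proj₁ (aggR r x) < 2 ^ b × proj₂ (aggR r x) < 2 ^ b
      bound learn x eq = 1≤2^ b , 1≤2^ b
      bound tell x eq = 1≤2^ b , 1≤2^ b
      bound (refresh τ) x eq = 1≤2^ b , 1≤2^ b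
      bound (sumR τ) x refl = marked<b _ , marked<b _
      bound (maxR τ) x refl = cap<b _ , cap<b _

  opBound : ∀ b r x y → x < 2 ^ b → y < 2 ^ b → opR r x y < 2 ^ b
  opBound b learn x y x< y< = ⊔-lub x< y<
  opBound b tell x y x< y< = ⊔-lub x< y<
  opBound b (refresh _) x y x< y< = ⊔-lub x< y<
  opBound b (sumR _) x y x< y< = satAdd< b x y x< y<
  opBound b (maxR _) x y x< y< = ⊔-lub x< y<

-- Positions in a list without repetitions, counted from its end

posIn : ∀ {n} → List (Fin n) → Fin n → ℕ
posIn [] v = 0
posIn (x ∷ xs) v = if does (x F.≟ v) then suc (length xs) else posIn xs v

posIn-here : ∀ {n} (x : Fin n) xs → posIn (x ∷ xs) x ≡ suc (length xs)
posIn-here x xs with x F.≟ x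
... | yes _ = refl
... | no ne = ⊥-elim (ne refl)

posIn-there : ∀ {n} {x v : Fin n} xs → x ≢ v → posIn (x ∷ xs) v ≡ posIn xs v
posIn-there {x = x} {v} xs ne with x F.≟ v
... | yes p = ⊥-elim (ne p)
... | no _ = refl

posIn≤ : ∀ {n} (xs : List (Fin n)) v → posIn xs v ≤ length xs
posIn≤ [] v = z≤n
posIn≤ (x ∷ xs) v with x F.≟ v
... | yes _ = ≤-refl
... | no _ = m≤n⇒m≤1+n (posIn≤ xs v)

posIn-∉ : ∀ {n} (xs : List (Fin n)) {v} → ¬ (v ∈ xs) → posIn xs v ≡ 0
posIn-∉ [] ne = refl
posIn-∉ (x ∷ xs) ne = trans (posIn-there xs (λ eq → ne (here (sym eq)))) (posIn-∉ xs (ne ∘ there))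

posIn-∈ : ∀ {n} (xs : List (Fin n)) {v} → v ∈ xs → 1 ≤ posIn xs v
posIn-∈ (x ∷ xs) {v} v∈ with x F.≟ v
... | yes _ = s≤s z≤n
... | no ne = posIn-∈ xs (tail v∈)
  where
  tail : v ∈ x ∷ xs → v ∈ xs
  tail (here eq) = ⊥-elim (ne (sym eq))
  tail (there p) = p

posIn-inj : ∀ {n} (xs : List (Fin n)) {u v} → 1 ≤ posIn xs u → posIn xs u ≡ posIn xs v → u ≡ v
posIn-inj (x ∷ xs) {u} {v} le eq with x F.≟ u | x F.≟ v
... | yes refl | yes refl = refl
... | yes refl | no _ = ⊥-elim (<-irrefl refl (subst (_≤ length xs) (sym eq) (posIn≤ xs v)))
... | no _ | yes refl = ⊥-elim (<-irrefl refl (subst (_≤ length xs) eq (posIn≤ xs u)))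
... | no _ | no _ = posIn-inj xs le eq

Unique-head : ∀ {A : Set} {x : A} {xs} → Unique (x ∷ xs) → ¬ (x ∈ xs)
Unique-head (ne AP.∷ _) x∈ = All.lookup ne x∈ refl

Unique-tail : ∀ {A : Set} {x : A} {xs} → Unique (x ∷ xs) → Unique xs
Unique-tail (_ AP.∷ u) = u

Consec-∈₁ : ∀ {A : Set} {a b : A} {xs} → Consec a b xs → a ∈ xs
Consec-∈₁ here = here refl
Consec-∈₁ (there c) = there (Consec-∈₁ c)

Consec-∈₂ : ∀ {A : Set} {a b x : A} {xs} → Consec a b (x ∷ xs) → b ∈ xs
Consec-∈₂ here = here refl
Consec-∈₂ (there {zs = y ∷ ys} c) = there (Consec-∈₂ c)

posIn-consec : ∀ {n} {r a b : Fin n} xs → Unique (r ∷ xs) → Consec a b (r ∷ xs) →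
  (a ≡ r × posIn xs b ≡ length xs) ⊎ (a ∈ xs × posIn xs a ≡ suc (posIn xs b))
posIn-consec (x ∷ xs) u here = inj₁ (refl , posIn-here x xs)
posIn-consec {a = a} {b} (x ∷ xs) u (there c) = inj₂ (aux (posIn-consec xs (Unique-tail u) c))
  where
  x≢b : x ≢ b
  x≢b eq = Unique-head (Unique-tail u) (subst (_∈ xs) (sym eq) (Consec-∈₂ c))
  aux : (a ≡ x × posIn xs b ≡ length xs) ⊎ (a ∈ xs × posIn xs a ≡ suc (posIn xs b)) →
    a ∈ x ∷ xs × posIn (x ∷ xs) a ≡ suc (posIn (x ∷ xs) b)
  aux (inj₁ (refl , eq)) = here refl , trans (posIn-here x xs) (cong suc (sym (trans (posIn-there xs x≢b) eq)))
  aux (inj₂ (a∈ , eq)) = there a∈ , trans (posIn-there xs x≢a) (trans eq (cong suc (sym (posIn-there xs x≢b))))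
    where
    x≢a : x ≢ a
    x≢a eq = Unique-head (Unique-tail u) (subst (_∈ xs) (sym eq) a∈)

pred-consec : ∀ {A : Set} {r v : A} {xs} → v ∈ xs → ∃ λ a → Consec a v (r ∷ xs)
pred-consec (here refl) = _ , here
pred-consec (there v∈) = let (a , c) = pred-consec v∈ in a , there c

between? : ℕ → ℕ → Bool
between? k p = (1 ≤ᵇ p) ∧ (p ≤ᵇ k)

≤ᵇ-true : ∀ {a b} → a ≤ b → (a ≤ᵇ b) ≡ true
≤ᵇ-true {a} {b} le with a ≤ᵇ b in eq
... | true = refl
... | false = ⊥-elim (subst So eq (≤⇒≤ᵇ le))

≤ᵇ-false : ∀ {a b} → b < a → (a ≤ᵇ b) ≡ false
≤ᵇ-false {a} {b} lt with a ≤ᵇ b in eq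
... | false = refl
... | true = ⊥-elim (<-irrefl refl (<-≤-trans lt (≤ᵇ⇒≤ a b (subst So (sym eq) _))))

≤ᵇ-sound : ∀ {a b} → (a ≤ᵇ b) ≡ true → a ≤ b
≤ᵇ-sound {a} {b} eq = ≤ᵇ⇒≤ a b (subst So (sym eq) _)

≡ᵇ-true : ∀ {a b} → a ≡ b → (a ≡ᵇ b) ≡ true
≡ᵇ-true {a} {b} e with a ≡ᵇ b in eq
... | true = refl
... | false = ⊥-elim (subst So eq (≡⇒≡ᵇ a b e))

≡ᵇ-sound : ∀ {a b} → (a ≡ᵇ b) ≡ true → a ≡ b
≡ᵇ-sound {a} {b} eq = ≡ᵇ⇒≡ a b (subst So (sym eq) _)

≡ᵇ-false : ∀ {a b} → a ≢ b → (a ≡ᵇ b) ≡ false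
≡ᵇ-false ne = ¬true⇒false (λ eq → ne (≡ᵇ-sound eq))

-- The positions of a list are the numbers from `1` to its length, each taken once. This is what
-- allows positions to be computed as suffix sums of ones.
count-posIn : ∀ {n} (xs : List (Fin n)) → Unique xs → ∀ k → k ≤ length xs →
  ∑ (λ u → between? k (posIn xs u) ▷ 1) ≡ k
count-posIn {n} [] u zero le = ∑-zero {n} {λ u → between? 0 (posIn [] u) ▷ 1} (λ _ → refl)
count-posIn {n} (x ∷ xs) u k le with k ≤? length xs
... | yes k≤ = trans (∑-cong (λ v → aux v (x F.≟ v))) (count-posIn xs (Unique-tail u) k k≤)
  where
  aux : ∀ v → Dec (x ≡ v) → (between? k (posIn (x ∷ xs) v) ▷ 1) ≡ (between? k (posIn xs v) ▷ 1)
  aux v (no ne) = cong (λ p → between? k p ▷ 1) (posIn-there xs ne)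
  aux v (yes refl) = trans (cong (λ p → between? k p ▷ 1) (posIn-here x xs))
    (trans (cong (λ b → true ∧ b ▷ 1) (≤ᵇ-false (s≤s k≤))) (sym (cong (λ p → between? k p ▷ 1) (posIn-∉ xs (Unique-head u)))))
... | no k≰ = trans (∑-cong (λ v → aux v (x F.≟ v))) (trans (∑-+ (λ v → does (x F.≟ v) ▷ 1) (λ v → between? (length xs) (posIn xs v) ▷ 1))
    (trans (cong₂ _+_ (trans (∑-point x (λ v ne → other v (ne ∘ sym))) self) (count-posIn xs (Unique-tail u) (length xs) ≤-refl)) (sym k≡)))
  where
  k≡ : k ≡ suc (length xs)
  k≡ = ≤-antisym le (≰⇒> k≰)
  self : (does (x F.≟ x) ▷ 1) ≡ 1
  self with x F.≟ x
  ... | yes _ = refl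
  ... | no ne = ⊥-elim (ne refl)
  other : ∀ v → x ≢ v → (does (x F.≟ v) ▷ 1) ≡ 0
  other v ne with x F.≟ v
  ... | yes p = ⊥-elim (ne p)
  ... | no _ = refl
  aux : ∀ v → Dec (x ≡ v) → (between? k (posIn (x ∷ xs) v) ▷ 1) ≡ (does (x F.≟ v) ▷ 1) + (between? (length xs) (posIn xs v) ▷ 1)
  aux v (yes refl) = trans (cong (λ p → between? k p ▷ 1) (posIn-here x xs))
    (trans (cong (λ b → true ∧ b ▷ 1) (≤ᵇ-true (≤-reflexive (sym k≡))))
    (sym (cong₂ _+_ self (cong (λ p → between? (length xs) p ▷ 1) (posIn-∉ xs (Unique-head u))))))
  aux v (no ne) = trans (cong (λ p → between? k p ▷ 1) (posIn-there xs ne))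
    (trans (cong (λ b → (1 ≤ᵇ posIn xs v) ∧ b ▷ 1) (trans (≤ᵇ-true (≤-trans (posIn≤ xs v) (≤-trans (n≤1+n _) (≤-reflexive (sym k≡))))) (sym (≤ᵇ-true (posIn≤ xs v)))))
    (sym (cong (_+ (between? (length xs) (posIn xs v) ▷ 1)) (other v ne))))

-- Spiders in coordinates: LEG is 0 at the root, 1 and 2 on the two paths; POS v counts
-- the nodes of the path of v from v downwards, so POS decreases away from the root.

record Legs (I : Instance) : Set where
  open InstanceDefs I
  field
    root : Fin n
    LEG POS : Fin n → ℕ
    LEG-root : LEG root ≡ 0
    root-LEG : ∀ v → LEG v ≡ 0 → v ≡ root
    LEG-cases : ∀ v → LEG v ≡ 0 ⊎ LEG v ≡ 1 ⊎ LEG v ≡ 2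
    POS-root : POS root ≡ 0
    POS≥1 : ∀ v → LEG v ≢ 0 → 1 ≤ POS v
    POS-inj : ∀ u v → LEG u ≡ LEG v → POS u ≡ POS v → u ≡ v
    up : ∀ v → LEG v ≢ 0 → ∃ λ e → IsTree e × e₂ e ≡ v
    tree-child : ∀ e → IsTree e → LEG (e₂ e) ≢ 0
    tree-parent : ∀ e → IsTree e →
      (e₁ e ≡ root × (∀ u → LEG u ≡ LEG (e₂ e) → POS u ≤ POS (e₂ e)))
      ⊎ (LEG (e₁ e) ≡ LEG (e₂ e) × POS (e₁ e) ≡ suc (POS (e₂ e)))
    connected : ∀ u v → Star TreeAdj u v
    count : ∀ v → LEG v ≢ 0 → ∑ (λ u → (LEG u ≡ᵇ LEG v) ∧ (POS u ≤ᵇ POS v) ▷ 1) ≡ POS v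

module FromSpider (I : Instance) (r : Fin (Instance.n I)) (ps qs : List (Fin (Instance.n I)))
  (sp : InstanceDefs.Spider I r ps qs) where
  open InstanceDefs I

  descP = proj₁ sp
  descQ = proj₁ (proj₂ sp)
  uniq : Unique (r ∷ ps ++ qs)
  uniq = proj₁ (proj₂ (proj₂ sp))
  covers = proj₁ (proj₂ (proj₂ (proj₂ sp)))
  onLegs = proj₂ (proj₂ (proj₂ (proj₂ sp)))

  r∉ : ¬ (r ∈ ps ++ qs)
  r∉ = Unique-head uniq
  uP : Unique ps
  uP = proj₁ (++-unique ps (Unique-tail uniq))
    where
    ++-unique : ∀ xs {ys : List (Fin n)} → Unique (xs ++ ys) → Unique xs × Unique ys
    ++-unique [] u = AP.[] , u
    ++-unique (x ∷ xs) (ne AP.∷ u) = (AllP.++⁻ˡ xs ne AP.∷ proj₁ (++-unique xs u)) , proj₂ (++-unique xs u)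
  uQ : Unique qs
  uQ = go ps (Unique-tail uniq)
    where
    go : ∀ xs {ys : List (Fin n)} → Unique (xs ++ ys) → Unique ys
    go [] u = u
    go (x ∷ xs) (_ AP.∷ u) = go xs u
  disj : ∀ {v} → v ∈ ps → v ∈ qs → ⊥
  disj = go ps (Unique-tail uniq)
    where
    go : ∀ xs {v} → Unique (xs ++ qs) → v ∈ xs → v ∈ qs → ⊥
    go (x ∷ xs) u (here refl) v∈ = Unique-head u (∈-++⁺ʳ xs v∈)
    go (x ∷ xs) u (there p) v∈ = go xs (Unique-tail u) p v∈
  cons-unique : ∀ {xs} → Unique xs → ¬ (r ∈ xs) → Unique (r ∷ xs)
  cons-unique {xs} u ne = All.tabulate (λ x∈ eq → ne (subst (_∈ xs) (sym eq) x∈)) AP.∷ u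
  urP : Unique (r ∷ ps)
  urP = cons-unique uP (r∉ ∘ ∈-++⁺ˡ)
  urQ : Unique (r ∷ qs)
  urQ = cons-unique uQ (r∉ ∘ ∈-++⁺ʳ ps)

  data Where (v : Fin n) : Set where
    atRoot : v ≡ r → Where v
    inP : v ∈ ps → Where v
    inQ : v ∈ qs → Where v

  locate : ∀ v → Where v
  locate v = aux (covers v)
    where
    aux : v ∈ r ∷ ps ++ qs → Where v
    aux (here eq) = atRoot eq
    aux (there p) = [ inP , inQ ]′ (∈-++⁻ ps p)

  LEG POS : Fin n → ℕ
  LEG v = if does (v ∈? ps) then 1 else if does (v ∈? qs) then 2 else 0
  POS v = posIn ps v + posIn qs v

  legP : ∀ {v} → v ∈ ps → LEG v ≡ 1
  legP {v} p = cong (λ b → if b then 1 else if does (v ∈? qs) then 2 else 0) (to (does⇔ (v ∈? ps)) p)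
  notin : ∀ {v : Fin n} {xs} → ¬ (v ∈ xs) → does (v ∈? xs) ≡ false
  notin {v} {xs} ne = ¬true⇒false (λ eq → ne (from (does⇔ (v ∈? xs)) eq))
  legQ : ∀ {v} → v ∈ qs → LEG v ≡ 2
  legQ {v} p = trans (cong (λ b → if b then 1 else if does (v ∈? qs) then 2 else 0) (notin {v} {ps} (λ q → disj q p)))
    (cong (λ b → if b then 2 else 0) (to (does⇔ (v ∈? qs)) p))
  leg0 : LEG r ≡ 0
  leg0 = trans (cong (λ b → if b then 1 else if does (r ∈? qs) then 2 else 0) (notin {r} {ps} (r∉ ∘ ∈-++⁺ˡ)))
    (cong (λ b → if b then 2 else 0) (notin {r} {qs} (r∉ ∘ ∈-++⁺ʳ ps)))
  posP : ∀ {v} → v ∈ ps → POS v ≡ posIn ps v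
  posP {v} p = trans (cong (posIn ps v +_) (posIn-∉ qs (λ q → disj p q))) (+-identityʳ _)
  posQ : ∀ {v} → v ∈ qs → POS v ≡ posIn qs v
  posQ {v} p = cong (_+ posIn qs v) (posIn-∉ ps (λ q → disj q p))

  chain : ∀ a xs → Descending (a ∷ xs) → ∀ v → v ∈ xs → Star TreeAdj a v
  chain a (x ∷ xs) d v v∈ = first ◅ rest v∈
    where
    first : TreeAdj a x
    first = let (e , t , p , q) = d a x here in e , t , inj₁ (p , q)
    rest : v ∈ x ∷ xs → Star TreeAdj x v
    rest (here refl) = ε
    rest (there p) = chain x xs (λ y z c → d y z (there c)) v p

  adj-sym : ∀ {u v} → TreeAdj u v → TreeAdj v u
  adj-sym (e , t , inj₁ p) = e , t , inj₂ p
  adj-sym (e , t , inj₂ p) = e , t , inj₁ p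

  star-sym : ∀ {u v} → Star TreeAdj u v → Star TreeAdj v u
  star-sym ε = ε
  star-sym (x ◅ p) = star-sym p ◅◅ (adj-sym x ◅ ε)

  fromRoot : ∀ v → Star TreeAdj r v
  fromRoot v with locate v
  ... | atRoot refl = ε
  ... | inP p = chain r ps descP v p
  ... | inQ p = chain r qs descQ v p

  up' : ∀ v → LEG v ≢ 0 → ∃ λ e → IsTree e × e₂ e ≡ v
  up' v ne with locate v
  ... | atRoot refl = ⊥-elim (ne leg0)
  ... | inP p = let (a , c) = pred-consec p; (e , t , _ , q) = descP a v c in e , t , q
  ... | inQ p = let (a , c) = pred-consec p; (e , t , _ , q) = descQ a v c in e , t , q

  childP : ∀ e → PathEdge (r ∷ ps) e → e₂ e ∈ ps
  childP e (t , c) = Consec-∈₂ c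
  childQ : ∀ e → PathEdge (r ∷ qs) e → e₂ e ∈ qs
  childQ e (t , c) = Consec-∈₂ c

  in1 : ∀ u → LEG u ≡ 1 → u ∈ ps
  in1 u eq with locate u
  ... | inP p = p
  ... | atRoot refl = case trans (sym leg0) eq of λ ()
  ... | inQ p = case trans (sym (legQ p)) eq of λ ()
  in2 : ∀ u → LEG u ≡ 2 → u ∈ qs
  in2 u eq with locate u
  ... | inQ p = p
  ... | atRoot refl = case trans (sym leg0) eq of λ ()
  ... | inP p = case trans (sym (legP p)) eq of λ ()
  in0 : ∀ u → LEG u ≡ 0 → u ≡ r
  in0 u eq with locate u
  ... | atRoot p = p
  ... | inP p = case trans (sym (legP p)) eq of λ ()
  ... | inQ p = case trans (sym (legQ p)) eq of λ ()

  pos0 : POS r ≡ 0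
  pos0 = cong₂ _+_ (posIn-∉ ps (r∉ ∘ ∈-++⁺ˡ)) (posIn-∉ qs (r∉ ∘ ∈-++⁺ʳ ps))

  parent : ∀ e → IsTree e → (e₁ e ≡ r × (∀ u → LEG u ≡ LEG (e₂ e) → POS u ≤ POS (e₂ e)))
      ⊎ (LEG (e₁ e) ≡ LEG (e₂ e) × POS (e₁ e) ≡ suc (POS (e₂ e)))
  parent e t with onLegs e t
  ... | inj₁ (_ , c) = aux (posIn-consec ps urP c)
    where
    b∈ = Consec-∈₂ c
    aux : (e₁ e ≡ r × posIn ps (e₂ e) ≡ length ps) ⊎ (e₁ e ∈ ps × posIn ps (e₁ e) ≡ suc (posIn ps (e₂ e))) → _
    aux (inj₁ (p , q)) = inj₁ (p , λ u eq → subst₂ _≤_ (sym (posP (in1 u (trans eq (legP b∈))))) (sym (trans (posP b∈) q)) (posIn≤ ps u))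
    aux (inj₂ (p , q)) = inj₂ (trans (legP p) (sym (legP b∈)) , trans (posP p) (trans q (cong suc (sym (posP b∈)))))
  ... | inj₂ (_ , c) = aux (posIn-consec qs urQ c)
    where
    b∈ = Consec-∈₂ c
    aux : (e₁ e ≡ r × posIn qs (e₂ e) ≡ length qs) ⊎ (e₁ e ∈ qs × posIn qs (e₁ e) ≡ suc (posIn qs (e₂ e))) → _
    aux (inj₁ (p , q)) = inj₁ (p , λ u eq → subst₂ _≤_ (sym (posQ (in2 u (trans eq (legQ b∈))))) (sym (trans (posQ b∈) q)) (posIn≤ qs u))
    aux (inj₂ (p , q)) = inj₂ (trans (legQ p) (sym (legQ b∈)) , trans (posQ p) (trans q (cong suc (sym (posQ b∈)))))

  pos≥1 : ∀ v → LEG v ≢ 0 → 1 ≤ POS v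
  pos≥1 v ne with locate v
  ... | atRoot refl = ⊥-elim (ne leg0)
  ... | inP p = subst (1 ≤_) (sym (posP p)) (posIn-∈ ps p)
  ... | inQ p = subst (1 ≤_) (sym (posQ p)) (posIn-∈ qs p)

  pos-inj : ∀ u v → LEG u ≡ LEG v → POS u ≡ POS v → u ≡ v
  pos-inj u v leq peq with locate v
  ... | atRoot refl = in0 u (trans leq leg0)
  ... | inP p = let q = in1 u (trans leq (legP p)) in posIn-inj ps (posIn-∈ ps q) (trans (sym (posP q)) (trans peq (posP p)))
  ... | inQ p = let q = in2 u (trans leq (legQ p)) in posIn-inj qs (posIn-∈ qs q) (trans (sym (posQ q)) (trans peq (posQ p)))

  count' : ∀ v → LEG v ≢ 0 → ∑ (λ u → (LEG u ≡ᵇ LEG v) ∧ (POS u ≤ᵇ POS v) ▷ 1) ≡ POS v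
  count' v ne with locate v
  ... | atRoot refl = ⊥-elim (ne leg0)
  ... | inP p = trans (∑-cong pt) (trans (count-posIn ps uP (posIn ps v) (posIn≤ ps v)) (sym (posP p)))
    where
    pt : ∀ u → ((LEG u ≡ᵇ LEG v) ∧ (POS u ≤ᵇ POS v) ▷ 1) ≡ (between? (posIn ps v) (posIn ps u) ▷ 1)
    pt u with locate u
    ... | inP q = cong₂ (λ a b → a ∧ b ▷ 1) (trans (≡ᵇ-true (trans (legP q) (sym (legP p)))) (sym (≤ᵇ-true (posIn-∈ ps q)))) (cong₂ _≤ᵇ_ (posP q) (posP p))
    ... | atRoot refl = trans (cong (λ a → a ∧ (POS u ≤ᵇ POS v) ▷ 1) (cong₂ _≡ᵇ_ leg0 (legP p))) (sym (cong (λ k → between? (posIn ps v) k ▷ 1) (posIn-∉ ps (r∉ ∘ ∈-++⁺ˡ))))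
    ... | inQ q = trans (cong (λ a → a ∧ (POS u ≤ᵇ POS v) ▷ 1) (cong₂ _≡ᵇ_ (legQ q) (legP p))) (sym (cong (λ k → between? (posIn ps v) k ▷ 1) (posIn-∉ ps (λ z → disj z q))))
  ... | inQ p = trans (∑-cong pt) (trans (count-posIn qs uQ (posIn qs v) (posIn≤ qs v)) (sym (posQ p)))
    where
    pt : ∀ u → ((LEG u ≡ᵇ LEG v) ∧ (POS u ≤ᵇ POS v) ▷ 1) ≡ (between? (posIn qs v) (posIn qs u) ▷ 1)
    pt u with locate u
    ... | inQ q = cong₂ (λ a b → a ∧ b ▷ 1) (trans (≡ᵇ-true (trans (legQ q) (sym (legQ p)))) (sym (≤ᵇ-true (posIn-∈ qs q)))) (cong₂ _≤ᵇ_ (posQ q) (posQ p))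
    ... | atRoot refl = trans (cong (λ a → a ∧ (POS u ≤ᵇ POS v) ▷ 1) (cong₂ _≡ᵇ_ leg0 (legQ p))) (sym (cong (λ k → between? (posIn qs v) k ▷ 1) (posIn-∉ qs (r∉ ∘ ∈-++⁺ʳ ps))))
    ... | inP q = trans (cong (λ a → a ∧ (POS u ≤ᵇ POS v) ▷ 1) (cong₂ _≡ᵇ_ (legP q) (legQ p))) (sym (cong (λ k → between? (posIn qs v) k ▷ 1) (posIn-∉ qs (disj q))))

  legs : Legs I
  legs = record
    { root = r ; LEG = LEG ; POS = POS ; LEG-root = leg0 ; root-LEG = in0
    ; LEG-cases = cases ; POS-root = pos0 ; POS≥1 = pos≥1 ; POS-inj = pos-inj ; up = up'
    ; tree-child = child ; tree-parent = parent
    ; connected = λ u v → star-sym (fromRoot u) ◅◅ fromRoot v ; count = count' }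
    where
    cases : ∀ v → LEG v ≡ 0 ⊎ LEG v ≡ 1 ⊎ LEG v ≡ 2
    cases v with locate v
    ... | atRoot refl = inj₁ leg0
    ... | inP p = inj₂ (inj₁ (legP p))
    ... | inQ p = inj₂ (inj₂ (legQ p))
    child : ∀ e → IsTree e → LEG (e₂ e) ≢ 0
    child e t eq with onLegs e t
    ... | inj₁ p = case trans (sym eq) (legP (childP e p)) of λ ()
    ... | inj₂ p = case trans (sym eq) (legQ (childQ e p)) of λ ()

  leg1⇔ : ∀ e → IsTree e → LEG (e₂ e) ≡ 1 → PathEdge (r ∷ ps) e
  leg1⇔ e t eq with onLegs e t
  ... | inj₁ p = p
  ... | inj₂ p = case trans (sym eq) (legQ (childQ e p)) of λ ()
  leg2⇔ : ∀ e → IsTree e → LEG (e₂ e) ≡ 2 → PathEdge (r ∷ qs) e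
  leg2⇔ e t eq with onLegs e t
  ... | inj₂ p = p
  ... | inj₁ p = case trans (sym eq) (legP (childP e p)) of λ ()

-- Cuts in coordinates

_xor_ : Bool → Bool → Bool
true xor b = not b
false xor b = b

IsWalk-≡ : ∀ {A : Set} {R : A → A → Set} {x z y L} → IsWalk R x z (y ∷ L) → x ≡ y
IsWalk-≡ single = refl
IsWalk-≡ (step _ _) = refl

suffix-walk : ∀ {A : Set} {R : A → A → Set} {y z x L} → IsWalk R y z L → Unique L → x ∈ L →
  ∃ λ L' → IsWalk R x z L' × Unique L'
suffix-walk {L = L} single u (here refl) = L , single , u
suffix-walk {L = L} (step s p) u (here refl) = L , step s p , u
suffix-walk (step s p) u (there x∈) = suffix-walk p (Unique-tail u) x∈

-- Loop erasure from the front: if the new vertex already lies on the path, the path is cut back to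
-- the suffix starting there.
simple-path : ∀ {n} {R : Fin n → Fin n → Set} {x z} → Star R x z → ∃ λ L → IsWalk R x z L × Unique L
simple-path ε = _ , single , [] AP.∷ AP.[]
simple-path {x = x} {z} (s ◅ p) = aux s (simple-path p)
  where
  aux : ∀ {y} → _ → (∃ λ L → IsWalk _ y z L × Unique L) → ∃ λ L → IsWalk _ x z L × Unique L
  aux s (y ∷ L , p , u) with IsWalk-≡ p | x ∈? (y ∷ L)
  ... | refl | yes x∈ = suffix-walk p u x∈
  ... | refl | no x∉ = x ∷ y ∷ L , step s p , All.tabulate (λ y∈ eq → x∉ (subst (_∈ y ∷ L) (sym eq) y∈)) AP.∷ u

-- Frequent forms of instructions.

quiet : ℕ → Bool → Mem → Mem → Bool
quiet _ _ _ _ = false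

maxI : (ℕ → Bool → Mem → Mem → Bool) → (Mem → ℕ) → (Mem → ℕ → Mem) → Instr
maxI c f u = record { kind = byMax ; con = c ; cons = f ; agg = λ _ _ _ _ _ _ → 0 , 0 ; upd = λ m y _ → u m y }

sumI : (ℕ → Bool → Mem → Mem → Bool) → (Mem → ℕ) → (Mem → ℕ → Mem) → Instr
sumI c f u = record { kind = bySum ; con = c ; cons = f ; agg = λ _ _ _ _ _ _ → 0 , 0 ; upd = λ m y _ → u m y }

localI : (Mem → Mem) → Instr
localI u = record { kind = byMax ; con = quiet ; cons = λ _ → 0 ; agg = λ _ _ _ _ _ _ → 0 , 0 ; upd = λ m _ _ → u m }

edgeI : (ℕ → Mem → Mem → ℕ) → (Mem → ℕ → Mem) → Instr
edgeI z u = record { kind = bySum ; con = quiet ; cons = λ _ → 0 ; agg = λ w _ a b _ _ → z w a b , z w b a ; upd = λ m _ g → u m g }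

-- Binary digits

odd? : ℕ → Bool
odd? zero = false
odd? (suc n) = not (odd? n)

bit : ℕ → ℕ → Bool
bit zero x = odd? x
bit (suc k) x = bit k ⌊ x /2⌋

half-unique : ∀ x y → odd? x ≡ odd? y → ⌊ x /2⌋ ≡ ⌊ y /2⌋ → x ≡ y
half-unique zero zero _ _ = refl
half-unique (suc zero) (suc zero) _ _ = refl
half-unique (suc (suc x)) (suc (suc y)) p q = cong (2 +_) (half-unique x y (not-inj (not-inj p)) (suc-injective q))
  where
  not-inj : ∀ {a b} → not a ≡ not b → a ≡ b
  not-inj {true} {true} _ = refl
  not-inj {false} {false} _ = refl
half-unique zero (suc zero) () _
half-unique (suc zero) zero () _
half-unique zero (suc (suc y)) _ ()
half-unique (suc zero) (suc (suc y)) _ ()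
half-unique (suc (suc x)) zero _ ()
half-unique (suc (suc x)) (suc zero) _ ()

bits-differ : ∀ ℓ x y → x < 2 ^ ℓ → y < 2 ^ ℓ → x ≢ y → ∃ λ k → k < ℓ × bit k x ≢ bit k y
bits-differ zero x y x< y< ne = ⊥-elim (ne (trans (n<1⇒n≡0 x<) (sym (n<1⇒n≡0 y<))))
bits-differ (suc ℓ) x y x< y< ne with odd? x Bool.≟ odd? y
... | no d = 0 , s≤s z≤n , d
... | yes eq = let (k , k< , d) = bits-differ ℓ ⌊ x /2⌋ ⌊ y /2⌋ (halve x x<) (halve y y<) (λ h → ne (half-unique x y eq h)) in suc k , s≤s k< , d
  where
  halve : ∀ x → x < 2 ^ suc ℓ → ⌊ x /2⌋ < 2 ^ ℓ
  halve x lt = *-cancelˡ-< 2 ⌊ x /2⌋ (2 ^ ℓ) (≤-<-trans (2*⌊/2⌋≤ x) lt)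

-- Ranking the leg edges. The rank of the tree edge above v is stored at v; rank 0 means
-- that the edge is not contracted yet. A merge step assigns the fresh rank t to some edges
-- between neighbouring segments, such that no segment is merged both upwards and downwards.

-- `φ` tests the maximum of a segment, taken over ranks or over identifiers. A segment that passes
-- is joined to the segment above it if that one fails.
record MS : Set where
  constructor ms-
  field
    useRk : Bool
    φ : ℕ → Bool
open MS public

-- Segments only look upwards. Of two neighbours that differ in digit `k`, the lower one may have
-- either value, so both tests are tried.
bitsMS : ℕ → List MS
bitsMS zero = []
bitsMS (suc k) = ms- false (bit k) ∷ ms- false (not ∘ bit k) ∷ bitsMS k

isOld isNew : ℕ → MS
isOld t₀ = ms- true (_≤ᵇ t₀)
isNew t₀ = ms- true (λ y → not (y ≤ᵇ t₀))

-- `t₀` is the last rank used before the phase, so a segment containing a rank above `t₀` has been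
-- merged during the phase. The two final steps attach the remaining segments, first to a merged
-- segment above, then to a merged segment below.
phaseMS : ℕ → ℕ → List MS
phaseMS ℓ t₀ = bitsMS ℓ ++ isOld t₀ ∷ isNew t₀ ∷ []

rankMS : ℕ → ℕ → ℕ → List MS
rankMS ℓ zero t₀ = []
rankMS ℓ (suc s) t₀ = phaseMS ℓ t₀ ++ rankMS ℓ s (length (phaseMS ℓ t₀) + t₀)

bitsMS-∈ : ∀ ℓ k → k < ℓ → ms- false (bit k) ∈ bitsMS ℓ × ms- false (not ∘ bit k) ∈ bitsMS ℓ
bitsMS-∈ (suc ℓ) k lt with k ≟ ℓ
... | yes refl = here refl , there (here refl)
... | no ne = let (p , q) = bitsMS-∈ ℓ k (≤∧≢⇒< (≤-pred lt) ne) in there (there p) , there (there q)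

nonzero-sound : ∀ {x} → not (x ≡ᵇ 0) ≡ true → x ≢ 0
nonzero-sound p refl = case p of λ ()

nonzero-true : ∀ {x} → x ≢ 0 → not (x ≡ᵇ 0) ≡ true
nonzero-true {x} ne = ¬true-not (λ p → ne (≡ᵇ-sound p))

legTree : Bool → Mem → Bool
legTree tr a = tr ∧ not (leg a ≡ᵇ 0)

-- The decision depends on both neighbouring segments and is made by the edge, but the rank must be
-- stored at its lower end. The whole lower segment hears the message; it contains the identifier of
-- the addressee, increased by one because `0` means silence.
mergeI : MS → ℕ → Instr
mergeI x t = record
  { kind = byMax
  ; con = λ w tr a b → legTree tr a ∧ not (rk b ≡ᵇ 0)
  ; cons = λ m → if useRk x then rk m else nid m
  ; agg = λ w tr a b y₁ y₂ → 0 , ((legTree tr a ∧ (rk b ≡ᵇ 0)) ∧ (φ x y₂ ∧ not (φ x y₁)) ▷ suc (nid b))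
  ; upd = λ m y g → record m { rk = if g ≡ᵇ suc (nid m) then t else rk m } }

mergeProg : ℕ → List MS → List Instr
mergeProg t [] = []
mergeProg t (x ∷ xs) = mergeI x (suc t) ∷ mergeProg (suc t) xs

-- With smaller ranks contracted, an edge of rank `t` hands the total of the segment below it to all
-- nodes of the segment above it, as long as both ends carry the same label `bP`.
sufI : ℕ → Instr
sufI t = record
  { kind = bySum
  ; con = λ w tr a b → legTree tr a ∧ ((suc (rk b) ≤ᵇ t) ∧ (bP a ≡ᵇ bP b))
  ; cons = val
  ; agg = λ w tr a b y₁ y₂ → (legTree tr a ∧ ((rk b ≡ᵇ t) ∧ (bP a ≡ᵇ bP b)) ▷ y₂) , 0
  ; upd = λ m y g → record m { acc = acc m + g } }

sufSteps : ℕ → ℕ → List Instr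
sufSteps t zero = []
sufSteps t (suc k) = sufI t ∷ sufSteps (suc t) k

sufProg : ℕ → List Instr
sufProg T = localI (λ m → record m { acc = val m }) ∷ sufSteps 1 T

-- Finding the root and telling the legs apart

-- Only the root has no tree edge leading upwards, so only the root hears `0` at first. The legs are
-- then separated by their maximal identifiers, the larger one giving number `1`. Whether this is
-- `P` or `Q` depends on the identifiers.
rootI legI sideI : Instr
rootI = record
  { kind = byMax ; con = quiet ; cons = λ _ → 0
  ; agg = λ w tr a b _ _ → 0 , (tr ▷ 1)
  ; upd = λ m y g → record m { leg = g } }
legI = maxI (λ w tr a b → legTree tr a) nid (λ m y → record m { tmp = y })
sideI = maxI (λ w tr a b → tr) (λ m → not (leg m ≡ᵇ 0) ▷ tmp m)
  (λ m y → record m { leg = if leg m ≡ᵇ 0 then 0 else (if tmp m ≡ᵇ y then 1 else 2) })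

swapLeg : ℕ → ℕ
swapLeg 1 = 2
swapLeg 2 = 1
swapLeg x = x

-- Positions and cut values of single edges

posProg cutProg : ℕ → List Instr
posProg T = localI (λ m → record m { val = if leg m ≡ᵇ 0 then 0 else 1 }) ∷ sufProg T
  ++ localI (λ m → record m { pos = if leg m ≡ᵇ 0 then 0 else acc m }) ∷ []

-- The cut above `v` is the sum of the weighted degrees below `v`, minus twice the weight of the
-- edges with both ends below `v`. Such an edge is charged to its upper end only: when that end is
-- below `v`, so is the other.
degZ innerZ : ℕ → Mem → Mem → ℕ
degZ w a b = w
innerZ w a b = (leg a ≡ᵇ leg b) ∧ (suc (pos b) ≤ᵇ pos a) ▷ 2 * w

setVal : Mem → ℕ → Mem
setVal m g = record m { val = g }

cutProg T = edgeI degZ setVal ∷ sufProg T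
  ++ localI (λ m → record m { cut = acc m }) ∷ edgeI innerZ setVal ∷ sufProg T
  ++ localI (λ m → record m { cut = cut m ∸ acc m ; best = cut m ∸ acc m }) ∷ []

-- Divide and conquer. Nodes with equal bP form a rectangle (rows on leg 1, columns on leg 2);
-- bP and bQ are the largest positions below its rows and columns, and kap is W bP bQ.

-- All edges of `G` inside a living rectangle are contracted, since its rows and columns need not be
-- joined by tree edges.
rectCon : ℕ → Bool → Mem → Mem → Bool
rectCon _ _ a b = (not (leg a ≡ᵇ 0) ∧ not (leg b ≡ᵇ 0)) ∧ ((not (act a ≡ᵇ 0) ∧ not (act b ≡ᵇ 0)) ∧ (bP a ≡ᵇ bP b))

-- A minimum of `X j - 2 W` in the pivot row, written as a maximum; adding `H` keeps the difference
-- positive.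
measure : ℕ → Mem → ℕ
measure H m = (H + 2 * acc m) ∸ cut m

-- At `t = 0` every row proposes itself, which serves the last pass, where rectangles have one row.
pivF : ℕ → Mem → ℕ
pivF t m = (not (act m ≡ᵇ 0)) ∧ ((leg m ≡ᵇ 1) ∧ ((t ≡ᵇ 0) ∨ (rk m ≡ᵇ t))) ▷ pos m

-- `rowZ` gives a column its weight towards the rows up to the pivot. `colZ` serves two sums at
-- once: rows collect their weight towards the columns up to the best one, and those columns their
-- weight towards the rows below the rectangle.
rowZ colZ : ℕ → Mem → Mem → ℕ
rowZ w a b = (leg a ≡ᵇ 2) ∧ ((leg b ≡ᵇ 1) ∧ (pos b ≤ᵇ pvP a)) ▷ w
colZ w a b = (if leg a ≡ᵇ 1 then (leg b ≡ᵇ 2) ∧ (pos b ≤ᵇ pvQ a)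
              else (leg a ≡ᵇ 2) ∧ ((leg b ≡ᵇ 1) ∧ ((pos b ≤ᵇ bP a) ∧ (pos a ≤ᵇ pvQ a)))) ▷ w

-- The value of the pair formed by a row and the best column of the pivot row. Every row of the
-- rectangle records its own pair, not only the pivot.
recU : Mem → Mem
recU m = record m { best = if (leg m ≡ᵇ 1) ∧ not (pvP m ≡ᵇ 0)
  then best m ⊓ ((cut m + cQ m) ∸ 2 * (kap m + ofs m + acc m)) else best m }

bestF pickF : ℕ → Mem → ℕ
bestF H m = (leg m ≡ᵇ 2) ▷ measure H m
pickF H m = (leg m ≡ᵇ 2) ∧ (measure H m ≡ᵇ tmp m) ▷ pos m

cQF ofsF : Mem → ℕ
cQF m = (leg m ≡ᵇ 2) ∧ (pos m ≡ᵇ pvQ m) ▷ cut m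
ofsF m = (leg m ≡ᵇ 2) ▷ val m

coreTail : ℕ → ℕ → List Instr
coreTail H T = maxI rectCon (bestF H) (λ m y → record m { tmp = y })
  ∷ maxI rectCon (pickF H) (λ m y → record m { pvQ = y })
  ∷ maxI rectCon cQF (λ m y → record m { cQ = y })
  ∷ edgeI colZ setVal
  ∷ sumI rectCon ofsF (λ m y → record m { ofs = y })
  ∷ sufProg T ++ localI recU ∷ []

coreProg : ℕ → ℕ → ℕ → List Instr
coreProg H T t = maxI rectCon (pivF t) (λ m y → record m { pvP = y }) ∷ edgeI rowZ setVal ∷ sufProg T ++ coreTail H T

▷-nz : ∀ b {x} → (b ▷ x) ≢ 0 → b ≡ true
▷-nz true nz = refl
▷-nz false nz = ⊥-elim (nz refl)

∨-true : ∀ {a b} → a ∨ b ≡ true → a ≡ true ⊎ b ≡ true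
∨-true {true} p = inj₁ refl
∨-true {false} p = inj₂ p

setPvP setTmp setPvQ setCQ setOfs : Mem → ℕ → Mem
setPvP m y = record m { pvP = y }
setTmp m y = record m { tmp = y }
setPvQ m y = record m { pvQ = y }
setCQ m y = record m { cQ = y }
setOfs m y = record m { ofs = y }

upperM : Mem → Bool
upperM m = not (pvP m ≡ᵇ 0) ∧ (((leg m ≡ᵇ 1) ∧ (suc (pvP m) ≤ᵇ pos m)) ∨ ((leg m ≡ᵇ 2) ∧ (suc (pvQ m) ≤ᵇ pos m)))

splitF : Mem → ℕ
splitF m = (leg m ≡ᵇ 1) ∧ (pos m ≡ᵇ pvP m) ▷ (kap m + ofs m + acc m)

splitU : Mem → ℕ → Mem
splitU m y = if upperM m then record m { bP = pvP m ; bQ = pvQ m ; kap = y } else m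

-- The pivot row announces the weight at the pivot, which the upper part takes over as its `kap`.
-- `checkI` contracts the two sides of a rectangle separately, so that edges between the sides
-- survive in the minor and can report; a rectangle once dropped stays dropped.
splitI checkI : Instr
splitI = maxI rectCon splitF splitU

crossZ : Mem → Mem → ℕ
crossZ a b = (not (leg a ≡ᵇ 0) ∧ not (leg b ≡ᵇ 0)) ∧ (not (leg a ≡ᵇ leg b) ∧ (bP a ≡ᵇ bP b)) ▷ 1

checkI = record
  { kind = byMax ; con = λ w tr a b → legTree tr a ∧ (bP a ≡ᵇ bP b) ; cons = λ _ → 0
  ; agg = λ w tr a b _ _ → crossZ a b , crossZ b a
  ; upd = λ m y g → record m { act = if act m ≡ᵇ 0 then 0 else g } }

levelProg : ℕ → ℕ → ℕ → List Instr
levelProg H T t = coreProg H T t ++ splitI ∷ checkI ∷ []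

levels : ℕ → ℕ → ℕ → List Instr
levels H T zero = []
levels H T (suc t) = levelProg H T (suc t) ++ levels H T t

activateU : Mem → Mem
activateU m = record m { act = 1 }

-- A minimum is obtained by complementing with respect to `H`. The root has no value of its own and
-- sends `0`, which cannot win because all values are less than `H`.
finalF : ℕ → Mem → ℕ
finalF H m = not (leg m ≡ᵇ 0) ▷ (H ∸ best m)

finalU : ℕ → Mem → ℕ → Mem
finalU H m y = record m { tmp = H ∸ y }

finalI : ℕ → Instr
finalI H = maxI (λ w tr a b → tr) (finalF H) (finalU H)

solveProg : ℕ → ℕ → List Instr
solveProg H T = localI activateU ∷ checkI ∷ levels H T T ++ coreProg H T 0 ++ finalI H ∷ []

mainProg : ℕ → List MS → List Instr
mainProg H xs = mergeProg 0 xs ++ posProg (length xs) ++ cutProg (length xs) ++ solveProg H (length xs)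

wholeProg : ℕ → List MS → List Instr
wholeProg H xs = rootI ∷ legI ∷ sideI ∷ mainProg H xs

-- Tree paths and cuts in terms of `LEG` and `POS`.

module Theory (I : Instance) (loopfree : ∀ e → InstanceDefs.e₁ I e ≢ InstanceDefs.e₂ I e) (lg : Legs I)
  (noPar : ∀ e f → e ≢ f → ¬ InstanceDefs.Joins I f (InstanceDefs.e₁ I e) (InstanceDefs.e₂ I e))
  (ident-inj : ∀ {u v} → Instance.ident I u ≡ Instance.ident I v → u ≡ v) where
  open InstanceDefs I
  open Semantics I
  open Legs lg

  bel : Fin n → Fin n → Bool
  bel c v = (LEG v ≡ᵇ LEG c) ∧ (POS v ≤ᵇ POS c)

  bel-true : ∀ {c v} → LEG v ≡ LEG c → POS v ≤ POS c → bel c v ≡ true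
  bel-true p q = cong₂ _∧_ (≡ᵇ-true p) (≤ᵇ-true q)

  bel-sound : ∀ {c v} → bel c v ≡ true → LEG v ≡ LEG c × POS v ≤ POS c
  bel-sound {c} {v} p = let (a , b) = ∧-true {LEG v ≡ᵇ LEG c} p in ≡ᵇ-sound a , ≤ᵇ-sound b

  up-unique : ∀ e f → IsTree e → IsTree f → e₂ e ≡ e₂ f → e ≡ f
  up-unique e f te tf eq with e F.≟ f
  ... | yes p = p
  ... | no ne = ⊥-elim (noPar e f ne (inj₁ (sym e₁≡ , sym eq)))
    where
    parents : _ → _ → e₁ e ≡ e₁ f
    parents (inj₁ (p , _)) (inj₁ (q , _)) = trans p (sym q)
    parents (inj₂ (p , q)) (inj₂ (p' , q')) = POS-inj _ _ (trans p (trans (cong LEG eq) (sym p'))) (trans q (trans (cong (suc ∘ POS) eq) (sym q')))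
    parents (inj₁ (p , top)) (inj₂ (p' , q')) = ⊥-elim (<-irrefl (cong POS (sym eq)) (≤-trans (≤-reflexive (sym q')) (top (e₁ f) (trans p' (cong LEG (sym eq))))))
    parents (inj₂ (p , q)) (inj₁ (p' , top)) = ⊥-elim (<-irrefl (cong POS eq) (≤-trans (≤-reflexive (sym q)) (top (e₁ e) (trans p (cong LEG eq)))))
    e₁≡ : e₁ e ≡ e₁ f
    e₁≡ = parents (tree-parent e te) (tree-parent f tf)

  bel-child : ∀ {c} f → IsTree f → LEG c ≢ 0 → bel c (e₁ f) ≡ true → bel c (e₂ f) ≡ true
  bel-child {c} f tf ne p = aux (tree-parent f tf)
    where
    q = bel-sound {c} p
    aux : _ → bel c (e₂ f) ≡ true
    aux (inj₁ (e , _)) = ⊥-elim (ne (trans (sym (proj₁ q)) (trans (cong LEG e) LEG-root)))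
    aux (inj₂ (l , s)) = bel-true (trans (sym l) (proj₁ q)) (≤-trans (n≤1+n _) (≤-trans (≤-reflexive (sym s)) (proj₂ q)))

  crossing-child : ∀ {c} f → IsTree f → LEG c ≢ 0 → bel c (e₂ f) ≡ true → bel c (e₁ f) ≡ false → e₂ f ≡ c
  crossing-child {c} f tf ne p q = POS-inj _ _ (proj₁ s) (≤-antisym (proj₂ s) (aux (tree-parent f tf)))
    where
    s = bel-sound {c} p
    aux : _ → POS c ≤ POS (e₂ f)
    aux (inj₁ (_ , top)) = top c (sym (proj₁ s))
    aux (inj₂ (l , eq)) = ≮⇒≥ λ lt → case trans (sym q) (bel-true (trans l (proj₁ s)) (≤-trans (≤-reflexive eq) lt)) of λ ()

  module _ (e : Fin m) (te : IsTree e) where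
    private
      c = e₂ e
      c≢0 : LEG c ≢ 0
      c≢0 = tree-child e te

    bel-parent : bel c (e₁ e) ≡ false
    bel-parent = ¬true⇒false λ p → aux p (tree-parent e te)
      where
      aux : bel c (e₁ e) ≡ true → _ → ⊥
      aux p (inj₁ (eq , _)) = c≢0 (trans (sym (proj₁ (bel-sound {c} p))) (trans (cong LEG eq) LEG-root))
      aux p (inj₂ (_ , eq)) = <-irrefl refl (≤-trans (≤-reflexive (sym eq)) (proj₂ (bel-sound {c} p)))

    bel-self : bel c c ≡ true
    bel-self = bel-true refl ≤-refl

    -- Lying below `c` is inherited by children and can be lost only in passing from `c` to its
    -- parent, so it changes along no tree edge other than `e`.
    crossing : ∀ {x y} → TreeAdj x y → bel c x ≢ bel c y → (x ≡ e₁ e × y ≡ e₂ e) ⊎ (x ≡ e₂ e × y ≡ e₁ e)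
    crossing {x} {y} (f , tf , j) ne = aux j (bel c (e₁ f)) (bel c (e₂ f)) refl refl
      where
      is-e : bel c (e₂ f) ≡ true → bel c (e₁ f) ≡ false → f ≡ e
      is-e p q = up-unique f e tf te (crossing-child f tf c≢0 p q)
      aux : Joins f x y → ∀ a b → bel c (e₁ f) ≡ a → bel c (e₂ f) ≡ b → (x ≡ e₁ e × y ≡ e₂ e) ⊎ (x ≡ e₂ e × y ≡ e₁ e)
      aux (inj₁ (refl , refl)) true b p q = ⊥-elim (ne (trans p (sym (bel-child f tf c≢0 p))))
      aux (inj₂ (refl , refl)) true b p q = ⊥-elim (ne (trans (bel-child f tf c≢0 p) (sym p)))
      aux (inj₁ (refl , refl)) false false p q = ⊥-elim (ne (trans p (sym q)))
      aux (inj₂ (refl , refl)) false false p q = ⊥-elim (ne (trans q (sym p)))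
      aux (inj₁ (refl , refl)) false true p q = inj₁ (cong e₁ (is-e q p) , cong e₂ (is-e q p))
      aux (inj₂ (refl , refl)) false true p q = inj₂ (cong e₂ (is-e q p) , cong e₁ (is-e q p))

    Uses : List (Fin n) → Set
    Uses L = Consec (e₁ e) (e₂ e) L ⊎ Consec (e₂ e) (e₁ e) L

    stay : ∀ {x z L} → IsWalk TreeAdj x z L → (¬ (e₁ e ∈ L) ⊎ ¬ (e₂ e ∈ L)) → bel c x ≡ bel c z
    stay single _ = refl
    stay {x} (step {y = y} {xs = xs} s p) miss with bel c x Bool.≟ bel c y
    ... | yes eq = trans eq (stay p ([ (λ f → inj₁ (f ∘ there)) , (λ f → inj₂ (f ∘ there)) ]′ miss))
    ... | no ne = ⊥-elim (both (crossing s ne) miss)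
      where
      both : (x ≡ e₁ e × y ≡ e₂ e) ⊎ (x ≡ e₂ e × y ≡ e₁ e) → ¬ (e₁ e ∈ x ∷ y ∷ xs) ⊎ ¬ (e₂ e ∈ x ∷ y ∷ xs) → ⊥
      both (inj₁ (refl , refl)) (inj₁ f) = f (here refl)
      both (inj₁ (refl , refl)) (inj₂ f) = f (there (here refl))
      both (inj₂ (refl , refl)) (inj₁ f) = f (there (here refl))
      both (inj₂ (refl , refl)) (inj₂ f) = f (here refl)

    -- A simple path uses `e` only once: if the side changed before the given use of `e`, an end of
    -- `e` would be visited twice.
    move : ∀ {x z L} → IsWalk TreeAdj x z L → Unique L → Uses L → bel c x ≢ bel c z
    move single u (inj₁ (there ())) 
    move single u (inj₂ (there ()))
    move (step s p) u (inj₁ here) eq = case trans (sym bel-parent) (trans eq (trans (sym (stay p (inj₁ (Unique-head u)))) bel-self)) of λ ()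
    move (step s p) u (inj₂ here) eq = case trans (sym bel-self) (trans eq (trans (sym (stay p (inj₂ (Unique-head u)))) bel-parent)) of λ ()
    move {x} (step {y = y} {xs = xs} s p) u (inj₁ (there k)) eq with bel c x Bool.≟ bel c y
    ... | yes q = move p (Unique-tail u) (inj₁ k) (trans (sym q) eq)
    ... | no ne = Unique-head u ([ (λ { (refl , _) → Consec-∈₁ k }) , (λ { (refl , _) → there (Consec-∈₂ k) }) ]′ (crossing s ne))
    move {x} (step {y = y} {xs = xs} s p) u (inj₂ (there k)) eq with bel c x Bool.≟ bel c y
    ... | yes q = move p (Unique-tail u) (inj₂ k) (trans (sym q) eq)
    ... | no ne = Unique-head u ([ (λ { (refl , _) → there (Consec-∈₂ k) }) , (λ { (refl , _) → Consec-∈₁ k }) ]′ (crossing s ne))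

    must-use : ∀ {x z L} → IsWalk TreeAdj x z L → bel c x ≢ bel c z → Uses L
    must-use single ne = ⊥-elim (ne refl)
    must-use {x} (step {y = y} s p) ne with bel c x Bool.≟ bel c y
    ... | yes q = [ inj₁ ∘ there , inj₂ ∘ there ]′ (must-use p (λ eq → ne (trans q eq)))
    ... | no q = [ (λ { (refl , refl) → inj₁ here }) , (λ { (refl , refl) → inj₂ here }) ]′ (crossing s q)

    onPath⇔ : ∀ u v → OnPath e u v ⇔ ((bel c u xor bel c v) ≡ true)
    onPath⇔ u v = mk⇔ f g
      where
      xor-≢ : ∀ a b → a ≢ b → (a xor b) ≡ true
      xor-≢ true true ne = ⊥-elim (ne refl)
      xor-≢ true false ne = refl
      xor-≢ false true ne = refl
      xor-≢ false false ne = ⊥-elim (ne refl)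
      ≢-xor : ∀ a b → (a xor b) ≡ true → a ≢ b
      ≢-xor true false _ ()
      ≢-xor false true _ ()
      f : OnPath e u v → (bel c u xor bel c v) ≡ true
      f (L , (p , uL) , k) = xor-≢ _ _ (move p uL k)
      g : (bel c u xor bel c v) ≡ true → OnPath e u v
      g x = let (L , p , uL) = simple-path (connected u v) in L , (p , uL) , must-use p (≢-xor _ _ x)

  cross : Fin n → Fin m → Bool
  cross c g = bel c (e₁ g) xor bel c (e₂ g)

  X : Fin n → ℕ
  X c = wsum (cross c)

  C : Fin n → Fin n → ℕ
  C c c' = wsum (λ g → cross c g xor cross c' g)

  wsum-cong : ∀ {χ χ' : Fin m → Bool} → (∀ g → χ g ≡ χ' g) → wsum χ ≡ wsum χ'
  wsum-cong eq = ∑-cong (λ g → cong (_▷ w g) (eq g))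

  cut₁≡ : ∀ e → IsTree e → ∀ y → Cut₁ e y → y ≡ X (e₂ e)
  cut₁≡ e te y (χ , eqv , yeq) = trans yeq (wsum-cong (λ g → true-ext
    (λ p → to (onPath⇔ e te _ _) (to (eqv g) p)) (λ p → from (eqv g) (from (onPath⇔ e te _ _) p))))

  cut₁! : ∀ e → IsTree e → Cut₁ e (X (e₂ e))
  cut₁! e te = cross (e₂ e) , (λ g → mk⇔ (from (onPath⇔ e te _ _)) (to (onPath⇔ e te _ _))) , refl

  xor⇔ : ∀ {A B : Set} {a b} → (A ⇔ (a ≡ true)) → (B ⇔ (b ≡ true)) → Xor A B ⇔ ((a xor b) ≡ true)
  xor⇔ {a = true} {true} p q = mk⇔ [ (λ { (_ , nb) → ⊥-elim (nb (from q refl)) }) , (λ { (na , _) → ⊥-elim (na (from p refl)) }) ]′ (λ ())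
  xor⇔ {a = true} {false} p q = mk⇔ (λ _ → refl) (λ _ → inj₁ (from p refl , λ b → case to q b of λ ()))
  xor⇔ {a = false} {true} p q = mk⇔ (λ _ → refl) (λ _ → inj₂ ((λ a → case to p a of λ ()) , from q refl))
  xor⇔ {a = false} {false} p q = mk⇔ [ (λ { (a , _) → to p a }) , (λ { (_ , b) → to q b }) ]′ (λ ())

  cut₂≡ : ∀ e f → IsTree e → IsTree f → ∀ y → Cut₂ e f y → y ≡ C (e₂ e) (e₂ f)
  cut₂≡ e f te tf y (χ , eqv , yeq) = trans yeq (wsum-cong (λ g → true-ext
    (λ p → to (xor⇔ (onPath⇔ e te _ _) (onPath⇔ f tf _ _)) (to (eqv g) p))
    (λ p → from (eqv g) (from (xor⇔ (onPath⇔ e te _ _) (onPath⇔ f tf _ _)) p))))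

  cut₂! : ∀ e f → IsTree e → IsTree f → Cut₂ e f (C (e₂ e) (e₂ f))
  cut₂! e f te tf = (λ g → cross (e₂ e) g xor cross (e₂ f) g) ,
    (λ g → mk⇔ (from (xor⇔ (onPath⇔ e te _ _) (onPath⇔ f tf _ _))) (to (xor⇔ (onPath⇔ e te _ _) (onPath⇔ f tf _ _)))) , refl

  -- `IsAnswer` with every tree edge named by its lower end.
  record Best (x : ℕ) : Set where
    field
      one : ∀ v → LEG v ≢ 0 → x ≤ X v
      two : ∀ u v → LEG u ≡ 1 → LEG v ≡ 2 → x ≤ C u v
      hit : (∃ λ v → LEG v ≢ 0 × x ≡ X v) ⊎ (∃ λ u → ∃ λ v → LEG u ≡ 1 × LEG v ≡ 2 × x ≡ C u v)

  inA : ℕ → ℕ → Fin n → Bool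
  inA l p v = (LEG v ≡ᵇ l) ∧ (POS v ≤ᵇ p)

  hits : ℕ → ℕ → Fin m → Bool
  hits p q g = (inA 1 p (e₁ g) ∧ inA 2 q (e₂ g)) ∨ (inA 1 p (e₂ g) ∧ inA 2 q (e₁ g))

  W : ℕ → ℕ → ℕ
  W p q = wsum (hits p q)

  inA-disj : ∀ p q v → inA 1 p v ∧ inA 2 q v ≡ false
  inA-disj p q v with LEG v
  ... | zero = refl
  ... | suc zero = trans (cong ((POS v ≤ᵇ p) ∧_) refl) (lem (POS v ≤ᵇ p))
    where
    lem : ∀ b → b ∧ false ≡ false
    lem true = refl
    lem false = refl
  ... | suc (suc zero) = refl
  ... | suc (suc (suc _)) = refl

  -- The subtrees below `u` and `v` are disjoint, so an edge crosses both cuts exactly if it joins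
  -- these subtrees. The right side counts such an edge twice, `C` not at all.
  C-split : ∀ u v → LEG u ≡ 1 → LEG v ≡ 2 → C u v + 2 * W (POS u) (POS v) ≡ X u + X v
  C-split u v lu lv = begin
    C u v + 2 * W (POS u) (POS v) ≡⟨ cong (C u v +_) (sym (∑-*ˡ 2 (λ g → hits (POS u) (POS v) g ▷ w g))) ⟩
    C u v + ∑ (λ g → 2 * (hits (POS u) (POS v) g ▷ w g)) ≡⟨ sym (∑-+ (λ g → cross u g xor cross v g ▷ w g) (λ g → 2 * (hits (POS u) (POS v) g ▷ w g))) ⟩
    ∑ (λ g → (cross u g xor cross v g ▷ w g) + 2 * (hits (POS u) (POS v) g ▷ w g)) ≡⟨ ∑-cong pt ⟩
    ∑ (λ g → (cross u g ▷ w g) + (cross v g ▷ w g)) ≡⟨ ∑-+ (λ g → cross u g ▷ w g) (λ g → cross v g ▷ w g) ⟩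
    X u + X v ∎
    where
    open ≡-Reasoning
    belP : ∀ x → bel u x ≡ inA 1 (POS u) x
    belP x = cong (λ l → (LEG x ≡ᵇ l) ∧ (POS x ≤ᵇ POS u)) lu
    belQ : ∀ x → bel v x ≡ inA 2 (POS v) x
    belQ x = cong (λ l → (LEG x ≡ᵇ l) ∧ (POS x ≤ᵇ POS v)) lv
    core : ∀ a a' b b' (k : ℕ) → a ∧ b ≡ false → a' ∧ b' ≡ false →
      ((a xor a') xor (b xor b') ▷ k) + 2 * ((a ∧ b') ∨ (a' ∧ b) ▷ k) ≡ (a xor a' ▷ k) + (b xor b' ▷ k)
    core true true true b' k () q
    core true true false true k p ()
    core true true false false k p q = refl
    core true false true b' k () q
    core true false false true k p q = cong (k +_) (+-identityʳ k)
    core true false false false k p q = refl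
    core false true true true k p ()
    core false true true false k p q = cong (k +_) (+-identityʳ k)
    core false true false true k p ()
    core false true false false k p q = refl
    core false false true true k p q = refl
    core false false true false k p q = +-identityʳ k
    core false false false true k p q = +-identityʳ k
    core false false false false k p q = refl
    pt : ∀ g → (cross u g xor cross v g ▷ w g) + 2 * (hits (POS u) (POS v) g ▷ w g) ≡ (cross u g ▷ w g) + (cross v g ▷ w g)
    pt g rewrite belP (e₁ g) | belP (e₂ g) | belQ (e₁ g) | belQ (e₂ g) =
      core (inA 1 (POS u) (e₁ g)) (inA 1 (POS u) (e₂ g)) (inA 2 (POS v) (e₁ g)) (inA 2 (POS v) (e₂ g)) (w g)
        (inA-disj (POS u) (POS v) (e₁ g)) (inA-disj (POS u) (POS v) (e₂ g))

  -- Segments of a leg.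

  Par : Fin n → Fin n → Set
  Par v p = LEG v ≡ LEG p × LEG v ≢ 0 × POS p ≡ suc (POS v)

  -- The edge above `x` is stored at `x`, so the edges between two nodes are found at the positions
  -- from the lower node, included, to the upper one, excluded.
  Between : Fin n → Fin n → Fin n → Set
  Between u v x = (POS u ≤ POS x × POS x < POS v) ⊎ (POS v ≤ POS x × POS x < POS u)

  Seg : (Fin n → Set) → Fin n → Fin n → Set
  Seg Q u v = LEG u ≡ LEG v × LEG u ≢ 0 × (∀ x → LEG x ≡ LEG u → Between u v x → Q x)

  seg-refl : ∀ {Q} u → LEG u ≢ 0 → Seg Q u u
  seg-refl u ne = refl , ne , λ x _ → [ (λ { (p , q) → ⊥-elim (<-irrefl refl (≤-<-trans p q)) }) , (λ { (p , q) → ⊥-elim (<-irrefl refl (≤-<-trans p q)) }) ]′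

  between-sym : ∀ {u v x} → Between u v x → Between v u x
  between-sym (inj₁ p) = inj₂ p
  between-sym (inj₂ p) = inj₁ p

  seg-sym : ∀ {Q u v} → Seg Q u v → Seg Q v u
  seg-sym {Q} {u} {v} (l , ne , f) = sym l , (λ z → ne (trans l z)) , λ x lx b → f x (trans lx (sym l)) (between-sym {v} {u} {x} b)

  between-split : ∀ u v z x → Between u z x → Between u v x ⊎ Between v z x
  between-split u v z x (inj₁ (p , q)) with POS x <? POS v
  ... | yes lt = inj₁ (inj₁ (p , lt))
  ... | no ge = inj₂ (inj₁ (≮⇒≥ ge , q))
  between-split u v z x (inj₂ (p , q)) with POS x <? POS v
  ... | yes lt = inj₂ (inj₂ (p , lt))
  ... | no ge = inj₁ (inj₂ (≮⇒≥ ge , q))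

  seg-trans : ∀ {Q u v z} → Seg Q u v → Seg Q v z → Seg Q u z
  seg-trans {Q} {u} {v} {z} (l , ne , f) (l' , ne' , g) = trans l l' , ne ,
    λ x lx b → [ f x lx , g x (trans lx l) ]′ (between-split u v z x b)

  seg-mono : ∀ {Q Q' : Fin n → Set} {u v} → (∀ x → Q x → Q' x) → Seg Q u v → Seg Q' u v
  seg-mono h (l , ne , f) = l , ne , λ x lx b → h x (f x lx b)

  par-of : ∀ e → IsTree e → LEG (e₁ e) ≢ 0 → Par (e₂ e) (e₁ e)
  par-of e te ne = aux (tree-parent e te)
    where
    aux : _ → Par (e₂ e) (e₁ e)
    aux (inj₁ (p , _)) = ⊥-elim (ne (trans (cong LEG p) LEG-root))
    aux (inj₂ (p , q)) = sym p , tree-child e te , q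

  edge-of : ∀ {v p} → Par v p → ∃ λ e → IsTree e × e₂ e ≡ v × e₁ e ≡ p
  edge-of {v} {p} (l , ne , q) = let (e , te , eq) = up v ne in e , te , eq , aux e eq (tree-parent e te)
    where
    aux : ∀ e → e₂ e ≡ v → (e₁ e ≡ root × (∀ u → LEG u ≡ LEG (e₂ e) → POS u ≤ POS (e₂ e)))
      ⊎ (LEG (e₁ e) ≡ LEG (e₂ e) × POS (e₁ e) ≡ suc (POS (e₂ e))) → e₁ e ≡ p
    aux e refl (inj₁ (_ , top)) = ⊥-elim (<-irrefl refl (≤-trans (≤-reflexive (sym q)) (top p (sym l))))
    aux e refl (inj₂ (l' , q')) = POS-inj _ _ (trans l' l) (trans q' (sym q))

  parent-below : ∀ {u v} → LEG u ≡ LEG v → LEG u ≢ 0 → POS u < POS v → ∃ λ p → Par u p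
  parent-below {u} {v} l ne lt = aux (up u ne)
    where
    aux : (∃ λ e → IsTree e × e₂ e ≡ u) → ∃ λ p → Par u p
    aux (e , te , refl) with tree-parent e te
    ... | inj₁ (_ , top) = ⊥-elim (<-irrefl refl (<-≤-trans lt (top v (sym l))))
    ... | inj₂ (l' , q) = e₁ e , sym l' , ne , q

  par-unique : ∀ {v p q} → Par v p → Par v q → p ≡ q
  par-unique (l , _ , e) (l' , _ , e') = POS-inj _ _ (trans (sym l) l') (trans e (sym e'))

  par-seg : ∀ {Q v p} → Par v p → Q v → Seg Q v p
  par-seg {Q} {v} {p} (l , ne , q) qv = l , ne , λ x lx → [ (λ { (a , b) → subst Q (sym (POS-inj x v lx (≤-antisym (≤-pred (≤-trans b (≤-reflexive q))) a))) qv })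
    , (λ { (a , b) → ⊥-elim (<-irrefl refl (<-trans b (≤-trans (≤-reflexive (sym q)) a))) }) ]′

  climb : ∀ (Q : Fin n → Set) {u v} → LEG u ≡ LEG v → LEG u ≢ 0 → POS u ≤ POS v →
    (∀ x p → Par x p → LEG x ≡ LEG u → POS u ≤ POS x → POS x < POS v → Q x → Q p) → Q u → Q v
  climb Q {u} {v} l ne le f q = go (POS v ∸ POS u) u l ne (m+[n∸m]≡n le) f q
    where
    go : ∀ k x → LEG x ≡ LEG v → LEG x ≢ 0 → POS x + k ≡ POS v →
      (∀ y p → Par y p → LEG y ≡ LEG x → POS x ≤ POS y → POS y < POS v → Q y → Q p) → Q x → Q v
    go zero x lx nx eq f q = subst Q (POS-inj x v lx (trans (sym (+-identityʳ _)) eq)) q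
    go (suc k) x lx nx eq f q = let (p , pr) = parent-below lx nx lt in
      go k p (trans (sym (proj₁ pr)) lx) (λ z → nx (trans (proj₁ pr) z)) (trans (cong (_+ k) (proj₂ (proj₂ pr))) (trans (sym (+-suc _ k)) eq))
        (λ y p' pr' ly a b → f y p' pr' (trans ly (sym (proj₁ pr))) (≤-trans (n≤1+n _) (≤-trans (≤-reflexive (sym (proj₂ (proj₂ pr)))) a)) b)
        (f x p pr refl ≤-refl lt q)
      where
      lt : POS x < POS v
      lt = ≤-trans (s≤s (m≤m+n (POS x) k)) (≤-reflexive (trans (sym (+-suc _ k)) eq))

  -- The contractions that stay inside the legs are all given by a predicate on lower ends.
  -- Connectivity then becomes a statement about intervals of positions.
  module Components (i : Instr) (s : State) (Q : Fin n → Set)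
    (h→ : ∀ e → Contracted i s e → IsTree e × LEG (e₁ e) ≢ 0 × Q (e₂ e))
    (h← : ∀ e → IsTree e → LEG (e₁ e) ≢ 0 → Q (e₂ e) → Contracted i s e) where

    edge-seg : ∀ e → Contracted i s e → Seg Q (e₂ e) (e₁ e)
    edge-seg e c = let (te , ne , q) = h→ e c in par-seg (par-of e te ne) q

    comp→ : ∀ {u v} → Comp i s u v → u ≡ v ⊎ Seg Q u v
    comp→ ε = inj₁ refl
    comp→ {u} {v} (_◅_ {j = y} (e , c , j) p) = inj₂ (join (first j) (comp→ p))
      where
      first : Joins e u y → Seg Q u y
      first (inj₁ (refl , refl)) = seg-sym {Q} (edge-seg e c)
      first (inj₂ (refl , refl)) = edge-seg e c
      join : Seg Q u y → y ≡ v ⊎ Seg Q y v → Seg Q u v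
      join a (inj₁ refl) = a
      join a (inj₂ b) = seg-trans {Q} a b

    comp-seg : ∀ {u v} → LEG u ≢ 0 → Comp i s u v → Seg Q u v
    comp-seg {u} ne p = [ (λ { refl → seg-refl {Q} u ne }) , (λ z → z) ]′ (comp→ p)

    up-comp : ∀ {u v} → POS u ≤ POS v → Seg Q u v → Comp i s u v
    up-comp {u} {v} le (l , ne , f) = climb (Comp i s u) l ne le stp ε
      where
      stp : ∀ x p → Par x p → LEG x ≡ LEG u → POS u ≤ POS x → POS x < POS v → Comp i s u x → Comp i s u p
      stp x p pr lx a b c = let (e , te , eq₂ , eq₁) = edge-of pr in
        c ◅◅ ((e , h← e te (λ z → proj₁ (proj₂ pr) (trans (proj₁ pr) (trans (cong LEG (sym eq₁)) z))) (subst Q (sym eq₂) (f x lx (inj₁ (a , b)))) , inj₂ (eq₁ , eq₂)) ◅ ε)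

    seg-comp : ∀ {u v} → Seg Q u v → Comp i s u v
    seg-comp {u} {v} sg with ≤-total (POS u) (POS v)
    ... | inj₁ le = up-comp le sg
    ... | inj₂ le = Comp-sym i s (up-comp le (seg-sym {Q} sg))

  -- Correctness of the ranking.

  NZ : (Fin n → ℕ) → Fin n → Set
  NZ R x = R x ≢ 0

  key : MS → (Fin n → ℕ) → Fin n → ℕ
  key x R u = if useRk x then R u else ident u

  -- The effect of a merge instruction on ranks alone, detached from memories and messages; `Y` is
  -- the maximal key of the segment of a node.
  record MergeStep (t : ℕ) (x : MS) (R R' : Fin n → ℕ) : Set where
    field
      Y : Fin n → ℕ
      ub : ∀ v u → Seg (NZ R) v u → key x R u ≤ Y v
      at' : ∀ v → LEG v ≢ 0 → ∃ λ u → Seg (NZ R) v u × Y v ≡ key x R u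
      merged : ∀ v p → R v ≡ 0 → Par v p → φ x (Y v) ≡ true → φ x (Y p) ≡ false → R' v ≡ t
      change : ∀ v → R' v ≡ R v ⊎ (R' v ≡ t × R v ≡ 0 × ∃ λ p → Par v p × φ x (Y v) ≡ true × φ x (Y p) ≡ false)

    Y≤ : ∀ v u → Seg (NZ R) v u → Y v ≤ Y u
    Y≤ v u sg = let (z , sz , eq) = at' v (proj₁ (proj₂ sg)) in
      subst (_≤ Y u) (sym eq) (ub u z (seg-trans {NZ R} (seg-sym {NZ R} sg) sz))

    Y-const : ∀ v u → Seg (NZ R) v u → Y v ≡ Y u
    Y-const v u sg = ≤-antisym (Y≤ v u sg) (Y≤ u v (seg-sym {NZ R} sg))

  data MRun : ℕ → List MS → (Fin n → ℕ) → (Fin n → ℕ) → Set where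
    []  : ∀ {t R} → MRun t [] R R
    _∷_ : ∀ {t x xs R R₁ R'} → MergeStep (suc t) x R R₁ → MRun (suc t) xs R₁ R' → MRun t (x ∷ xs) R R'

  MRun-++ : ∀ {t} xs {ys R R'} → MRun t (xs ++ ys) R R' → ∃ λ R₁ → MRun t xs R R₁ × MRun (length xs + t) ys R₁ R'
  MRun-++ [] r = _ , [] , r
  MRun-++ {t} (x ∷ xs) {ys} {R} {R'} (s ∷ r) = let (R₁ , p , q) = MRun-++ xs r in
    R₁ , s ∷ p , subst (λ k → MRun k ys R₁ R') (+-suc (length xs) t) q

  -- Ranks are written once. Since fresh ones exceed `t`, a later state still shows which edges had
  -- been contracted by then.
  Mono : ℕ → (Fin n → ℕ) → (Fin n → ℕ) → Set
  Mono t R R' = ∀ v → R' v ≡ R v ⊎ (R v ≡ 0 × t < R' v)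

  mono-trans : ∀ {t R R₁ R'} → Mono t R R₁ → Mono t R₁ R' → Mono t R R'
  mono-trans {t} p q v with p v | q v
  ... | inj₁ a | inj₁ b = inj₁ (trans b a)
  ... | inj₁ a | inj₂ (b , c) = inj₂ (trans (sym a) b , c)
  ... | inj₂ (a , c) | inj₁ b = inj₂ (a , subst (t <_) (sym b) c)
  ... | inj₂ (a , c) | inj₂ (_ , d) = inj₂ (a , d)

  step-mono : ∀ {t₀ t x R R'} → t₀ < t → MergeStep t x R R' → Mono t₀ R R'
  step-mono {t₀} lt m v with MergeStep.change m v
  ... | inj₁ p = inj₁ p
  ... | inj₂ (p , q , _) = inj₂ (q , subst (t₀ <_) (sym p) lt)

  run-mono : ∀ {t₀ t xs R R'} → t₀ ≤ t → MRun t xs R R' → Mono t₀ R R'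
  run-mono le [] v = inj₁ refl
  run-mono le (s ∷ r) = mono-trans (step-mono (s≤s le) s) (run-mono (m≤n⇒m≤1+n le) r)

  run-∈ : ∀ {t₀ t x xs R R'} → t₀ ≤ t → x ∈ xs → MRun t xs R R' →
    ∃ λ t' → ∃ λ R₁ → ∃ λ R₂ → MergeStep (suc t') x R₁ R₂ × Mono t₀ R₁ R' × Mono t₀ R₂ R'
  run-∈ {t = t} le (here refl) (s ∷ r) = t , _ , _ , s , run-mono le (s ∷ r) , run-mono (m≤n⇒m≤1+n le) r
  run-∈ le (there x∈) (s ∷ r) = run-∈ (m≤n⇒m≤1+n le) x∈ r

  -- During the ranking, equal ranks may be separated by an edge without a rank instead of one with
  -- a larger rank: whatever that edge receives later will be larger.
  record RInv (t : ℕ) (R : Fin n → ℕ) : Set where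
    field
      bound : ∀ v → R v ≤ t
      top : ∀ v → R v ≢ 0 → ∃ λ p → Par v p
      rank : ∀ u v → LEG u ≡ LEG v → LEG u ≢ 0 → POS u < POS v → R u ≡ R v → R u ≢ 0 →
        ∃ λ x → LEG x ≡ LEG u × POS u < POS x × POS x < POS v × (R x ≡ 0 ⊎ R u < R x)

  -- If two edges obtain the fresh rank, the segment just above the lower edge fails the test,
  -- whereas the segment ending at the upper edge passes it. The edge that ends the failing segment
  -- lies between the two and is not merged in this step.
  RInv-step : ∀ {t x R R'} → MergeStep (suc t) x R R' → RInv t R → RInv (suc t) R'
  RInv-step {t} {x} {R} {R'} m inv = record { bound = bound' ; top = top' ; rank = rank' }
    where
    open MergeStep m
    open RInv inv
    bound' : ∀ v → R' v ≤ suc t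
    bound' v with change v
    ... | inj₁ p = ≤-trans (≤-reflexive p) (m≤n⇒m≤1+n (bound v))
    ... | inj₂ (p , _) = ≤-reflexive p
    top' : ∀ v → R' v ≢ 0 → ∃ λ p → Par v p
    top' v ne with change v
    ... | inj₁ p = top v (λ z → ne (trans p z))
    ... | inj₂ (_ , _ , p , pr , _) = p , pr
    -- walking up from p, the first edge not contracted yet is not merged in this step
    search : ∀ k p v → LEG p ≡ LEG v → LEG p ≢ 0 → POS p + k ≡ POS v → φ x (Y p) ≡ false → φ x (Y v) ≡ true →
      ∃ λ y → LEG y ≡ LEG p × POS p ≤ POS y × POS y < POS v × R' y ≡ 0
    search zero p v l ne eq f g = case trans (sym f) (trans (cong (φ x ∘ Y) (POS-inj p v l (trans (sym (+-identityʳ _)) eq))) g) of λ ()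
    search (suc k) p v l ne eq f g with R p ≟ 0
    ... | yes z = p , refl , ≤-refl , lt , unmerged (change p)
      where
      lt : POS p < POS v
      lt = ≤-trans (s≤s (m≤m+n (POS p) k)) (≤-reflexive (trans (sym (+-suc _ k)) eq))
      unmerged : R' p ≡ R p ⊎ (R' p ≡ suc t × R p ≡ 0 × ∃ λ q → Par p q × φ x (Y p) ≡ true × φ x (Y q) ≡ false) → R' p ≡ 0
      unmerged (inj₁ e) = trans e z
      unmerged (inj₂ (_ , _ , _ , _ , g , _)) = case trans (sym f) g of λ ()
    ... | no nz = let (q , pr) = top p nz
                      (y , ly , a , b , c) = search k q v (trans (sym (proj₁ pr)) l) (λ z → ne (trans (proj₁ pr) z))
                         (trans (cong (_+ k) (proj₂ (proj₂ pr))) (trans (sym (+-suc _ k)) eq))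
                         (trans (cong (φ x) (sym (Y-const p q (par-seg {NZ R} pr nz)))) f) g
                  in y , trans ly (sym (proj₁ pr)) , ≤-trans (n≤1+n _) (≤-trans (≤-reflexive (sym (proj₂ (proj₂ pr)))) a) , b , c
    rank' : ∀ u v → LEG u ≡ LEG v → LEG u ≢ 0 → POS u < POS v → R' u ≡ R' v → R' u ≢ 0 →
        ∃ λ x → LEG x ≡ LEG u × POS u < POS x × POS x < POS v × (R' x ≡ 0 ⊎ R' u < R' x)
    rank' u v l ne lt eq nz with change u | change v
    ... | inj₁ p | inj₁ q = let (y , ly , a , b , c) = rank u v l ne lt (trans (sym p) (trans eq q)) (λ z → nz (trans p z)) in y , ly , a , b , later y c (change y)
      where
      later : ∀ y → R y ≡ 0 ⊎ R u < R y → R' y ≡ R y ⊎ (R' y ≡ suc t × R y ≡ 0 × ∃ λ q → Par y q × φ x (Y y) ≡ true × φ x (Y q) ≡ false) → R' y ≡ 0 ⊎ R' u < R' y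
      later y (inj₁ z) (inj₁ e) = inj₁ (trans e z)
      later y (inj₂ l) (inj₁ e) = inj₂ (subst₂ _<_ (sym p) (sym e) l)
      later y _ (inj₂ (e , _)) = inj₂ (subst₂ _<_ (sym p) (sym e) (s≤s (bound u)))
    ... | inj₁ p | inj₂ (q , _) = ⊥-elim (<-irrefl refl (≤-trans (≤-reflexive (trans (sym q) (trans (sym eq) p))) (bound u)))
    ... | inj₂ (p , _) | inj₁ q = ⊥-elim (<-irrefl refl (≤-trans (≤-reflexive (trans (sym p) (trans eq q))) (bound v)))
    ... | inj₂ (p , _ , pu , pr , _ , f) | inj₂ (q , _ , _ , _ , g , _) =
      let (y , ly , a , b , c) = search (POS v ∸ POS pu) pu v (trans (sym (proj₁ pr)) l) (λ z → ne (trans (proj₁ pr) z))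
             (m+[n∸m]≡n (≤-trans (≤-reflexive (proj₂ (proj₂ pr))) lt)) f g
      in y , trans ly (sym (proj₁ pr)) , ≤-trans (≤-reflexive (sym (proj₂ (proj₂ pr)))) a , b , inj₁ c

  RInv-rn : ∀ {t xs R R'} → MRun t xs R R' → RInv t R → RInv (length xs + t) R'
  RInv-rn [] inv = inv
  RInv-rn {t} {x ∷ xs} {R' = R'} (s ∷ r) inv = subst (λ k → RInv k R') (+-suc (length xs) t) (RInv-rn r (RInv-step s inv))

  seg-sub : ∀ {Q u v x} → Seg Q u v → LEG x ≡ LEG u → Between u v x → Seg Q u x
  seg-sub {Q} {u} {v} {x} (l , ne , f) lx b = sym lx , ne , λ z lz b' → f z lz (inner b b')
    where
    inner : ∀ {z} → Between u v x → Between u x z → Between u v z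
    inner (inj₁ (a , b)) (inj₁ (c , d)) = inj₁ (c , <-trans d b)
    inner (inj₁ (a , b)) (inj₂ (c , d)) = ⊥-elim (<-irrefl refl (≤-<-trans (≤-trans a c) d))
    inner (inj₂ (a , b)) (inj₁ (c , d)) = ⊥-elim (<-irrefl refl (≤-<-trans c (<-trans d b)))
    inner (inj₂ (a , b)) (inj₂ (c , d)) = inj₂ (≤-trans a c , d)

  Untouched : ℕ → (Fin n → ℕ) → Fin n → Set
  Untouched t₀ R c = ∀ y → Seg (NZ R) c y → R y ≤ t₀

  module _ {t₀ R R'} (mono : Mono t₀ R R') where
    zero-back : ∀ v → R' v ≡ 0 → R v ≡ 0
    zero-back v z with mono v
    ... | inj₁ e = trans (sym e) z
    ... | inj₂ (e , _) = e

    nz-forth : ∀ v → R v ≢ 0 → R' v ≢ 0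
    nz-forth v nz with mono v
    ... | inj₁ e = λ z → nz (trans (sym e) z)
    ... | inj₂ (e , _) = ⊥-elim (nz e)

    seg-forth : ∀ {u v} → Seg (NZ R) u v → Seg (NZ R') u v
    seg-forth = seg-mono {NZ R} {NZ R'} nz-forth

    old-back : ∀ v → R' v ≢ 0 → R' v ≤ t₀ → R v ≢ 0
    old-back v nz le with mono v
    ... | inj₁ e = λ z → nz (trans e z)
    ... | inj₂ (_ , lt) = ⊥-elim (<-irrefl refl (<-≤-trans lt le))

    -- An untouched segment contains only old ranks, hence it was already a segment in every earlier
    -- state of the phase.
    seg-back : ∀ {c y} → Untouched t₀ R' c → Seg (NZ R') c y → Seg (NZ R) c y
    seg-back un sg@(l , ne , f) = l , ne , λ x lx b → old-back x (f x lx b) (un x (seg-sub {NZ R'} sg lx b))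

    untouched-back : ∀ {c} → Untouched t₀ R' c → Untouched t₀ R c
    untouched-back {c} un y sg with mono y
    ... | inj₁ e = subst (_≤ t₀) e (un y (seg-forth sg))
    ... | inj₂ (e , _) = subst (_≤ t₀) (sym e) z≤n

  -- Two neighbouring segments that were not merged by the bit steps would have equal
  -- maximal identifiers.
  sweep : ∀ {ℓ t₀ R₀ R} → (∀ v → ident v < 2 ^ suc ℓ) → MRun t₀ (bitsMS (suc ℓ)) R₀ R →
    ∀ {c p} → Par c p → R c ≡ 0 → Untouched t₀ R c → Untouched t₀ R p → ⊥
  sweep {ℓ} {t₀} {R₀} {R} small rn {c} {p} pr rc uc up' = clash (proj₂ (first c c≢0 uc)) (proj₂ (first p p≢0 up'))
    where
    c≢0 : LEG c ≢ 0
    c≢0 = proj₁ (proj₂ pr)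
    p≢0 : LEG p ≢ 0
    p≢0 z = c≢0 (trans (proj₁ pr) z)
    IsMax : Fin n → ℕ → Set
    IsMax c y = (∀ u → Seg (NZ R) c u → ident u ≤ y) × (∃ λ u → Seg (NZ R) c u × y ≡ ident u)
    unique : ∀ {c y y'} → IsMax c y → IsMax c y' → y ≡ y'
    unique (ub , u , su , eq) (ub' , u' , su' , eq') = ≤-antisym (subst (_≤ _) (sym eq) (ub' u su)) (subst (_≤ _) (sym eq') (ub u' su'))
    ismax : ∀ {t' f R₁ R₂} (m : MergeStep (suc t') (ms- false f) R₁ R₂) → Mono t₀ R₁ R →
      ∀ z → LEG z ≢ 0 → Untouched t₀ R z → IsMax z (MergeStep.Y m z)
    ismax m mo z ne un = (λ u sg → MergeStep.ub m z u (seg-back mo un sg)) ,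
      (let (u , sg , eq) = MergeStep.at' m z ne in u , seg-forth mo sg , eq)
    first : ∀ z → LEG z ≢ 0 → Untouched t₀ R z → ∃ λ y → IsMax z y
    first z ne un = let (_ , _ , _ , m , mo , _) = run-∈ ≤-refl (here refl) rn in MergeStep.Y m z , ismax m mo z ne un
    never : ∀ {f a b} → ms- false f ∈ bitsMS (suc ℓ) → IsMax c a → IsMax p b → f a ≡ true → f b ≡ false → ⊥
    never {f} {a} {b} x∈ ma mb fa fb = let (t' , R₁ , R₂ , m , mo , mo₂) = run-∈ ≤-refl x∈ rn in
      case trans (sym (MergeStep.merged m c p (zero-back mo c rc) pr
        (trans (cong f (unique (ismax m mo c c≢0 uc) ma)) fa) (trans (cong f (unique (ismax m mo p p≢0 up') mb)) fb)))
        (zero-back mo₂ c rc) of λ ()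
    clash : ∀ {a b} → IsMax c a → IsMax p b → ⊥
    clash {a} {b} ma@(_ , u , su , eu) mb@(_ , v , sv , ev) = decide (bits-differ (suc ℓ) a b (subst (_< 2 ^ suc ℓ) (sym eu) (small u)) (subst (_< 2 ^ suc ℓ) (sym ev) (small v)) distinct)
      where
      distinct : a ≢ b
      distinct eq = proj₂ (proj₂ (seg-trans {NZ R} su (seg-sym {NZ R} (subst (Seg (NZ R) p) (sym u≡v) sv)))) c refl (inj₁ (≤-refl , ≤-reflexive (sym (proj₂ (proj₂ pr))))) rc
        where
        u≡v : u ≡ v
        u≡v = ident-inj (trans (sym eu) (trans eq ev))
      decide : (∃ λ k → k < suc ℓ × bit k a ≢ bit k b) → ⊥
      decide (k , k< , d) = go (bit k a) (bit k b) refl refl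
        where
        go : ∀ x y → bit k a ≡ x → bit k b ≡ y → ⊥
        go true true p q = d (trans p (sym q))
        go false false p q = d (trans p (sym q))
        go true false p q = never (proj₁ (bitsMS-∈ (suc ℓ) k k<)) ma mb p q
        go false true p q = never (proj₂ (bitsMS-∈ (suc ℓ) k k<)) ma mb (cong not p) (cong not q)

  -- Edges of rank `0` end segments, so consecutive ones measure the size of the segment between
  -- them. `low` treats the lowest segment and says nothing if that segment is the whole leg.
  record Gaps (g : ℕ) (R : Fin n → ℕ) : Set where
    field
      low : ∀ u p → Par u p → R u ≡ 0 → g ≤ POS u
      gap : ∀ u v → LEG u ≡ LEG v → LEG u ≢ 0 → POS u < POS v → R u ≡ 0 → R v ≡ 0 → POS u + g ≤ POS v

  dec-Seg : ∀ {Q : Fin n → Set} → (∀ x → Dec (Q x)) → ∀ u v → Dec (Seg Q u v)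
  dec-Seg q? u v = (LEG u ≟ LEG v) ×-dec (¬? (LEG u ≟ 0) ×-dec
    F.all? (λ x → (LEG x ≟ LEG u) →-dec ((((POS u ≤? POS x) ×-dec (POS x <? POS v)) ⊎-dec ((POS v ≤? POS x) ×-dec (POS x <? POS u))) →-dec q? x)))

  -- The highest unranked edge below `u` separates the segment of `u` from its lower neighbour.
  next-top : ∀ {R} u x → LEG x ≡ LEG u → LEG u ≢ 0 → POS x < POS u → R x ≡ 0 →
    ∃ λ c → ∃ λ p → Par c p × R c ≡ 0 × Seg (NZ R) p u
  next-top {R} u x lx ne lt z = go (POS u) x lx lt (m≤n+m (POS u) (POS x)) z
    where
    go : ∀ k c → LEG c ≡ LEG u → POS c < POS u → POS u ≤ POS c + k → R c ≡ 0 →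
      ∃ λ c → ∃ λ p → Par c p × R c ≡ 0 × Seg (NZ R) p u
    go zero c lc lt le z = ⊥-elim (<-irrefl refl (<-≤-trans lt (≤-trans le (≤-reflexive (+-identityʳ _)))))
    go (suc k) c lc lt le z = let (p , pr) = parent-below lc (λ q → ne (trans (sym lc) q)) lt in
      found p pr (F.any? (λ y → (LEG y ≟ LEG u) ×-dec ((POS p ≤? POS y) ×-dec ((POS y <? POS u) ×-dec (R y ≟ 0)))))
      where
      found : ∀ p → Par c p → Dec (∃ λ y → LEG y ≡ LEG u × POS p ≤ POS y × POS y < POS u × R y ≡ 0) →
        ∃ λ c → ∃ λ p → Par c p × R c ≡ 0 × Seg (NZ R) p u
      found p pr (yes (y , ly , a , b , z')) = go k y ly b (≤-trans le (≤-trans (≤-reflexive (+-suc (POS c) k)) (+-monoˡ-≤ k (≤-trans (≤-reflexive (sym (proj₂ (proj₂ pr)))) a)))) z'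
      found p pr (no none') = c , p , pr , z , lp , (λ q → ne (trans (sym lp) q)) ,
        λ y ly → [ (λ { (a , b) z' → none' (y , trans ly lp , a , b , z') })
                 , (λ { (a , b) → ⊥-elim (<-irrefl refl (≤-<-trans a (<-≤-trans b (≤-trans (≤-reflexive (proj₂ (proj₂ pr))) lt)))) }) ]′
        where
        lp : LEG p ≡ LEG u
        lp = trans (sym (proj₁ pr)) lc

  module Phase {ℓ t₀ g R₀ R} (small : ∀ v → ident v < 2 ^ suc ℓ) (bd : ∀ v → R₀ v ≤ t₀)
    (rn : MRun t₀ (phaseMS (suc ℓ) t₀) R₀ R) (gaps : Gaps g R₀) where

    private
      len = length (bitsMS (suc ℓ))

    module Steps {Rᴬ Rᴮ} (bits : MRun t₀ (bitsMS (suc ℓ)) R₀ Rᴬ)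
      (sA : MergeStep (suc (len + t₀)) (isOld t₀) Rᴬ Rᴮ) (sB : MergeStep (suc (suc (len + t₀))) (isNew t₀) Rᴮ R) where

      late : t₀ < suc (len + t₀)
      late = s≤s (m≤n+m t₀ len)
      moB : Mono t₀ Rᴮ R
      moB = step-mono (m≤n⇒m≤1+n late) sB
      moAB : Mono t₀ Rᴬ Rᴮ
      moAB = step-mono late sA
      moA : Mono t₀ Rᴬ R
      moA = mono-trans moAB moB
      mo₀ : Mono t₀ R₀ R
      mo₀ = mono-trans (run-mono ≤-refl bits) moA

      low-Y : ∀ {t f R R'} (m : MergeStep t (ms- true f) R R') c → LEG c ≢ 0 → Untouched t₀ R c → MergeStep.Y m c ≤ t₀
      low-Y m c ne un = let (z , sg , eq) = MergeStep.at' m c ne in subst (_≤ t₀) (sym eq) (un z sg)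

      untouched-Y : ∀ {t f R R'} (m : MergeStep t (ms- true f) R R') c → MergeStep.Y m c ≤ t₀ → Untouched t₀ R c
      untouched-Y m c le y sg = ≤-trans (MergeStep.ub m c y sg) le

      -- By `sweep` the neighbour of an untouched segment cannot be untouched. A merged neighbour
      -- above would have attracted the segment in the `isOld` step, a merged neighbour below would
      -- have joined it in the `isNew` step.
      stuck : ∀ u → LEG u ≢ 0 → R u ≡ 0 → Untouched t₀ R u →
        (∃ λ p → Par u p) ⊎ (∃ λ x → LEG x ≡ LEG u × POS x < POS u × R x ≡ 0) → ⊥
      stuck u ne z un (inj₁ (p , pr)) = go (MergeStep.Y sA p ≤? t₀)
        where
        unA : Untouched t₀ Rᴬ u
        unA = untouched-back moA un
        go : Dec (MergeStep.Y sA p ≤ t₀) → ⊥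
        go (yes le) = sweep small bits pr (zero-back moA u z) unA (untouched-Y sA p le)
        go (no nle) = case trans (sym (MergeStep.merged sA u p (zero-back moA u z) pr (≤ᵇ-true (low-Y sA u ne unA)) (≤ᵇ-false (≰⇒> nle)))) (zero-back moB u z) of λ ()
      stuck u ne z un (inj₂ (x , lx , lt , zx)) = cont (next-top u x lx ne lt (zero-back moB x zx))
        where
        cont : (∃ λ c → ∃ λ p → Par c p × Rᴮ c ≡ 0 × Seg (NZ Rᴮ) p u) → ⊥
        cont (c , p , pr , zc , sg) = go (MergeStep.Y sB c ≤? t₀)
          where
          unB : Untouched t₀ Rᴮ p
          unB y sy = untouched-back moB un y (seg-trans {NZ Rᴮ} (seg-sym {NZ Rᴮ} sg) sy)
          go : Dec (MergeStep.Y sB c ≤ t₀) → ⊥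
          go (yes le) = sweep small bits pr (zero-back moAB c zc) (untouched-back moAB (untouched-Y sB c le)) (untouched-back moAB unB)
          go (no nle) = <-irrefl refl (<-≤-trans (m≤n⇒m≤1+n late) (subst (_≤ t₀) rc (un c (seg-trans {NZ R} (seg-sym {NZ R} (seg-forth moB sg)) (seg-sym {NZ R} (par-seg {NZ R} pr (λ q → case trans (sym rc) q of λ ())))))))
            where
            rc : R c ≡ suc (suc (len + t₀))
            rc = MergeStep.merged sB c p zc pr (cong not (≤ᵇ-false (≰⇒> nle))) (cong not (≤ᵇ-true (low-Y sB p (proj₁ (proj₂ sg)) unB)))

      -- The node `y` ended a segment before the phase, so the segment ending at `u` has absorbed at
      -- least one further segment.
      touched : ∀ u → LEG u ≢ 0 → R u ≡ 0 →
        (∃ λ p → Par u p) ⊎ (∃ λ x → LEG x ≡ LEG u × POS x < POS u × R x ≡ 0) →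
        ∃ λ y → LEG y ≡ LEG u × POS y < POS u × R₀ y ≡ 0 × Seg (NZ R) u y
      touched u ne z alt with F.any? (λ y → dec-Seg {NZ R} (λ x → ¬? (R x ≟ 0)) u y ×-dec (t₀ <? R y))
      ... | no none' = ⊥-elim (stuck u ne z (λ y sg → ≮⇒≥ λ lt → none' (y , sg , lt)) alt)
      ... | yes (y , sg , lt) = y , sym (proj₁ sg) , below (<-cmp (POS y) (POS u)) , old (mo₀ y) , sg
        where
        old : R y ≡ R₀ y ⊎ (R₀ y ≡ 0 × t₀ < R y) → R₀ y ≡ 0
        old (inj₁ e) = ⊥-elim (<-irrefl refl (<-≤-trans lt (≤-trans (≤-reflexive e) (bd y))))
        old (inj₂ (e , _)) = e
        below : Tri (POS y < POS u) (POS y ≡ POS u) (POS u < POS y) → POS y < POS u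
        below (tri< a _ _) = a
        below (tri≈ _ b _) = ⊥-elim (<-irrefl refl (<-≤-trans (<-≤-trans (s≤s z≤n) lt) (≤-reflexive (trans (cong R (POS-inj y u (sym (proj₁ sg)) b)) z))))
        below (tri> _ _ c) = ⊥-elim (proj₂ (proj₂ sg) u refl (inj₁ (≤-refl , c)) z)

      -- Each surviving segment contains an absorbed end `y`. There are `g` nodes up to `y`, and
      -- another `g` from there to the end of the segment.
      gaps' : Gaps (g + g) R
      gaps' = record { low = low' ; gap = gap' }
        where
        open Gaps gaps
        low' : ∀ u p → Par u p → R u ≡ 0 → g + g ≤ POS u
        low' u p pr z = let (y , ly , lt , zy , _) = touched u (proj₁ (proj₂ pr)) z (inj₁ (p , pr))
                            y≢0 = λ q → proj₁ (proj₂ pr) (trans (sym ly) q)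
                            (q , prq) = parent-below ly y≢0 lt
          in ≤-trans (+-monoˡ-≤ g (low y q prq zy)) (gap y u ly y≢0 lt zy (zero-back mo₀ u z))
        gap' : ∀ u v → LEG u ≡ LEG v → LEG u ≢ 0 → POS u < POS v → R u ≡ 0 → R v ≡ 0 → POS u + (g + g) ≤ POS v
        gap' u v l ne lt zu zv =
          let v≢0 = λ q → ne (trans l q)
              (y , ly , lt' , zy , sg) = touched v v≢0 zv (inj₂ (u , l , lt , zu))
              u<y : POS u < POS y
              u<y = ≰⇒> λ le → proj₂ (proj₂ sg) u l (inj₂ (le , lt)) zu
          in ≤-trans (≤-reflexive (sym (+-assoc (POS u) g g)))
             (≤-trans (+-monoˡ-≤ g (gap u y (trans l (sym ly)) ne u<y (zero-back mo₀ u zu) zy))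
                      (gap y v ly (λ q → v≢0 (trans (sym ly) q)) lt' zy (zero-back mo₀ v zv)))

    result : Gaps (g + g) R
    result with MRun-++ (bitsMS (suc ℓ)) rn
    ... | Rᴬ , bits , (sA ∷ sB ∷ []) = Steps.gaps' bits sA sB

  rank-gaps : ∀ {ℓ} s {t₀ g R R'} → (∀ v → ident v < 2 ^ suc ℓ) → (∀ v → R v ≤ t₀) → Gaps g R → RInv t₀ R →
    MRun t₀ (rankMS (suc ℓ) s t₀) R R' → Gaps (2 ^ s * g) R'
  rank-gaps zero {g = g} {R' = R'} small bd gaps inv [] = subst (λ k → Gaps k R') (sym (*-identityˡ g)) gaps
  rank-gaps {ℓ} (suc s) {t₀} {g} {R' = R'} small bd gaps inv rn with MRun-++ (phaseMS (suc ℓ) t₀) rn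
  ... | R₁ , r₁ , r₂ = subst (λ k → Gaps k R') eq
      (rank-gaps s small (RInv.bound inv₁) (Phase.result small bd r₁ gaps) inv₁ r₂)
    where
    inv₁ : RInv (length (phaseMS (suc ℓ) t₀) + t₀) R₁
    inv₁ = RInv-rn r₁ inv
    eq : 2 ^ s * (g + g) ≡ 2 ^ suc s * g
    eq = trans (cong (2 ^ s *_) (cong (g +_) (sym (+-identityʳ g)))) (trans (sym (*-assoc (2 ^ s) 2 g)) (cong (_* g) (*-comm (2 ^ s) 2)))

  record Ranked (T : ℕ) (R : Fin n → ℕ) : Set where
    field
      bound : ∀ v → R v ≤ T
      positive : ∀ v p → Par v p → R v ≢ 0
      top : ∀ v → R v ≢ 0 → ∃ λ p → Par v p
      rank : ∀ u v → LEG u ≡ LEG v → LEG u ≢ 0 → POS u < POS v → R u ≡ R v → R u ≢ 0 →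
        ∃ λ x → LEG x ≡ LEG u × POS u < POS x × POS x < POS v × R u < R x

  ranked : ∀ {ℓ s R R'} → (∀ v → ident v < 2 ^ suc ℓ) → (∀ v → POS v < 2 ^ s) → (∀ v → R v ≡ 0) →
    MRun 0 (rankMS (suc ℓ) s 0) R R' → Ranked (length (rankMS (suc ℓ) s 0)) R'
  ranked {ℓ} {s} {R} {R'} small pos< z rn = record
    { bound = λ v → subst (R' v ≤_) (+-identityʳ _) (RInv.bound inv v) ; positive = positive ; top = RInv.top inv ; rank = rank }
    where
    inv₀ : RInv 0 R
    inv₀ = record { bound = λ v → ≤-reflexive (z v) ; top = λ v ne → ⊥-elim (ne (z v)) ; rank = λ u v _ _ _ _ ne → ⊥-elim (ne (z u)) }
    inv : RInv (length (rankMS (suc ℓ) s 0) + 0) R'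
    inv = RInv-rn rn inv₀
    gaps₀ : Gaps 1 R
    gaps₀ = record { low = λ u p pr _ → POS≥1 u (proj₁ (proj₂ pr)) ; gap = λ u v _ _ lt _ _ → ≤-trans (≤-reflexive (+-comm (POS u) 1)) lt }
    gaps : Gaps (2 ^ s * 1) R'
    gaps = rank-gaps s small (λ v → ≤-reflexive (z v)) gaps₀ inv₀ rn
    -- An unranked inner edge would now have at least `2 ^ s` nodes below it, more than positions
    -- allow.
    positive : ∀ v p → Par v p → R' v ≢ 0
    positive v p pr e = <-irrefl refl (<-≤-trans (pos< v) (≤-trans (≤-reflexive (sym (*-identityʳ (2 ^ s)))) (Gaps.low gaps v p pr e)))
    rank : ∀ u v → LEG u ≡ LEG v → LEG u ≢ 0 → POS u < POS v → R' u ≡ R' v → R' u ≢ 0 →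
        ∃ λ x → LEG x ≡ LEG u × POS u < POS x × POS x < POS v × R' u < R' x
    rank u v l ne lt eq nz = let (x , lx , a , b , c) = RInv.rank inv u v l ne lt eq nz in
      x , lx , a , b , [ (λ e → ⊥-elim (let (p , pr) = parent-below (trans lx l) (λ q → ne (trans (sym lx) q)) b in positive x p pr e)) , (λ q → q) ]′ c

  -- Supermodularity of the weight between the legs.

  EW : (Fin n → Fin n → Bool) → ℕ
  EW F = ∑ (λ e → (F (e₁ e) (e₂ e) ▷ w e) + (F (e₂ e) (e₁ e) ▷ w e))

  EW-cong : ∀ {F F'} → (∀ a b → F a b ≡ F' a b) → EW F ≡ EW F'
  EW-cong eq = ∑-cong (λ e → cong₂ (λ x y → (x ▷ w e) + (y ▷ w e)) (eq _ _) (eq _ _))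

  EW-flip : ∀ F → EW (λ a b → F b a) ≡ EW F
  EW-flip F = ∑-cong (λ e → +-comm (F (e₂ e) (e₁ e) ▷ w e) (F (e₁ e) (e₂ e) ▷ w e))

  -- A disjoint union of conditions, phrased through the numbers they gate so that it can be summed
  -- directly.
  Splits : Bool → Bool → Bool → Set
  Splits x y z = ∀ k → (x ▷ k) ≡ (y ▷ k) + (z ▷ k)

  EW-add : ∀ {F F₁ F₂} → (∀ a b → Splits (F a b) (F₁ a b) (F₂ a b)) → EW F ≡ EW F₁ + EW F₂
  EW-add {F} {F₁} {F₂} eq = trans (∑-cong pt) (∑-+ (λ e → (F₁ (e₁ e) (e₂ e) ▷ w e) + (F₁ (e₂ e) (e₁ e) ▷ w e)) (λ e → (F₂ (e₁ e) (e₂ e) ▷ w e) + (F₂ (e₂ e) (e₁ e) ▷ w e)))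
    where
    open +-*-Solver
    pt : ∀ e → (F (e₁ e) (e₂ e) ▷ w e) + (F (e₂ e) (e₁ e) ▷ w e) ≡ ((F₁ (e₁ e) (e₂ e) ▷ w e) + (F₁ (e₂ e) (e₁ e) ▷ w e)) + ((F₂ (e₁ e) (e₂ e) ▷ w e) + (F₂ (e₂ e) (e₁ e) ▷ w e))
    pt e = trans (cong₂ _+_ (eq (e₁ e) (e₂ e) (w e)) (eq (e₂ e) (e₁ e) (w e)))
      (solve 4 (λ a b c d → (a :+ b) :+ (c :+ d) := (a :+ c) :+ (b :+ d)) refl (F₁ (e₁ e) (e₂ e) ▷ w e) (F₂ (e₁ e) (e₂ e) ▷ w e) (F₁ (e₂ e) (e₁ e) ▷ w e) (F₂ (e₂ e) (e₁ e) ▷ w e))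

  EW-zero : ∀ {F} → (∀ e i j → Joins e i j → F i j ≡ false) → EW F ≡ 0
  EW-zero z = ∑-zero (λ e → cong₂ (λ x y → (x ▷ w e) + (y ▷ w e)) (z e _ _ (inj₁ (refl , refl))) (z e _ _ (inj₂ (refl , refl))))

  split-on : ∀ {x y z} → x ≡ true → y ≡ true → z ≡ false → Splits x y z
  split-on refl refl refl k = sym (+-identityʳ k)
  split-on' : ∀ {x y z} → x ≡ true → y ≡ false → z ≡ true → Splits x y z
  split-on' refl refl refl k = refl
  split-off : ∀ {x y z} → x ≡ false → y ≡ false → z ≡ false → Splits x y z
  split-off refl refl refl k = refl

  splits-∧ʳ : ∀ {x y z} c → Splits x y z → Splits (x ∧ c) (y ∧ c) (z ∧ c)
  splits-∧ʳ {x} {y} {z} true s k = subst₂ (λ a b → (a ▷ k) ≡ b) (sym (∧-tr x)) (cong₂ (λ a b → (a ▷ k) + (b ▷ k)) (sym (∧-tr y)) (sym (∧-tr z))) (s k)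
    where
    ∧-tr : ∀ a → a ∧ true ≡ a
    ∧-tr true = refl
    ∧-tr false = refl
  splits-∧ʳ {x} {y} {z} false s k = cong₂ (λ a b → (a ▷ k) ≡ b) (∧-fl x) (cong₂ (λ a b → (a ▷ k) + (b ▷ k)) (∧-fl y) (∧-fl z)) ~> refl
    where
    ∧-fl : ∀ a → a ∧ false ≡ false
    ∧-fl true = refl
    ∧-fl false = refl
    _~>_ : ∀ {A B : Set} → A ≡ B → B → A
    refl ~> b = b

  splits-∧ˡ : ∀ {x y z} c → Splits x y z → Splits (c ∧ x) (c ∧ y) (c ∧ z)
  splits-∧ˡ true s k = s k
  splits-∧ˡ false s k = refl

  W≡ : ∀ p q → W p q ≡ EW (λ a b → inA 1 p a ∧ inA 2 q b)
  W≡ p q = ∑-cong (λ e → aux (inA 1 p (e₁ e)) (inA 2 q (e₂ e)) (inA 1 p (e₂ e)) (inA 2 q (e₁ e)) (w e) (inA-disj p q (e₁ e)))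
    where
    aux : ∀ a b' a' b k → a ∧ b ≡ false → ((a ∧ b') ∨ (a' ∧ b) ▷ k) ≡ (a ∧ b' ▷ k) + (a' ∧ b ▷ k)
    aux true b' a' true k ()
    aux true true true false k _ = sym (+-identityʳ k)
    aux true true false false k _ = sym (+-identityʳ k)
    aux true false true false k _ = refl
    aux true false false false k _ = refl
    aux false b' a' b k _ = refl

  diff : ℕ → ℕ → ℕ → Fin n → Bool
  diff l p₁ p₂ v = not (inA l p₁ v) ∧ inA l p₂ v

  inA-split : ∀ l p₁ p₂ v → p₁ ≤ p₂ → Splits (inA l p₂ v) (inA l p₁ v) (diff l p₁ p₂ v)
  inA-split l p₁ p₂ v le = aux (inA l p₁ v) refl
    where
    aux : ∀ b → inA l p₁ v ≡ b → Splits (inA l p₂ v) (inA l p₁ v) (diff l p₁ p₂ v)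
    aux true p = split-on bigger p (cong (λ b → not b ∧ inA l p₂ v) p)
      where
      bigger : inA l p₂ v ≡ true
      bigger = let (a , b) = ∧-true {LEG v ≡ᵇ l} p in cong₂ _∧_ a (≤ᵇ-true (≤-trans (≤ᵇ-sound {POS v} b) le))
    aux false p k = trans (sym refl) (cong₂ (λ a b → (a ▷ k) + (b ▷ k)) (sym p) (cong (λ b → not b ∧ inA l p₂ v) (sym p)))

  Box : ℕ → ℕ → ℕ → ℕ → ℕ
  Box p₁ p₂ q₁ q₂ = EW (λ a b → diff 1 p₁ p₂ a ∧ diff 2 q₁ q₂ b)

  -- Inclusion and exclusion with the error term kept. That `Box` is nonnegative eliminates pairs on
  -- opposite sides of a pivot; that it vanishes without edges allows a rectangle to be dropped.
  monge : ∀ p₁ p₂ q₁ q₂ → p₁ ≤ p₂ → q₁ ≤ q₂ → W p₂ q₂ + W p₁ q₁ ≡ (W p₁ q₂ + W p₂ q₁) + Box p₁ p₂ q₁ q₂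
  monge p₁ p₂ q₁ q₂ lp lq = begin
    W p₂ q₂ + W p₁ q₁ ≡⟨ cong (_+ W p₁ q₁) (row q₂) ⟩
    (W p₁ q₂ + E q₂) + W p₁ q₁ ≡⟨ cong (λ x → (W p₁ q₂ + x) + W p₁ q₁) col ⟩
    (W p₁ q₂ + (E q₁ + Box p₁ p₂ q₁ q₂)) + W p₁ q₁ ≡⟨ solve 4 (λ a b c d → (a :+ (b :+ c)) :+ d := (a :+ (d :+ b)) :+ c) refl (W p₁ q₂) (E q₁) (Box p₁ p₂ q₁ q₂) (W p₁ q₁) ⟩
    (W p₁ q₂ + (W p₁ q₁ + E q₁)) + Box p₁ p₂ q₁ q₂ ≡⟨ cong (λ x → (W p₁ q₂ + x) + Box p₁ p₂ q₁ q₂) (sym (row q₁)) ⟩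
    (W p₁ q₂ + W p₂ q₁) + Box p₁ p₂ q₁ q₂ ∎
    where
    open ≡-Reasoning
    open +-*-Solver
    E : ℕ → ℕ
    E q = EW (λ a b → diff 1 p₁ p₂ a ∧ inA 2 q b)
    row : ∀ q → W p₂ q ≡ W p₁ q + E q
    row q = trans (W≡ p₂ q) (trans (EW-add {λ a b → inA 1 p₂ a ∧ inA 2 q b} {λ a b → inA 1 p₁ a ∧ inA 2 q b} {λ a b → diff 1 p₁ p₂ a ∧ inA 2 q b} (λ a b → splits-∧ʳ {inA 1 p₂ a} {inA 1 p₁ a} {diff 1 p₁ p₂ a} (inA 2 q b) (inA-split 1 p₁ p₂ a lp))) (cong (_+ E q) (sym (W≡ p₁ q))))
    col : E q₂ ≡ E q₁ + Box p₁ p₂ q₁ q₂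
    col = EW-add {λ a b → diff 1 p₁ p₂ a ∧ inA 2 q₂ b} {λ a b → diff 1 p₁ p₂ a ∧ inA 2 q₁ b} {λ a b → diff 1 p₁ p₂ a ∧ diff 2 q₁ q₂ b} (λ a b → splits-∧ˡ (diff 1 p₁ p₂ a) (inA-split 2 q₁ q₂ b lq))

  diff-sound : ∀ {l p₁ p₂ v} → diff l p₁ p₂ v ≡ true → LEG v ≡ l × p₁ < POS v × POS v ≤ p₂
  diff-sound {l} {p₁} {p₂} {v} d = ≡ᵇ-sound (proj₁ i) , ≰⇒> (λ le → not-true (proj₁ n') (cong₂ _∧_ (proj₁ i) (≤ᵇ-true le))) , ≤ᵇ-sound (proj₂ i)
    where
    n' = ∧-true {not (inA l p₁ v)} d
    i = ∧-true {LEG v ≡ᵇ l} (proj₂ n')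

  Box-zero : ∀ p₁ p₂ q₁ q₂ → (∀ e i j → Joins e i j → LEG i ≡ 1 → LEG j ≡ 2 → p₁ < POS i → POS i ≤ p₂ → q₁ < POS j → POS j ≤ q₂ → ⊥) → Box p₁ p₂ q₁ q₂ ≡ 0
  Box-zero p₁ p₂ q₁ q₂ h = EW-zero {λ a b → diff 1 p₁ p₂ a ∧ diff 2 q₁ q₂ b} (λ e i j jn → ¬true⇒false λ d →
    let (a , b) = ∧-true {diff 1 p₁ p₂ i} d
        (l , x , y) = diff-sound {1} {p₁} {p₂} {i} a
        (l' , x' , y') = diff-sound {2} {q₁} {q₂} {j} b
    in h e i j jn l l' x y x' y')

  wsum≤ : ∀ χ → wsum χ ≤ ∑ w
  wsum≤ χ = ∑-≤ (λ e → aux (χ e) (w e))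
    where
    aux : ∀ b x → (b ▷ x) ≤ x
    aux true x = ≤-refl
    aux false x = z≤n

  -- The exchange step: the two hypotheses say that j* beats j in row p, and that moving from
  -- row p to row i does not favour j.
  dominate : ∀ {i j j*} p → LEG i ≡ 1 → LEG j ≡ 2 → LEG j* ≡ 2 →
    X j* + 2 * W p (POS j) ≤ X j + 2 * W p (POS j*) →
    W (POS i) (POS j) + W p (POS j*) ≤ W (POS i) (POS j*) + W p (POS j) → C i j* ≤ C i j
  dominate {i} {j} {j*} p li lj lj* opt ex = +-cancelʳ-≤ (2 * Wij* + 2 * Wij) (C i j*) (C i j) (begin
    C i j* + (2 * Wij* + 2 * Wij) ≡⟨ sym (+-assoc (C i j*) _ _) ⟩
    C i j* + 2 * Wij* + 2 * Wij ≡⟨ cong (_+ 2 * Wij) (C-split i j* li lj*) ⟩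
    X i + X j* + 2 * Wij ≡⟨ +-assoc (X i) _ _ ⟩
    X i + (X j* + 2 * Wij) ≤⟨ +-monoʳ-≤ (X i) key' ⟩
    X i + (X j + 2 * Wij*) ≡⟨ sym (+-assoc (X i) _ _) ⟩
    X i + X j + 2 * Wij* ≡⟨ cong (_+ 2 * Wij*) (sym (C-split i j li lj)) ⟩
    C i j + 2 * Wij + 2 * Wij* ≡⟨ trans (+-assoc (C i j) _ _) (cong (C i j +_) (+-comm (2 * Wij) _)) ⟩
    C i j + (2 * Wij* + 2 * Wij) ∎)
    where
    open ≤-Reasoning
    Wij = W (POS i) (POS j)
    Wij* = W (POS i) (POS j*)
    A = W p (POS j*)
    B = W p (POS j)
    open +-*-Solver renaming (con to cst)
    key' : X j* + 2 * Wij ≤ X j + 2 * Wij*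
    key' = +-cancelʳ-≤ (2 * A + 2 * B) (X j* + 2 * Wij) (X j + 2 * Wij*) (begin
      X j* + 2 * Wij + (2 * A + 2 * B) ≡⟨ solve 4 (λ x u a b → x :+ cst 2 :* u :+ (cst 2 :* a :+ cst 2 :* b) := (x :+ cst 2 :* b) :+ cst 2 :* (u :+ a)) refl (X j*) Wij A B ⟩
      (X j* + 2 * B) + 2 * (Wij + A) ≤⟨ +-mono-≤ opt (*-monoʳ-≤ 2 ex) ⟩
      (X j + 2 * A) + 2 * (Wij* + B) ≡⟨ solve 4 (λ x u a b → (x :+ cst 2 :* a) :+ cst 2 :* (u :+ b) := x :+ cst 2 :* u :+ (cst 2 :* a :+ cst 2 :* b)) refl (X j) Wij* A B ⟩
      X j + 2 * Wij* + (2 * A + 2 * B) ∎)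

  -- Instructions on registers that do not overflow.

  module AtWidth (K : ℕ) where

    Capped : State → Set
    Capped s = ∀ v → capM K (s v) ≡ s v

    -- Clipping acts on each register separately, so for the setters in use the naturality
    -- hypothesis holds by computation.
    set-ok : (S : Mem → ℕ → Mem) → (∀ m a → capM K (S m a) ≡ S (capM K m) (cap K a)) →
      ∀ {m a} → capM K m ≡ m → a < 2 ^ K → capM K (S m a) ≡ S m a
    set-ok S nat {m} {a} c lt = trans (nat m a) (cong₂ S c (cap-id K lt))

    capped-by : ∀ {s' : State} {g : Fin n → Mem} → (∀ v → s' v ≡ capM K (g v)) → Capped s'
    capped-by {g = g} eq v = subst (λ m → capM K m ≡ m) (sym (eq v)) (capM-capM K (g v))

    quiet-comp : ∀ {i s u v} → (∀ w b x y → con i w b x y ≡ false) → Comp i s u v → u ≡ v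
    quiet-comp q ε = refl
    quiet-comp q ((e , c , _) ◅ p) = case trans (sym c) (q _ _ _ _) of λ ()

    record MaxSpec (i : Instr) (s : State) (f : Mem → ℕ → Mem) (s' : State) : Set where
      field
        Y : Fin n → ℕ
        ub : ∀ v u → Comp i s v u → cons i (s u) ≤ Y v
        at' : ∀ v → ∃ λ u → Comp i s v u × Y v ≡ cons i (s u)
        res : ∀ v → s' v ≡ capM K (f (s v) (Y v))

    max-spec : ∀ {c f u s s'} → MaxSem K (maxI c f u) s s' → (∀ v → f (s v) < 2 ^ K) → MaxSpec (maxI c f u) s u s'
    max-spec {c} {f} {u} {s} r bd = record
      { Y = Y ; ub = λ v x p → subst (_≤ Y v) (cap-id K (bd x)) (Y-ub v x p)
      ; at' = λ v → let (x , p , q) = Y-at v in x , p , trans q (cap-id K (bd x))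
      ; res = result }
      where open MaxSem r

    local-spec : ∀ {u s s'} → MaxSem K (localI u) s s' → ∀ v → s' v ≡ capM K (u (s v))
    local-spec r = MaxSem.result r

    local-set : ∀ (S : Mem → ℕ → Mem) → (∀ m a → capM K (S m a) ≡ S (capM K m) (cap K a)) →
      ∀ {u s s'} (x : Fin n → ℕ) → MaxSem K (localI u) s s' → Capped s → (∀ v → u (s v) ≡ S (s v) (x v)) → (∀ v → x v < 2 ^ K) →
      Capped s' × (∀ v → s' v ≡ S (s v) (x v))
    local-set S nat {u} x sem c eq lt = capped-by (local-spec {u} sem) ,
      λ v → trans (local-spec {u} sem v) (trans (cong (capM K) (eq v)) (set-ok S nat (c v) (lt v)))

    cap-sum : ∀ {n} (χ : Fin n → Bool) (f : Fin n → ℕ) → ∑ (λ u → χ u ▷ f u) < 2 ^ K →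
      cap K (∑ (λ u → χ u ▷ cap K (f u))) ≡ ∑ (λ u → χ u ▷ f u)
    cap-sum χ f lt = trans (cong (cap K) (∑-cong pt)) (cap-id K lt)
      where
      small : ∀ u → (χ u ▷ f u) < 2 ^ K
      small u = ≤-<-trans (term≤∑ (λ u → χ u ▷ f u) u) lt
      pt : ∀ u → (χ u ▷ cap K (f u)) ≡ (χ u ▷ f u)
      pt u = aux (χ u) (small u)
        where
        aux : ∀ b → (b ▷ f u) < 2 ^ K → (b ▷ cap K (f u)) ≡ (b ▷ f u)
        aux true l = cap-id K l
        aux false l = refl

    ∑-▷≤ : ∀ {n} (χ : Fin n → Bool) (f : Fin n → ℕ) → ∑ (λ u → χ u ▷ f u) ≤ ∑ f
    ∑-▷≤ χ f = ∑-≤ (λ u → aux (χ u) (f u))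
      where
      aux : ∀ b x → (b ▷ x) ≤ x
      aux true x = ≤-refl
      aux false x = z≤n

    record SumSpec (i : Instr) (s : State) (f : Mem → ℕ → Mem) (s' : State) : Set where
      field
        same : Fin n → Fin n → Bool
        same⇔ : ∀ u v → (same u v ≡ true) ⇔ Comp i s u v
        res : ∀ v → s' v ≡ capM K (f (s v) (∑ (λ u → same v u ▷ cons i (s u))))

    sum-spec : ∀ {c f u s s'} → SumSem K (sumI c f u) s s' → ∑ (λ v → f (s v)) < 2 ^ K → SumSpec (sumI c f u) s u s'
    sum-spec {c} {f} {u} {s} r bd = record
      { same = same ; same⇔ = same⇔
      ; res = λ v → trans (result v) (cong (λ y → capM K (u (s v) y))
          (cap-sum (same v) (λ x → f (s x)) (≤-<-trans (∑-▷≤ (same v) (λ x → f (s x))) bd))) }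
      where open SumSem r

    isEnd : Fin n → Fin n → Bool
    isEnd v x = does (v F.≟ x)

    isEnd-refl : ∀ v → isEnd v v ≡ true
    isEnd-refl v = to (does⇔ (v F.≟ v)) refl

    recv : (Fin m → ℕ) → (Fin m → ℕ) → Fin n → ℕ
    recv z₁ z₂ v = ∑ (λ e → (isEnd v (e₁ e) ▷ z₁ e) + (isEnd v (e₂ e) ▷ z₂ e))

    -- Nothing is contracted, so each supernode is one node and, as there are no loops, every edge
    -- is present and reports to both ends.
    edge-spec : ∀ {z u s s'} → SumSem K (edgeI z u) s s' →
      (∀ v → recv (λ e → z (w e) (s (e₁ e)) (s (e₂ e))) (λ e → z (w e) (s (e₂ e)) (s (e₁ e))) v < 2 ^ K) →
      ∀ v → s' v ≡ capM K (u (s v) (recv (λ e → z (w e) (s (e₁ e)) (s (e₂ e))) (λ e → z (w e) (s (e₂ e)) (s (e₁ e))) v))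
    edge-spec {z} {u} {s} r bd v = trans (result v) (cong (λ y → capM K (u (s v) y)) (trans (cong (cap K) (∑-cong pt)) (cap-id K (bd v))))
      where
      open SumSem r
      z₁ z₂ : Fin m → ℕ
      z₁ e = z (w e) (s (e₁ e)) (s (e₂ e))
      z₂ e = z (w e) (s (e₂ e)) (s (e₁ e))
      same≡ : ∀ x y → same x y ≡ isEnd x y
      same≡ x y = true-ext (λ p → to (does⇔ (x F.≟ y)) (quiet-comp {edgeI z u} {s} (λ _ _ _ _ → refl) (to (same⇔ x y) p)))
        (λ p → from (same⇔ x y) (subst (Comp (edgeI z u) s x) (from (does⇔ (x F.≟ y)) p) ε))
      sep : ∀ e → same (e₁ e) (e₂ e) ≡ false
      sep e = ¬true⇒false (λ p → loopfree e (quiet-comp {edgeI z u} {s} (λ _ _ _ _ → refl) (to (same⇔ _ _) p)))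
      small : ∀ e → (isEnd v (e₁ e) ▷ z₁ e) + (isEnd v (e₂ e) ▷ z₂ e) < 2 ^ K
      small e = ≤-<-trans (term≤∑ (λ e → (isEnd v (e₁ e) ▷ z₁ e) + (isEnd v (e₂ e) ▷ z₂ e)) e) (bd v)
      drop : ∀ b x → (b ▷ x) < 2 ^ K → (b ▷ cap K x) ≡ (b ▷ x)
      drop true x l = cap-id K l
      drop false x l = refl
      pt : ∀ e → (not (same (e₁ e) (e₂ e)) ∧ same v (e₁ e) ▷ cap K (z₁ e)) + (not (same (e₁ e) (e₂ e)) ∧ same v (e₂ e) ▷ cap K (z₂ e))
        ≡ (isEnd v (e₁ e) ▷ z₁ e) + (isEnd v (e₂ e) ▷ z₂ e)
      pt e = cong₂ _+_
        (trans (cong₂ (λ a b → not a ∧ b ▷ cap K (z₁ e)) (sep e) (same≡ v (e₁ e))) (drop (isEnd v (e₁ e)) (z₁ e) (≤-<-trans (m≤m+n (isEnd v (e₁ e) ▷ z₁ e) _) (small e))))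
        (trans (cong₂ (λ a b → not a ∧ b ▷ cap K (z₂ e)) (sep e) (same≡ v (e₂ e))) (drop (isEnd v (e₂ e)) (z₂ e) (≤-<-trans (m≤n+m (isEnd v (e₂ e) ▷ z₂ e) (isEnd v (e₁ e) ▷ z₁ e)) (small e))))

    edge-set : ∀ (S : Mem → ℕ → Mem) → (∀ m a → capM K (S m a) ≡ S (capM K m) (cap K a)) →
      ∀ {z s s'} → SumSem K (edgeI z S) s s' → Capped s → ∀ z₁ z₂ →
      (∀ e → z (w e) (s (e₁ e)) (s (e₂ e)) ≡ z₁ e) → (∀ e → z (w e) (s (e₂ e)) (s (e₁ e)) ≡ z₂ e) → (∀ v → recv z₁ z₂ v < 2 ^ K) →
      Capped s' × (∀ v → s' v ≡ S (s v) (recv z₁ z₂ v))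
    edge-set S nat {z} {s} {s'} sem c z₁ z₂ eq₁ eq₂ lt = capped-by res , λ v → trans (res v) (set-ok S nat (c v) (lt v))
      where
      recv≡ : ∀ v → recv (λ e → z (w e) (s (e₁ e)) (s (e₂ e))) (λ e → z (w e) (s (e₂ e)) (s (e₁ e))) v ≡ recv z₁ z₂ v
      recv≡ v = ∑-cong (λ e → cong₂ _+_ (cong (isEnd v (e₁ e) ▷_) (eq₁ e)) (cong (isEnd v (e₂ e) ▷_) (eq₂ e)))
      res : ∀ v → s' v ≡ capM K (S (s v) (recv z₁ z₂ v))
      res v = trans (edge-spec {z} {S} sem (λ v → subst (_< 2 ^ K) (sym (recv≡ v)) (lt v)) v) (cong (λ x → capM K (S (s v) x)) (recv≡ v))

    recv≤ : ∀ z₁ z₂ v → recv z₁ z₂ v ≤ ∑ (λ e → z₁ e + z₂ e)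
    recv≤ z₁ z₂ v = ∑-≤ (λ e → +-mono-≤ (aux (isEnd v (e₁ e)) (z₁ e)) (aux (isEnd v (e₂ e)) (z₂ e)))
      where
      aux : ∀ b x → (b ▷ x) ≤ x
      aux true x = ≤-refl
      aux false x = z≤n

    recv-sum : ∀ (S : Fin n → Bool) z₁ z₂ →
      ∑ (λ v → S v ▷ recv z₁ z₂ v) ≡ ∑ (λ e → (S (e₁ e) ▷ z₁ e) + (S (e₂ e) ▷ z₂ e))
    recv-sum S z₁ z₂ = begin
      ∑ (λ v → S v ▷ recv z₁ z₂ v) ≡⟨ ∑-cong (λ v → inside (S v) v) ⟩
      ∑ (λ v → ∑ (λ e → (S v ▷ (isEnd v (e₁ e) ▷ z₁ e)) + (S v ▷ (isEnd v (e₂ e) ▷ z₂ e)))) ≡⟨ ∑-swap (λ v e → (S v ▷ (isEnd v (e₁ e) ▷ z₁ e)) + (S v ▷ (isEnd v (e₂ e) ▷ z₂ e))) ⟩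
      ∑ (λ e → ∑ (λ v → (S v ▷ (isEnd v (e₁ e) ▷ z₁ e)) + (S v ▷ (isEnd v (e₂ e) ▷ z₂ e)))) ≡⟨ ∑-cong (λ e → ∑-+ (λ v → S v ▷ (isEnd v (e₁ e) ▷ z₁ e)) (λ v → S v ▷ (isEnd v (e₂ e) ▷ z₂ e))) ⟩
      ∑ (λ e → ∑ (λ v → S v ▷ (isEnd v (e₁ e) ▷ z₁ e)) + ∑ (λ v → S v ▷ (isEnd v (e₂ e) ▷ z₂ e))) ≡⟨ ∑-cong (λ e → cong₂ _+_ (point (e₁ e) (z₁ e)) (point (e₂ e) (z₂ e))) ⟩
      ∑ (λ e → (S (e₁ e) ▷ z₁ e) + (S (e₂ e) ▷ z₂ e)) ∎
      where
      open ≡-Reasoning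
      inside : ∀ b v → (b ▷ recv z₁ z₂ v) ≡ ∑ (λ e → (b ▷ (isEnd v (e₁ e) ▷ z₁ e)) + (b ▷ (isEnd v (e₂ e) ▷ z₂ e)))
      inside true v = refl
      inside false v = sym (∑-zero {m} {λ e → 0} (λ e → refl))
      ▷-0 : ∀ b → (b ▷ 0) ≡ 0
      ▷-0 true = refl
      ▷-0 false = refl
      point : ∀ x k → ∑ (λ v → S v ▷ (isEnd v x ▷ k)) ≡ (S x ▷ k)
      point x k = trans (∑-point x (λ v ne → trans (cong (λ b → S v ▷ (b ▷ k)) (¬true⇒false (λ p → ne (from (does⇔ (v F.≟ x)) p)))) (▷-0 (S v))))
        (cong (λ b → S x ▷ (b ▷ k)) (isEnd-refl x))

    legTree→ : ∀ (s : State) → (∀ v → leg (s v) ≡ LEG v) → ∀ e {b} → legTree (tree e) (s (e₁ e)) ∧ b ≡ true → IsTree e × LEG (e₁ e) ≢ 0 × b ≡ true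
    legTree→ s ls e p = let (q , r) = ∧-true {legTree (tree e) (s (e₁ e))} p; (a , c) = ∧-true {tree e} q in
      a , (λ z → nonzero-sound c (trans (ls (e₁ e)) z)) , r

    legTree← : ∀ (s : State) → (∀ v → leg (s v) ≡ LEG v) → ∀ e {b} → IsTree e → LEG (e₁ e) ≢ 0 → b ≡ true → legTree (tree e) (s (e₁ e)) ∧ b ≡ true
    legTree← s ls e te ne b = cong₂ _∧_ (cong₂ _∧_ te (nonzero-true (λ z → ne (trans (sym (ls (e₁ e))) z)))) b

    record Base (s : State) : Set where
      field
        capped : Capped s
        legs : ∀ v → leg (s v) ≡ LEG v
        ids : ∀ v → nid (s v) ≡ ident v

    -- Merge instructions realise merge steps.

    module Merge (x : MS) (t : ℕ) (t< : t < 2 ^ K) (small : ∀ v → suc (ident v) < 2 ^ K) {s s' : State} (basis : Base s)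
      (sem : MaxSem K (mergeI x t) s s') where
      open Base basis
      open MaxSem sem

      R R' : Fin n → ℕ
      R v = rk (s v)
      R' v = if G v ≡ᵇ suc (nid (s v)) then t else R v

      R< : ∀ v → R v < 2 ^ K
      R< v = subst (_< 2 ^ K) (cong rk (capped v)) (cap< K (rk (s v)))

      contracted→ : ∀ e → Contracted (mergeI x t) s e → IsTree e × LEG (e₁ e) ≢ 0 × NZ R (e₂ e)
      contracted→ e c = let (a , b , d) = legTree→ s legs e c in a , b , nonzero-sound d

      open Components (mergeI x t) s (NZ R) contracted→
        (λ e te ne q → legTree← s legs e te ne (nonzero-true q))

      key≡ : ∀ u → cap K (cons (mergeI x t) (s u)) ≡ key x R u
      key≡ u = aux (useRk x)
        where
        aux : ∀ b → cap K (if b then rk (s u) else nid (s u)) ≡ (if b then R u else ident u)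
        aux true = cap-id K (R< u)
        aux false = trans (cap-id K (≤-<-trans (≤-trans (≤-reflexive (ids u)) (n≤1+n _)) (small u))) (ids u)

      z₂ : Fin m → ℕ
      z₂ e = proj₂ (zz (mergeI x t) s Y e)

      z₂-on : ∀ e → IsTree e → LEG (e₁ e) ≢ 0 → R (e₂ e) ≡ 0 → φ x (Y (e₂ e)) ≡ true → φ x (Y (e₁ e)) ≡ false → z₂ e ≡ suc (ident (e₂ e))
      z₂-on e te ne rz a b = trans (cong (_▷ suc (nid (s (e₂ e)))) (cong₂ _∧_ (legTree← s legs e te ne (≡ᵇ-true rz)) (cong₂ _∧_ a (cong not b)))) (cong suc (ids (e₂ e)))

      z₂-off : ∀ e → z₂ e ≢ 0 → IsTree e × LEG (e₁ e) ≢ 0 × R (e₂ e) ≡ 0 × φ x (Y (e₂ e)) ≡ true × φ x (Y (e₁ e)) ≡ false × z₂ e ≡ suc (ident (e₂ e))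
      z₂-off e ne = aux _ refl
        where
        not-false : ∀ {b} → not b ≡ true → b ≡ false
        not-false {false} _ = refl
        aux : ∀ b → ((legTree (tree e) (s (e₁ e)) ∧ (rk (s (e₂ e)) ≡ᵇ 0)) ∧ (φ x (Y (e₂ e)) ∧ not (φ x (Y (e₁ e))))) ≡ b →
          IsTree e × LEG (e₁ e) ≢ 0 × R (e₂ e) ≡ 0 × φ x (Y (e₂ e)) ≡ true × φ x (Y (e₁ e)) ≡ false × z₂ e ≡ suc (ident (e₂ e))
        aux false eq = ⊥-elim (ne (cong (_▷ suc (nid (s (e₂ e)))) eq))
        aux true eq = let (p , q) = ∧-true {legTree (tree e) (s (e₁ e)) ∧ (rk (s (e₂ e)) ≡ᵇ 0)} eq
                          (te , l , rz) = legTree→ s legs e p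
                          (a , b) = ∧-true {φ x (Y (e₂ e))} q in
          te , l , ≡ᵇ-sound rz , a , not-false b , trans (cong (_▷ suc (nid (s (e₂ e)))) eq) (cong suc (ids (e₂ e)))

      cap-z₂ : ∀ e → cap K (z₂ e) ≢ 0 → cap K (z₂ e) ≡ suc (ident (e₂ e)) × z₂ e ≢ 0
      cap-z₂ e ne = trans (cong (cap K) (proj₂ (proj₂ (proj₂ (proj₂ (proj₂ off)))))) (cap-id K (small (e₂ e))) , nz
        where
        nz : z₂ e ≢ 0
        nz z = ne (cong (cap K) z)
        off = z₂-off e nz

      Cond : Fin n → Fin n → Set
      Cond v p = Par v p × φ x (Y v) ≡ true × φ x (Y p) ≡ false

      merged : ∀ v p → R v ≡ 0 → Par v p → φ x (Y v) ≡ true → φ x (Y p) ≡ false → R' v ≡ t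
      merged v p rz pr a b = cong (λ b → if b then t else R v) (≡ᵇ-true (≤-antisym upper lower))
        where
        e = proj₁ (edge-of pr)
        te = proj₁ (proj₂ (edge-of pr))
        e₂≡ : e₂ e ≡ v
        e₂≡ = proj₁ (proj₂ (proj₂ (edge-of pr)))
        e₁≡ : e₁ e ≡ p
        e₁≡ = proj₂ (proj₂ (proj₂ (edge-of pr)))
        v≢0 = proj₁ (proj₂ pr)
        apart : ¬ Comp (mergeI x t) s (e₁ e) (e₂ e)
        apart c = proj₂ (proj₂ (seg-sym {NZ R} (comp-seg (λ z → v≢0 (trans (proj₁ pr) (trans (cong LEG (sym e₁≡)) z))) c))) (e₂ e) refl
          (inj₁ (≤-refl , ≤-reflexive (sym (trans (cong POS e₁≡) (trans (proj₂ (proj₂ pr)) (cong (suc ∘ POS) (sym e₂≡))))))) (trans (cong R e₂≡) rz)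
        on : z₂ e ≡ suc (ident v)
        on = trans (z₂-on e te (λ z → v≢0 (trans (proj₁ pr) (trans (cong LEG (sym e₁≡)) z))) (trans (cong R e₂≡) rz) (trans (cong (φ x ∘ Y) e₂≡) a) (trans (cong (φ x ∘ Y) e₁≡) b)) (cong (suc ∘ ident) e₂≡)
        lower : suc (nid (s v)) ≤ G v
        lower = subst (_≤ G v) (trans (cong (cap K) on) (trans (cap-id K (small v)) (cong suc (sym (ids v))))) (G-ub₂ v e apart (subst (λ y → Comp (mergeI x t) s v y) (sym e₂≡) ε))
        upper : G v ≤ suc (nid (s v))
        upper with G-at v
        ... | inj₁ z = ≤-trans (≤-reflexive z) z≤n
        ... | inj₂ (e' , _ , inj₁ (_ , q)) = ≤-trans (≤-reflexive q) z≤n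
        ... | inj₂ (e' , _ , inj₂ (c , q)) = ≤-reflexive (trans q (trans (proj₁ (cap-z₂ e' nz)) (cong suc (trans (cong ident same-top) (sym (ids v))))))
          where
          nz : cap K (z₂ e') ≢ 0
          nz z = case ≤-trans lower (≤-reflexive (trans q z)) of λ ()
          rz' : R (e₂ e') ≡ 0
          rz' = proj₁ (proj₂ (proj₂ (z₂-off e' (proj₂ (cap-z₂ e' nz)))))
          sg = comp-seg v≢0 c
          -- Rank `0` occurs in a segment only at its top. Both `v` and the sender lie in one
          -- segment and have rank `0`, so no second message can compete.
          same-top : e₂ e' ≡ v
          same-top with <-cmp (POS (e₂ e')) (POS v)
          ... | tri< l _ _ = ⊥-elim (proj₂ (proj₂ sg) (e₂ e') (sym (proj₁ sg)) (inj₂ (≤-refl , l)) rz')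
          ... | tri≈ _ q _ = POS-inj _ _ (sym (proj₁ sg)) q
          ... | tri> _ _ l = ⊥-elim (proj₂ (proj₂ sg) v refl (inj₁ (≤-refl , l)) rz)

      change : ∀ v → R' v ≡ R v ⊎ (R' v ≡ t × R v ≡ 0 × ∃ λ p → Cond v p)
      change v = aux (G v ≡ᵇ suc (nid (s v))) refl
        where
        aux : ∀ b → (G v ≡ᵇ suc (nid (s v))) ≡ b → R' v ≡ R v ⊎ (R' v ≡ t × R v ≡ 0 × ∃ λ p → Cond v p)
        aux false eq = inj₁ (cong (λ b → if b then t else R v) eq)
        aux true eq = inj₂ (cong (λ b → if b then t else R v) eq , found (G-at v))
          where
          gv≡ : G v ≡ suc (ident v)
          gv≡ = trans (≡ᵇ-sound eq) (cong suc (ids v))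
          found : (G v ≡ 0 ⊎ ∃ λ e → ¬ Comp (mergeI x t) s (e₁ e) (e₂ e) ×
            ((Comp (mergeI x t) s v (e₁ e) × G v ≡ cap K 0) ⊎ (Comp (mergeI x t) s v (e₂ e) × G v ≡ cap K (z₂ e)))) → R v ≡ 0 × ∃ λ p → Cond v p
          found (inj₁ z) = case trans (sym gv≡) z of λ ()
          found (inj₂ (e , _ , inj₁ (_ , q))) = case trans (sym gv≡) q of λ ()
          found (inj₂ (e , _ , inj₂ (_ , q))) = rz , e₁ e , subst (λ v → Par v (e₁ e)) e₂≡v (par-of e te l) , subst (λ v → φ x (Y v) ≡ true) e₂≡v a , b
            where
            nz : cap K (z₂ e) ≢ 0
            nz z = case trans (sym gv≡) (trans q z) of λ ()
            off = z₂-off e (proj₂ (cap-z₂ e nz))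
            te = proj₁ off
            l = proj₁ (proj₂ off)
            a = proj₁ (proj₂ (proj₂ (proj₂ off)))
            b = proj₁ (proj₂ (proj₂ (proj₂ (proj₂ off))))
            e₂≡v : e₂ e ≡ v
            e₂≡v = ident-inj (suc-injective (trans (sym (proj₁ (cap-z₂ e nz))) (trans (sym q) gv≡)))
            rz : R v ≡ 0
            rz = trans (cong R (sym e₂≡v)) (proj₁ (proj₂ (proj₂ off)))

      R'< : ∀ v → R' v < 2 ^ K
      R'< v = aux (G v ≡ᵇ suc (nid (s v)))
        where
        aux : ∀ b → (if b then t else R v) < 2 ^ K
        aux true = t<
        aux false = R< v

      state : ∀ v → s' v ≡ record (s v) { rk = R' v }
      state v = trans (result v) (set-ok (λ m a → record m { rk = a }) (λ _ _ → refl) (capped v) (R'< v))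

      step' : MergeStep t x R (λ v → rk (s' v))
      step' = record
        { Y = Y
        ; ub = λ v u sg → subst (_≤ Y v) (key≡ u) (Y-ub v u (seg-comp sg))
        ; at' = λ v ne → let (u , c , q) = Y-at v in u , comp-seg ne c , trans q (key≡ u)
        ; merged = λ v p a b c d → trans (cong rk (state v)) (merged v p a b c d)
        ; change = λ v → subst (λ r → r ≡ R v ⊎ (r ≡ t × R v ≡ 0 × ∃ λ p → Cond v p)) (sym (cong rk (state v))) (change v) }

      base' : Base s'
      base' = record
        { capped = λ v → subst (λ m → capM K m ≡ m) (sym (state v)) (set-ok (λ m a → record m { rk = a }) (λ _ _ → refl) (capped v) (R'< v))
        ; legs = λ v → trans (cong leg (state v)) (legs v) ; ids = λ v → trans (cong nid (state v)) (ids v) }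

    merge-run : ∀ xs t {s s'} → (∀ v → suc (ident v) < 2 ^ K) → length xs + t < 2 ^ K → Base s → Run K (mergeProg t xs) s s' →
      Base s' × MRun t xs (λ v → rk (s v)) (λ v → rk (s' v)) × (∀ v → s' v ≡ record (s v) { rk = rk (s' v) })
    merge-run [] t small lt b [] = b , [] , λ v → refl
    merge-run (x ∷ xs) t {s} {s'} small lt b (sem ∷ r) =
      let (b' , mr , eq) = merge-run xs (suc t) small (subst (_< 2 ^ K) (sym (+-suc (length xs) t)) lt) base' r
      in b' , step' ∷ mr , λ v → trans (eq v) (cong (λ m → record m { rk = rk (s' v) }) (state v))
      where
      open Merge x (suc t) (≤-<-trans (s≤s (m≤n+m t (length xs))) lt) small b sem

    -- Suffix sums along a leg.

    module Suffix (T : ℕ) (R : Fin n → ℕ) (rkd : Ranked T R) (lab V : Fin n → ℕ)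
      (conv : ∀ u v x → LEG u ≡ LEG v → LEG u ≢ 0 → LEG x ≡ LEG u → POS u ≤ POS x → POS x ≤ POS v → lab u ≡ lab v → lab x ≡ lab u)
      (V< : ∑ V < 2 ^ K) where

      -- The edges already contracted at step `t`: smaller rank, and both ends in one class of
      -- `lab`, so that sums never leave a class.
      Q : ℕ → Fin n → Set
      Q t x = R x < t × (∀ p → Par x p → lab p ≡ lab x)

      dec-Q : ∀ t x → Dec (Q t x)
      dec-Q t x = (R x <? t) ×-dec F.all? (λ p → ((LEG x ≟ LEG p) ×-dec (¬? (LEG x ≟ 0) ×-dec (POS p ≟ suc (POS x)))) →-dec (lab p ≟ lab x))

      ind : ℕ → Fin n → Fin n → Bool
      ind t v u = does (dec-Seg {Q t} (dec-Q t) v u ×-dec (POS u ≤? POS v))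

      ind⇔ : ∀ t v u → (Seg (Q t) v u × POS u ≤ POS v) ⇔ (ind t v u ≡ true)
      ind⇔ t v u = does⇔ (dec-Seg {Q t} (dec-Q t) v u ×-dec (POS u ≤? POS v))

      Q-suc : ∀ t x → Q t x → Q (suc t) x
      Q-suc t x (a , b) = m≤n⇒m≤1+n a , b

      seg-suc : ∀ {t u v} → Seg (Q t) u v → Seg (Q (suc t)) u v
      seg-suc {t} = seg-mono {Q t} {Q (suc t)} (Q-suc t)

      no-rank-0 : ∀ {u v} → Seg (Q 1) u v → POS u < POS v → ⊥
      no-rank-0 {u} {v} (l , ne , f) lt = let (p , pr) = parent-below l ne lt in
        Ranked.positive rkd u p pr (n<1⇒n≡0 (proj₁ (f u refl (inj₁ (≤-refl , lt)))))

      ind-1 : ∀ v → LEG v ≢ 0 → ∑ (λ u → ind 1 v u ▷ V u) ≡ V v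
      ind-1 v ne = trans (∑-point v other) (cong (_▷ V v) (to (ind⇔ 1 v v) (seg-refl {Q 1} v ne , ≤-refl)))
        where
        other : ∀ u → u ≢ v → (ind 1 v u ▷ V u) ≡ 0
        other u u≢v = cong (_▷ V u) (¬true⇒false λ p → bad (from (ind⇔ 1 v u) p))
          where
          bad : Seg (Q 1) v u × POS u ≤ POS v → ⊥
          bad (sg , le) with m≤n⇒m<n∨m≡n le
          ... | inj₁ lt = no-rank-0 (seg-sym {Q 1} sg) lt
          ... | inj₂ eq = u≢v (POS-inj u v (sym (proj₁ sg)) eq)

      same-lab : ∀ {t u v} → POS u ≤ POS v → Seg (Q t) u v → lab v ≡ lab u
      same-lab {t} {u} {v} le (l , ne , f) = climb (λ y → lab y ≡ lab u) l ne le
        (λ x p pr lx a b eq → trans (proj₂ (f x lx (inj₁ (a , b))) p pr) eq) refl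

      -- No rank exceeds `T`, so in the end only labels limit a segment; as the classes of `lab` are
      -- intervals, the segment is the entire class.
      ind-T : ∀ v → LEG v ≢ 0 → ∀ u → ind (suc T) v u ≡ (LEG u ≡ᵇ LEG v) ∧ ((lab u ≡ᵇ lab v) ∧ (POS u ≤ᵇ POS v))
      ind-T v ne u = true-ext f g
        where
        f : ind (suc T) v u ≡ true → (LEG u ≡ᵇ LEG v) ∧ ((lab u ≡ᵇ lab v) ∧ (POS u ≤ᵇ POS v)) ≡ true
        f p = let (sg , le) = from (ind⇔ (suc T) v u) p in
          cong₂ _∧_ (≡ᵇ-true (sym (proj₁ sg))) (cong₂ _∧_ (≡ᵇ-true (sym (same-lab {suc T} le (seg-sym {Q (suc T)} sg)))) (≤ᵇ-true le))
        g : (LEG u ≡ᵇ LEG v) ∧ ((lab u ≡ᵇ lab v) ∧ (POS u ≤ᵇ POS v)) ≡ true → ind (suc T) v u ≡ true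
        g p = to (ind⇔ (suc T) v u) (seg-sym {Q (suc T)} (l , u≢0 , inner) , le)
          where
          l : LEG u ≡ LEG v
          l = ≡ᵇ-sound (proj₁ (∧-true {LEG u ≡ᵇ LEG v} p))
          lb : lab u ≡ lab v
          lb = ≡ᵇ-sound (proj₁ (∧-true {lab u ≡ᵇ lab v} (proj₂ (∧-true {LEG u ≡ᵇ LEG v} p))))
          le : POS u ≤ POS v
          le = ≤ᵇ-sound (proj₂ (∧-true {lab u ≡ᵇ lab v} (proj₂ (∧-true {LEG u ≡ᵇ LEG v} p))))
          u≢0 : LEG u ≢ 0
          u≢0 z = ne (trans (sym l) z)
          inner : ∀ x → LEG x ≡ LEG u → Between u v x → Q (suc T) x
          inner x lx (inj₂ (a , b)) = ⊥-elim (<-irrefl refl (≤-<-trans a (<-≤-trans b le)))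
          inner x lx (inj₁ (a , b)) = s≤s (Ranked.bound rkd x) , λ p pr →
            trans (conv u v p l u≢0 (trans (sym (proj₁ pr)) lx) (≤-trans a (≤-trans (n≤1+n _) (≤-reflexive (sym (proj₂ (proj₂ pr)))))) (≤-trans (≤-reflexive (proj₂ (proj₂ pr))) b) lb)
                  (sym (conv u v x l u≢0 lx a (<⇒≤ b) lb))

      record Acc (t : ℕ) (s₀ s : State) : Set where
        field
          A : Fin n → ℕ
          shape : ∀ v → s v ≡ record (s₀ v) { acc = A v }
          total : ∀ v → LEG v ≢ 0 → A v ≡ ∑ (λ u → ind t v u ▷ V u)
          capd : Capped s

      record Start (s : State) : Set where
        field
          basis : Base s
          ranks : ∀ v → rk (s v) ≡ R v
          labs : ∀ v → bP (s v) ≡ lab v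
          vals : ∀ v → val (s v) ≡ V v

      part< : ∀ (χ : Fin n → Bool) → ∑ (λ u → χ u ▷ V u) < 2 ^ K
      part< χ = ≤-<-trans (∑-▷≤ χ V) V<

      module SufStep (t : ℕ) {s₀ s s' : State} (st : Start s₀) (ac : Acc t s₀ s) (sem : SumSem K (sufI t) s s') where
        open Start st
        open Base basis
        open Acc ac
        open SumSem sem

        legs' : ∀ v → leg (s v) ≡ LEG v
        legs' v = trans (cong leg (shape v)) (legs v)
        ranks' : ∀ v → rk (s v) ≡ R v
        ranks' v = trans (cong rk (shape v)) (ranks v)
        labs' : ∀ v → bP (s v) ≡ lab v
        labs' v = trans (cong bP (shape v)) (labs v)
        vals' : ∀ v → val (s v) ≡ V v
        vals' v = trans (cong val (shape v)) (vals v)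

        lab-edge : ∀ e → IsTree e → LEG (e₁ e) ≢ 0 → (∀ p → Par (e₂ e) p → lab p ≡ lab (e₂ e)) ⇔ (lab (e₁ e) ≡ lab (e₂ e))
        lab-edge e te ne = mk⇔ (λ f → f (e₁ e) (par-of e te ne)) (λ q p pr → trans (cong lab (par-unique pr (par-of e te ne))) q)

        contracted→ : ∀ e → Contracted (sufI t) s e → IsTree e × LEG (e₁ e) ≢ 0 × Q t (e₂ e)
        contracted→ e c = let (te , ne , b) = legTree→ s legs' e c; (p , q) = ∧-true {suc (rk (s (e₂ e))) ≤ᵇ t} b in
          te , ne , subst (_< t) (ranks' (e₂ e)) (≤ᵇ-sound p) ,
          from (lab-edge e te ne) (trans (sym (labs' (e₁ e))) (trans (≡ᵇ-sound q) (labs' (e₂ e))))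

        open Components (sufI t) s (Q t) contracted→
          (λ e te ne q → legTree← s legs' e te ne (cong₂ _∧_ (≤ᵇ-true (subst (_< t) (sym (ranks' (e₂ e))) (proj₁ q)))
            (≡ᵇ-true (trans (labs' (e₁ e)) (trans (to (lab-edge e te ne) (proj₂ q)) (sym (labs' (e₂ e))))))))

        sameS : ∀ u v → LEG u ≢ 0 → (same u v ≡ true) ⇔ Seg (Q t) u v
        sameS u v ne = mk⇔ (λ p → comp-seg ne (to (same⇔ u v) p)) (λ p → from (same⇔ u v) (seg-comp p))

        Y≡ : ∀ v → Y v ≡ ∑ (λ u → same v u ▷ V u)
        Y≡ v = trans (cong (cap K) (∑-cong (λ u → cong (λ x → same v u ▷ cap K x) (vals' u)))) (cap-sum (same v) V (part< (same v)))

        cond : Fin m → Bool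
        cond e = legTree (tree e) (s (e₁ e)) ∧ ((rk (s (e₂ e)) ≡ᵇ t) ∧ (bP (s (e₁ e)) ≡ᵇ bP (s (e₂ e))))

        gate : Fin n → Fin m → Bool
        gate v e = (not (same (e₁ e) (e₂ e)) ∧ same v (e₁ e)) ∧ cond e

        record Open (v : Fin n) (e : Fin m) : Set where
          field
            te : IsTree e
            pr : Par (e₂ e) (e₁ e)
            rt : R (e₂ e) ≡ t
            lb : lab (e₁ e) ≡ lab (e₂ e)
            sg : Seg (Q t) v (e₁ e)

        gate→ : ∀ v e → LEG v ≢ 0 → gate v e ≡ true → Open v e
        gate→ v e ne g = record { te = te ; pr = par-of e te l ; rt = trans (sym (ranks' (e₂ e))) (≡ᵇ-sound r)
            ; lb = trans (sym (labs' (e₁ e))) (trans (≡ᵇ-sound q) (labs' (e₂ e))) ; sg = to (sameS v (e₁ e) ne) sm }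
          where
          g₁ = ∧-true {not (same (e₁ e) (e₂ e)) ∧ same v (e₁ e)} g
          sm = proj₂ (∧-true {not (same (e₁ e) (e₂ e))} (proj₁ g₁))
          c = legTree→ s legs' e (proj₂ g₁)
          te = proj₁ c
          l = proj₁ (proj₂ c)
          r = proj₁ (∧-true {rk (s (e₂ e)) ≡ᵇ t} (proj₂ (proj₂ c)))
          q = proj₂ (∧-true {rk (s (e₂ e)) ≡ᵇ t} (proj₂ (proj₂ c)))

        gate← : ∀ v e → LEG v ≢ 0 → Open v e → gate v e ≡ true
        gate← v e ne o = cong₂ _∧_ (cong₂ _∧_ (¬true-not apart) (from (sameS v (e₁ e) ne) sg))
            (legTree← s legs' e te l (cong₂ _∧_ (≡ᵇ-true (trans (ranks' (e₂ e)) rt)) (≡ᵇ-true (trans (labs' (e₁ e)) (trans lb (sym (labs' (e₂ e))))))))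
          where
          open Open o
          l : LEG (e₁ e) ≢ 0
          l z = proj₁ (proj₂ pr) (trans (proj₁ pr) z)
          apart : ¬ (same (e₁ e) (e₂ e) ≡ true)
          apart p = <-irrefl rt (proj₁ (proj₂ (proj₂ (to (sameS (e₁ e) (e₂ e) l) p)) (e₂ e) (proj₁ pr) (inj₂ (≤-refl , ≤-reflexive (sym (proj₂ (proj₂ pr)))))))

        -- an open edge for v separates v from the segment hanging below its lower end
        record Geometry (v u : Fin n) (y : Fin n) : Set where
          field
            u≤y : POS u ≤ POS y
            y<v : POS y < POS v
            ly : LEG y ≡ LEG v
            sg' : Seg (Q (suc t)) v u

        geometry : ∀ {v u e} → LEG v ≢ 0 → Open v e → Seg (Q t) (e₂ e) u → Geometry v u (e₂ e)
        geometry {v} {u} {e} ne o sy = record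
          { u≤y = ≮⇒≥ λ lt → <-irrefl rt (proj₁ (proj₂ (proj₂ sy) (e₂ e) refl (inj₁ (≤-refl , lt))))
          ; y<v = ≰⇒> λ le → <-irrefl rt (proj₁ (proj₂ (proj₂ sg) (e₂ e) ly (inj₁ (le , ≤-reflexive (sym (proj₂ (proj₂ pr)))))))
          ; ly = ly
          ; sg' = seg-trans {Q (suc t)} (seg-suc sg) (seg-trans {Q (suc t)}
              (seg-sym {Q (suc t)} (par-seg {Q (suc t)} pr (s≤s (≤-reflexive rt) , λ p pr' → trans (cong lab (par-unique pr' pr)) lb))) (seg-suc sy)) }
          where
          open Open o
          ly : LEG (e₂ e) ≡ LEG v
          ly = trans (proj₁ pr) (sym (proj₁ sg))

        -- Two edges of rank `t` have an edge of larger rank between them, which cannot belong to a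
        -- segment of ranks at most `t`.
        unique-y : ∀ {v u y y'} → Seg (Q (suc t)) v u → LEG y ≡ LEG v → LEG y' ≡ LEG v → POS u ≤ POS y → POS y < POS v → POS u ≤ POS y' → POS y' < POS v →
          R y ≡ t → R y' ≡ t → POS y < POS y' → ⊥
        unique-y {v} {u} {y} {y'} (l , ne , f) ly ly' a b a' b' ry ry' lt =
          let y≢0 = λ z → ne (trans (sym ly) z)
              (p , pr) = parent-below ly y≢0 b
              (x , lx , c , d , big) = Ranked.rank rkd y y' (trans ly (sym ly')) y≢0 lt (trans ry (sym ry')) (Ranked.positive rkd y p pr)
          in <-irrefl refl (<-≤-trans (subst (_< R x) ry big) (≤-pred (proj₁ (f x (trans lx ly) (inj₂ (≤-trans a (<⇒≤ c) , <-trans d b'))))))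

        -- A segment for `suc t` contains at most one edge of rank `t`. The part of the leg that
        -- becomes visible from `v` is thus a single old segment, reached through a single open
        -- edge, and nothing is counted twice.
        gain : ∀ v → LEG v ≢ 0 → ∀ u → (ind (suc t) v u ▷ V u) ≡ (ind t v u ▷ V u) + ∑ (λ e → gate v e ▷ (same (e₂ e) u ▷ V u))
        gain v ne u = cases (ind t v u) (ind (suc t) v u) refl refl
          where
          contributes : ∀ e → (gate v e ▷ (same (e₂ e) u ▷ V u)) ≢ 0 → Open v e × Seg (Q t) (e₂ e) u
          contributes e nz = aux (gate v e) (same (e₂ e) u) refl refl
            where
            aux : ∀ a b → gate v e ≡ a → same (e₂ e) u ≡ b → Open v e × Seg (Q t) (e₂ e) u
            aux true true p q = let o = gate→ v e ne p in o , to (sameS (e₂ e) u (proj₁ (proj₂ (Open.pr o)))) q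
            aux false b p q = ⊥-elim (nz (cong (_▷ (same (e₂ e) u ▷ V u)) p))
            aux true false p q = ⊥-elim (nz (trans (cong (_▷ (same (e₂ e) u ▷ V u)) p) (cong (_▷ V u) q)))
          none-zero : ((e : Fin m) → Open v e → Seg (Q t) (e₂ e) u → ⊥) → ∑ (λ e → gate v e ▷ (same (e₂ e) u ▷ V u)) ≡ 0
          none-zero h = ∑-zero (λ e → decide e ((gate v e ▷ (same (e₂ e) u ▷ V u)) ≟ 0))
            where
            decide : ∀ e → Dec ((gate v e ▷ (same (e₂ e) u ▷ V u)) ≡ 0) → (gate v e ▷ (same (e₂ e) u ▷ V u)) ≡ 0
            decide e (yes p) = p
            decide e (no p) = let (o , sg) = contributes e p in ⊥-elim (h e o sg)
          cases : ∀ a b → ind t v u ≡ a → ind (suc t) v u ≡ b → (ind (suc t) v u ▷ V u) ≡ (ind t v u ▷ V u) + ∑ (λ e → gate v e ▷ (same (e₂ e) u ▷ V u))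
          cases true b p q = trans (cong (_▷ V u) (trans now (sym p))) (sym (trans (cong ((ind t v u ▷ V u) +_) (none-zero clash)) (+-identityʳ _)))
            where
            old : Seg (Q t) v u × POS u ≤ POS v
            old = from (ind⇔ t v u) p
            now : ind (suc t) v u ≡ true
            now = to (ind⇔ (suc t) v u) (seg-suc (proj₁ old) , proj₂ old)
            clash : (e : Fin m) → Open v e → Seg (Q t) (e₂ e) u → ⊥
            clash e o sy = let open Geometry (geometry ne o sy) in
              <-irrefl (Open.rt o) (proj₁ (proj₂ (proj₂ (proj₁ old)) (e₂ e) ly (inj₂ (u≤y , y<v))))
          cases false false p q = trans (cong (_▷ V u) q) (sym (trans (cong₂ _+_ (cong (_▷ V u) p) (none-zero clash)) refl))
            where
            clash : (e : Fin m) → Open v e → Seg (Q t) (e₂ e) u → ⊥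
            clash e o sy = let open Geometry (geometry ne o sy) in
              case trans (sym q) (to (ind⇔ (suc t) v u) (sg' , ≤-trans u≤y (<⇒≤ y<v))) of λ ()
          cases false true p q = trans (cong (_▷ V u) q) (sym (trans (cong (λ b → (b ▷ V u) + ∑ (λ e → gate v e ▷ (same (e₂ e) u ▷ V u))) p)
              (trans (∑-point e other) (cong₂ (λ a b → a ▷ (b ▷ V u)) (gate← v e ne o) (from (sameS (e₂ e) u (proj₁ (proj₂ pr'))) sy)))))
            where
            new : Seg (Q (suc t)) v u × POS u ≤ POS v
            new = from (ind⇔ (suc t) v u) q
            sgn = proj₁ new
            inside : ∀ x → LEG x ≡ LEG v → POS u ≤ POS x → POS x < POS v → Q (suc t) x
            inside x lx a b = proj₂ (proj₂ sgn) x lx (inj₂ (a , b))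
            -- If no edge of rank `t` lay between `u` and `v`, then `u` would have been counted
            -- before.
            splitter : ∃ λ y → LEG y ≡ LEG v × POS u ≤ POS y × POS y < POS v × R y ≡ t
            splitter with F.any? (λ y → (LEG y ≟ LEG v) ×-dec ((POS u ≤? POS y) ×-dec ((POS y <? POS v) ×-dec (R y ≟ t))))
            ... | yes r = r
            ... | no none' = case trans (sym p) (to (ind⇔ t v u) ((proj₁ sgn , ne , inner) , proj₂ new)) of λ ()
              where
              inner : ∀ x → LEG x ≡ LEG v → Between v u x → Q t x
              inner x lx (inj₁ (a , b)) = ⊥-elim (<-irrefl refl (≤-<-trans a (<-≤-trans b (proj₂ new))))
              inner x lx (inj₂ (a , b)) = ≤∧≢⇒< (≤-pred (proj₁ (inside x lx a b))) (λ r → none' (x , lx , a , b , r)) , proj₂ (inside x lx a b)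
            y = proj₁ splitter
            ly : LEG y ≡ LEG v
            ly = proj₁ (proj₂ splitter)
            u≤y : POS u ≤ POS y
            u≤y = proj₁ (proj₂ (proj₂ splitter))
            y<v : POS y < POS v
            y<v = proj₁ (proj₂ (proj₂ (proj₂ splitter)))
            ry : R y ≡ t
            ry = proj₂ (proj₂ (proj₂ (proj₂ splitter)))
            y≢0 : LEG y ≢ 0
            y≢0 z = ne (trans (sym ly) z)
            par : ∃ λ p → Par y p
            par = parent-below ly y≢0 y<v
            eo : ∃ λ e → IsTree e × e₂ e ≡ y × e₁ e ≡ proj₁ par
            eo = edge-of (proj₂ par)
            e = proj₁ eo
            e₂≡ : e₂ e ≡ y
            e₂≡ = proj₁ (proj₂ (proj₂ eo))
            e₁≡ : e₁ e ≡ proj₁ par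
            e₁≡ = proj₂ (proj₂ (proj₂ eo))
            pr' : Par (e₂ e) (e₁ e)
            pr' = subst₂ Par (sym e₂≡) (sym e₁≡) (proj₂ par)
            rest : ∀ x → LEG x ≡ LEG v → POS u ≤ POS x → POS x < POS v → POS x ≢ POS y → Q t x
            rest x lx a b x≢y = ≤∧≢⇒< (≤-pred (proj₁ (inside x lx a b))) differ , proj₂ (inside x lx a b)
              where
              differ : R x ≢ t
              differ r with <-cmp (POS x) (POS y)
              ... | tri< l _ _ = unique-y sgn lx ly a b u≤y y<v r ry l
              ... | tri≈ _ eq _ = x≢y eq
              ... | tri> _ _ l = unique-y sgn ly lx u≤y y<v a b ry r l
            py : POS (e₁ e) ≡ suc (POS y)
            py = trans (proj₂ (proj₂ pr')) (cong (suc ∘ POS) e₂≡)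
            o : Open v e
            o = record { te = proj₁ (proj₂ eo) ; pr = pr' ; rt = trans (cong R e₂≡) ry
                       ; lb = proj₂ (subst (Q (suc t)) (sym e₂≡) (inside y ly u≤y y<v)) (e₁ e) pr'
                       ; sg = trans (sym ly) (trans (cong LEG (sym e₂≡)) (proj₁ pr')) , ne , upper }
              where
              upper : ∀ x → LEG x ≡ LEG v → Between v (e₁ e) x → Q t x
              upper x lx (inj₁ (a , b)) = ⊥-elim (<-irrefl refl (<-≤-trans b (≤-trans (≤-reflexive py) (≤-trans y<v a))))
              upper x lx (inj₂ (a , b)) = rest x lx (≤-trans u≤y (<⇒≤ y<x)) b (λ q → <-irrefl (sym q) y<x)
                where
                y<x : POS y < POS x
                y<x = ≤-trans (≤-reflexive (sym py)) a
            sy : Seg (Q t) (e₂ e) u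
            sy = subst (λ z → Seg (Q t) z u) (sym e₂≡) (trans ly (proj₁ sgn) , y≢0 , lower)
              where
              lower : ∀ x → LEG x ≡ LEG y → Between y u x → Q t x
              lower x lx (inj₁ (a , b)) = ⊥-elim (<-irrefl refl (≤-<-trans a (<-≤-trans b u≤y)))
              lower x lx (inj₂ (a , b)) = rest x (trans lx ly) a (<-trans b y<v) (λ q → <-irrefl q b)
            other : ∀ e' → e' ≢ e → (gate v e' ▷ (same (e₂ e') u ▷ V u)) ≡ 0
            other e' e'≢e with (gate v e' ▷ (same (e₂ e') u ▷ V u)) ≟ 0
            ... | yes z = z
            ... | no nz = ⊥-elim (e'≢e (up-unique e' e (Open.te o') (proj₁ (proj₂ eo)) (trans same-y (sym e₂≡))))
              where
              oo = contributes e' nz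
              o' = proj₁ oo
              open Geometry (geometry ne o' (proj₂ oo)) renaming (u≤y to u≤y'; y<v to y<v'; ly to ly')
              same-y : e₂ e' ≡ y
              same-y with <-cmp (POS (e₂ e')) (POS y)
              ... | tri< l _ _ = ⊥-elim (unique-y sgn ly' ly u≤y' y<v' u≤y y<v (Open.rt o') ry l)
              ... | tri≈ _ eq _ = POS-inj _ _ (trans ly' (sym ly)) eq
              ... | tri> _ _ l = ⊥-elim (unique-y sgn ly ly' u≤y y<v u≤y' y<v' ry (Open.rt o') l)

        G≡ : ∀ v → G v ≡ cap K (∑ (λ e → gate v e ▷ ∑ (λ u → same (e₂ e) u ▷ V u)))
        G≡ v = cong (cap K) (∑-cong pt)
          where
          sep : ∀ a b k → k < 2 ^ K → (a ▷ cap K (b ▷ k)) ≡ (a ∧ b ▷ k)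
          sep false b k lt = refl
          sep true true k lt = cap-id K lt
          sep true false k lt = refl
          ▷-0 : ∀ b → (b ▷ cap K 0) ≡ 0
          ▷-0 true = refl
          ▷-0 false = refl
          pt : ∀ e → (not (same (e₁ e) (e₂ e)) ∧ same v (e₁ e) ▷ cap K (cond e ▷ Y (e₂ e))) + (not (same (e₁ e) (e₂ e)) ∧ same v (e₂ e) ▷ cap K 0)
            ≡ (gate v e ▷ ∑ (λ u → same (e₂ e) u ▷ V u))
          pt e = trans (cong₂ _+_ (sep (not (same (e₁ e) (e₂ e)) ∧ same v (e₁ e)) (cond e) (Y (e₂ e)) (subst (_< 2 ^ K) (sym (Y≡ (e₂ e))) (part< (same (e₂ e)))))
              (▷-0 (not (same (e₁ e) (e₂ e)) ∧ same v (e₂ e)))) (trans (+-identityʳ _) (cong (gate v e ▷_) (Y≡ (e₂ e))))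

        Σgates : ∀ v → ∑ (λ e → gate v e ▷ ∑ (λ u → same (e₂ e) u ▷ V u)) ≡ ∑ (λ u → ∑ (λ e → gate v e ▷ (same (e₂ e) u ▷ V u)))
        Σgates v = trans (∑-cong (λ e → push (gate v e) (λ u → same (e₂ e) u ▷ V u))) (∑-swap (λ e u → gate v e ▷ (same (e₂ e) u ▷ V u)))
          where
          push : ∀ b (f : Fin n → ℕ) → (b ▷ ∑ f) ≡ ∑ (λ u → b ▷ f u)
          push true f = refl
          push false f = sym (∑-zero {n} {λ _ → 0} (λ _ → refl))

        A' : Fin n → ℕ
        A' v = cap K (A v + G v)

        acc' : Acc (suc t) s₀ s'
        acc' = record { A = A' ; shape = shape' ; total = total' ; capd = capped-by result }
          where
          shape' : ∀ v → s' v ≡ record (s₀ v) { acc = A' v }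
          shape' v = trans (result v) (trans (cong (λ m → capM K (record m { acc = acc m + G v })) (shape v)) (cong (λ m → record m { acc = A' v }) (capped v)))
          total' : ∀ v → LEG v ≢ 0 → A' v ≡ ∑ (λ u → ind (suc t) v u ▷ V u)
          total' v ne = trans (cong (cap K) sum≡) (cap-id K (part< (ind (suc t) v)))
            where
            open ≡-Reasoning
            D : Fin n → ℕ
            D u = ∑ (λ e → gate v e ▷ (same (e₂ e) u ▷ V u))
            D-sum : ∑ (λ u → ind (suc t) v u ▷ V u) ≡ ∑ (λ u → ind t v u ▷ V u) + ∑ D
            D-sum = trans (∑-cong (gain v ne)) (∑-+ (λ u → ind t v u ▷ V u) D)
            D< : ∑ D < 2 ^ K
            D< = ≤-<-trans (subst (∑ D ≤_) (sym D-sum) (m≤n+m (∑ D) _)) (part< (ind (suc t) v))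
            sum≡ : A v + G v ≡ ∑ (λ u → ind (suc t) v u ▷ V u)
            sum≡ = begin
              A v + G v ≡⟨ cong₂ _+_ (total v ne) (trans (G≡ v) (cong (cap K) (Σgates v))) ⟩
              ∑ (λ u → ind t v u ▷ V u) + cap K (∑ D) ≡⟨ cong (∑ (λ u → ind t v u ▷ V u) +_) (cap-id K D<) ⟩
              ∑ (λ u → ind t v u ▷ V u) + ∑ D ≡⟨ sym D-sum ⟩
              ∑ (λ u → ind (suc t) v u ▷ V u) ∎

      suf-run : ∀ k t {s₀ s s'} → Start s₀ → Acc t s₀ s → Run K (sufSteps t k) s s' → Acc (k + t) s₀ s'
      suf-run zero t st ac [] = ac
      suf-run (suc k) t {s₀} {s' = s'} st ac (sem ∷ r) = subst (λ x → Acc x s₀ s') (+-suc k t) (suf-run k (suc t) st (SufStep.acc' t st ac sem) r)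

      Suf : Fin n → ℕ
      Suf v = ∑ (λ u → (LEG u ≡ᵇ LEG v) ∧ ((lab u ≡ᵇ lab v) ∧ (POS u ≤ᵇ POS v)) ▷ V u)

      suffix : ∀ {s s'} → Start s → Run K (sufProg T) s s' →
        Capped s' × Σ (Fin n → ℕ) λ A → (∀ v → s' v ≡ record (s v) { acc = A v }) × (∀ v → LEG v ≢ 0 → A v ≡ Suf v)
      suffix {s} {s'} st (loc ∷ r) = Acc.capd fin , Acc.A fin , Acc.shape fin , λ v ne →
          trans (Acc.total fin v ne) (∑-cong (λ u → cong (_▷ V u) (trans (cong (λ k → ind k v u) (+-comm T 1)) (ind-T v ne u))))
        where
        open Start st
        vs< : ∀ v → val (s v) < 2 ^ K
        vs< v = subst (_< 2 ^ K) (cong val (Base.capped basis v)) (cap< K (val (s v)))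
        init : Acc 1 s _
        init = record { A = λ v → val (s v)
          ; shape = λ v → trans (local-spec {λ m → record m { acc = val m }} loc v) (set-ok (λ m a → record m { acc = a }) (λ _ _ → refl) (Base.capped basis v) (vs< v))
          ; total = λ v ne → trans (vals v) (sym (ind-1 v ne))
          ; capd = capped-by (local-spec {λ m → record m { acc = val m }} loc) }
        fin : Acc (T + 1) s s'
        fin = suf-run T 1 st init r

    -- Numbering the legs.

    module FindLegs (2<K : 2 < 2 ^ K) (small : ∀ v → ident v < 2 ^ K) (v₁ : Fin n) (v₁≢0 : LEG v₁ ≢ 0) where

      capped₀ : ∀ v → capM K (mem₀ (ident v)) ≡ mem₀ (ident v)
      capped₀ v = cong mem₀ (cap-id K (small v))

      module _ {s₀ s₁ s₂ s₃ : State} (st₀ : ∀ v → s₀ v ≡ capM K (mem₀ (ident v)))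
        (sem₁ : MaxSem K rootI s₀ s₁) (sem₂ : MaxSem K legI s₁ s₂) (sem₃ : MaxSem K sideI s₂ s₃) where

        1<K : 1 < 2 ^ K
        1<K = <-trans (s≤s (s≤s z≤n)) 2<K

        module S₁ = MaxSem sem₁

        comp₁ : ∀ {u v} → Comp rootI s₀ u v → u ≡ v
        comp₁ = quiet-comp {rootI} {s₀} (λ _ _ _ _ → refl)

        g-leg : ∀ v → LEG v ≢ 0 → S₁.G v ≡ 1
        g-leg v ne = ≤-antisym upper lower
          where
          e = proj₁ (up v ne)
          te = proj₁ (proj₂ (up v ne))
          lower : 1 ≤ S₁.G v
          lower = subst (_≤ S₁.G v) (trans (cong (λ b → cap K (b ▷ 1)) te) (cap-id K 1<K))
            (S₁.G-ub₂ v e (λ c → loopfree e (comp₁ c)) (subst (Comp rootI s₀ v) (sym (proj₂ (proj₂ (up v ne)))) ε))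
          flag : ∀ b → cap K (b ▷ 1) ≤ 1
          flag true = ≤-reflexive (cap-id K 1<K)
          flag false = z≤n
          upper : S₁.G v ≤ 1
          upper with S₁.G-at v
          ... | inj₁ z = ≤-trans (≤-reflexive z) z≤n
          ... | inj₂ (e' , _ , inj₁ (_ , q)) = ≤-trans (≤-reflexive q) z≤n
          ... | inj₂ (e' , _ , inj₂ (_ , q)) = ≤-trans (≤-reflexive q) (flag (tree e'))

        g-root : ∀ v → LEG v ≡ 0 → S₁.G v ≡ 0
        g-root v z with S₁.G-at v
        ... | inj₁ q = q
        ... | inj₂ (e , _ , inj₁ (_ , q)) = q
        ... | inj₂ (e , _ , inj₂ (c , q)) = trans q (cong (λ b → cap K (b ▷ 1)) (¬true⇒false (λ te → tree-child e te (trans (cong LEG (sym (comp₁ c))) z))))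

        g< : ∀ v → S₁.G v < 2 ^ K
        g< v with LEG v ≟ 0
        ... | yes z = subst (_< 2 ^ K) (sym (g-root v z)) (1≤2^ K)
        ... | no ne = subst (_< 2 ^ K) (sym (g-leg v ne)) 1<K

        state₁ : ∀ v → s₁ v ≡ record (mem₀ (ident v)) { leg = S₁.G v }
        state₁ v = trans (S₁.result v) (trans (cong (λ m → capM K (record m { leg = S₁.G v })) (trans (st₀ v) (capped₀ v)))
          (set-ok (λ m a → record m { leg = a }) (λ _ _ → refl) (capped₀ v) (g< v)))

        leg₁ : ∀ v → leg (s₁ v) ≡ S₁.G v
        leg₁ v = cong leg (state₁ v)

        contracted→ : ∀ e → Contracted legI s₁ e → IsTree e × LEG (e₁ e) ≢ 0 × ⊤
        contracted→ e c = let (a , b) = ∧-true {tree e} c in a , (λ z → nonzero-sound b (trans (leg₁ (e₁ e)) (g-root (e₁ e) z))) , tt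

        open Components legI s₁ (λ _ → ⊤) contracted→
          (λ e te ne _ → cong₂ _∧_ te (nonzero-true (λ z → case trans (sym (g-leg (e₁ e) ne)) (trans (sym (leg₁ (e₁ e))) z) of λ ())))

        spec₂ : MaxSpec legI s₁ (λ m y → record m { tmp = y }) s₂
        spec₂ = max-spec {λ w tr a b → legTree tr a} sem₂ (λ v → subst (_< 2 ^ K) (sym (cong nid (state₁ v))) (small v))
        module S₂ = MaxSpec spec₂

        τ : Fin n → ℕ
        τ = S₂.Y

        τ-at : ∀ v → LEG v ≢ 0 → ∃ λ u → LEG u ≡ LEG v × τ v ≡ ident u
        τ-at v ne = let (u , c , q) = S₂.at' v in u , sym (proj₁ (comp-seg ne c)) , trans q (cong nid (state₁ u))

        τ≤ : ∀ u v → LEG u ≡ LEG v → LEG u ≢ 0 → τ u ≤ τ v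
        τ≤ u v l ne = let (x , lx , q) = τ-at u ne in
          subst (_≤ τ v) (sym (trans q (sym (cong nid (state₁ x))))) (S₂.ub v x (seg-comp (trans (sym l) (sym lx) , (λ z → ne (trans l z)) , λ _ _ _ → tt)))

        τ-const : ∀ u v → LEG u ≡ LEG v → LEG u ≢ 0 → τ u ≡ τ v
        τ-const u v l ne = ≤-antisym (τ≤ u v l ne) (τ≤ v u (sym l) (λ z → ne (trans l z)))

        τ-inj : ∀ u v → LEG u ≢ 0 → LEG v ≢ 0 → τ u ≡ τ v → LEG u ≡ LEG v
        τ-inj u v nu nv eq = let (x , lx , q) = τ-at u nu; (y , ly , q') = τ-at v nv in
          trans (sym lx) (trans (cong LEG (ident-inj (trans (sym q) (trans eq q')))) ly)

        τ< : ∀ v → τ v < 2 ^ K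
        τ< v = let (u , _ , q) = S₂.at' v in subst (_< 2 ^ K) (sym (trans q (cong nid (state₁ u)))) (small u)

        state₂ : ∀ v → s₂ v ≡ record (mem₀ (ident v)) { leg = S₁.G v ; tmp = τ v }
        state₂ v = trans (S₂.res v) (trans (cong (λ m → capM K (record m { tmp = τ v })) (state₁ v))
          (trans (set-ok (λ m a → record m { tmp = a }) (λ _ _ → refl) {record (mem₀ (ident v)) { leg = S₁.G v }} (set-ok (λ m a → record m { leg = a }) (λ _ _ → refl) (capped₀ v) (g< v)) (τ< v)) refl))

        f₃ : Fin n → ℕ
        f₃ v = not (leg (s₂ v) ≡ᵇ 0) ▷ tmp (s₂ v)

        f₃-leg : ∀ v → LEG v ≢ 0 → f₃ v ≡ τ v
        f₃-leg v ne = cong₂ (λ a b → not (a ≡ᵇ 0) ▷ b) (trans (cong leg (state₂ v)) (g-leg v ne)) (cong tmp (state₂ v))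

        f₃-root : ∀ v → LEG v ≡ 0 → f₃ v ≡ 0
        f₃-root v z = cong (λ a → not (a ≡ᵇ 0) ▷ tmp (s₂ v)) (trans (cong leg (state₂ v)) (g-root v z))

        f₃< : ∀ v → f₃ v < 2 ^ K
        f₃< v with LEG v ≟ 0
        ... | yes z = subst (_< 2 ^ K) (sym (f₃-root v z)) (1≤2^ K)
        ... | no ne = subst (_< 2 ^ K) (sym (f₃-leg v ne)) (τ< v)

        spec₃ : MaxSpec sideI s₂ (λ m y → record m { leg = if leg m ≡ᵇ 0 then 0 else (if tmp m ≡ᵇ y then 1 else 2) }) s₃
        spec₃ = max-spec {λ w tr a b → tr} sem₃ f₃<
        module S₃ = MaxSpec spec₃

        all-comp : ∀ u v → Comp sideI s₂ u v
        all-comp u v = connected u v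

        winner : ∀ v → ∃ λ x → LEG x ≢ 0 × τ x ≡ S₃.Y v
        winner v with S₃.at' v
        ... | u , c , q with LEG u ≟ 0
        ... | no ne = u , ne , trans (sym (f₃-leg u ne)) (sym q)
        -- An identifier may be `0`, so the maximum may be attained at the root. It is then `0`, and
        -- the leg of `v₁` attains it as well.
        ... | yes z = v₁ , v₁≢0 , ≤-antisym (subst (_≤ S₃.Y v) (f₃-leg v₁ v₁≢0) (S₃.ub v v₁ (all-comp v v₁))) (≤-trans (≤-reflexive (trans q (f₃-root u z))) z≤n)

        Y-all : ∀ u v → S₃.Y u ≡ S₃.Y v
        Y-all u v = ≤-antisym (half u v) (half v u)
          where
          half : ∀ u v → S₃.Y u ≤ S₃.Y v
          half u v = let (x , ne , q) = winner u in subst (_≤ S₃.Y v) (trans (f₃-leg x ne) q) (S₃.ub v x (all-comp v x))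

        v* : Fin n
        v* = proj₁ (winner v₁)
        v*≢0 : LEG v* ≢ 0
        v*≢0 = proj₁ (proj₂ (winner v₁))
        τ* : ∀ v → τ v* ≡ S₃.Y v
        τ* v = trans (proj₂ (proj₂ (winner v₁))) (Y-all v₁ v)

        Λ : Fin n → ℕ
        Λ v = if S₁.G v ≡ᵇ 0 then 0 else (if τ v ≡ᵇ S₃.Y v then 1 else 2)

        Λ-root : ∀ v → LEG v ≡ 0 → Λ v ≡ 0
        Λ-root v z = cong (λ a → if a ≡ᵇ 0 then 0 else (if τ v ≡ᵇ S₃.Y v then 1 else 2)) (g-root v z)

        Λ-first : ∀ v → LEG v ≡ LEG v* → Λ v ≡ 1
        Λ-first v l = trans (cong (λ a → if a ≡ᵇ 0 then 0 else (if τ v ≡ᵇ S₃.Y v then 1 else 2)) (g-leg v ne))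
          (cong (λ b → if b then 1 else 2) (≡ᵇ-true (trans (τ-const v v* l ne) (τ* v))))
          where
          ne : LEG v ≢ 0
          ne z = v*≢0 (trans (sym l) z)

        Λ-second : ∀ v → LEG v ≢ 0 → LEG v ≢ LEG v* → Λ v ≡ 2
        Λ-second v ne d = trans (cong (λ a → if a ≡ᵇ 0 then 0 else (if τ v ≡ᵇ S₃.Y v then 1 else 2)) (g-leg v ne))
          (cong (λ b → if b then 1 else 2) (≡ᵇ-false (λ q → d (τ-inj v v* ne v*≢0 (trans q (sym (τ* v)))))))

        Λ< : ∀ v → Λ v < 2 ^ K
        Λ< v = aux (S₁.G v ≡ᵇ 0) (τ v ≡ᵇ S₃.Y v)
          where
          aux : ∀ a b → (if a then 0 else (if b then 1 else 2)) < 2 ^ K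
          aux true b = 1≤2^ K
          aux false true = 1<K
          aux false false = 2<K

        capped₂ : ∀ v → capM K (record (mem₀ (ident v)) { leg = S₁.G v ; tmp = τ v }) ≡ record (mem₀ (ident v)) { leg = S₁.G v ; tmp = τ v }
        capped₂ v = set-ok (λ m a → record m { tmp = a }) (λ _ _ → refl) {record (mem₀ (ident v)) { leg = S₁.G v }} (set-ok (λ m a → record m { leg = a }) (λ _ _ → refl) (capped₀ v) (g< v)) (τ< v)

        capped₃ : ∀ v → capM K (record (mem₀ (ident v)) { leg = Λ v ; tmp = τ v }) ≡ record (mem₀ (ident v)) { leg = Λ v ; tmp = τ v }
        capped₃ v = set-ok (λ m a → record m { leg = a }) (λ _ _ → refl) (capped₂ v) (Λ< v)

        state₃ : ∀ v → s₃ v ≡ record (mem₀ (ident v)) { leg = Λ v ; tmp = τ v }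
        state₃ v = trans (S₃.res v) (trans (cong (λ m → capM K (record m { leg = if leg m ≡ᵇ 0 then 0 else (if tmp m ≡ᵇ S₃.Y v then 1 else 2) })) (state₂ v)) (capped₃ v))

        one : Λ v* ≡ 1
        one = Λ-first v* refl

        orient : (∀ v → Λ v ≡ LEG v) ⊎ (∀ v → Λ v ≡ swapLeg (LEG v))
        orient with LEG-cases v*
        ... | inj₁ z = ⊥-elim (v*≢0 z)
        ... | inj₂ (inj₁ l₁) = inj₁ same
          where
          same : ∀ v → Λ v ≡ LEG v
          same v with LEG-cases v
          ... | inj₁ z = trans (Λ-root v z) (sym z)
          ... | inj₂ (inj₁ l) = trans (Λ-first v (trans l (sym l₁))) (sym l)
          ... | inj₂ (inj₂ l) = trans (Λ-second v (λ z → case trans (sym l) z of λ ()) (λ q → case trans (sym l) (trans q l₁) of λ ())) (sym l)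
        ... | inj₂ (inj₂ l₂) = inj₂ swapped
          where
          swapped : ∀ v → Λ v ≡ swapLeg (LEG v)
          swapped v with LEG-cases v
          ... | inj₁ z = trans (Λ-root v z) (cong swapLeg (sym z))
          ... | inj₂ (inj₁ l) = trans (Λ-second v (λ z → case trans (sym l) z of λ ()) (λ q → case trans (sym l) (trans q l₂) of λ ())) (cong swapLeg (sym l))
          ... | inj₂ (inj₂ l) = trans (Λ-first v (trans l (sym l₂))) (cong swapLeg (sym l))

    -- Positions and single cuts.

    module Values (n< : n < 2 ^ K) (Ω< : 4 * ∑ w < 2 ^ K) (T : ℕ) (R : Fin n → ℕ) (rkd : Ranked T R) where

      acc< : ∀ {s} → Capped s → ∀ v → acc (s v) < 2 ^ K
      acc< {s} c v = subst (_< 2 ^ K) (cong acc (c v)) (cap< K (acc (s v)))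

      cut< : ∀ {s} → Capped s → ∀ v → cut (s v) < 2 ^ K
      cut< {s} c v = subst (_< 2 ^ K) (cong cut (c v)) (cap< K (cut (s v)))

      Ω : ℕ
      Ω = ∑ w

      leg-or-root : ∀ {A : Set} v → (LEG v ≡ 0 → A) → (LEG v ≢ 0 → A) → A
      leg-or-root v f g with LEG v ≟ 0
      ... | yes z = f z
      ... | no ne = g ne

      V₁ : Fin n → ℕ
      V₁ v = if LEG v ≡ᵇ 0 then 0 else 1

      V₁≤1 : ∀ v → V₁ v ≤ 1
      V₁≤1 v = aux (LEG v ≡ᵇ 0)
        where
        aux : ∀ b → (if b then 0 else 1) ≤ 1
        aux true = z≤n
        aux false = ≤-refl

      ∑V₁< : ∑ V₁ < 2 ^ K
      ∑V₁< = ≤-<-trans (≤-trans (∑-≤ V₁≤1) (≤-reflexive (trans (∑-const n 1) (*-identityʳ n)))) n<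

      1≤n : 1 ≤ n
      1≤n = aux root
        where
        aux : ∀ {k} → Fin k → 1 ≤ k
        aux zero = s≤s z≤n
        aux (suc i) = s≤s z≤n

      -- All labels are still `0`, hence the class of a node is its whole leg and the suffix sum of
      -- ones counts the nodes from it downwards.
      pos-spec : ∀ {s s'} → Base s → (∀ v → rk (s v) ≡ R v) → (∀ v → bP (s v) ≡ 0) → Run K (posProg T) s s' →
        Capped s' × Σ (Fin n → ℕ) λ a → Σ (Fin n → ℕ) λ b → ∀ v → s' v ≡ record (s v) { val = b v ; acc = a v ; pos = POS v }
      pos-spec {s} {s'} bs ranks zs (_∷_ {s' = s₁} loc rs) = go (Run-++ (sufProg T) rs)
        where
        open Base bs
        l₁ : Capped s₁ × (∀ v → s₁ v ≡ record (s v) { val = V₁ v })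
        l₁ = local-set (λ m a → record m { val = a }) (λ _ _ → refl) {λ m → record m { val = if leg m ≡ᵇ 0 then 0 else 1 }} V₁ loc capped
          (λ v → cong (λ l → record (s v) { val = if l ≡ᵇ 0 then 0 else 1 }) (legs v)) (λ v → ≤-<-trans (≤-trans (V₁≤1 v) 1≤n) n<)
        sh₁ : ∀ v → s₁ v ≡ record (s v) { val = V₁ v }
        sh₁ = proj₂ l₁
        open Suffix T R rkd (λ _ → 0) V₁ (λ _ _ _ _ _ _ _ _ _ → refl) ∑V₁<
        st : Start s₁
        st = record
          { basis = record { capped = proj₁ l₁ ; legs = λ v → trans (cong leg (sh₁ v)) (legs v) ; ids = λ v → trans (cong nid (sh₁ v)) (ids v) }
          ; ranks = λ v → trans (cong rk (sh₁ v)) (ranks v) ; labs = λ v → trans (cong bP (sh₁ v)) (zs v) ; vals = λ v → cong val (sh₁ v) }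
        go : (∃ λ s₂ → Run K (sufProg T) s₁ s₂ × Run K (localI (λ m → record m { pos = if leg m ≡ᵇ 0 then 0 else acc m }) ∷ []) s₂ s') →
          Capped s' × Σ (Fin n → ℕ) λ a → Σ (Fin n → ℕ) λ b → ∀ v → s' v ≡ record (s v) { val = b v ; acc = a v ; pos = POS v }
        go (s₂ , r , (fin ∷ [])) = proj₁ l₃ , A , V₁ , λ v → trans (proj₂ l₃ v) (cong (λ m → record m { pos = POS v }) (sh₂ v))
          where
          sf = suffix st r
          A : Fin n → ℕ
          A = proj₁ (proj₂ sf)
          sh₂ : ∀ v → s₂ v ≡ record (s v) { val = V₁ v ; acc = A v }
          sh₂ v = trans (proj₁ (proj₂ (proj₂ sf)) v) (cong (λ m → record m { acc = A v }) (sh₁ v))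
          A≡ : ∀ v → LEG v ≢ 0 → A v ≡ POS v
          A≡ v ne = trans (proj₂ (proj₂ (proj₂ sf)) v ne) (trans (∑-cong pt) (count v ne))
            where
            pt : ∀ u → ((LEG u ≡ᵇ LEG v) ∧ (POS u ≤ᵇ POS v) ▷ V₁ u) ≡ ((LEG u ≡ᵇ LEG v) ∧ (POS u ≤ᵇ POS v) ▷ 1)
            pt u = aux (LEG u ≡ᵇ LEG v) (POS u ≤ᵇ POS v) refl
              where
              aux : ∀ a b → (LEG u ≡ᵇ LEG v) ≡ a → (a ∧ b ▷ V₁ u) ≡ (a ∧ b ▷ 1)
              aux false b _ = refl
              aux true false _ = refl
              aux true true q = cong (λ b → if b then 0 else 1) (≡ᵇ-false (λ z → ne (trans (sym (≡ᵇ-sound {LEG u} q)) z)))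
          final : ∀ v → (if leg (s₂ v) ≡ᵇ 0 then 0 else acc (s₂ v)) ≡ POS v
          final v = trans (cong₂ (λ a b → if a ≡ᵇ 0 then 0 else b) (trans (cong leg (sh₂ v)) (legs v)) (cong acc (sh₂ v)))
            (leg-or-root v (λ z → trans (cong (λ a → if a ≡ᵇ 0 then 0 else A v) z) (sym (trans (cong POS (root-LEG v z)) POS-root)))
              (λ ne → trans (cong (λ b → if b then 0 else A v) (≡ᵇ-false ne)) (A≡ v ne)))
          POS< : ∀ v → POS v < 2 ^ K
          POS< v = leg-or-root v (λ z → subst (_< 2 ^ K) (sym (trans (cong POS (root-LEG v z)) POS-root)) (1≤2^ K))
            (λ ne → subst (_< 2 ^ K) (trans (cong acc (sh₂ v)) (A≡ v ne)) (acc< (proj₁ sf) v))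
          l₃ : Capped s' × (∀ v → s' v ≡ record (s₂ v) { pos = POS v })
          l₃ = local-set (λ m a → record m { pos = a }) (λ _ _ → refl) {λ m → record m { pos = if leg m ≡ᵇ 0 then 0 else acc m }} POS fin (proj₁ sf)
            (λ v → cong (λ x → record (s₂ v) { pos = x }) (final v)) POS<

      belowSum : (Fin m → ℕ) → (Fin m → ℕ) → Fin n → ℕ
      belowSum z₁ z₂ v = ∑ (λ e → (bel v (e₁ e) ▷ z₁ e) + (bel v (e₂ e) ▷ z₂ e))

      edgeSuffix : ∀ z {s s' s''} z₁ z₂ → Base s → (∀ v → rk (s v) ≡ R v) → (∀ v → bP (s v) ≡ 0) →
        (∀ e → z (w e) (s (e₁ e)) (s (e₂ e)) ≡ z₁ e) → (∀ e → z (w e) (s (e₂ e)) (s (e₁ e)) ≡ z₂ e) → ∑ (λ e → z₁ e + z₂ e) < 2 ^ K →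
        SumSem K (edgeI z setVal) s s' → Run K (sufProg T) s' s'' →
        Capped s'' × Σ (Fin n → ℕ) λ a → Σ (Fin n → ℕ) λ b → (∀ v → s'' v ≡ record (s v) { val = b v ; acc = a v }) × (∀ v → LEG v ≢ 0 → a v ≡ belowSum z₁ z₂ v)
      edgeSuffix z {s} {s'} {s''} z₁ z₂ bs ranks zs eq₁ eq₂ lt sem r =
        proj₁ sf , proj₁ (proj₂ sf) , V , (λ v → trans (proj₁ (proj₂ (proj₂ sf)) v) (cong (λ m → record m { acc = proj₁ (proj₂ sf) v }) (sh₁ v))) ,
        λ v ne → trans (proj₂ (proj₂ (proj₂ sf)) v ne) (recv-sum (bel v) z₁ z₂)
        where
        open Base bs
        V : Fin n → ℕ
        V = recv z₁ z₂
        l₁ : Capped s' × (∀ v → s' v ≡ record (s v) { val = V v })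
        l₁ = edge-set setVal (λ _ _ → refl) {z} sem capped z₁ z₂ eq₁ eq₂ (λ v → ≤-<-trans (recv≤ z₁ z₂ v) lt)
        sh₁ = proj₂ l₁
        ∑V< : ∑ V < 2 ^ K
        ∑V< = subst (_< 2 ^ K) (sym (recv-sum (λ _ → true) z₁ z₂)) lt
        open Suffix T R rkd (λ _ → 0) V (λ _ _ _ _ _ _ _ _ _ → refl) ∑V<
        st : Start s'
        st = record
          { basis = record { capped = proj₁ l₁ ; legs = λ v → trans (cong leg (sh₁ v)) (legs v) ; ids = λ v → trans (cong nid (sh₁ v)) (ids v) }
          ; ranks = λ v → trans (cong rk (sh₁ v)) (ranks v) ; labs = λ v → trans (cong bP (sh₁ v)) (zs v) ; vals = λ v → cong val (sh₁ v) }
        sf = suffix st r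

      inner : Fin n → Fin n → ℕ → ℕ
      inner a b k = (LEG a ≡ᵇ LEG b) ∧ (suc (POS b) ≤ᵇ POS a) ▷ 2 * k

      X-identity : ∀ v → X v + belowSum (λ e → inner (e₁ e) (e₂ e) (w e)) (λ e → inner (e₂ e) (e₁ e) (w e)) v ≡ belowSum w w v
      X-identity v = trans (sym (∑-+ (λ e → cross v e ▷ w e) (λ e → (bel v (e₁ e) ▷ inner (e₁ e) (e₂ e) (w e)) + (bel v (e₂ e) ▷ inner (e₂ e) (e₁ e) (w e))))) (∑-cong pt)
        where
        off : ∀ a b k → bel v a ≡ true → bel v b ≡ false → inner a b k ≡ 0
        off a b k p q = cong (_▷ 2 * k) (¬true⇒false λ r → let (l , lt) = ∧-true {LEG a ≡ᵇ LEG b} r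
                                                               (la , le) = bel-sound {v} {a} p in
          case trans (sym q) (bel-true (trans (sym (≡ᵇ-sound {LEG a} l)) la) (≤-trans (<⇒≤ (≤ᵇ-sound lt)) le)) of λ ())
        on : ∀ a b k → a ≢ b → bel v a ≡ true → bel v b ≡ true → inner a b k + inner b a k ≡ 2 * k
        on a b k ne p q = aux (<-cmp (POS a) (POS b))
          where
          l : LEG a ≡ LEG b
          l = trans (proj₁ (bel-sound {v} {a} p)) (sym (proj₁ (bel-sound {v} {b} q)))
          aux : Tri (POS a < POS b) (POS a ≡ POS b) (POS b < POS a) → inner a b k + inner b a k ≡ 2 * k
          aux (tri< lt _ ngt) = cong₂ _+_ (cong (_▷ 2 * k) (trans (cong ((LEG a ≡ᵇ LEG b) ∧_) (≤ᵇ-false {suc (POS b)} (s≤s (<⇒≤ lt)))) (zeroʳ (LEG a ≡ᵇ LEG b))))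
            (cong (_▷ 2 * k) (cong₂ _∧_ (≡ᵇ-true (sym l)) (≤ᵇ-true lt)))
            where
            zeroʳ : ∀ b → b ∧ false ≡ false
            zeroʳ true = refl
            zeroʳ false = refl
          aux (tri≈ _ eq _) = ⊥-elim (ne (POS-inj a b l eq))
          aux (tri> _ _ gt) = trans (cong₂ _+_ (cong (_▷ 2 * k) (cong₂ _∧_ (≡ᵇ-true l) (≤ᵇ-true gt)))
            (cong (_▷ 2 * k) (trans (cong ((LEG b ≡ᵇ LEG a) ∧_) (≤ᵇ-false {suc (POS a)} (s≤s (<⇒≤ gt)))) (zeroʳ (LEG b ≡ᵇ LEG a))))) (+-identityʳ _)
            where
            zeroʳ : ∀ b → b ∧ false ≡ false
            zeroʳ true = refl
            zeroʳ false = refl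
        pt : ∀ e → (cross v e ▷ w e) + ((bel v (e₁ e) ▷ inner (e₁ e) (e₂ e) (w e)) + (bel v (e₂ e) ▷ inner (e₂ e) (e₁ e) (w e)))
          ≡ (bel v (e₁ e) ▷ w e) + (bel v (e₂ e) ▷ w e)
        pt e = aux (bel v (e₁ e)) (bel v (e₂ e)) refl refl
          where
          aux : ∀ a b → bel v (e₁ e) ≡ a → bel v (e₂ e) ≡ b →
            (a xor b ▷ w e) + ((a ▷ inner (e₁ e) (e₂ e) (w e)) + (b ▷ inner (e₂ e) (e₁ e) (w e))) ≡ (a ▷ w e) + (b ▷ w e)
          aux false false p q = refl
          aux true true p q = trans (on (e₁ e) (e₂ e) (w e) (loopfree e) p q) (cong (w e +_) (+-identityʳ _))
          aux true false p q = cong (w e +_) (trans (+-identityʳ _) (off (e₁ e) (e₂ e) (w e) p q))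
          aux false true p q = trans (cong (w e +_) (off (e₂ e) (e₁ e) (w e) q p)) (+-identityʳ _)

      cut-spec : ∀ {s s'} → Base s → (∀ v → rk (s v) ≡ R v) → (∀ v → bP (s v) ≡ 0) → (∀ v → pos (s v) ≡ POS v) → Run K (cutProg T) s s' →
        Capped s' × Σ (Fin n → ℕ) λ a → Σ (Fin n → ℕ) λ b → Σ (Fin n → ℕ) λ c →
          (∀ v → s' v ≡ record (s v) { val = b v ; acc = a v ; cut = c v ; best = c v }) × (∀ v → LEG v ≢ 0 → c v ≡ X v)
      cut-spec {s} {s'} bs ranks zs ps (_∷_ {s' = s₁} sem₁ rs) = go (Run-++ (sufProg T) rs)
        where
        Goal : Set
        Goal = Capped s' × Σ (Fin n → ℕ) λ a → Σ (Fin n → ℕ) λ b → Σ (Fin n → ℕ) λ c →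
          (∀ v → s' v ≡ record (s v) { val = b v ; acc = a v ; cut = c v ; best = c v }) × (∀ v → LEG v ≢ 0 → c v ≡ X v)
        rest : List Instr
        rest = localI (λ m → record m { cut = acc m }) ∷ edgeI innerZ setVal ∷ sufProg T
          ++ localI (λ m → record m { cut = cut m ∸ acc m ; best = cut m ∸ acc m }) ∷ []
        2w< : ∑ (λ e → w e + w e) < 2 ^ K
        2w< = ≤-<-trans (≤-trans (≤-reflexive (∑-+ w w)) (≤-trans (+-monoʳ-≤ Ω (m≤m+n Ω (Ω + (Ω + 0)))) ≤-refl)) Ω<
        go : (∃ λ s₂ → Run K (sufProg T) s₁ s₂ × Run K rest s₂ s') → Goal
        go (s₂ , r , (_∷_ {s' = s₃} loc (_∷_ {s' = s₄} sem₂ rs'))) = go' (Run-++ (sufProg T) rs')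
          where
          p₁ = edgeSuffix degZ w w bs ranks zs (λ _ → refl) (λ _ → refl) 2w< sem₁ r
          a₁ = proj₁ (proj₂ p₁)
          b₁ = proj₁ (proj₂ (proj₂ p₁))
          sh₂ : ∀ v → s₂ v ≡ record (s v) { val = b₁ v ; acc = a₁ v }
          sh₂ = proj₁ (proj₂ (proj₂ (proj₂ p₁)))
          l₃ : Capped s₃ × (∀ v → s₃ v ≡ record (s₂ v) { cut = acc (s₂ v) })
          l₃ = local-set (λ m a → record m { cut = a }) (λ _ _ → refl) {λ m → record m { cut = acc m }} (λ v → acc (s₂ v)) loc (proj₁ p₁) (λ _ → refl) (acc< (proj₁ p₁))
          sh₃ : ∀ v → s₃ v ≡ record (s v) { val = b₁ v ; acc = a₁ v ; cut = a₁ v }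
          sh₃ v = trans (proj₂ l₃ v) (cong (λ m → record m { cut = acc m }) (sh₂ v))
          bs₃ : Base s₃
          bs₃ = record { capped = proj₁ l₃ ; legs = λ v → trans (cong leg (sh₃ v)) (Base.legs bs v) ; ids = λ v → trans (cong nid (sh₃ v)) (Base.ids bs v) }
          inn : ∀ a b k → innerZ k (s₃ a) (s₃ b) ≡ inner a b k
          inn a b k = cong₂ (λ x y → x ∧ y ▷ 2 * k) (cong₂ _≡ᵇ_ (Base.legs bs₃ a) (Base.legs bs₃ b))
            (cong₂ (λ x y → suc x ≤ᵇ y) (trans (cong pos (sh₃ b)) (ps b)) (trans (cong pos (sh₃ a)) (ps a)))
          inner≤ : ∀ a b k → inner a b k ≤ 2 * k
          inner≤ a b k = aux ((LEG a ≡ᵇ LEG b) ∧ (suc (POS b) ≤ᵇ POS a))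
            where
            aux : ∀ x → (x ▷ 2 * k) ≤ 2 * k
            aux true = ≤-refl
            aux false = z≤n
          -- Each end is bounded separately by twice the weight, which is where the factor `4` in
          -- the bound on the total weight comes from.
          in< : ∑ (λ e → inner (e₁ e) (e₂ e) (w e) + inner (e₂ e) (e₁ e) (w e)) < 2 ^ K
          in< = ≤-<-trans (∑-≤ (λ e → ≤-trans (+-mono-≤ (inner≤ (e₁ e) (e₂ e) (w e)) (inner≤ (e₂ e) (e₁ e) (w e))) (≤-reflexive (four (w e))))) (≤-<-trans (≤-reflexive (∑-*ˡ 4 w)) Ω<)
            where
            four : ∀ k → 2 * k + 2 * k ≡ 4 * k
            four k = sym (*-distribʳ-+ k 2 2)
          go' : (∃ λ s₅ → Run K (sufProg T) s₄ s₅ × Run K (localI (λ m → record m { cut = cut m ∸ acc m ; best = cut m ∸ acc m }) ∷ []) s₅ s') → Goal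
          go' (s₅ , r' , (fin ∷ [])) = proj₁ l₆ , a₂ , b₂ , (λ v → a₁ v ∸ a₂ v) , sh₆ , value
            where
            p₂ = edgeSuffix innerZ {s₃} {s₄} {s₅} (λ e → inner (e₁ e) (e₂ e) (w e)) (λ e → inner (e₂ e) (e₁ e) (w e)) bs₃
              (λ v → trans (cong rk (sh₃ v)) (ranks v)) (λ v → trans (cong bP (sh₃ v)) (zs v)) (λ e → inn (e₁ e) (e₂ e) (w e)) (λ e → inn (e₂ e) (e₁ e) (w e)) in< sem₂ r'
            a₂ = proj₁ (proj₂ p₂)
            b₂ = proj₁ (proj₂ (proj₂ p₂))
            sh₅ : ∀ v → s₅ v ≡ record (s v) { val = b₂ v ; acc = a₂ v ; cut = a₁ v }
            sh₅ v = trans (proj₁ (proj₂ (proj₂ (proj₂ p₂))) v) (cong (λ m → record m { val = b₂ v ; acc = a₂ v }) (sh₃ v))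
            l₆ : Capped s' × (∀ v → s' v ≡ record (s₅ v) { cut = cut (s₅ v) ∸ acc (s₅ v) ; best = cut (s₅ v) ∸ acc (s₅ v) })
            l₆ = local-set (λ m a → record m { cut = a ; best = a }) (λ _ _ → refl) {λ m → record m { cut = cut m ∸ acc m ; best = cut m ∸ acc m }} (λ v → cut (s₅ v) ∸ acc (s₅ v)) fin (proj₁ p₂)
              (λ _ → refl) (λ v → ≤-<-trans (m∸n≤m (cut (s₅ v)) (acc (s₅ v))) (cut< (proj₁ p₂) v))
            sh₆ : ∀ v → s' v ≡ record (s v) { val = b₂ v ; acc = a₂ v ; cut = a₁ v ∸ a₂ v ; best = a₁ v ∸ a₂ v }
            sh₆ v = trans (proj₂ l₆ v) (cong (λ m → record m { cut = cut m ∸ acc m ; best = cut m ∸ acc m }) (sh₅ v))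
            value : ∀ v → LEG v ≢ 0 → a₁ v ∸ a₂ v ≡ X v
            value v ne = trans (cong₂ _∸_ (trans (proj₂ (proj₂ (proj₂ (proj₂ p₁))) v ne) (sym (X-identity v))) (proj₂ (proj₂ (proj₂ (proj₂ p₂))) v ne))
              (m+n∸n≡m (X v) (belowSum (λ e → inner (e₁ e) (e₂ e) (w e)) (λ e → inner (e₂ e) (e₁ e) (w e)) v))

    -- Rectangles of candidate pairs.

    module Levels (H : ℕ) (Ω<H : 4 * ∑ w < H) (H<K : H + H ≤ 2 ^ K) (T : ℕ) (R : Fin n → ℕ) (rkd : Ranked T R) where

      Ω : ℕ
      Ω = ∑ w

      leg1≢0 : ∀ {v} → LEG v ≡ 1 → LEG v ≢ 0
      leg1≢0 l z = case trans (sym l) z of λ ()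
      leg2≢0 : ∀ {v} → LEG v ≡ 2 → LEG v ≢ 0
      leg2≢0 l z = case trans (sym l) z of λ ()

      record Frame (s : State) : Set where
        field
          capped : Capped s
          legs : ∀ v → leg (s v) ≡ LEG v
          ids : ∀ v → nid (s v) ≡ ident v
          ranks : ∀ v → rk (s v) ≡ R v
          poss : ∀ v → pos (s v) ≡ POS v
          cuts : ∀ v → LEG v ≢ 0 → cut (s v) ≡ X v

      -- Labels increase along each leg, so rows and columns of a rectangle are intervals, and by
      -- `gapP` and `gapQ` a larger label lies higher on both legs: rectangles are arranged along a
      -- diagonal. `coverQ` gives each rectangle with columns a row. `rank→` and `rank←` say that
      -- the rows of a living rectangle are the runs of rows joined by edges of rank at most `t`,
      -- which ties the depth of the recursion to the ranks.
      record Labels (t : ℕ) (b q k a : Fin n → ℕ) : Set where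
        field
          mono : ∀ u v → LEG u ≡ LEG v → LEG u ≢ 0 → POS u ≤ POS v → b u ≤ b v
          b<P : ∀ u → LEG u ≡ 1 → b u < POS u
          gapP : ∀ u v → LEG u ≡ 1 → LEG v ≡ 1 → b v < b u → POS v ≤ b u
          q<Q : ∀ u → LEG u ≡ 2 → q u < POS u
          gapQ : ∀ u v → LEG u ≡ 2 → LEG v ≡ 2 → b v < b u → POS v ≤ q u
          shareQ : ∀ u v → LEG u ≢ 0 → LEG v ≢ 0 → b u ≡ b v → q u ≡ q v
          shareA : ∀ u v → LEG u ≢ 0 → LEG v ≢ 0 → b u ≡ b v → a u ≡ a v
          kapW : ∀ u → LEG u ≢ 0 → k u ≡ W (b u) (q u)
          coverQ : ∀ u → LEG u ≡ 2 → ∃ λ i → LEG i ≡ 1 × b i ≡ b u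
          rank→ : ∀ u p → LEG u ≡ 1 → Par u p → a u ≢ 0 → b p ≡ b u → R u ≤ t
          rank← : ∀ u p → LEG u ≡ 1 → Par u p → a u ≢ 0 → R u ≤ t → b p ≡ b u

      HasEdge : (Fin n → ℕ) → ℕ → Set
      HasEdge b x = ∃ λ e → ∃ λ i → ∃ λ j → Joins e i j × LEG i ≡ 1 × LEG j ≡ 2 × b i ≡ x × b j ≡ x

      IsCut : ℕ → Set
      IsCut x = (∃ λ v → LEG v ≢ 0 × x ≡ X v) ⊎ (∃ λ u → ∃ λ v → LEG u ≡ 1 × LEG v ≡ 2 × x ≡ C u v)

      Below : (Fin n → ℕ) → ℕ → Set
      Below β x = ∃ λ v → LEG v ≢ 0 × β v ≤ x

      record Bests (β : Fin n → ℕ) : Set where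
        field
          bestX : ∀ v → LEG v ≢ 0 → β v ≤ X v
          sound : ∀ v → LEG v ≢ 0 → IsCut (β v)

      -- `witness` is what makes a living rectangle connected. By `covered`, no pair is lost: either
      -- a recorded value is at least as good, or both nodes of the pair share a living rectangle.
      record LInv (t : ℕ) (s : State) : Set where
        field
          frame : Frame s
          labels : Labels t (λ v → bP (s v)) (λ v → bQ (s v)) (λ v → kap (s v)) (λ v → act (s v))
          witness : ∀ u → LEG u ≢ 0 → act (s u) ≢ 0 → HasEdge (λ v → bP (s v)) (bP (s u))
          bests : Bests (λ v → best (s v))
          covered : ∀ i j → LEG i ≡ 1 → LEG j ≡ 2 →
            Below (λ v → best (s v)) (C i j) ⊎ (bP (s i) ≡ bP (s j) × act (s i) ≢ 0)

      H≤K : H ≤ 2 ^ K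
      H≤K = ≤-trans (m≤m+n H H) H<K

      small : ∀ {x} → x ≤ 4 * Ω → x < 2 ^ K
      small le = <-≤-trans (≤-<-trans le Ω<H) H≤K

      Ω≤4Ω : Ω ≤ 4 * Ω
      Ω≤4Ω = m≤m+n Ω (3 * Ω)

      2Ω≤4Ω : Ω + Ω ≤ 4 * Ω
      2Ω≤4Ω = +-monoʳ-≤ Ω (m≤m+n Ω (2 * Ω))

      X≤Ω : ∀ v → X v ≤ Ω
      X≤Ω v = wsum≤ (cross v)

      W≤Ω : ∀ p q → W p q ≤ Ω
      W≤Ω p q = wsum≤ (hits p q)

      ▷w≤ : ∀ b k → (b ▷ k) ≤ k
      ▷w≤ true k = ≤-refl
      ▷w≤ false k = z≤n

      two-sided : ∀ (F : Fin n → Fin n → Bool) → ∑ (λ e → (F (e₁ e) (e₂ e) ▷ w e) + (F (e₂ e) (e₁ e) ▷ w e)) < 2 ^ K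
      two-sided F = small (≤-trans (∑-≤ (λ e → +-mono-≤ (▷w≤ (F (e₁ e) (e₂ e)) (w e)) (▷w≤ (F (e₂ e) (e₁ e)) (w e)))) (≤-trans (≤-reflexive (∑-+ w w)) 2Ω≤4Ω))

      max-set : ∀ (S : Mem → ℕ → Mem) → (∀ m x → capM K (S m x) ≡ S (capM K m) (cap K x)) →
        ∀ {c f s s'} → MaxSem K (maxI c f S) s s' → Capped s → (∀ v → f (s v) < 2 ^ K) →
        Σ (MaxSpec (maxI c f S) s S s') λ sp → Capped s' × (∀ v → s' v ≡ S (s v) (MaxSpec.Y sp v))
      max-set S nat {c} {f} {s} sem cp bd = sp , capped-by (MaxSpec.res sp) , λ v → trans (MaxSpec.res sp v) (set-ok S nat (cp v) (Y< v))
        where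
        sp = max-spec {c} {f} {S} sem bd
        Y< : ∀ v → MaxSpec.Y sp v < 2 ^ K
        Y< v = let (u , _ , q) = MaxSpec.at' sp v in subst (_< 2 ^ K) (sym q) (bd u)

      sum-set : ∀ (S : Mem → ℕ → Mem) → (∀ m x → capM K (S m x) ≡ S (capM K m) (cap K x)) →
        ∀ {c f s s'} → SumSem K (sumI c f S) s s' → Capped s → ∑ (λ v → f (s v)) < 2 ^ K →
        Σ (SumSpec (sumI c f S) s S s') λ sp → Capped s' × (∀ v → s' v ≡ S (s v) (∑ (λ u → SumSpec.same sp v u ▷ f (s u))))
      sum-set S nat {c} {f} {s} sem cp bd = sp , capped-by (SumSpec.res sp) ,
        λ v → trans (SumSpec.res sp v) (set-ok S nat (cp v) (≤-<-trans (∑-▷≤ (SumSpec.same sp v) (λ u → f (s u))) bd))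
        where
        sp = sum-spec {c} {f} {S} sem bd

      -- One pass over all living rectangles.

      module Core (t : ℕ) (s₀ : State) (inv : LInv t s₀) where
        open LInv inv
        open Frame frame
        open Labels labels

        b q k a : Fin n → ℕ
        b v = bP (s₀ v)
        q v = bQ (s₀ v)
        k v = kap (s₀ v)
        a v = act (s₀ v)

        Agree : State → Set
        Agree s = ∀ v → leg (s v) ≡ LEG v × act (s v) ≡ a v × bP (s v) ≡ b v

        agree₀ : Agree s₀
        agree₀ v = legs v , refl , refl

        module Rect (i : Instr) (s : State) (isRect : ∀ w tr x y → con i w tr x y ≡ rectCon w tr x y) (ag : Agree s) where

          rect-edge→ : ∀ e → Contracted i s e → LEG (e₁ e) ≢ 0 × LEG (e₂ e) ≢ 0 × a (e₁ e) ≢ 0 × a (e₂ e) ≢ 0 × b (e₁ e) ≡ b (e₂ e)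
          rect-edge→ e c =
            (λ z → nonzero-sound (proj₁ ls) (trans (proj₁ (ag (e₁ e))) z)) ,
            (λ z → nonzero-sound (proj₂ ls) (trans (proj₁ (ag (e₂ e))) z)) ,
            (λ z → nonzero-sound (proj₁ as) (trans (proj₁ (proj₂ (ag (e₁ e)))) z)) ,
            (λ z → nonzero-sound (proj₂ as) (trans (proj₁ (proj₂ (ag (e₂ e)))) z)) ,
            trans (sym (proj₂ (proj₂ (ag (e₁ e))))) (trans (≡ᵇ-sound (proj₂ r)) (proj₂ (proj₂ (ag (e₂ e)))))
            where
            p = ∧-true {not (leg (s (e₁ e)) ≡ᵇ 0) ∧ not (leg (s (e₂ e)) ≡ᵇ 0)} (trans (sym (isRect (w e) (tree e) (s (e₁ e)) (s (e₂ e)))) c)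
            ls = ∧-true {not (leg (s (e₁ e)) ≡ᵇ 0)} (proj₁ p)
            r = ∧-true {not (act (s (e₁ e)) ≡ᵇ 0) ∧ not (act (s (e₂ e)) ≡ᵇ 0)} (proj₂ p)
            as = ∧-true {not (act (s (e₁ e)) ≡ᵇ 0)} (proj₁ r)

          rect-edge← : ∀ e → LEG (e₁ e) ≢ 0 → LEG (e₂ e) ≢ 0 → a (e₁ e) ≢ 0 → a (e₂ e) ≢ 0 → b (e₁ e) ≡ b (e₂ e) → Contracted i s e
          rect-edge← e l₁ l₂ a₁ a₂ eq = trans (isRect (w e) (tree e) (s (e₁ e)) (s (e₂ e))) (cong₂ _∧_
            (cong₂ _∧_ (nonzero-true (λ z → l₁ (trans (sym (proj₁ (ag (e₁ e)))) z))) (nonzero-true (λ z → l₂ (trans (sym (proj₁ (ag (e₂ e)))) z))))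
            (cong₂ _∧_ (cong₂ _∧_ (nonzero-true (λ z → a₁ (trans (sym (proj₁ (proj₂ (ag (e₁ e))))) z))) (nonzero-true (λ z → a₂ (trans (sym (proj₁ (proj₂ (ag (e₂ e))))) z))))
              (≡ᵇ-true (trans (proj₂ (proj₂ (ag (e₁ e)))) (trans eq (sym (proj₂ (proj₂ (ag (e₂ e))))))))))

          rect→ : ∀ {u v} → LEG u ≢ 0 → a u ≢ 0 → Comp i s u v → LEG v ≢ 0 × a v ≢ 0 × b v ≡ b u
          rect→ lu au ε = lu , au , refl
          rect→ {u} {v} lu au (_◅_ {j = y} (e , c , j) p) = aux j (rect-edge→ e c)
            where
            aux : Joins e u y → LEG (e₁ e) ≢ 0 × LEG (e₂ e) ≢ 0 × a (e₁ e) ≢ 0 × a (e₂ e) ≢ 0 × b (e₁ e) ≡ b (e₂ e) → LEG v ≢ 0 × a v ≢ 0 × b v ≡ b u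
            aux (inj₁ (refl , refl)) (_ , l₂ , _ , a₂ , eq) = let (x , y , z) = rect→ l₂ a₂ p in x , y , trans z (sym eq)
            aux (inj₂ (refl , refl)) (l₁ , _ , a₁ , _ , eq) = let (x , y , z) = rect→ l₁ a₁ p in x , y , trans z eq

          inactive : ∀ {u v} → a u ≡ 0 → Comp i s u v → u ≡ v
          inactive z ε = refl
          inactive {u} z (_◅_ {j = y} (e , c , j) p) = ⊥-elim (aux j (rect-edge→ e c))
            where
            aux : Joins e u y → LEG (e₁ e) ≢ 0 × LEG (e₂ e) ≢ 0 × a (e₁ e) ≢ 0 × a (e₂ e) ≢ 0 × b (e₁ e) ≡ b (e₂ e) → ⊥
            aux (inj₁ (refl , refl)) (_ , _ , a₁ , _ , _) = a₁ z
            aux (inj₂ (refl , refl)) (_ , _ , _ , a₂ , _) = a₂ z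

          sameLeg↑ : ∀ {u v} → LEG u ≡ LEG v → LEG u ≢ 0 → a u ≢ 0 → b v ≡ b u → POS u ≤ POS v → Comp i s u v
          sameLeg↑ {u} {v} l lu au eq le = climb (Comp i s u) l lu le stp ε
            where
            in-class : ∀ x → LEG x ≡ LEG u → POS u ≤ POS x → POS x ≤ POS v → b x ≡ b u
            in-class x lx p q = ≤-antisym (≤-trans (mono x v (trans lx l) (λ z → lu (trans (sym lx) z)) q) (≤-reflexive eq)) (mono u x (sym lx) lu p)
            stp : ∀ x p → Par x p → LEG x ≡ LEG u → POS u ≤ POS x → POS x < POS v → Comp i s u x → Comp i s u p
            stp x p pr lx le₁ lt c = c ◅◅ ((e , contracted , inj₂ (e₁≡ , e₂≡)) ◅ ε)
              where
              eo = edge-of pr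
              e = proj₁ eo
              e₂≡ : e₂ e ≡ x
              e₂≡ = proj₁ (proj₂ (proj₂ eo))
              e₁≡ : e₁ e ≡ p
              e₁≡ = proj₂ (proj₂ (proj₂ eo))
              x≢0 : LEG x ≢ 0
              x≢0 z = lu (trans (sym lx) z)
              p≢0 : LEG p ≢ 0
              p≢0 z = x≢0 (trans (proj₁ pr) z)
              bx : b x ≡ b u
              bx = in-class x lx le₁ (<⇒≤ lt)
              bp : b p ≡ b u
              bp = in-class p (trans (sym (proj₁ pr)) lx) (≤-trans le₁ (≤-trans (n≤1+n _) (≤-reflexive (sym (proj₂ (proj₂ pr)))))) (≤-trans (≤-reflexive (proj₂ (proj₂ pr))) lt)
              contracted : Contracted i s e
              contracted = rect-edge← e (subst (λ z → LEG z ≢ 0) (sym e₁≡) p≢0) (subst (λ z → LEG z ≢ 0) (sym e₂≡) x≢0)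
                (λ z → au (trans (sym (shareA p u p≢0 lu bp)) (trans (cong a (sym e₁≡)) z))) (λ z → au (trans (sym (shareA x u x≢0 lu bx)) (trans (cong a (sym e₂≡)) z)))
                (trans (cong b e₁≡) (trans bp (trans (sym bx) (cong b (sym e₂≡)))))

          sameLeg : ∀ {u v} → LEG u ≡ LEG v → LEG u ≢ 0 → a u ≢ 0 → b v ≡ b u → Comp i s u v
          sameLeg {u} {v} l lu au eq with ≤-total (POS u) (POS v)
          ... | inj₁ le = sameLeg↑ l lu au eq le
          ... | inj₂ le = Comp-sym i s (sameLeg↑ (sym l) v≢0 (λ z → au (trans (sym (shareA v u v≢0 lu eq)) z)) (sym eq) le)
            where
            v≢0 : LEG v ≢ 0
            v≢0 z = lu (trans l z)

          -- Leg edges join the rows to each other and the columns to each other, and the witness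
          -- edge joins the two sides. A living rectangle is thus exactly one supernode.
          rect← : ∀ {u v} → LEG u ≢ 0 → a u ≢ 0 → LEG v ≢ 0 → b v ≡ b u → Comp i s u v
          rect← {u} {v} lu au lv eq = aux (witness u lu au)
            where
            av : a v ≢ 0
            av z = au (trans (sym (shareA v u lv lu eq)) z)
            aux : HasEdge b (b u) → Comp i s u v
            aux (e , x , y , jn , lx , ly , bx , by) = join (LEG-cases u) (LEG-cases v)
              where
              link : Comp i s x y
              link = (e , contracted jn , jn) ◅ ε
                where
                ax : a x ≢ 0
                ax z = au (trans (sym (shareA x u (leg1≢0 lx) lu bx)) z)
                ay : a y ≢ 0
                ay z = au (trans (sym (shareA y u (leg2≢0 ly) lu by)) z)
                contracted : Joins e x y → Contracted i s e
                contracted (inj₁ (refl , refl)) = rect-edge← e (leg1≢0 lx) (leg2≢0 ly) ax ay (trans bx (sym by))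
                contracted (inj₂ (refl , refl)) = rect-edge← e (leg2≢0 ly) (leg1≢0 lx) ay ax (trans by (sym bx))
              join : LEG u ≡ 0 ⊎ LEG u ≡ 1 ⊎ LEG u ≡ 2 → LEG v ≡ 0 ⊎ LEG v ≡ 1 ⊎ LEG v ≡ 2 → Comp i s u v
              join (inj₁ z) _ = ⊥-elim (lu z)
              join _ (inj₁ z) = ⊥-elim (lv z)
              join (inj₂ (inj₁ p)) (inj₂ (inj₁ q)) = sameLeg (trans p (sym q)) lu au eq
              join (inj₂ (inj₂ p)) (inj₂ (inj₂ q)) = sameLeg (trans p (sym q)) lu au eq
              join (inj₂ (inj₁ p)) (inj₂ (inj₂ q)) = sameLeg (trans p (sym lx)) lu au bx ◅◅ (link ◅◅ Comp-sym i s (sameLeg (trans q (sym ly)) lv av (trans by (sym eq))))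
              join (inj₂ (inj₂ p)) (inj₂ (inj₁ q)) = sameLeg (trans p (sym ly)) lu au by ◅◅ (Comp-sym i s link ◅◅ Comp-sym i s (sameLeg (trans q (sym lx)) lv av (trans bx (sym eq))))

          module RectMax {f : Mem → ℕ} {S : Mem → ℕ → Mem} {s'} (ieq : i ≡ maxI rectCon f S) (sp : MaxSpec i s S s') where
            open MaxSpec sp
            rub : ∀ u v → LEG u ≢ 0 → a u ≢ 0 → LEG v ≢ 0 → b v ≡ b u → f (s v) ≤ Y u
            rub u v lu au lv eq = subst (λ j → cons j (s v) ≤ Y u) ieq (ub u v (rect← lu au lv eq))
            rat : ∀ u → LEG u ≢ 0 → a u ≢ 0 → ∃ λ v → LEG v ≢ 0 × b v ≡ b u × Y u ≡ f (s v)
            rat u lu au = let (v , c , e) = at' u; (x , _ , z) = rect→ lu au c in v , x , z , trans e (cong (λ j → cons j (s v)) ieq)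
            rconst : ∀ u v → LEG u ≢ 0 → a u ≢ 0 → LEG v ≢ 0 → b v ≡ b u → Y u ≡ Y v
            rconst u v lu au lv eq = ≤-antisym (half u v lu au lv eq) (half v u lv (λ z → au (trans (sym (shareA v u lv lu eq)) z)) lu (sym eq))
              where
              half : ∀ u v → LEG u ≢ 0 → a u ≢ 0 → LEG v ≢ 0 → b v ≡ b u → Y u ≤ Y v
              half u v lu au lv eq = let (x , lx , bx , e) = rat u lu au in
                subst (_≤ Y v) (sym e) (rub v x lv (λ z → au (trans (sym (shareA v u lv lu eq)) z)) lx (trans bx (sym eq)))
            rinactive : ∀ u → a u ≡ 0 → Y u ≡ f (s u)
            rinactive u z = let (v , c , e) = at' u in trans e (trans (cong (λ j → cons j (s v)) ieq) (cong (f ∘ s) (sym (inactive z c))))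

        In : Fin n → Fin n → Bool
        In v u = (LEG u ≡ᵇ LEG v) ∧ ((b u ≡ᵇ b v) ∧ (POS u ≤ᵇ POS v))

        In-true : ∀ {v u} → LEG u ≡ LEG v → b u ≡ b v → POS u ≤ POS v → In v u ≡ true
        In-true x y z = cong₂ _∧_ (≡ᵇ-true x) (cong₂ _∧_ (≡ᵇ-true y) (≤ᵇ-true z))

        In-sound : ∀ {v u} → In v u ≡ true → LEG u ≡ LEG v × b u ≡ b v × POS u ≤ POS v
        In-sound {v} {u} p = let (x , r) = ∧-true {LEG u ≡ᵇ LEG v} p; (y , z) = ∧-true {b u ≡ᵇ b v} r in ≡ᵇ-sound x , ≡ᵇ-sound y , ≤ᵇ-sound z

        inA-true : ∀ {l p v} → LEG v ≡ l → POS v ≤ p → inA l p v ≡ true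
        inA-true x y = cong₂ _∧_ (≡ᵇ-true x) (≤ᵇ-true y)

        inA-sound : ∀ {l p v} → inA l p v ≡ true → LEG v ≡ l × POS v ≤ p
        inA-sound {l} {p} {v} x = let (y , z) = ∧-true {LEG v ≡ᵇ l} x in ≡ᵇ-sound y , ≤ᵇ-sound z

        -- From the end of the leg up to `v` come first the classes with smaller labels, which reach
        -- at most position `c v`, and then the class of `v`.
        split-at : ∀ l (c : Fin n → ℕ) v → LEG v ≡ l → LEG v ≢ 0 → c v < POS v → (∀ x → LEG x ≡ l → b x ≡ b v → c v < POS x) → (∀ x → LEG x ≡ l → b x < b v → POS x ≤ c v) →
          ∀ x → Splits (inA l (POS v) x) (In v x) (inA l (c v) x)
        split-at l c v lv v≢0 cv above below x = aux (inA l (POS v) x) refl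
          where
          aux : ∀ β → inA l (POS v) x ≡ β → Splits (inA l (POS v) x) (In v x) (inA l (c v) x)
          aux false e = split-off e (¬true⇒false (λ p → let (p₁ , _ , p₃) = In-sound {v} {x} p in case trans (sym e) (inA-true (trans p₁ lv) p₃) of λ ()))
            (¬true⇒false (λ p → let (p₁ , p₂) = inA-sound {l} {c v} {x} p in case trans (sym e) (inA-true p₁ (≤-trans p₂ (<⇒≤ cv))) of λ ()))
          aux true e with m≤n⇒m<n∨m≡n (mono x v (trans (proj₁ (inA-sound {l} {POS v} {x} e)) (sym lv)) (λ z → v≢0 (trans lv (trans (sym (proj₁ (inA-sound {l} {POS v} {x} e))) z))) (proj₂ (inA-sound {l} {POS v} {x} e)))
          ... | inj₁ lt = split-on' e (¬true⇒false (λ p → <-irrefl (proj₁ (proj₂ (In-sound {v} {x} p))) lt)) (inA-true lx (below x lx lt))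
            where lx = proj₁ (inA-sound {l} {POS v} {x} e)
          ... | inj₂ eq = split-on e (In-true (trans lx (sym lv)) eq (proj₂ (inA-sound {l} {POS v} {x} e))) (¬true⇒false (λ p → <-irrefl refl (<-≤-trans (above x lx eq) (proj₂ (inA-sound {l} {c v} {x} p)))))
            where lx = proj₁ (inA-sound {l} {POS v} {x} e)

        P-split : ∀ i → LEG i ≡ 1 → ∀ x → Splits (inA 1 (POS i) x) (In i x) (inA 1 (b i) x)
        P-split i li = split-at 1 b i li (leg1≢0 li) (b<P i li) (λ x lx eq → subst (_< POS x) eq (b<P x lx)) (λ x lx lt → gapP i x li lx lt)

        Q-split : ∀ j → LEG j ≡ 2 → ∀ x → Splits (inA 2 (POS j) x) (In j x) (inA 2 (q j) x)
        Q-split j lj = split-at 2 q j lj (leg2≢0 lj) (q<Q j lj) (λ x lx eq → subst (_< POS x) (shareQ x j (leg2≢0 lx) (leg2≢0 lj) eq) (q<Q x lx)) (λ x lx lt → gapQ j x lj lx lt)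

        conv : ∀ u v x → LEG u ≡ LEG v → LEG u ≢ 0 → LEG x ≡ LEG u → POS u ≤ POS x → POS x ≤ POS v → b u ≡ b v → b x ≡ b u
        conv u v x l lu lx p r eq = ≤-antisym (≤-trans (mono x v (trans lx l) (λ z → lu (trans (sym lx) z)) r) (≤-reflexive (sym eq))) (mono u x (sym lx) lu p)

      module CoreSteps (t : ℕ) (s₀ : State) (inv : LInv t s₀) {s₁ s₂ s₃ s₄ s₅ s₆ s₇ s₈ s₉ s : State}
        (m₁ : MaxSem K (maxI rectCon (pivF t) setPvP) s₀ s₁) (m₂ : SumSem K (edgeI rowZ setVal) s₁ s₂) (r₃ : Run K (sufProg T) s₂ s₃)
        (m₄ : MaxSem K (maxI rectCon (bestF H) setTmp) s₃ s₄) (m₅ : MaxSem K (maxI rectCon (pickF H) setPvQ) s₄ s₅)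
        (m₆ : MaxSem K (maxI rectCon cQF setCQ) s₅ s₆) (m₇ : SumSem K (edgeI colZ setVal) s₆ s₇)
        (m₈ : SumSem K (sumI rectCon ofsF setOfs) s₇ s₈) (r₉ : Run K (sufProg T) s₈ s₉) (m₁₀ : MaxSem K (localI recU) s₉ s) where
        open LInv inv
        open Frame frame
        open Labels labels
        open Core t s₀ inv

        Act : Fin n → Set
        Act u = LEG u ≢ 0 × a u ≢ 0

        act-class : ∀ {u v} → Act u → LEG v ≢ 0 → b v ≡ b u → Act v
        act-class {u} {v} (lu , au) lv eq = lv , λ z → au (trans (sym (shareA v u lv lu eq)) z)

        Piv : Fin n → Set
        Piv i = t ≡ 0 ⊎ R i ≡ t

        pivF-on : ∀ i → LEG i ≡ 1 → a i ≢ 0 → Piv i → pivF t (s₀ i) ≡ POS i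
        pivF-on i li ai pv = trans (cong (_▷ pos (s₀ i)) (cong₂ _∧_ (nonzero-true ai) (cong₂ _∧_ (≡ᵇ-true (trans (legs i) li)) (alt pv)))) (poss i)
          where
          alt : Piv i → (t ≡ᵇ 0) ∨ (rk (s₀ i) ≡ᵇ t) ≡ true
          alt (inj₁ z) = cong (_∨ (rk (s₀ i) ≡ᵇ t)) (≡ᵇ-true z)
          alt (inj₂ r) = trans (cong ((t ≡ᵇ 0) ∨_) (≡ᵇ-true (trans (ranks i) r))) (∨-tr (t ≡ᵇ 0))
            where
            ∨-tr : ∀ x → x ∨ true ≡ true
            ∨-tr true = refl
            ∨-tr false = refl

        pivF-off : ∀ v → pivF t (s₀ v) ≢ 0 → LEG v ≡ 1 × a v ≢ 0 × Piv v × pivF t (s₀ v) ≡ POS v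
        pivF-off v nz = li , av , pv , pivF-on v li av pv
          where
          g = ▷-nz (not (act (s₀ v) ≡ᵇ 0) ∧ ((leg (s₀ v) ≡ᵇ 1) ∧ ((t ≡ᵇ 0) ∨ (rk (s₀ v) ≡ᵇ t)))) nz
          g₁ = ∧-true {not (act (s₀ v) ≡ᵇ 0)} g
          av : a v ≢ 0
          av = nonzero-sound (proj₁ g₁)
          g₂ = ∧-true {leg (s₀ v) ≡ᵇ 1} (proj₂ g₁)
          li : LEG v ≡ 1
          li = trans (sym (legs v)) (≡ᵇ-sound (proj₁ g₂))
          pv : Piv v
          pv = [ (λ e → inj₁ (≡ᵇ-sound e)) , (λ e → inj₂ (trans (sym (ranks v)) (≡ᵇ-sound e))) ]′ (∨-true {t ≡ᵇ 0} (proj₂ g₂))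

        pos< : ∀ v → POS v < 2 ^ K
        pos< v = subst (_< 2 ^ K) (trans (cong pos (capped v)) (poss v)) (cap< K (pos (s₀ v)))

        gate< : ∀ x {y} → y < 2 ^ K → (x ▷ y) < 2 ^ K
        gate< true lt = lt
        gate< false lt = 1≤2^ K

        pos<' : ∀ v → pos (s₀ v) < 2 ^ K
        pos<' v = subst (_< 2 ^ K) (sym (poss v)) (pos< v)

        p₁ = max-set setPvP (λ _ _ → refl) m₁ capped (λ v → gate< (not (act (s₀ v) ≡ᵇ 0) ∧ ((leg (s₀ v) ≡ᵇ 1) ∧ ((t ≡ᵇ 0) ∨ (rk (s₀ v) ≡ᵇ t)))) (pos<' v))

        PV : Fin n → ℕ
        PV = MaxSpec.Y (proj₁ p₁)

        sh₁ : ∀ v → s₁ v ≡ record (s₀ v) { pvP = PV v }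
        sh₁ = proj₂ (proj₂ p₁)

        module R₁ = Rect (maxI rectCon (pivF t) setPvP) s₀ (λ _ _ _ _ → refl) agree₀
        module M₁ = R₁.RectMax {pivF t} {setPvP} refl (proj₁ p₁)

        pv-ub : ∀ u i → Act u → LEG i ≡ 1 → b i ≡ b u → Piv i → POS i ≤ PV u
        pv-ub u i (lu , au) li bi pv = subst (_≤ PV u) (pivF-on i li (proj₂ (act-class (lu , au) (leg1≢0 li) bi)) pv) (M₁.rub u i lu au (leg1≢0 li) bi)

        pv-inactive : ∀ u → a u ≡ 0 → PV u ≡ 0
        pv-inactive u z = trans (M₁.rinactive u z) (cong (λ x → not (x ≡ᵇ 0) ∧ ((leg (s₀ u) ≡ᵇ 1) ∧ ((t ≡ᵇ 0) ∨ (rk (s₀ u) ≡ᵇ t))) ▷ pos (s₀ u)) z)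

        pv-act : ∀ u → LEG u ≢ 0 → PV u ≢ 0 → Act u
        pv-act u lu nz = lu , λ z → nz (pv-inactive u z)

        pv-at : ∀ u → LEG u ≢ 0 → PV u ≢ 0 → ∃ λ i → LEG i ≡ 1 × b i ≡ b u × Piv i × PV u ≡ POS i
        pv-at u lu nz = let (v , lv , bv , e) = M₁.rat u lu (proj₂ (pv-act u lu nz)); (l , _ , pv , e') = pivF-off v (λ z → nz (trans e z)) in v , l , bv , pv , trans e e'

        pv-const : ∀ u v → LEG u ≢ 0 → LEG v ≢ 0 → b v ≡ b u → PV u ≡ PV v
        pv-const u v lu lv eq with a u ≟ 0
        ... | yes z = trans (pv-inactive u z) (sym (pv-inactive v (trans (shareA v u lv lu eq) z)))
        ... | no nz = M₁.rconst u v lu nz lv eq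

        Frow : Fin n → Fin n → Bool
        Frow x y = (LEG x ≡ᵇ 2) ∧ ((LEG y ≡ᵇ 1) ∧ (POS y ≤ᵇ PV x))

        rowZ≡ : ∀ x y k → rowZ k (s₁ x) (s₁ y) ≡ (Frow x y ▷ k)
        rowZ≡ x y k = cong (_▷ k) (cong₂ _∧_ (cong (_≡ᵇ 2) (trans (cong leg (sh₁ x)) (legs x)))
          (cong₂ _∧_ (cong (_≡ᵇ 1) (trans (cong leg (sh₁ y)) (legs y))) (cong₂ _≤ᵇ_ (trans (cong pos (sh₁ y)) (poss y)) (cong pvP (sh₁ x)))))

        V₁ : Fin n → ℕ
        V₁ = recv (λ e → Frow (e₁ e) (e₂ e) ▷ w e) (λ e → Frow (e₂ e) (e₁ e) ▷ w e)

        p₂ : Capped s₂ × (∀ v → s₂ v ≡ setVal (s₁ v) (V₁ v))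
        p₂ = edge-set setVal (λ _ _ → refl) {rowZ} m₂ (proj₁ (proj₂ p₁)) (λ e → Frow (e₁ e) (e₂ e) ▷ w e) (λ e → Frow (e₂ e) (e₁ e) ▷ w e)
          (λ e → rowZ≡ (e₁ e) (e₂ e) (w e)) (λ e → rowZ≡ (e₂ e) (e₁ e) (w e)) (λ v → ≤-<-trans (recv≤ _ _ v) (two-sided Frow))

        sh₂ : ∀ v → s₂ v ≡ record (s₀ v) { pvP = PV v ; val = V₁ v }
        sh₂ v = trans (proj₂ p₂ v) (cong (λ m → record m { val = V₁ v }) (sh₁ v))

        ∑recv< : ∀ (F : Fin n → Fin n → Bool) → ∑ (recv (λ e → F (e₁ e) (e₂ e) ▷ w e) (λ e → F (e₂ e) (e₁ e) ▷ w e)) < 2 ^ K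
        ∑recv< F = subst (_< 2 ^ K) (sym (recv-sum (λ _ → true) (λ e → F (e₁ e) (e₂ e) ▷ w e) (λ e → F (e₂ e) (e₁ e) ▷ w e))) (two-sided F)

        recv-EW : ∀ (S : Fin n → Bool) (F : Fin n → Fin n → Bool) → ∑ (λ v → S v ▷ recv (λ e → F (e₁ e) (e₂ e) ▷ w e) (λ e → F (e₂ e) (e₁ e) ▷ w e) v) ≡ EW (λ x y → S x ∧ F x y)
        recv-EW S F = trans (recv-sum S (λ e → F (e₁ e) (e₂ e) ▷ w e) (λ e → F (e₂ e) (e₁ e) ▷ w e)) (∑-cong (λ e → cong₂ _+_ (nest (S (e₁ e)) (F (e₁ e) (e₂ e)) (w e)) (nest (S (e₂ e)) (F (e₂ e) (e₁ e)) (w e))))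
          where
          nest : ∀ x y z → (x ▷ (y ▷ z)) ≡ (x ∧ y ▷ z)
          nest true y z = refl
          nest false y z = refl

        module Suf₁ = Suffix T R rkd b V₁ conv (∑recv< Frow)

        st₂ : Suf₁.Start s₂
        st₂ = record
          { basis = record { capped = proj₁ p₂ ; legs = λ v → trans (cong leg (sh₂ v)) (legs v) ; ids = λ v → trans (cong nid (sh₂ v)) (ids v) }
          ; ranks = λ v → trans (cong rk (sh₂ v)) (ranks v) ; labs = λ v → cong bP (sh₂ v) ; vals = λ v → cong val (sh₂ v) }

        p₃ = Suf₁.suffix st₂ r₃

        A₁ : Fin n → ℕ
        A₁ = proj₁ (proj₂ p₃)

        sh₃ : ∀ v → s₃ v ≡ record (s₀ v) { pvP = PV v ; val = V₁ v ; acc = A₁ v }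
        sh₃ v = trans (proj₁ (proj₂ (proj₂ p₃)) v) (cong (λ m → record m { acc = A₁ v }) (sh₂ v))

        A₁-EW : ∀ v → LEG v ≢ 0 → A₁ v ≡ EW (λ x y → In v x ∧ Frow x y)
        A₁-EW v lv = trans (proj₂ (proj₂ (proj₂ p₃)) v lv) (recv-EW (In v) Frow)

        bool-ext : ∀ {x y} → (x ≡ true → y ≡ true) → (y ≡ true → x ≡ true) → x ≡ y
        bool-ext = true-ext

        -- The suffix sum sees only the columns of the rectangle. What is missing is the weight
        -- towards the columns below it, which is the same for all columns of the rectangle.
        row-W : ∀ j → LEG j ≡ 2 → W (PV j) (POS j) ≡ A₁ j + W (PV j) (q j)
        row-W j lj = begin
          W p (POS j) ≡⟨ W≡ p (POS j) ⟩
          EW (λ y x → inA 1 p y ∧ inA 2 (POS j) x) ≡⟨ sym (EW-flip (λ y x → inA 1 p y ∧ inA 2 (POS j) x)) ⟩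
          EW (λ x y → inA 1 p y ∧ inA 2 (POS j) x) ≡⟨ EW-add {λ x y → inA 1 p y ∧ inA 2 (POS j) x} {λ x y → inA 1 p y ∧ In j x} {λ x y → inA 1 p y ∧ inA 2 (q j) x} (λ x y → splits-∧ˡ (inA 1 p y) (Q-split j lj x)) ⟩
          EW (λ x y → inA 1 p y ∧ In j x) + EW (λ x y → inA 1 p y ∧ inA 2 (q j) x) ≡⟨ cong₂ _+_ (EW-cong {λ x y → inA 1 p y ∧ In j x} {λ x y → In j x ∧ Frow x y} (λ x y → bool-ext (fwd x y) (bwd x y))) (EW-flip (λ y x → inA 1 p y ∧ inA 2 (q j) x)) ⟩
          EW (λ x y → In j x ∧ Frow x y) + EW (λ y x → inA 1 p y ∧ inA 2 (q j) x) ≡⟨ cong₂ _+_ (sym (A₁-EW j (leg2≢0 lj))) (sym (W≡ p (q j))) ⟩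
          A₁ j + W p (q j) ∎
          where
          open ≡-Reasoning
          p = PV j
          fwd : ∀ x y → inA 1 p y ∧ In j x ≡ true → In j x ∧ Frow x y ≡ true
          fwd x y e = let (e₁' , e₂') = ∧-true {inA 1 p y} e
                          (ly , py) = inA-sound {1} {p} {y} e₁'
                          (lx , bx , _) = In-sound {j} {x} e₂' in
            cong₂ _∧_ e₂' (cong₂ _∧_ (≡ᵇ-true (trans lx lj)) (cong₂ _∧_ (≡ᵇ-true ly) (≤ᵇ-true (≤-trans py (≤-reflexive (pv-const j x (leg2≢0 lj) (leg2≢0 (trans lx lj)) bx))))))
          bwd : ∀ x y → In j x ∧ Frow x y ≡ true → inA 1 p y ∧ In j x ≡ true
          bwd x y e = let (e₁' , e₂') = ∧-true {In j x} e
                          (lx , bx , _) = In-sound {j} {x} e₁'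
                          (_ , e₃) = ∧-true {LEG x ≡ᵇ 2} e₂'
                          (ly , py) = ∧-true {LEG y ≡ᵇ 1} e₃ in
            cong₂ _∧_ (inA-true (≡ᵇ-sound ly) (≤-trans (≤ᵇ-sound {POS y} py) (≤-reflexive (sym (pv-const j x (leg2≢0 lj) (leg2≢0 (trans lx lj)) bx))))) e₁'

        A₁≤Ω : ∀ j → LEG j ≡ 2 → A₁ j ≤ Ω
        A₁≤Ω j lj = ≤-trans (≤-trans (m≤m+n (A₁ j) _) (≤-reflexive (sym (row-W j lj)))) (W≤Ω (PV j) (POS j))

        μ : Fin n → ℕ
        μ j = (H + 2 * A₁ j) ∸ X j

        measure≡ : ∀ j → LEG j ≡ 2 → ∀ x → x ≡ s₃ j → measure H x ≡ μ j
        measure≡ j lj _ refl = cong₂ (λ x y → (H + 2 * x) ∸ y) (cong acc (sh₃ j)) (trans (cong cut (sh₃ j)) (cuts j (leg2≢0 lj)))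

        2*Ω≤ : 2 * Ω ≤ 4 * Ω
        2*Ω≤ = *-monoˡ-≤ Ω {2} {4} (s≤s (s≤s z≤n))

        μ< : ∀ j → LEG j ≡ 2 → μ j < 2 ^ K
        μ< j lj = <-≤-trans (≤-<-trans (m∸n≤m (H + 2 * A₁ j) (X j)) (+-monoʳ-< H (≤-<-trans (≤-trans (*-monoʳ-≤ 2 (A₁≤Ω j lj)) 2*Ω≤) Ω<H))) H<K

        Ω<H' : Ω < H
        Ω<H' = ≤-<-trans Ω≤4Ω Ω<H

        X<H+ : ∀ j → X j < H + 2 * A₁ j
        X<H+ j = <-≤-trans (≤-<-trans (X≤Ω j) Ω<H') (m≤m+n H _)

        leg₃ : ∀ v → leg (s₃ v) ≡ LEG v
        leg₃ v = trans (cong leg (sh₃ v)) (legs v)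

        bestF-on : ∀ j → LEG j ≡ 2 → bestF H (s₃ j) ≡ μ j
        bestF-on j lj = trans (cong (_▷ measure H (s₃ j)) (≡ᵇ-true (trans (leg₃ j) lj))) (measure≡ j lj _ refl)

        bestF< : ∀ v → bestF H (s₃ v) < 2 ^ K
        bestF< v with leg (s₃ v) ≡ᵇ 2 in e
        ... | false = 1≤2^ K
        ... | true = subst (_< 2 ^ K) (sym (measure≡ v l _ refl)) (μ< v l)
          where
          l : LEG v ≡ 2
          l = trans (sym (leg₃ v)) (≡ᵇ-sound e)

        p₄ = max-set setTmp (λ _ _ → refl) m₄ (proj₁ p₃) bestF<

        agree₃ : Agree s₃
        agree₃ v = leg₃ v , cong act (sh₃ v) , cong bP (sh₃ v)

        module R₄ = Rect (maxI rectCon (bestF H) setTmp) s₃ (λ _ _ _ _ → refl) agree₃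
        module M₄ = R₄.RectMax {bestF H} {setTmp} refl (proj₁ p₄)

        τ : Fin n → ℕ
        τ = MaxSpec.Y (proj₁ p₄)

        sh₄ : ∀ v → s₄ v ≡ record (s₀ v) { pvP = PV v ; val = V₁ v ; acc = A₁ v ; tmp = τ v }
        sh₄ v = trans (proj₂ (proj₂ p₄) v) (cong (λ m → record m { tmp = τ v }) (sh₃ v))

        leg₄ : ∀ v → leg (s₄ v) ≡ LEG v
        leg₄ v = trans (cong leg (sh₄ v)) (legs v)

        agree₄ : Agree s₄
        agree₄ v = leg₄ v , cong act (sh₄ v) , cong bP (sh₄ v)

        τ-ub : ∀ u j → Act u → LEG j ≡ 2 → b j ≡ b u → μ j ≤ τ u
        τ-ub u j (lu , au) lj bj = subst (_≤ τ u) (bestF-on j lj) (M₄.rub u j lu au (leg2≢0 lj) bj)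

        -- Rows contribute `0` to this maximum, while every column has a positive measure; the
        -- witness edge guarantees that there is a column.
        τ-at : ∀ u → Act u → ∃ λ j → LEG j ≡ 2 × b j ≡ b u × τ u ≡ μ j
        τ-at u (lu , au) = aux (M₄.rat u lu au) (witness u lu au)
          where
          aux : (∃ λ v → LEG v ≢ 0 × b v ≡ b u × τ u ≡ bestF H (s₃ v)) → HasEdge b (b u) → ∃ λ j → LEG j ≡ 2 × b j ≡ b u × τ u ≡ μ j
          aux (v , lv , bv , e) (_ , _ , y , _ , _ , ly , _ , by) = v , l , bv , trans e (bestF-on v l)
            where
            nz : bestF H (s₃ v) ≢ 0
            nz z = <-irrefl refl (<-≤-trans (m<n⇒0<n∸m (X<H+ y)) (≤-trans (τ-ub u y (lu , au) ly by) (≤-reflexive (trans e z))))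
            l : LEG v ≡ 2
            l = trans (sym (leg₃ v)) (≡ᵇ-sound (▷-nz (leg (s₃ v) ≡ᵇ 2) nz))

        measure₄ : ∀ j → LEG j ≡ 2 → measure H (s₄ j) ≡ μ j
        measure₄ j lj = cong₂ (λ x y → (H + 2 * x) ∸ y) (cong acc (sh₄ j)) (trans (cong cut (sh₄ j)) (cuts j (leg2≢0 lj)))

        pickF-on : ∀ j → LEG j ≡ 2 → μ j ≡ τ j → pickF H (s₄ j) ≡ POS j
        pickF-on j lj e = trans (cong (_▷ pos (s₄ j)) (cong₂ _∧_ (≡ᵇ-true (trans (leg₄ j) lj)) (≡ᵇ-true (trans (measure₄ j lj) (trans e (sym (cong tmp (sh₄ j)))))))) (trans (cong pos (sh₄ j)) (poss j))

        pickF-off : ∀ v → pickF H (s₄ v) ≢ 0 → LEG v ≡ 2 × μ v ≡ τ v × pickF H (s₄ v) ≡ POS v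
        pickF-off v nz = l , e , pickF-on v l e
          where
          g = ∧-true {leg (s₄ v) ≡ᵇ 2} (▷-nz ((leg (s₄ v) ≡ᵇ 2) ∧ (measure H (s₄ v) ≡ᵇ tmp (s₄ v))) nz)
          l : LEG v ≡ 2
          l = trans (sym (leg₄ v)) (≡ᵇ-sound (proj₁ g))
          e : μ v ≡ τ v
          e = trans (sym (measure₄ v l)) (trans (≡ᵇ-sound (proj₂ g)) (cong tmp (sh₄ v)))

        p₅ = max-set setPvQ (λ _ _ → refl) m₅ (proj₁ (proj₂ p₄)) (λ v → gate< ((leg (s₄ v) ≡ᵇ 2) ∧ (measure H (s₄ v) ≡ᵇ tmp (s₄ v))) (subst (_< 2 ^ K) (sym (cong pos (sh₄ v))) (pos<' v)))

        module R₅ = Rect (maxI rectCon (pickF H) setPvQ) s₄ (λ _ _ _ _ → refl) agree₄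
        module M₅ = R₅.RectMax {pickF H} {setPvQ} refl (proj₁ p₅)

        PQ : Fin n → ℕ
        PQ = MaxSpec.Y (proj₁ p₅)

        sh₅ : ∀ v → s₅ v ≡ record (s₀ v) { pvP = PV v ; val = V₁ v ; acc = A₁ v ; tmp = τ v ; pvQ = PQ v }
        sh₅ v = trans (proj₂ (proj₂ p₅) v) (cong (λ m → record m { pvQ = PQ v }) (sh₄ v))

        record Star* (u j : Fin n) : Set where
          field
            lj : LEG j ≡ 2
            bj : b j ≡ b u
            pq : PQ u ≡ POS j
            maximal : ∀ j' → LEG j' ≡ 2 → b j' ≡ b u → μ j' ≤ μ j

        star : ∀ u → Act u → ∃ λ j → Star* u j
        star u act@(lu , au) = aux (M₅.rat u lu au) (τ-at u act)
          where
          aux : (∃ λ v → LEG v ≢ 0 × b v ≡ b u × PQ u ≡ pickF H (s₄ v)) → (∃ λ j → LEG j ≡ 2 × b j ≡ b u × τ u ≡ μ j) → ∃ λ j → Star* u j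
          aux (v , lv , bv , e) (j , lj , bj , ej) = v , record { lj = proj₁ off ; bj = bv ; pq = trans e (proj₂ (proj₂ off))
              ; maximal = λ j' lj' bj' → ≤-trans (τ-ub u j' act lj' bj') (≤-reflexive (trans (M₄.rconst u v lu au lv bv) (sym (proj₁ (proj₂ off))))) }
            where
            hit : POS j ≤ PQ u
            hit = subst (_≤ PQ u) (pickF-on j lj (trans (sym ej) (M₄.rconst u j lu au (leg2≢0 lj) bj))) (M₅.rub u j lu au (leg2≢0 lj) bj)
            off = pickF-off v (λ z → <-irrefl refl (<-≤-trans (POS≥1 j (leg2≢0 lj)) (≤-trans hit (≤-reflexive (trans e z)))))

        pq-const : ∀ u v → Act u → LEG v ≢ 0 → b v ≡ b u → PQ u ≡ PQ v
        pq-const u v (lu , au) lv eq = M₅.rconst u v lu au lv eq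

        -- Both sides contain the weight towards the columns below the rectangle, so comparing
        -- suffix sums compares values in the pivot row.
        optimal : ∀ {u j*} → Act u → Star* u j* → ∀ j → LEG j ≡ 2 → b j ≡ b u → X j* + 2 * W (PV u) (POS j) ≤ X j + 2 * W (PV u) (POS j*)
        optimal {u} {j*} act@(lu , au) st j lj bj = begin
          X j* + 2 * W p (POS j) ≡⟨ cong (λ x → X j* + 2 * x) (row j lj bj) ⟩
          X j* + 2 * (A₁ j + Wq) ≡⟨ solve 3 (λ x y z → x :+ cst 2 :* (y :+ z) := (cst 2 :* y :+ x) :+ cst 2 :* z) refl (X j*) (A₁ j) Wq ⟩
          (2 * A₁ j + X j*) + 2 * Wq ≤⟨ +-monoˡ-≤ (2 * Wq) main ⟩
          (2 * A₁ j* + X j) + 2 * Wq ≡⟨ solve 3 (λ x y z → (cst 2 :* y :+ x) :+ cst 2 :* z := x :+ cst 2 :* (y :+ z)) refl (X j) (A₁ j*) Wq ⟩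
          X j + 2 * (A₁ j* + Wq) ≡⟨ cong (λ x → X j + 2 * x) (sym (row j* (Star*.lj st) (Star*.bj st))) ⟩
          X j + 2 * W p (POS j*) ∎
          where
          open ≤-Reasoning
          open +-*-Solver renaming (con to cst)
          p = PV u
          Wq = W p (q u)
          row : ∀ j → LEG j ≡ 2 → b j ≡ b u → W p (POS j) ≡ A₁ j + Wq
          row j lj bj = trans (cong (λ x → W x (POS j)) pe) (trans (row-W j lj) (cong₂ (λ x y → A₁ j + W x y) (sym pe) (shareQ j u (leg2≢0 lj) lu bj)))
            where
            pe : p ≡ PV j
            pe = pv-const u j lu (leg2≢0 lj) bj
          main : 2 * A₁ j + X j* ≤ 2 * A₁ j* + X j
          main = +-cancelˡ-≤ H _ _ (begin
            H + (2 * A₁ j + X j*) ≡⟨ sym (+-assoc H _ _) ⟩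
            (H + 2 * A₁ j) + X j* ≡⟨ cong (_+ X j*) (sym (m∸n+n≡m (<⇒≤ (X<H+ j)))) ⟩
            (μ j + X j) + X j* ≤⟨ +-monoˡ-≤ (X j*) (+-monoˡ-≤ (X j) (Star*.maximal st j lj bj)) ⟩
            (μ j* + X j) + X j* ≡⟨ solve 3 (λ x y z → (x :+ y) :+ z := (x :+ z) :+ y) refl (μ j*) (X j) (X j*) ⟩
            (μ j* + X j*) + X j ≡⟨ cong (_+ X j) (m∸n+n≡m (<⇒≤ (X<H+ j*))) ⟩
            (H + 2 * A₁ j*) + X j ≡⟨ +-assoc H _ _ ⟩
            H + (2 * A₁ j* + X j) ∎)

        leg₅ : ∀ v → leg (s₅ v) ≡ LEG v
        leg₅ v = trans (cong leg (sh₅ v)) (legs v)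

        agree₅ : Agree s₅
        agree₅ v = leg₅ v , cong act (sh₅ v) , cong bP (sh₅ v)

        cut<' : ∀ v → cut (s₀ v) < 2 ^ K
        cut<' v = subst (_< 2 ^ K) (cong cut (capped v)) (cap< K (cut (s₀ v)))

        p₆ = max-set setCQ (λ _ _ → refl) m₆ (proj₁ (proj₂ p₅)) (λ v → gate< ((leg (s₅ v) ≡ᵇ 2) ∧ (pos (s₅ v) ≡ᵇ pvQ (s₅ v))) (subst (_< 2 ^ K) (sym (cong cut (sh₅ v))) (cut<' v)))

        module R₆ = Rect (maxI rectCon cQF setCQ) s₅ (λ _ _ _ _ → refl) agree₅
        module M₆ = R₆.RectMax {cQF} {setCQ} refl (proj₁ p₆)

        XQ : Fin n → ℕ
        XQ = MaxSpec.Y (proj₁ p₆)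

        sh₆ : ∀ v → s₆ v ≡ record (s₀ v) { pvP = PV v ; val = V₁ v ; acc = A₁ v ; tmp = τ v ; pvQ = PQ v ; cQ = XQ v }
        sh₆ v = trans (proj₂ (proj₂ p₆) v) (cong (λ m → record m { cQ = XQ v }) (sh₅ v))

        XQ≡ : ∀ {u j*} → Act u → Star* u j* → XQ u ≡ X j*
        XQ≡ {u} {j*} act@(lu , au) st = ≤-antisym upper lower
          where
          open Star* st
          on : cQF (s₅ j*) ≡ X j*
          on = trans (cong (_▷ cut (s₅ j*)) (cong₂ _∧_ (≡ᵇ-true (trans (leg₅ j*) lj)) (≡ᵇ-true (trans (cong pos (sh₅ j*)) (trans (poss j*) (trans (sym pq) (trans (pq-const u j* act (leg2≢0 lj) bj) (sym (cong pvQ (sh₅ j*))))))))))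
            (trans (cong cut (sh₅ j*)) (cuts j* (leg2≢0 lj)))
          lower : X j* ≤ XQ u
          lower = subst (_≤ XQ u) on (M₆.rub u j* lu au (leg2≢0 lj) bj)
          upper : XQ u ≤ X j*
          upper = aux (M₆.rat u lu au)
            where
            aux : (∃ λ v → LEG v ≢ 0 × b v ≡ b u × XQ u ≡ cQF (s₅ v)) → XQ u ≤ X j*
            aux (v , lv , bv , e) = go ((leg (s₅ v) ≡ᵇ 2) ∧ (pos (s₅ v) ≡ᵇ pvQ (s₅ v))) refl
              where
              go : ∀ β → ((leg (s₅ v) ≡ᵇ 2) ∧ (pos (s₅ v) ≡ᵇ pvQ (s₅ v))) ≡ β → XQ u ≤ X j*
              go false g = ≤-trans (≤-reflexive (trans e (cong (_▷ cut (s₅ v)) g))) z≤n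
              go true g = ≤-reflexive (trans e (trans (cong (λ x → cQF (s₅ x)) v≡) on))
                where
                g' = ∧-true {leg (s₅ v) ≡ᵇ 2} g
                l : LEG v ≡ 2
                l = trans (sym (leg₅ v)) (≡ᵇ-sound (proj₁ g'))
                v≡ : v ≡ j*
                v≡ = POS-inj v j* (trans l (sym lj)) (trans (sym (trans (cong pos (sh₅ v)) (poss v))) (trans (≡ᵇ-sound (proj₂ g')) (trans (cong pvQ (sh₅ v)) (trans (sym (pq-const u v act lv bv)) pq))))

        Fcol : Fin n → Fin n → Bool
        Fcol x y = if LEG x ≡ᵇ 1 then (LEG y ≡ᵇ 2) ∧ (POS y ≤ᵇ PQ x)
                   else (LEG x ≡ᵇ 2) ∧ ((LEG y ≡ᵇ 1) ∧ ((POS y ≤ᵇ b x) ∧ (POS x ≤ᵇ PQ x)))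

        leg₆ : ∀ v → leg (s₆ v) ≡ LEG v
        leg₆ v = trans (cong leg (sh₆ v)) (legs v)
        pos₆ : ∀ v → pos (s₆ v) ≡ POS v
        pos₆ v = trans (cong pos (sh₆ v)) (poss v)
        pvQ₆ : ∀ v → pvQ (s₆ v) ≡ PQ v
        pvQ₆ v = cong pvQ (sh₆ v)

        colZ≡ : ∀ x y k → colZ k (s₆ x) (s₆ y) ≡ (Fcol x y ▷ k)
        colZ≡ x y k = cong (_▷ k) (cong₃ (λ c d f → if c then d else f) (cong (_≡ᵇ 1) (leg₆ x))
          (cong₂ _∧_ (cong (_≡ᵇ 2) (leg₆ y)) (cong₂ _≤ᵇ_ (pos₆ y) (pvQ₆ x)))
          (cong₂ _∧_ (cong (_≡ᵇ 2) (leg₆ x)) (cong₂ _∧_ (cong (_≡ᵇ 1) (leg₆ y)) (cong₂ _∧_ (cong₂ _≤ᵇ_ (pos₆ y) (cong bP (sh₆ x))) (cong₂ _≤ᵇ_ (pos₆ x) (pvQ₆ x))))))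
          where
          cong₃ : ∀ {A B C D : Set} (f : A → B → C → D) {x x' y y' z z'} → x ≡ x' → y ≡ y' → z ≡ z' → f x y z ≡ f x' y' z'
          cong₃ f refl refl refl = refl

        V₂ : Fin n → ℕ
        V₂ = recv (λ e → Fcol (e₁ e) (e₂ e) ▷ w e) (λ e → Fcol (e₂ e) (e₁ e) ▷ w e)

        p₇ : Capped s₇ × (∀ v → s₇ v ≡ setVal (s₆ v) (V₂ v))
        p₇ = edge-set setVal (λ _ _ → refl) {colZ} m₇ (proj₁ (proj₂ p₆)) (λ e → Fcol (e₁ e) (e₂ e) ▷ w e) (λ e → Fcol (e₂ e) (e₁ e) ▷ w e)
          (λ e → colZ≡ (e₁ e) (e₂ e) (w e)) (λ e → colZ≡ (e₂ e) (e₁ e) (w e)) (λ v → ≤-<-trans (recv≤ _ _ v) (two-sided Fcol))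

        sh₇ : ∀ v → s₇ v ≡ record (s₀ v) { pvP = PV v ; val = V₂ v ; acc = A₁ v ; tmp = τ v ; pvQ = PQ v ; cQ = XQ v }
        sh₇ v = trans (proj₂ p₇ v) (cong (λ m → record m { val = V₂ v }) (sh₆ v))

        leg₇ : ∀ v → leg (s₇ v) ≡ LEG v
        leg₇ v = trans (cong leg (sh₇ v)) (legs v)

        agree₇ : Agree s₇
        agree₇ v = leg₇ v , cong act (sh₇ v) , cong bP (sh₇ v)

        ofsF≡ : ∀ v → ofsF (s₇ v) ≡ ((LEG v ≡ᵇ 2) ▷ V₂ v)
        ofsF≡ v = cong₂ (λ x y → (x ≡ᵇ 2) ▷ y) (leg₇ v) (cong val (sh₇ v))

        p₈ = sum-set setOfs (λ _ _ → refl) m₈ (proj₁ p₇) (≤-<-trans (∑-≤ (λ v → ≤-trans (≤-reflexive (ofsF≡ v)) (▷w≤ (LEG v ≡ᵇ 2) (V₂ v)))) (∑recv< Fcol))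

        module S₈ = SumSpec (proj₁ p₈)
        module R₈ = Rect (sumI rectCon ofsF setOfs) s₇ (λ _ _ _ _ → refl) agree₇

        OF : Fin n → ℕ
        OF v = ∑ (λ u → S₈.same v u ▷ ofsF (s₇ u))

        sh₈ : ∀ v → s₈ v ≡ record (s₀ v) { pvP = PV v ; val = V₂ v ; acc = A₁ v ; tmp = τ v ; pvQ = PQ v ; cQ = XQ v ; ofs = OF v }
        sh₈ v = trans (proj₂ (proj₂ p₈) v) (cong (λ m → record m { ofs = OF v }) (sh₇ v))

        OF-EW : ∀ v → OF v ≡ EW (λ x y → (S₈.same v x ∧ (LEG x ≡ᵇ 2)) ∧ Fcol x y)
        OF-EW v = trans (∑-cong (λ u → trans (cong (S₈.same v u ▷_) (ofsF≡ u)) (nest (S₈.same v u) (LEG u ≡ᵇ 2) (V₂ u)))) (recv-EW (λ x → S₈.same v x ∧ (LEG x ≡ᵇ 2)) Fcol)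
          where
          nest : ∀ x y z → (x ▷ (y ▷ z)) ≡ (x ∧ y ▷ z)
          nest true y z = refl
          nest false y z = refl

        Fcol-Q : ∀ {x y} → LEG x ≡ 2 → Fcol x y ≡ (LEG y ≡ᵇ 1) ∧ ((POS y ≤ᵇ b x) ∧ (POS x ≤ᵇ PQ x))
        Fcol-Q {x} {y} l = cong (λ z → if z ≡ᵇ 1 then (LEG y ≡ᵇ 2) ∧ (POS y ≤ᵇ PQ x) else (z ≡ᵇ 2) ∧ ((LEG y ≡ᵇ 1) ∧ ((POS y ≤ᵇ b x) ∧ (POS x ≤ᵇ PQ x)))) l

        Fcol-P : ∀ {x y} → LEG x ≡ 1 → Fcol x y ≡ (LEG y ≡ᵇ 2) ∧ (POS y ≤ᵇ PQ x)
        Fcol-P {x} {y} l = cong (λ z → if z ≡ᵇ 1 then (LEG y ≡ᵇ 2) ∧ (POS y ≤ᵇ PQ x) else (z ≡ᵇ 2) ∧ ((LEG y ≡ᵇ 1) ∧ ((POS y ≤ᵇ b x) ∧ (POS x ≤ᵇ PQ x)))) l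

        ofs-W : ∀ u → Act u → W (b u) (PQ u) ≡ OF u + W (b u) (q u)
        ofs-W u act@(lu , au) = begin
          W p (PQ u) ≡⟨ cong (W p) pq ⟩
          W p (POS j) ≡⟨ W≡ p (POS j) ⟩
          EW (λ y x → inA 1 p y ∧ inA 2 (POS j) x) ≡⟨ sym (EW-flip (λ y x → inA 1 p y ∧ inA 2 (POS j) x)) ⟩
          EW (λ x y → inA 1 p y ∧ inA 2 (POS j) x) ≡⟨ EW-add {λ x y → inA 1 p y ∧ inA 2 (POS j) x} {λ x y → inA 1 p y ∧ In j x} {λ x y → inA 1 p y ∧ inA 2 (q j) x} (λ x y → splits-∧ˡ (inA 1 p y) (Q-split j lj x)) ⟩
          EW (λ x y → inA 1 p y ∧ In j x) + EW (λ x y → inA 1 p y ∧ inA 2 (q j) x) ≡⟨ cong₂ _+_ (EW-cong {λ x y → inA 1 p y ∧ In j x} {λ x y → (S₈.same u x ∧ (LEG x ≡ᵇ 2)) ∧ Fcol x y} (λ x y → bool-ext (fwd x y) (bwd x y))) (EW-flip (λ y x → inA 1 p y ∧ inA 2 (q j) x)) ⟩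
          EW (λ x y → (S₈.same u x ∧ (LEG x ≡ᵇ 2)) ∧ Fcol x y) + EW (λ y x → inA 1 p y ∧ inA 2 (q j) x) ≡⟨ cong₂ _+_ (sym (OF-EW u)) (trans (sym (W≡ p (q j))) (cong (W p) (shareQ j u (leg2≢0 lj) lu bj))) ⟩
          OF u + W p (q u) ∎
          where
          open ≡-Reasoning
          p = b u
          j = proj₁ (star u act)
          open Star* (proj₂ (star u act))
          fwd : ∀ x y → inA 1 p y ∧ In j x ≡ true → (S₈.same u x ∧ (LEG x ≡ᵇ 2)) ∧ Fcol x y ≡ true
          fwd x y e = let (e₁' , e₂') = ∧-true {inA 1 p y} e
                          (ly , py) = inA-sound {1} {p} {y} e₁'
                          (lx , bx , px) = In-sound {j} {x} e₂'
                          l2 = trans lx lj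
                          bu = trans bx bj in
            cong₂ _∧_ (cong₂ _∧_ (from (S₈.same⇔ u x) (R₈.rect← lu au (leg2≢0 l2) bu)) (≡ᵇ-true l2))
              (trans (Fcol-Q {x} {y} l2) (cong₂ _∧_ (≡ᵇ-true ly) (cong₂ _∧_ (≤ᵇ-true (≤-trans py (≤-reflexive (sym bu)))) (≤ᵇ-true (≤-trans px (≤-reflexive (trans (sym pq) (pq-const u x act (leg2≢0 l2) bu))))))))
          bwd : ∀ x y → (S₈.same u x ∧ (LEG x ≡ᵇ 2)) ∧ Fcol x y ≡ true → inA 1 p y ∧ In j x ≡ true
          bwd x y e = let (e₁' , e₂') = ∧-true {S₈.same u x ∧ (LEG x ≡ᵇ 2)} e
                          (sm , lx) = ∧-true {S₈.same u x} e₁'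
                          l2 = ≡ᵇ-sound lx
                          (_ , _ , bu) = R₈.rect→ lu au (to (S₈.same⇔ u x) sm)
                          e₃ = trans (sym (Fcol-Q {x} {y} l2)) e₂'
                          (ly , e₄) = ∧-true {LEG y ≡ᵇ 1} e₃
                          (py , px) = ∧-true {POS y ≤ᵇ b x} e₄ in
            cong₂ _∧_ (inA-true (≡ᵇ-sound ly) (≤-trans (≤ᵇ-sound {POS y} py) (≤-reflexive bu)))
              (In-true (trans l2 (sym lj)) (trans bu (sym bj)) (≤-trans (≤ᵇ-sound {POS x} px) (≤-reflexive (trans (sym (pq-const u x act (leg2≢0 l2) bu)) pq))))

        module Suf₂ = Suffix T R rkd b V₂ conv (∑recv< Fcol)

        st₈ : Suf₂.Start s₈
        st₈ = record
          { basis = record { capped = proj₁ (proj₂ p₈) ; legs = λ v → trans (cong leg (sh₈ v)) (legs v) ; ids = λ v → trans (cong nid (sh₈ v)) (ids v) }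
          ; ranks = λ v → trans (cong rk (sh₈ v)) (ranks v) ; labs = λ v → cong bP (sh₈ v) ; vals = λ v → cong val (sh₈ v) }

        p₉ = Suf₂.suffix st₈ r₉

        A₂ : Fin n → ℕ
        A₂ = proj₁ (proj₂ p₉)

        sh₉ : ∀ v → s₉ v ≡ record (s₀ v) { pvP = PV v ; val = V₂ v ; acc = A₂ v ; tmp = τ v ; pvQ = PQ v ; cQ = XQ v ; ofs = OF v }
        sh₉ v = trans (proj₁ (proj₂ (proj₂ p₉)) v) (cong (λ m → record m { acc = A₂ v }) (sh₈ v))

        -- Three disjoint blocks: rows below the rectangle against columns below it; the same rows
        -- against the columns of the rectangle up to the best one; and rows of the rectangle up to
        -- `i` against all columns up to the best one.
        total-W : ∀ i → LEG i ≡ 1 → Act i → k i + OF i + A₂ i ≡ W (POS i) (PQ i)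
        total-W i li act@(lu , au) = sym (begin
          W (POS i) (PQ i) ≡⟨ W≡ (POS i) (PQ i) ⟩
          EW (λ x y → inA 1 (POS i) x ∧ inA 2 (PQ i) y) ≡⟨ EW-add {λ x y → inA 1 (POS i) x ∧ inA 2 (PQ i) y} {λ x y → In i x ∧ inA 2 (PQ i) y} {λ x y → inA 1 (b i) x ∧ inA 2 (PQ i) y}
              (λ x y → splits-∧ʳ {inA 1 (POS i) x} {In i x} {inA 1 (b i) x} (inA 2 (PQ i) y) (P-split i li x)) ⟩
          EW (λ x y → In i x ∧ inA 2 (PQ i) y) + EW (λ x y → inA 1 (b i) x ∧ inA 2 (PQ i) y) ≡⟨ cong₂ _+_ (trans (EW-cong {λ x y → In i x ∧ inA 2 (PQ i) y} {λ x y → In i x ∧ Fcol x y} in≡) (sym (trans (proj₂ (proj₂ (proj₂ p₉)) i lu) (recv-EW (In i) Fcol)))) (sym (W≡ (b i) (PQ i))) ⟩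
          A₂ i + W (b i) (PQ i) ≡⟨ cong (A₂ i +_) (trans (ofs-W i act) (trans (+-comm (OF i) _) (cong (_+ OF i) (sym (kapW i lu))))) ⟩
          A₂ i + (k i + OF i) ≡⟨ +-comm (A₂ i) _ ⟩
          k i + OF i + A₂ i ∎)
          where
          open ≡-Reasoning
          in≡ : ∀ x y → In i x ∧ inA 2 (PQ i) y ≡ In i x ∧ Fcol x y
          in≡ x y = bool-ext
            (λ e → let (e₁' , e₂') = ∧-true {In i x} e; (l1 , pc) = cls x e₁'; (ly , py) = inA-sound {2} {PQ i} {y} e₂' in
              cong₂ _∧_ e₁' (trans (Fcol-P {x} {y} l1) (cong₂ _∧_ (≡ᵇ-true ly) (≤ᵇ-true (≤-trans py (≤-reflexive pc))))))
            (λ e → let (e₁' , e₂') = ∧-true {In i x} e; (l1 , pc) = cls x e₁'; (ly , py) = ∧-true {LEG y ≡ᵇ 2} (trans (sym (Fcol-P {x} {y} l1)) e₂') in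
              cong₂ _∧_ e₁' (inA-true (≡ᵇ-sound ly) (≤-trans (≤ᵇ-sound {POS y} py) (≤-reflexive (sym pc)))))
            where
            cls : ∀ x → In i x ≡ true → LEG x ≡ 1 × PQ i ≡ PQ x
            cls x e = let (lx , bx , _) = In-sound {i} {x} e in trans lx li , pq-const i x act (leg1≢0 (trans lx li)) bx

        β' : Fin n → ℕ
        β' v = best (recU (s₉ v))

        β'≤ : ∀ v → β' v ≤ best (s₀ v)
        β'≤ v = ≤-trans (aux ((leg (s₉ v) ≡ᵇ 1) ∧ not (pvP (s₉ v) ≡ᵇ 0))) (≤-reflexive (cong best (sh₉ v)))
          where
          aux : ∀ x {y} → (if x then best (s₉ v) ⊓ y else best (s₉ v)) ≤ best (s₉ v)
          aux true {y} = m⊓n≤m (best (s₉ v)) y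
          aux false = ≤-refl

        best< : ∀ v → best (s₀ v) < 2 ^ K
        best< v = subst (_< 2 ^ K) (cong best (capped v)) (cap< K (best (s₀ v)))

        p₁₀ : Capped s × (∀ v → s v ≡ record (s₉ v) { best = β' v })
        p₁₀ = local-set (λ m x → record m { best = x }) (λ _ _ → refl) {recU} β' m₁₀ (proj₁ p₉) (λ v → refl) (λ v → ≤-<-trans (β'≤ v) (best< v))

        sh : ∀ v → s v ≡ record (s₀ v) { pvP = PV v ; val = V₂ v ; acc = A₂ v ; tmp = τ v ; pvQ = PQ v ; cQ = XQ v ; ofs = OF v ; best = β' v }
        sh v = trans (proj₂ p₁₀ v) (cong (λ m → record m { best = β' v }) (sh₉ v))

        cost : ∀ {i j*} → LEG i ≡ 1 → Act i → Star* i j* → (cut (s₉ i) + cQ (s₉ i)) ∸ 2 * (kap (s₉ i) + ofs (s₉ i) + acc (s₉ i)) ≡ C i j*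
        cost {i} {j*} li act st = trans (cong₂ (λ x y → x ∸ 2 * y)
            (cong₂ _+_ (trans (cong cut (sh₉ i)) (cuts i (proj₁ act))) (trans (cong cQ (sh₉ i)) (XQ≡ act st)))
            (trans (cong₂ _+_ (cong₂ _+_ (cong kap (sh₉ i)) (cong ofs (sh₉ i))) (cong acc (sh₉ i))) (trans (total-W i li act) (cong (W (POS i)) (Star*.pq st)))))
          (trans (cong (_∸ 2 * W (POS i) (POS j*)) (sym (C-split i j* li (Star*.lj st)))) (m+n∸n≡m (C i j*) (2 * W (POS i) (POS j*))))

        β'-case : ∀ v → LEG v ≢ 0 → (β' v ≡ best (s₀ v)) ⊎ (∃ λ j → LEG v ≡ 1 × LEG j ≡ 2 × β' v ≡ best (s₀ v) ⊓ C v j)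
        β'-case v lv = aux ((leg (s₉ v) ≡ᵇ 1) ∧ not (pvP (s₉ v) ≡ᵇ 0)) refl
          where
          aux : ∀ x → ((leg (s₉ v) ≡ᵇ 1) ∧ not (pvP (s₉ v) ≡ᵇ 0)) ≡ x → (β' v ≡ best (s₀ v)) ⊎ (∃ λ j → LEG v ≡ 1 × LEG j ≡ 2 × β' v ≡ best (s₀ v) ⊓ C v j)
          aux false e = inj₁ (trans (cong (λ x → if x then best (s₉ v) ⊓ ((cut (s₉ v) + cQ (s₉ v)) ∸ 2 * (kap (s₉ v) + ofs (s₉ v) + acc (s₉ v))) else best (s₉ v)) e) (cong best (sh₉ v)))
          aux true e = inj₂ (j , l , Star*.lj st , trans (cong (λ x → if x then best (s₉ v) ⊓ ((cut (s₉ v) + cQ (s₉ v)) ∸ 2 * (kap (s₉ v) + ofs (s₉ v) + acc (s₉ v))) else best (s₉ v)) e) (cong₂ _⊓_ (cong best (sh₉ v)) (cost l ac st)))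
            where
            g = ∧-true {leg (s₉ v) ≡ᵇ 1} e
            l : LEG v ≡ 1
            l = trans (sym (trans (cong leg (sh₉ v)) (legs v))) (≡ᵇ-sound (proj₁ g))
            ac : Act v
            ac = pv-act v lv (λ z → nonzero-sound (proj₂ g) (trans (cong pvP (sh₉ v)) z))
            j = proj₁ (star v ac)
            st = proj₂ (star v ac)

        recorded : ∀ {i j*} → LEG i ≡ 1 → PV i ≢ 0 → Act i → Star* i j* → β' i ≤ C i j*
        recorded {i} {j*} li nz act st = ≤-trans (≤-reflexive (cong (λ x → if x then best (s₉ i) ⊓ ((cut (s₉ i) + cQ (s₉ i)) ∸ 2 * (kap (s₉ i) + ofs (s₉ i) + acc (s₉ i))) else best (s₉ i))
            (cong₂ _∧_ (≡ᵇ-true (trans (cong leg (sh₉ i)) (trans (legs i) li))) (nonzero-true (λ z → nz (trans (sym (cong pvP (sh₉ i))) z))))))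
          (≤-trans (m⊓n≤n (best (s₉ i)) _) (≤-reflexive (cost li act st)))

        bests' : Bests (λ v → best (s v))
        bests' = record { bestX = λ v lv → ≤-trans (≤-reflexive (cong best (sh v))) (≤-trans (β'≤ v) (Bests.bestX bests v lv)) ; sound = λ v lv → subst IsCut (sym (cong best (sh v))) (snd v lv (β'-case v lv)) }
          where
          snd : ∀ v → LEG v ≢ 0 → (β' v ≡ best (s₀ v)) ⊎ (∃ λ j → LEG v ≡ 1 × LEG j ≡ 2 × β' v ≡ best (s₀ v) ⊓ C v j) → IsCut (β' v)
          snd v lv (inj₁ e) = subst IsCut (sym e) (Bests.sound bests v lv)
          snd v lv (inj₂ (j , l1 , l2 , e)) with ⊓-sel (best (s₀ v)) (C v j)
          ... | inj₁ x = subst IsCut (sym (trans e x)) (Bests.sound bests v lv)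
          ... | inj₂ x = inj₂ (v , j , l1 , l2 , trans e x)

      record Column (s₀ s : State) (PV PQ : Fin n → ℕ) (u j : Fin n) : Set where
        field
          lj : LEG j ≡ 2
          bj : bP (s₀ j) ≡ bP (s₀ u)
          pq : PQ u ≡ POS j
          opt : ∀ j' → LEG j' ≡ 2 → bP (s₀ j') ≡ bP (s₀ u) → X j + 2 * W (PV u) (POS j') ≤ X j' + 2 * W (PV u) (POS j)
          rec : ∀ i → LEG i ≡ 1 → bP (s₀ i) ≡ bP (s₀ u) → PV i ≢ 0 → best (s i) ≤ C i j

      -- The interface of a pass, which hides its intermediate states.
      record CoreResult (t : ℕ) (s₀ s : State) : Set where
        field
          PV PQ : Fin n → ℕ
          capd : Capped s
          pv-ub : ∀ u i → LEG u ≢ 0 → act (s₀ u) ≢ 0 → LEG i ≡ 1 → bP (s₀ i) ≡ bP (s₀ u) → t ≡ 0 ⊎ R i ≡ t → POS i ≤ PV u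
          pv-act : ∀ u → LEG u ≢ 0 → PV u ≢ 0 → act (s₀ u) ≢ 0
          pv-at : ∀ u → LEG u ≢ 0 → PV u ≢ 0 → ∃ λ i → LEG i ≡ 1 × bP (s₀ i) ≡ bP (s₀ u) × (t ≡ 0 ⊎ R i ≡ t) × PV u ≡ POS i
          pv-const : ∀ u v → LEG u ≢ 0 → LEG v ≢ 0 → bP (s₀ v) ≡ bP (s₀ u) → PV u ≡ PV v
          pq-const : ∀ u v → LEG u ≢ 0 → act (s₀ u) ≢ 0 → LEG v ≢ 0 → bP (s₀ v) ≡ bP (s₀ u) → PQ u ≡ PQ v
          column : ∀ u → LEG u ≢ 0 → act (s₀ u) ≢ 0 → ∃ λ j → Column s₀ s PV PQ u j
          total-W : ∀ i → LEG i ≡ 1 → act (s₀ i) ≢ 0 → kap (s i) + ofs (s i) + acc (s i) ≡ W (POS i) (PQ i)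
          bests' : Bests (λ v → best (s v))
          best≤ : ∀ v → best (s v) ≤ best (s₀ v)
          r-leg : ∀ v → leg (s v) ≡ leg (s₀ v)
          r-nid : ∀ v → nid (s v) ≡ nid (s₀ v)
          r-rk : ∀ v → rk (s v) ≡ rk (s₀ v)
          r-pos : ∀ v → pos (s v) ≡ pos (s₀ v)
          r-cut : ∀ v → cut (s v) ≡ cut (s₀ v)
          r-bP : ∀ v → bP (s v) ≡ bP (s₀ v)
          r-bQ : ∀ v → bQ (s v) ≡ bQ (s₀ v)
          r-kap : ∀ v → kap (s v) ≡ kap (s₀ v)
          r-act : ∀ v → act (s v) ≡ act (s₀ v)
          r-pvP : ∀ v → pvP (s v) ≡ PV v
          r-pvQ : ∀ v → pvQ (s v) ≡ PQ v

      core-result : ∀ {t s₀ s} → LInv t s₀ → Run K (coreProg H T t) s₀ s → CoreResult t s₀ s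
      core-result {t} {s₀} {s} inv (m₁ ∷ m₂ ∷ r) = first (Run-++ (sufProg T) r)
        where
        last' : ∀ {s₁ s₂ s₃ s₄ s₅ s₆ s₇ s₈} →
          MaxSem K (maxI rectCon (pivF t) setPvP) s₀ s₁ → SumSem K (edgeI rowZ setVal) s₁ s₂ → Run K (sufProg T) s₂ s₃ →
          MaxSem K (maxI rectCon (bestF H) setTmp) s₃ s₄ → MaxSem K (maxI rectCon (pickF H) setPvQ) s₄ s₅ →
          MaxSem K (maxI rectCon cQF setCQ) s₅ s₆ → SumSem K (edgeI colZ setVal) s₆ s₇ → SumSem K (sumI rectCon ofsF setOfs) s₇ s₈ →
          (∃ λ s₉ → Run K (sufProg T) s₈ s₉ × Run K (localI recU ∷ []) s₉ s) → CoreResult t s₀ s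
        last' m₁ m₂ r₃ m₄ m₅ m₆ m₇ m₈ (s₉ , r₉ , (m₁₀ ∷ [])) = record
          { PV = PV ; PQ = PQ ; capd = proj₁ p₁₀
          ; pv-ub = λ u i lu au → pv-ub u i (lu , au)
          ; pv-act = λ u lu nz → proj₂ (CoreSteps.pv-act t s₀ inv m₁ m₂ r₃ m₄ m₅ m₆ m₇ m₈ r₉ m₁₀ u lu nz)
          ; pv-at = pv-at ; pv-const = pv-const
          ; pq-const = λ u v lu au → pq-const u v (lu , au)
          ; column = λ u lu au → let (j , st) = star u (lu , au) in j , record
              { lj = Star*.lj st ; bj = Star*.bj st ; pq = Star*.pq st ; opt = optimal (lu , au) st
              ; rec = λ i li bi nz → subst (_≤ C i j) (sym (cong best (sh i))) (recorded li nz (act-class (lu , au) (leg1≢0 li) bi) (shift (lu , au) st (leg1≢0 li) bi)) }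
          ; total-W = λ i li ai → trans (cong₂ _+_ (cong₂ _+_ (cong kap (sh i)) (cong ofs (sh i))) (cong acc (sh i))) (total-W i li (leg1≢0 li , ai))
          ; bests' = bests' ; best≤ = λ v → ≤-trans (≤-reflexive (cong best (sh v))) (β'≤ v)
          ; r-leg = λ v → cong leg (sh v) ; r-nid = λ v → cong nid (sh v) ; r-rk = λ v → cong rk (sh v) ; r-pos = λ v → cong pos (sh v)
          ; r-cut = λ v → cong cut (sh v) ; r-bP = λ v → cong bP (sh v) ; r-bQ = λ v → cong bQ (sh v) ; r-kap = λ v → cong kap (sh v)
          ; r-act = λ v → cong act (sh v) ; r-pvP = λ v → cong pvP (sh v) ; r-pvQ = λ v → cong pvQ (sh v) }
          where
          open CoreSteps t s₀ inv m₁ m₂ r₃ m₄ m₅ m₆ m₇ m₈ r₉ m₁₀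
          shift : ∀ {u j i} → Act u → Star* u j → LEG i ≢ 0 → bP (s₀ i) ≡ bP (s₀ u) → Star* i j
          shift {u} {j} {i} ac st li bi = record { lj = Star*.lj st ; bj = trans (Star*.bj st) (sym bi)
            ; pq = trans (sym (pq-const u i ac li bi)) (Star*.pq st) ; maximal = λ j' lj' bj' → Star*.maximal st j' lj' (trans bj' bi) }
        first : (∃ λ s₃ → Run K (sufProg T) _ s₃ × Run K (coreTail H T) s₃ s) → CoreResult t s₀ s
        first (s₃ , r₃ , (m₄ ∷ m₅ ∷ m₆ ∷ m₇ ∷ m₈ ∷ r')) = last' m₁ m₂ r₃ m₄ m₅ m₆ m₇ m₈ (Run-++ (sufProg T) r')

      -- In the last pass every rectangle has a single row, which is its own pivot.
      final-pass : ∀ {s₀ s} → LInv 0 s₀ → CoreResult 0 s₀ s → ∀ i j → LEG i ≡ 1 → LEG j ≡ 2 → Below (λ v → best (s v)) (C i j)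
      final-pass {s₀} {s} inv cr i j li lj = aux (covered i j li lj)
        where
        open LInv inv
        open Labels labels
        open CoreResult cr
        aux : Below (λ v → best (s₀ v)) (C i j) ⊎ (bP (s₀ i) ≡ bP (s₀ j) × act (s₀ i) ≢ 0) → Below (λ v → best (s v)) (C i j)
        aux (inj₁ (v , lv , le)) = v , lv , ≤-trans (best≤ v) le
        aux (inj₂ (bij , ai)) = i , i≢0 , ≤-trans (Column.rec col i li refl pv≢0) (subst₂ _≤_ refl refl best-col)
          where
          i≢0 : LEG i ≢ 0
          i≢0 = leg1≢0 li
          j* = proj₁ (column i i≢0 ai)
          col = proj₂ (column i i≢0 ai)
          pv≥ : POS i ≤ PV i
          pv≥ = pv-ub i i i≢0 ai li refl (inj₁ refl)
          pv≢0 : PV i ≢ 0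
          pv≢0 z = <-irrefl refl (<-≤-trans (POS≥1 i i≢0) (≤-trans pv≥ (≤-reflexive z)))
          pv≡ : PV i ≡ POS i
          pv≡ = only (pv-at i i≢0 pv≢0)
            where
            only : (∃ λ m → LEG m ≡ 1 × bP (s₀ m) ≡ bP (s₀ i) × (0 ≡ 0 ⊎ R m ≡ 0) × PV i ≡ POS m) → PV i ≡ POS i
            only (m , lm , bm , _ , e) with m≤n⇒m<n∨m≡n (subst (POS i ≤_) e pv≥)
            ... | inj₂ eq = trans e (sym eq)
            -- If the pivot were higher than `i`, the parent of `i` would lie in the same rectangle,
            -- and the edge above `i` would have rank `0`.
            ... | inj₁ lt = ⊥-elim (contra (parent-below (trans li (sym lm)) i≢0 lt))
              where
              contra : (∃ λ p → Par i p) → ⊥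
              contra (p , pr) = Ranked.positive rkd i p pr (n≤0⇒n≡0 (rank→ i p li pr ai bp))
                where
                lp : LEG p ≡ 1
                lp = trans (sym (proj₁ pr)) li
                bp : bP (s₀ p) ≡ bP (s₀ i)
                bp = ≤-antisym (≤-trans (mono p m (trans lp (sym lm)) (leg1≢0 lp) (≤-trans (≤-reflexive (proj₂ (proj₂ pr))) lt)) (≤-reflexive bm))
                               (mono i p (proj₁ pr) i≢0 (≤-trans (n≤1+n _) (≤-reflexive (sym (proj₂ (proj₂ pr))))))
          best-col : C i j* ≤ C i j
          best-col = dominate (POS i) li lj (Column.lj col)
            (subst (λ p → X j* + 2 * W p (POS j) ≤ X j + 2 * W p (POS j*)) pv≡ (Column.opt col j lj (sym bij)))
            (≤-reflexive (+-comm (W (POS i) (POS j)) (W (POS i) (POS j*))))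

      -- Dropping rectangles without edges.

      1<K : 1 < 2 ^ K
      1<K = ≤-trans (+-mono-≤ 1≤H 1≤H) H<K
        where
        1≤H : 1 ≤ H
        1≤H = ≤-<-trans z≤n Ω<H

      -- After a split, a rectangle may contain no edge. For that case `covered` carries along the
      -- reason why its pairs are beaten; it is called upon only when the rectangle is found empty.
      record PreInv (t : ℕ) (s : State) : Set where
        field
          frame : Frame s
          labels : Labels t (λ v → bP (s v)) (λ v → bQ (s v)) (λ v → kap (s v)) (λ v → act (s v))
          bests : Bests (λ v → best (s v))
          covered : ∀ i j → LEG i ≡ 1 → LEG j ≡ 2 → Below (λ v → best (s v)) (C i j) ⊎
            (bP (s i) ≡ bP (s j) × act (s i) ≢ 0 × (¬ HasEdge (λ v → bP (s v)) (bP (s i)) → Below (λ v → best (s v)) (C i j)))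

      module Check (t : ℕ) {s s' : State} (pre : PreInv t s) (sem : MaxSem K checkI s s') where
        open PreInv pre
        open Frame frame
        open Labels labels
        open MaxSem sem

        b a : Fin n → ℕ
        b v = bP (s v)
        a v = act (s v)

        contracted→ : ∀ e → Contracted checkI s e → IsTree e × LEG (e₁ e) ≢ 0 × (∀ p → Par (e₂ e) p → b p ≡ b (e₂ e))
        contracted→ e c = let (te , ne , q) = legTree→ s legs e c in te , ne , λ p pr → trans (cong b (par-unique pr (par-of e te ne))) (≡ᵇ-sound q)

        open Components checkI s (λ x → ∀ p → Par x p → b p ≡ b x) contracted→
          (λ e te ne q → legTree← s legs e te ne (≡ᵇ-true (q (e₁ e) (par-of e te ne))))

        seg-label↑ : ∀ {u v} → POS u ≤ POS v → Seg (λ x → ∀ p → Par x p → b p ≡ b x) u v → b v ≡ b u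
        seg-label↑ {u} le (l , ne , f) = climb (λ y → b y ≡ b u) l ne le (λ x p pr lx p₁ p₂ eq → trans (f x lx (inj₁ (p₁ , p₂)) p pr) eq) refl

        seg-label : ∀ {u v} → Seg (λ x → ∀ p → Par x p → b p ≡ b x) u v → b v ≡ b u
        seg-label {u} {v} sg with ≤-total (POS u) (POS v)
        ... | inj₁ le = seg-label↑ le sg
        ... | inj₂ le = sym (seg-label↑ le (seg-sym {λ x → ∀ p → Par x p → b p ≡ b x} sg))

        comp-label : ∀ {u v} → LEG u ≢ 0 → Comp checkI s u v → LEG v ≡ LEG u × b v ≡ b u
        comp-label lu c = let sg = comp-seg lu c in sym (proj₁ sg) , seg-label sg

        label-seg : ∀ {u v} → POS u ≤ POS v → LEG u ≡ LEG v → LEG u ≢ 0 → b u ≡ b v → Seg (λ x → ∀ p → Par x p → b p ≡ b x) u v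
        label-seg {u} {v} le l lu eq = l , lu , inner
          where
          cls : ∀ x → LEG x ≡ LEG u → POS u ≤ POS x → POS x ≤ POS v → b x ≡ b u
          cls x lx p r = ≤-antisym (≤-trans (mono x v (trans lx l) (λ z → lu (trans (sym lx) z)) r) (≤-reflexive (sym eq))) (mono u x (sym lx) lu p)
          inner : ∀ x → LEG x ≡ LEG u → Between u v x → ∀ p → Par x p → b p ≡ b x
          inner x lx (inj₂ (p , r)) = ⊥-elim (<-irrefl refl (≤-<-trans p (<-≤-trans r le)))
          inner x lx (inj₁ (p , r)) y pr = trans (cls y (trans (sym (proj₁ pr)) lx) (≤-trans p (≤-trans (n≤1+n _) (≤-reflexive (sym (proj₂ (proj₂ pr)))))) (≤-trans (≤-reflexive (proj₂ (proj₂ pr))) r)) (sym (cls x lx p (<⇒≤ r)))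

        label-comp : ∀ {u v} → LEG u ≡ LEG v → LEG u ≢ 0 → b u ≡ b v → Comp checkI s u v
        label-comp {u} {v} l lu eq with ≤-total (POS u) (POS v)
        ... | inj₁ le = seg-comp (label-seg le l lu eq)
        ... | inj₂ le = Comp-sym checkI s (seg-comp (label-seg le (sym l) (λ z → lu (trans l z)) (sym eq)))

        crossZ-on : ∀ {x y} → LEG x ≢ 0 → LEG y ≢ 0 → LEG x ≢ LEG y → b x ≡ b y → crossZ (s x) (s y) ≡ 1
        crossZ-on {x} {y} lx ly ne eq = cong (_▷ 1) (cong₂ _∧_ (cong₂ _∧_ (nonzero-true (λ z → lx (trans (sym (legs x)) z))) (nonzero-true (λ z → ly (trans (sym (legs y)) z))))
          (cong₂ _∧_ (¬true-not (λ p → ne (trans (sym (legs x)) (trans (≡ᵇ-sound p) (legs y))))) (≡ᵇ-true eq)))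

        crossZ-off : ∀ x y → crossZ (s x) (s y) ≢ 0 → LEG x ≢ 0 × LEG y ≢ 0 × LEG x ≢ LEG y × b x ≡ b y
        crossZ-off x y nz = (λ z → nonzero-sound (proj₁ g₂) (trans (legs x) z)) , (λ z → nonzero-sound (proj₂ g₂) (trans (legs y) z)) ,
            (λ l → not-true (proj₁ g₃) (≡ᵇ-true (trans (legs x) (trans l (sym (legs y)))))) , ≡ᵇ-sound (proj₂ g₃)
          where
          g₁ = ∧-true {not (leg (s x) ≡ᵇ 0) ∧ not (leg (s y) ≡ᵇ 0)} (▷-nz ((not (leg (s x) ≡ᵇ 0) ∧ not (leg (s y) ≡ᵇ 0)) ∧ (not (leg (s x) ≡ᵇ leg (s y)) ∧ (bP (s x) ≡ᵇ bP (s y)))) nz)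
          g₂ = ∧-true {not (leg (s x) ≡ᵇ 0)} (proj₁ g₁)
          g₃ = ∧-true {not (leg (s x) ≡ᵇ leg (s y))} (proj₂ g₁)

        crossZ≤1 : ∀ x y → crossZ x y ≤ 1
        crossZ≤1 x y = aux ((not (leg x ≡ᵇ 0) ∧ not (leg y ≡ᵇ 0)) ∧ (not (leg x ≡ᵇ leg y) ∧ (bP x ≡ᵇ bP y)))
          where
          aux : ∀ z → (z ▷ 1) ≤ 1
          aux true = ≤-refl
          aux false = z≤n

        cap-cross : ∀ x y → cap K (crossZ x y) ≡ crossZ x y
        cap-cross x y = cap-id K (≤-<-trans (crossZ≤1 x y) 1<K)

        G≤1 : ∀ v → G v ≤ 1
        G≤1 v with G-at v
        ... | inj₁ z = ≤-trans (≤-reflexive z) z≤n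
        ... | inj₂ (e , _ , inj₁ (_ , q)) = ≤-trans (≤-reflexive (trans q (cap-cross (s (e₁ e)) (s (e₂ e))))) (crossZ≤1 (s (e₁ e)) (s (e₂ e)))
        ... | inj₂ (e , _ , inj₂ (_ , q)) = ≤-trans (≤-reflexive (trans q (cap-cross (s (e₂ e)) (s (e₁ e))))) (crossZ≤1 (s (e₂ e)) (s (e₁ e)))

        orient : ∀ {x y β} e → Joins e x y → LEG x ≢ 0 → LEG y ≢ 0 → LEG x ≢ LEG y → b x ≡ β → b y ≡ β → HasEdge b β
        orient {x} {y} e jn lx ly ne bx by = aux (LEG-cases x) (LEG-cases y)
          where
          aux : LEG x ≡ 0 ⊎ LEG x ≡ 1 ⊎ LEG x ≡ 2 → LEG y ≡ 0 ⊎ LEG y ≡ 1 ⊎ LEG y ≡ 2 → HasEdge b _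
          aux (inj₁ z) _ = ⊥-elim (lx z)
          aux _ (inj₁ z) = ⊥-elim (ly z)
          aux (inj₂ (inj₁ p)) (inj₂ (inj₁ r)) = ⊥-elim (ne (trans p (sym r)))
          aux (inj₂ (inj₂ p)) (inj₂ (inj₂ r)) = ⊥-elim (ne (trans p (sym r)))
          aux (inj₂ (inj₁ p)) (inj₂ (inj₂ r)) = e , x , y , jn , p , r , bx , by
          aux (inj₂ (inj₂ p)) (inj₂ (inj₁ r)) = e , y , x , Joins-sym {e} jn , r , p , by , bx

        G-sound : ∀ v → LEG v ≢ 0 → G v ≢ 0 → HasEdge b (b v)
        G-sound v lv nz with G-at v
        ... | inj₁ z = ⊥-elim (nz z)
        ... | inj₂ (e , _ , inj₁ (c , q)) = let (l , eq) = comp-label lv c; (x , y , z , w) = crossZ-off (e₁ e) (e₂ e) (λ z → nz (trans q (trans (cap-cross (s (e₁ e)) (s (e₂ e))) z))) in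
          orient e (inj₁ (refl , refl)) x y z eq (trans (sym w) eq)
        ... | inj₂ (e , _ , inj₂ (c , q)) = let (l , eq) = comp-label lv c; (x , y , z , w) = crossZ-off (e₂ e) (e₁ e) (λ z → nz (trans q (trans (cap-cross (s (e₂ e)) (s (e₁ e))) z))) in
          orient e (inj₂ (refl , refl)) x y z eq (trans (sym w) eq)

        G-complete : ∀ v → LEG v ≢ 0 → HasEdge b (b v) → G v ≡ 1
        G-complete v lv (e , i , j , jn , li , lj , bi , bj) = ≤-antisym (G≤1 v) (hit jn (LEG-cases v))
          where
          i≢0 = leg1≢0 li
          j≢0 = leg2≢0 lj
          i≢j : LEG i ≢ LEG j
          i≢j q = case trans (sym li) (trans q lj) of λ ()
          zi : cap K (crossZ (s i) (s j)) ≡ 1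
          zi = trans (cap-cross (s i) (s j)) (crossZ-on {i} {j} i≢0 j≢0 i≢j (trans bi (sym bj)))
          zj : cap K (crossZ (s j) (s i)) ≡ 1
          zj = trans (cap-cross (s j) (s i)) (crossZ-on {j} {i} j≢0 i≢0 (λ q → i≢j (sym q)) (trans bj (sym bi)))
          hit : Joins e i j → LEG v ≡ 0 ⊎ LEG v ≡ 1 ⊎ LEG v ≡ 2 → 1 ≤ G v
          hit _ (inj₁ z) = ⊥-elim (lv z)
          hit (inj₁ (refl , refl)) (inj₂ (inj₁ l)) = subst (_≤ G v) zi (G-ub₁ v e (λ c → i≢j (sym (proj₁ (comp-label i≢0 c)))) (label-comp (trans l (sym li)) lv (sym bi)))
          hit (inj₁ (refl , refl)) (inj₂ (inj₂ l)) = subst (_≤ G v) zj (G-ub₂ v e (λ c → i≢j (sym (proj₁ (comp-label i≢0 c)))) (label-comp (trans l (sym lj)) lv (sym bj)))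
          hit (inj₂ (refl , refl)) (inj₂ (inj₁ l)) = subst (_≤ G v) zi (G-ub₂ v e (λ c → i≢j (proj₁ (comp-label j≢0 c))) (label-comp (trans l (sym li)) lv (sym bi)))
          hit (inj₂ (refl , refl)) (inj₂ (inj₂ l)) = subst (_≤ G v) zj (G-ub₁ v e (λ c → i≢j (proj₁ (comp-label j≢0 c))) (label-comp (trans l (sym lj)) lv (sym bj)))

        a' : Fin n → ℕ
        a' v = if a v ≡ᵇ 0 then 0 else G v

        sh : ∀ v → s' v ≡ record (s v) { act = a' v }
        sh v = trans (result v) (set-ok (λ m x → record m { act = x }) (λ _ _ → refl) (capped v) (≤-<-trans (aux (a v ≡ᵇ 0)) 1<K))
          where
          aux : ∀ z → (if z then 0 else G v) ≤ 1
          aux true = z≤n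
          aux false = G≤1 v

        a'-sound : ∀ v → act (s' v) ≢ 0 → a v ≢ 0 × G v ≢ 0
        a'-sound v nz = aux (a v ≡ᵇ 0) refl
          where
          aux : ∀ z → (a v ≡ᵇ 0) ≡ z → a v ≢ 0 × G v ≢ 0
          aux true e = ⊥-elim (nz (trans (cong act (sh v)) (cong (λ z → if z then 0 else G v) e)))
          aux false e = (λ z → case trans (sym e) (≡ᵇ-true z) of λ ()) , λ g → nz (trans (cong act (sh v)) (trans (cong (λ z → if z then 0 else G v) e) g))

        a'-on : ∀ v → a v ≢ 0 → act (s' v) ≡ G v
        a'-on v nz = trans (cong act (sh v)) (cong (λ z → if z then 0 else G v) (≡ᵇ-false nz))

        dec-HasEdge : ∀ β → Dec (HasEdge b β)
        dec-HasEdge β = F.any? (λ e → F.any? (λ i → F.any? (λ j →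
          (((e₁ e F.≟ i) ×-dec (e₂ e F.≟ j)) ⊎-dec ((e₁ e F.≟ j) ×-dec (e₂ e F.≟ i))) ×-dec ((LEG i ≟ 1) ×-dec ((LEG j ≟ 2) ×-dec ((b i ≟ β) ×-dec (b j ≟ β)))))))

        inv' : LInv t s'
        inv' = record
          { frame = record { capped = capped-by result ; legs = λ v → trans (cong leg (sh v)) (legs v) ; ids = λ v → trans (cong nid (sh v)) (ids v)
              ; ranks = λ v → trans (cong rk (sh v)) (ranks v) ; poss = λ v → trans (cong pos (sh v)) (poss v) ; cuts = λ v lv → trans (cong cut (sh v)) (cuts v lv) }
          ; labels = record
              { mono = λ u v l lu le → subst₂ _≤_ (sym (sb u)) (sym (sb v)) (mono u v l lu le)
              ; b<P = λ u l → subst (_< POS u) (sym (sb u)) (b<P u l)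
              ; gapP = λ u v lu lv lt → subst (POS v ≤_) (sym (sb u)) (gapP u v lu lv (subst₂ _<_ (sb v) (sb u) lt))
              ; q<Q = λ u l → subst (_< POS u) (sym (sq u)) (q<Q u l)
              ; gapQ = λ u v lu lv lt → subst (POS v ≤_) (sym (sq u)) (gapQ u v lu lv (subst₂ _<_ (sb v) (sb u) lt))
              ; shareQ = λ u v lu lv eq → trans (sq u) (trans (shareQ u v lu lv (trans (sym (sb u)) (trans eq (sb v)))) (sym (sq v)))
              ; shareA = λ u v lu lv eq → shareA' u v lu lv (trans (sym (sb u)) (trans eq (sb v)))
              ; kapW = λ u lu → trans (cong kap (sh u)) (trans (kapW u lu) (sym (cong₂ W (sb u) (sq u))))
              ; coverQ = λ u l → let (i , li , eq) = coverQ u l in i , li , trans (sb i) (trans eq (sym (sb u)))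
              ; rank→ = λ u p l pr nz eq → rank→ u p l pr (proj₁ (a'-sound u nz)) (trans (sym (sb p)) (trans eq (sb u)))
              ; rank← = λ u p l pr nz le → trans (sb p) (trans (rank← u p l pr (proj₁ (a'-sound u nz)) le) (sym (sb u))) }
          ; witness = λ u lu nz → let (e , i , j , jn , li , lj , bi , bj) = G-sound u lu (proj₂ (a'-sound u nz)) in
              e , i , j , jn , li , lj , trans (sb i) (trans bi (sym (sb u))) , trans (sb j) (trans bj (sym (sb u)))
          ; bests = record { bestX = λ v lv → subst (_≤ X v) (sym (sβ v)) (Bests.bestX bests v lv) ; sound = λ v lv → subst IsCut (sym (sβ v)) (Bests.sound bests v lv) }
          ; covered = λ i j li lj → cov i j li lj (covered i j li lj) }
          where
          sb : ∀ v → bP (s' v) ≡ b v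
          sb v = cong bP (sh v)
          sq : ∀ v → bQ (s' v) ≡ bQ (s v)
          sq v = cong bQ (sh v)
          sβ : ∀ v → best (s' v) ≡ best (s v)
          sβ v = cong best (sh v)
          -- The two sides of a rectangle are separate supernodes in this check. They reach the same
          -- verdict because an edge between them reports to both.
          G-same : ∀ u v → LEG u ≢ 0 → LEG v ≢ 0 → b u ≡ b v → G u ≡ G v
          G-same u v lu lv eq with dec-HasEdge (b u)
          ... | yes h = trans (G-complete u lu h) (sym (G-complete v lv (subst (HasEdge b) eq h)))
          ... | no nh = trans (off u lu nh) (sym (off v lv (λ h → nh (subst (HasEdge b) (sym eq) h))))
            where
            off : ∀ u → LEG u ≢ 0 → ¬ HasEdge b (b u) → G u ≡ 0
            off u lu nh with G u ≟ 0
            ... | yes z = z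
            ... | no nz = ⊥-elim (nh (G-sound u lu nz))
          shareA' : ∀ u v → LEG u ≢ 0 → LEG v ≢ 0 → b u ≡ b v → act (s' u) ≡ act (s' v)
          shareA' u v lu lv eq = trans (cong act (sh u)) (trans (cong₂ (λ x y → if x ≡ᵇ 0 then 0 else y) (shareA u v lu lv eq) (G-same u v lu lv eq)) (sym (cong act (sh v))))
          lift : ∀ {x} → Below (λ v → best (s v)) x → Below (λ v → best (s' v)) x
          lift {x} (v , lv , le) = v , lv , subst (_≤ x) (sym (sβ v)) le
          cov : ∀ i j → LEG i ≡ 1 → LEG j ≡ 2 → Below (λ v → best (s v)) (C i j) ⊎ (b i ≡ b j × a i ≢ 0 × (¬ HasEdge b (b i) → Below (λ v → best (s v)) (C i j))) →
            Below (λ v → best (s' v)) (C i j) ⊎ (bP (s' i) ≡ bP (s' j) × act (s' i) ≢ 0)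
          cov i j li lj (inj₁ x) = inj₁ (lift x)
          cov i j li lj (inj₂ (eq , ai , f)) with dec-HasEdge (b i)
          ... | no nh = inj₁ (lift (f nh))
          ... | yes h = inj₂ (trans (sb i) (trans eq (sym (sb j))) , λ z → case trans (sym (G-complete i (leg1≢0 li) h)) (trans (sym (a'-on i ai)) z) of λ ())

      -- Splitting rectangles at their pivots.

      module Split (t : ℕ) {s₀ s s' : State} (inv : LInv (suc t) s₀) (cr : CoreResult (suc t) s₀ s) (sem : MaxSem K splitI s s') where
        open LInv inv
        open Frame frame
        open Labels labels
        open CoreResult cr

        b q a : Fin n → ℕ
        b v = bP (s₀ v)
        q v = bQ (s₀ v)
        a v = act (s₀ v)

        legS : ∀ v → leg (s v) ≡ LEG v
        legS v = trans (r-leg v) (legs v)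
        posS : ∀ v → pos (s v) ≡ POS v
        posS v = trans (r-pos v) (poss v)

        Upper : Fin n → Set
        Upper v = PV v ≢ 0 × ((LEG v ≡ 1 × PV v < POS v) ⊎ (LEG v ≡ 2 × PQ v < POS v))

        upper→ : ∀ v → upperM (s v) ≡ true → Upper v
        upper→ v e = (λ z → nonzero-sound (proj₁ g) (trans (r-pvP v) z)) , [ (λ x → inj₁ (one x)) , (λ x → inj₂ (two x)) ]′ (∨-true {(leg (s v) ≡ᵇ 1) ∧ (suc (pvP (s v)) ≤ᵇ pos (s v))} (proj₂ g))
          where
          g = ∧-true {not (pvP (s v) ≡ᵇ 0)} e
          one : (leg (s v) ≡ᵇ 1) ∧ (suc (pvP (s v)) ≤ᵇ pos (s v)) ≡ true → LEG v ≡ 1 × PV v < POS v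
          one x = let (l , p) = ∧-true {leg (s v) ≡ᵇ 1} x in trans (sym (legS v)) (≡ᵇ-sound l) , subst₂ _<_ (r-pvP v) (posS v) (≤ᵇ-sound p)
          two : (leg (s v) ≡ᵇ 2) ∧ (suc (pvQ (s v)) ≤ᵇ pos (s v)) ≡ true → LEG v ≡ 2 × PQ v < POS v
          two x = let (l , p) = ∧-true {leg (s v) ≡ᵇ 2} x in trans (sym (legS v)) (≡ᵇ-sound l) , subst₂ _<_ (r-pvQ v) (posS v) (≤ᵇ-sound p)

        upper← : ∀ v → Upper v → upperM (s v) ≡ true
        upper← v (nz , alt) = cong₂ _∧_ (nonzero-true (λ z → nz (trans (sym (r-pvP v)) z))) (aux alt)
          where
          ∨-tr : ∀ x → x ∨ true ≡ true
          ∨-tr true = refl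
          ∨-tr false = refl
          aux : (LEG v ≡ 1 × PV v < POS v) ⊎ (LEG v ≡ 2 × PQ v < POS v) → ((leg (s v) ≡ᵇ 1) ∧ (suc (pvP (s v)) ≤ᵇ pos (s v))) ∨ ((leg (s v) ≡ᵇ 2) ∧ (suc (pvQ (s v)) ≤ᵇ pos (s v))) ≡ true
          aux (inj₁ (l , lt)) = cong (_∨ ((leg (s v) ≡ᵇ 2) ∧ (suc (pvQ (s v)) ≤ᵇ pos (s v)))) (cong₂ _∧_ (≡ᵇ-true (trans (legS v) l)) (≤ᵇ-true (subst₂ _<_ (sym (r-pvP v)) (sym (posS v)) lt)))
          aux (inj₂ (l , lt)) = trans (cong (((leg (s v) ≡ᵇ 1) ∧ (suc (pvP (s v)) ≤ᵇ pos (s v))) ∨_) (cong₂ _∧_ (≡ᵇ-true (trans (legS v) l)) (≤ᵇ-true (subst₂ _<_ (sym (r-pvQ v)) (sym (posS v)) lt)))) (∨-tr ((leg (s v) ≡ᵇ 1) ∧ (suc (pvP (s v)) ≤ᵇ pos (s v))))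

        dec-Upper : ∀ v → Dec (Upper v)
        dec-Upper v = map′ (upper→ v) (upper← v) (upperM (s v) Bool.≟ true)

        splitF-on : ∀ i → LEG i ≡ 1 → a i ≢ 0 → POS i ≡ PV i → splitF (s i) ≡ W (POS i) (PQ i)
        splitF-on i li ai e = trans (cong (_▷ (kap (s i) + ofs (s i) + acc (s i))) (cong₂ _∧_ (≡ᵇ-true (trans (legS i) li)) (≡ᵇ-true (trans (posS i) (trans e (sym (r-pvP i))))))) (total-W i li ai)

        splitF-cases : ∀ v → splitF (s v) ≡ 0 ⊎ (LEG v ≡ 1 × POS v ≡ PV v × splitF (s v) ≡ W (POS v) (PQ v))
        splitF-cases v = aux ((leg (s v) ≡ᵇ 1) ∧ (pos (s v) ≡ᵇ pvP (s v))) refl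
          where
          aux : ∀ z → ((leg (s v) ≡ᵇ 1) ∧ (pos (s v) ≡ᵇ pvP (s v))) ≡ z → splitF (s v) ≡ 0 ⊎ (LEG v ≡ 1 × POS v ≡ PV v × splitF (s v) ≡ W (POS v) (PQ v))
          aux false e = inj₁ (cong (_▷ (kap (s v) + ofs (s v) + acc (s v))) e)
          aux true e = inj₂ (l , p , splitF-on v l (pv-act v (leg1≢0 l) (λ z → <-irrefl refl (<-≤-trans (POS≥1 v (leg1≢0 l)) (≤-reflexive (trans p z))))) p)
            where
            g = ∧-true {leg (s v) ≡ᵇ 1} e
            l : LEG v ≡ 1
            l = trans (sym (legS v)) (≡ᵇ-sound (proj₁ g))
            p : POS v ≡ PV v
            p = trans (sym (posS v)) (trans (≡ᵇ-sound (proj₂ g)) (r-pvP v))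

        splitF< : ∀ v → splitF (s v) < 2 ^ K
        splitF< v with splitF-cases v
        ... | inj₁ z = subst (_< 2 ^ K) (sym z) (1≤2^ K)
        ... | inj₂ (_ , _ , e) = subst (_< 2 ^ K) (sym e) (small (≤-trans (W≤Ω (POS v) (PQ v)) Ω≤4Ω))

        spec : MaxSpec splitI s splitU s'
        spec = max-spec {rectCon} {splitF} {splitU} sem splitF<
        open MaxSpec spec using (Y)

        Y< : ∀ v → Y v < 2 ^ K
        Y< v = let (u , _ , e) = MaxSpec.at' spec v in subst (_< 2 ^ K) (sym e) (splitF< u)

        sh : ∀ v → s' v ≡ splitU (s v) (Y v)
        sh v = trans (MaxSpec.res spec v) (aux (upperM (s v)))
          where
          x = s v
          aux : ∀ z → capM K (if z then record x { bP = pvP x ; bQ = pvQ x ; kap = Y v } else x) ≡ (if z then record x { bP = pvP x ; bQ = pvQ x ; kap = Y v } else x)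
          aux false = capd v
          aux true = trans (cong (λ m → record m { bP = pvP m ; bQ = pvQ m ; kap = cap K (Y v) }) (capd v)) (cong (λ y → record x { bP = pvP x ; bQ = pvQ x ; kap = y }) (cap-id K (Y< v)))

        module Rc = Core.Rect (suc t) s₀ inv splitI s (λ _ _ _ _ → refl) (λ v → legS v , r-act v , r-bP v)
        module Mx = Rc.RectMax {splitF} {splitU} refl spec

        b' q' k' a' : Fin n → ℕ
        b' v = bP (s' v)
        q' v = bQ (s' v)
        k' v = kap (s' v)
        a' v = act (s' v)

        keep : ∀ {A : Set} (f : Mem → A) → (∀ m y → f (record m { bP = pvP m ; bQ = pvQ m ; kap = y }) ≡ f m) → ∀ v → f (s' v) ≡ f (s v)
        keep f h v = trans (cong f (sh v)) (aux (upperM (s v)))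
          where
          aux : ∀ z → f (if z then record (s v) { bP = pvP (s v) ; bQ = pvQ (s v) ; kap = Y v } else s v) ≡ f (s v)
          aux true = h (s v) (Y v)
          aux false = refl

        up-eq : ∀ v → Upper v → s' v ≡ record (s v) { bP = pvP (s v) ; bQ = pvQ (s v) ; kap = Y v }
        up-eq v u = trans (sh v) (cong (λ z → if z then record (s v) { bP = pvP (s v) ; bQ = pvQ (s v) ; kap = Y v } else s v) (upper← v u))

        lo-eq : ∀ v → ¬ Upper v → s' v ≡ s v
        lo-eq v nu = trans (sh v) (cong (λ z → if z then record (s v) { bP = pvP (s v) ; bQ = pvQ (s v) ; kap = Y v } else s v) (¬true⇒false (λ e → nu (upper→ v e))))

        b'-up : ∀ v → Upper v → b' v ≡ PV v
        b'-up v u = trans (cong bP (up-eq v u)) (r-pvP v)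
        q'-up : ∀ v → Upper v → q' v ≡ PQ v
        q'-up v u = trans (cong bQ (up-eq v u)) (r-pvQ v)
        b'-lo : ∀ v → ¬ Upper v → b' v ≡ b v
        b'-lo v u = trans (cong bP (lo-eq v u)) (r-bP v)
        q'-lo : ∀ v → ¬ Upper v → q' v ≡ q v
        q'-lo v u = trans (cong bQ (lo-eq v u)) (r-bQ v)
        a'≡ : ∀ v → a' v ≡ a v
        a'≡ v = trans (keep act (λ _ _ → refl) v) (r-act v)

        -- The edge above the pivot row `mid` has rank `suc t`, so by `rank←` its upper end `i⁺`
        -- belongs to the same rectangle. Hence neither part of the split is without rows.
        record Pivot (u : Fin n) : Set where
          field
            mid i⁺ : Fin n
            l-mid : LEG mid ≡ 1
            b-mid : b mid ≡ b u
            r-mid : R mid ≡ suc t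
            p-mid : PV u ≡ POS mid
            l-i⁺ : LEG i⁺ ≡ 1
            b-i⁺ : b i⁺ ≡ b u
            p-i⁺ : PV u < POS i⁺

        pivot : ∀ u → LEG u ≢ 0 → PV u ≢ 0 → Pivot u
        pivot u lu nz = aux (pv-at u lu nz)
          where
          aux : (∃ λ i → LEG i ≡ 1 × b i ≡ b u × (suc t ≡ 0 ⊎ R i ≡ suc t) × PV u ≡ POS i) → Pivot u
          aux (i , li , bi , inj₂ ri , e) = record { mid = i ; i⁺ = p ; l-mid = li ; b-mid = bi ; r-mid = ri ; p-mid = e ; l-i⁺ = trans (sym (proj₁ pr)) li
              ; b-i⁺ = trans (rank← i p li pr (λ z → pv-act u lu nz (trans (sym (shareA i u (leg1≢0 li) lu bi)) z)) (≤-reflexive ri)) bi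
              ; p-i⁺ = ≤-trans (s≤s (≤-reflexive e)) (≤-reflexive (sym (proj₂ (proj₂ pr)))) }
            where
            tp = Ranked.top rkd i (λ z → case trans (sym ri) z of λ ())
            p = proj₁ tp
            pr = proj₂ tp

        label<pivot : ∀ u → LEG u ≢ 0 → PV u ≢ 0 → b u < PV u
        label<pivot u lu nz = let open Pivot (pivot u lu nz) in subst₂ _<_ b-mid (sym p-mid) (b<P mid l-mid)

        rowOf : ∀ v → LEG v ≢ 0 → ∃ λ i → LEG i ≡ 1 × b i ≡ b v
        rowOf v lv with LEG-cases v
        ... | inj₁ z = ⊥-elim (lv z)
        ... | inj₂ (inj₁ l) = v , l , refl
        ... | inj₂ (inj₂ l) = coverQ v l

        -- The new label of an upper part fits strictly between the old label and the next larger
        -- one. The old order is refined and parts of different rectangles never receive the same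
        -- label.
        pivot<label : ∀ u v → LEG u ≢ 0 → PV u ≢ 0 → LEG v ≢ 0 → b u < b v → PV u < b v
        pivot<label u v lu nz lv lt = let open Pivot (pivot u lu nz); (i , li , bi) = rowOf v lv in
          <-≤-trans p-i⁺ (≤-trans (gapP i i⁺ li l-i⁺ (subst₂ _<_ (sym b-i⁺) (sym bi) lt)) (≤-reflexive bi))

        b≤b' : ∀ v → LEG v ≢ 0 → b v ≤ b' v
        b≤b' v lv with dec-Upper v
        ... | yes u = ≤-trans (<⇒≤ (label<pivot v lv (proj₁ u))) (≤-reflexive (sym (b'-up v u)))
        ... | no nu = ≤-reflexive (sym (b'-lo v nu))

        strict : ∀ u v → LEG u ≢ 0 → LEG v ≢ 0 → b u < b v → b' u < b' v
        strict u v lu lv lt with dec-Upper u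
        ... | yes up = subst (_< b' v) (sym (b'-up u up)) (<-≤-trans (pivot<label u v lu (proj₁ up) lv lt) (b≤b' v lv))
        ... | no nu = subst (_< b' v) (sym (b'-lo u nu)) (<-≤-trans lt (b≤b' v lv))

        same-old : ∀ u v → LEG u ≢ 0 → LEG v ≢ 0 → b' u ≡ b' v → b u ≡ b v
        same-old u v lu lv eq with <-cmp (b u) (b v)
        ... | tri< lt _ _ = ⊥-elim (<-irrefl eq (strict u v lu lv lt))
        ... | tri≈ _ e _ = e
        ... | tri> _ _ gt = ⊥-elim (<-irrefl (sym eq) (strict v u lv lu gt))

        pq-same : ∀ u v → LEG u ≢ 0 → PV u ≢ 0 → LEG v ≢ 0 → b v ≡ b u → PQ u ≡ PQ v
        pq-same u v lu nz lv eq = pq-const u v lu (pv-act u lu nz) lv eq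

        pv-nz : ∀ u v → LEG u ≢ 0 → LEG v ≢ 0 → b v ≡ b u → PV u ≢ 0 → PV v ≢ 0
        pv-nz u v lu lv eq nz z = nz (trans (pv-const u v lu lv eq) z)

        upper-class : ∀ u v → LEG u ≡ LEG v → LEG u ≢ 0 → b v ≡ b u → POS u ≤ POS v → Upper u → Upper v
        upper-class u v l lu eq le (nz , alt) = pv-nz u v lu lv eq nz , aux alt
          where
          lv : LEG v ≢ 0
          lv z = lu (trans l z)
          aux : (LEG u ≡ 1 × PV u < POS u) ⊎ (LEG u ≡ 2 × PQ u < POS u) → (LEG v ≡ 1 × PV v < POS v) ⊎ (LEG v ≡ 2 × PQ v < POS v)
          aux (inj₁ (x , lt)) = inj₁ (trans (sym l) x , <-≤-trans (subst (_< POS u) (pv-const u v lu lv eq) lt) le)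
          aux (inj₂ (x , lt)) = inj₂ (trans (sym l) x , <-≤-trans (subst (_< POS u) (pq-same u v lu nz lv eq) lt) le)

        same-side : ∀ u v → LEG u ≢ 0 → LEG v ≢ 0 → b' u ≡ b' v → Upper u → Upper v
        same-side u v lu lv eq up with dec-Upper v
        ... | yes x = x
        ... | no nv = ⊥-elim (<-irrefl refl (<-≤-trans (label<pivot u lu (proj₁ up)) (≤-reflexive (trans (sym (b'-up u up)) (trans eq (trans (b'-lo v nv) (sym (same-old u v lu lv eq))))))))

        both-up : ∀ u v → LEG u ≢ 0 → LEG v ≢ 0 → b v ≡ b u → Upper u → Upper v → b' u ≡ b' v
        both-up u v lu lv eq up vp = trans (b'-up u up) (trans (pv-const u v lu lv eq) (sym (b'-up v vp)))

        both-lo : ∀ u v → b v ≡ b u → ¬ Upper u → ¬ Upper v → b' u ≡ b' v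
        both-lo u v eq nu nv = trans (b'-lo u nu) (trans (sym eq) (sym (b'-lo v nv)))

        mono' : ∀ u v → LEG u ≡ LEG v → LEG u ≢ 0 → POS u ≤ POS v → b' u ≤ b' v
        mono' u v l lu le with m≤n⇒m<n∨m≡n (mono u v l lu le)
        ... | inj₁ lt = <⇒≤ (strict u v lu (λ z → lu (trans l z)) lt)
        ... | inj₂ eq with dec-Upper u
        ... | yes up = ≤-reflexive (both-up u v lu (λ z → lu (trans l z)) (sym eq) up (upper-class u v l lu (sym eq) le up))
        ... | no nu = ≤-trans (≤-reflexive (trans (b'-lo u nu) eq)) (b≤b' v (λ z → lu (trans l z)))

        b<P' : ∀ u → LEG u ≡ 1 → b' u < POS u
        b<P' u l with dec-Upper u
        ... | no nu = subst (_< POS u) (sym (b'-lo u nu)) (b<P u l)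
        ... | yes up@(_ , inj₁ (_ , lt)) = subst (_< POS u) (sym (b'-up u up)) lt
        ... | yes (_ , inj₂ (l2 , _)) = case trans (sym l) l2 of λ ()

        q<Q' : ∀ u → LEG u ≡ 2 → q' u < POS u
        q<Q' u l with dec-Upper u
        ... | no nu = subst (_< POS u) (sym (q'-lo u nu)) (q<Q u l)
        ... | yes up@(_ , inj₂ (_ , lt)) = subst (_< POS u) (sym (q'-up u up)) lt
        ... | yes (_ , inj₁ (l1 , _)) = case trans (sym l) l1 of λ ()

        gapP' : ∀ u v → LEG u ≡ 1 → LEG v ≡ 1 → b' v < b' u → POS v ≤ b' u
        gapP' u v lu lv lt with <-cmp (b v) (b u)
        ... | tri< l _ _ = ≤-trans (gapP u v lu lv l) (b≤b' u (leg1≢0 lu))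
        ... | tri> _ _ g = ⊥-elim (<-irrefl refl (<-trans lt (strict u v (leg1≢0 lu) (leg1≢0 lv) g)))
        ... | tri≈ _ e _ with dec-Upper u | dec-Upper v
        ... | yes up | yes vp = ⊥-elim (<-irrefl (sym (both-up u v (leg1≢0 lu) (leg1≢0 lv) e up vp)) lt)
        ... | no nu | no nv = ⊥-elim (<-irrefl (sym (both-lo u v e nu nv)) lt)
        ... | no nu | yes vp = ⊥-elim (<-irrefl refl (<-≤-trans lt (≤-trans (≤-reflexive (trans (b'-lo u nu) (sym e))) (b≤b' v (leg1≢0 lv)))))
        ... | yes up | no nv = ≤-trans (≮⇒≥ (λ l → nv (pv-nz u v (leg1≢0 lu) (leg1≢0 lv) e (proj₁ up) , inj₁ (lv , subst (_< POS v) (pv-const u v (leg1≢0 lu) (leg1≢0 lv) e) l)))) (≤-reflexive (sym (b'-up u up)))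

        gapQ' : ∀ u v → LEG u ≡ 2 → LEG v ≡ 2 → b' v < b' u → POS v ≤ q' u
        gapQ' u v lu lv lt with <-cmp (b v) (b u)
        ... | tri> _ _ g = ⊥-elim (<-irrefl refl (<-trans lt (strict u v (leg2≢0 lu) (leg2≢0 lv) g)))
        ... | tri< l _ _ = go (dec-Upper u)
          where
          go : Dec (Upper u) → POS v ≤ q' u
          go (no nu) = ≤-trans (gapQ u v lu lv l) (≤-reflexive (sym (q'-lo u nu)))
          go (yes up) = ≤-trans (≤-trans (gapQ u v lu lv l) (≤-trans (≤-reflexive (sym (shareQ j u (leg2≢0 lj) (leg2≢0 lu) bj))) (<⇒≤ (q<Q j lj)))) (≤-reflexive (trans (sym pq) (sym (q'-up u up))))
            where
            cl = column u (leg2≢0 lu) (pv-act u (leg2≢0 lu) (proj₁ up))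
            j = proj₁ cl
            open Column (proj₂ cl)
        ... | tri≈ _ e _ with dec-Upper u | dec-Upper v
        ... | yes up | yes vp = ⊥-elim (<-irrefl (sym (both-up u v (leg2≢0 lu) (leg2≢0 lv) e up vp)) lt)
        ... | no nu | no nv = ⊥-elim (<-irrefl (sym (both-lo u v e nu nv)) lt)
        ... | no nu | yes vp = ⊥-elim (<-irrefl refl (<-≤-trans lt (≤-trans (≤-reflexive (trans (b'-lo u nu) (sym e))) (b≤b' v (leg2≢0 lv)))))
        ... | yes up | no nv = ≤-trans (≮⇒≥ (λ l → nv (pv-nz u v (leg2≢0 lu) (leg2≢0 lv) e (proj₁ up) , inj₂ (lv , subst (_< POS v) (pq-same u v (leg2≢0 lu) (proj₁ up) (leg2≢0 lv) e) l)))) (≤-reflexive (sym (q'-up u up)))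

        shareQ' : ∀ u v → LEG u ≢ 0 → LEG v ≢ 0 → b' u ≡ b' v → q' u ≡ q' v
        shareQ' u v lu lv eq with dec-Upper u | dec-Upper v
        ... | yes up | yes vp = trans (q'-up u up) (trans (pq-same u v lu (proj₁ up) lv (sym (same-old u v lu lv eq))) (sym (q'-up v vp)))
        ... | no nu | no nv = trans (q'-lo u nu) (trans (shareQ u v lu lv (same-old u v lu lv eq)) (sym (q'-lo v nv)))
        ... | yes up | no nv = ⊥-elim (nv (same-side u v lu lv eq up))
        ... | no nu | yes vp = ⊥-elim (nu (same-side v u lv lu (sym eq) vp))

        Y≡ : ∀ u → LEG u ≢ 0 → PV u ≢ 0 → Y u ≡ W (PV u) (PQ u)
        Y≡ u lu nz = ≤-antisym (upper (Mx.rat u lu au)) lower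
          where
          au = pv-act u lu nz
          open Pivot (pivot u lu nz)
          pm : PV mid ≡ PV u
          pm = sym (pv-const u mid lu (leg1≢0 l-mid) b-mid)
          lower : W (PV u) (PQ u) ≤ Y u
          lower = subst (_≤ Y u) (trans (splitF-on mid l-mid (λ z → au (trans (sym (shareA mid u (leg1≢0 l-mid) lu b-mid)) z)) (trans (sym p-mid) (sym pm)))
            (cong₂ W (sym p-mid) (sym (pq-const u mid lu au (leg1≢0 l-mid) b-mid)))) (Mx.rub u mid lu au (leg1≢0 l-mid) b-mid)
          upper : (∃ λ v → LEG v ≢ 0 × b v ≡ b u × Y u ≡ splitF (s v)) → Y u ≤ W (PV u) (PQ u)
          upper (v , lv , bv , e) with splitF-cases v
          ... | inj₁ z = ≤-trans (≤-reflexive (trans e z)) z≤n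
          ... | inj₂ (l1 , pv , e') = ≤-reflexive (trans e (trans e' (cong₂ W (trans pv (sym (pv-const u v lu lv bv))) (sym (pq-const u v lu au lv bv)))))

        kapW' : ∀ u → LEG u ≢ 0 → k' u ≡ W (b' u) (q' u)
        kapW' u lu with dec-Upper u
        ... | yes up = trans (cong kap (up-eq u up)) (trans (Y≡ u lu (proj₁ up)) (sym (cong₂ W (b'-up u up) (q'-up u up))))
        ... | no nu = trans (cong kap (lo-eq u nu)) (trans (r-kap u) (trans (kapW u lu) (sym (cong₂ W (b'-lo u nu) (q'-lo u nu)))))

        coverQ' : ∀ u → LEG u ≡ 2 → ∃ λ i → LEG i ≡ 1 × b' i ≡ b' u
        coverQ' u l with dec-Upper u
        ... | yes up = let open Pivot (pivot u (leg2≢0 l) (proj₁ up))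
                           lp = leg1≢0 l-i⁺ in
          i⁺ , l-i⁺ , both-up i⁺ u lp (leg2≢0 l) (sym b-i⁺) (pv-nz u i⁺ (leg2≢0 l) lp b-i⁺ (proj₁ up) , inj₁ (l-i⁺ , subst (_< POS i⁺) (pv-const u i⁺ (leg2≢0 l) lp b-i⁺) p-i⁺)) up
        ... | no nu with PV u ≟ 0
        ... | yes z = let (i , li , bi) = coverQ u l in i , li , both-lo i u (sym bi) (λ up → proj₁ up (trans (sym (pv-const u i (leg2≢0 l) (leg1≢0 li) bi)) z)) nu
        ... | no nz = let open Pivot (pivot u (leg2≢0 l) nz) in mid , l-mid , both-lo mid u (sym b-mid) (low l-mid b-mid p-mid) nu
          where
          low : ∀ {mid} → LEG mid ≡ 1 → b mid ≡ b u → PV u ≡ POS mid → ¬ Upper mid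
          low {mid} lm bm pm (_ , inj₁ (_ , lt)) = <-irrefl (trans (sym (pv-const u mid (leg2≢0 l) (leg1≢0 lm) bm)) pm) lt
          low lm bm pm (_ , inj₂ (l2 , _)) = case trans (sym lm) l2 of λ ()

        -- A rectangle has at most one inner edge of rank `suc t`, because an edge between two such
        -- would have a larger rank. That edge lies above the pivot row, and this is where the rows
        -- are cut.
        rank→' : ∀ u p → LEG u ≡ 1 → Par u p → a' u ≢ 0 → b' p ≡ b' u → R u ≤ t
        rank→' u p l pr nz eq = ≤-pred (≤∧≢⇒< ru differ)
          where
          lu = leg1≢0 l
          lp : LEG p ≡ 1
          lp = trans (sym (proj₁ pr)) l
          au : a u ≢ 0
          au z = nz (trans (a'≡ u) z)
          old : b p ≡ b u
          old = same-old p u (leg1≢0 lp) lu eq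
          ru : R u ≤ suc t
          ru = rank→ u p l pr au old
          differ : R u ≢ suc t
          differ r = split-here
            where
            u≤ : POS u ≤ PV u
            u≤ = pv-ub u u lu au l refl (inj₂ r)
            pvnz : PV u ≢ 0
            pvnz z = <-irrefl refl (<-≤-trans (POS≥1 u lu) (≤-trans u≤ (≤-reflexive z)))
            open Pivot (pivot u lu pvnz)
            u≡ : POS u ≡ PV u
            u≡ with m≤n⇒m<n∨m≡n (subst (POS u ≤_) p-mid u≤)
            ... | inj₂ e = trans e (sym p-mid)
            ... | inj₁ lt = ⊥-elim (between (Ranked.rank rkd u mid (trans l (sym l-mid)) lu lt (trans r (sym r-mid)) (λ z → case trans (sym r) z of λ ())))
              where
              between : (∃ λ x → LEG x ≡ LEG u × POS u < POS x × POS x < POS mid × R u < R x) → ⊥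
              between (x , lx , x₁ , x₂ , big) = <-irrefl refl (<-≤-trans (subst (_< R x) r big) (rank→ x y l1 prx ax by))
                where
                l1 : LEG x ≡ 1
                l1 = trans lx l
                par = parent-below (trans l1 (sym l-mid)) (leg1≢0 l1) x₂
                y = proj₁ par
                prx = proj₂ par
                ly : LEG y ≡ 1
                ly = trans (sym (proj₁ prx)) l1
                bx : b x ≡ b u
                bx = ≤-antisym (≤-trans (mono x mid (trans l1 (sym l-mid)) (leg1≢0 l1) (<⇒≤ x₂)) (≤-reflexive b-mid)) (mono u x (sym lx) lu (<⇒≤ x₁))
                by : b y ≡ b x
                by = ≤-antisym (≤-trans (mono y mid (trans ly (sym l-mid)) (leg1≢0 ly) (≤-trans (≤-reflexive (proj₂ (proj₂ prx))) x₂)) (≤-reflexive (trans b-mid (sym bx))))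
                  (mono x y (proj₁ prx) (leg1≢0 l1) (≤-trans (n≤1+n _) (≤-reflexive (sym (proj₂ (proj₂ prx))))))
                ax : a x ≢ 0
                ax z = au (trans (sym (shareA x u (leg1≢0 l1) lu bx)) z)
            up-p : Upper p
            up-p = pv-nz u p lu (leg1≢0 lp) old pvnz , inj₁ (lp , subst (_< POS p) (pv-const u p lu (leg1≢0 lp) old) (≤-trans (s≤s (≤-reflexive (sym u≡))) (≤-reflexive (sym (proj₂ (proj₂ pr))))))
            split-here : ⊥
            split-here with same-side p u (leg1≢0 lp) lu eq up-p
            ... | _ , inj₁ (_ , lt) = <-irrefl (sym u≡) lt
            ... | _ , inj₂ (l2 , _) = case trans (sym l) l2 of λ ()

        rank←' : ∀ u p → LEG u ≡ 1 → Par u p → a' u ≢ 0 → R u ≤ t → b' p ≡ b' u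
        rank←' u p l pr nz le = go (dec-Upper u) (dec-Upper p)
          where
          lu = leg1≢0 l
          lp : LEG p ≡ 1
          lp = trans (sym (proj₁ pr)) l
          old : b p ≡ b u
          old = rank← u p l pr (λ z → nz (trans (a'≡ u) z)) (m≤n⇒m≤1+n le)
          go : Dec (Upper u) → Dec (Upper p) → b' p ≡ b' u
          go (yes up) (yes pp) = sym (both-up u p lu (leg1≢0 lp) old up pp)
          go (no nu) (no np) = sym (both-lo u p old nu np)
          go (yes up) (no np) = ⊥-elim (np (upper-class u p (proj₁ pr) lu old (≤-trans (n≤1+n _) (≤-reflexive (sym (proj₂ (proj₂ pr))))) up))
          go (no nu) (yes (pvp , inj₂ (l2 , _))) = case trans (sym lp) l2 of λ ()
          go (no nu) (yes (pvp , inj₁ (_ , lt))) = ⊥-elim (<-irrefl refl (≤-trans (≤-reflexive (sym r-u)) le))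
            where
            pvu : PV u ≢ 0
            pvu = pv-nz p u (leg1≢0 lp) lu (sym old) pvp
            open Pivot (pivot u lu pvu)
            pv-u : PV u ≡ POS u
            pv-u = ≤-antisym (≤-pred (≤-trans (subst (_< POS p) (sym (pv-const u p lu (leg1≢0 lp) old)) lt) (≤-reflexive (proj₂ (proj₂ pr)))))
              (≮⇒≥ (λ x → nu (pvu , inj₁ (l , x))))
            r-u : R u ≡ suc t
            r-u = trans (cong R (POS-inj u mid (trans l (sym l-mid)) (trans (sym pv-u) p-mid))) r-mid

        labels' : Labels t b' q' k' a'
        labels' = record { mono = mono' ; b<P = b<P' ; gapP = gapP' ; q<Q = q<Q' ; gapQ = gapQ' ; shareQ = shareQ'
          ; shareA = λ u v lu lv eq → trans (a'≡ u) (trans (shareA u v lu lv (same-old u v lu lv eq)) (sym (a'≡ v)))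
          ; kapW = kapW' ; coverQ = coverQ' ; rank→ = rank→' ; rank← = rank←' }

        β≡ : ∀ v → best (s' v) ≡ best (s v)
        β≡ = keep best (λ _ _ → refl)

        -- The pivot row and its best column `j*` divide the pairs of a rectangle into four
        -- quadrants. In the two mixed ones `monge` has the sign that `dominate` needs. The other
        -- two are the new rectangles; if one of them contains no edge, `Box` vanishes, `monge`
        -- becomes an equality, and `dominate` applies there too.
        covered' : ∀ i j → LEG i ≡ 1 → LEG j ≡ 2 → Below (λ v → best (s' v)) (C i j) ⊎
            (b' i ≡ b' j × a' i ≢ 0 × (¬ HasEdge b' (b' i) → Below (λ v → best (s' v)) (C i j)))
        covered' i j li lj = aux (covered i j li lj)
          where
          i≢0 = leg1≢0 li
          j≢0 = leg2≢0 lj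
          aux : Below (λ v → best (s₀ v)) (C i j) ⊎ (b i ≡ b j × a i ≢ 0) → _
          aux (inj₁ (v , lv , le)) = inj₁ (v , lv , ≤-trans (≤-reflexive (β≡ v)) (≤-trans (best≤ v) le))
          aux (inj₂ (bij , ai)) with PV i ≟ 0
          -- Without a pivot the rectangle stays as it is and keeps its witness edge.
          ... | yes z = inj₂ (both-lo i j (sym bij) (λ u → proj₁ u z) (flat j j≢0 (sym bij)) , (λ y → ai (trans (sym (a'≡ i)) y)) ,
                  λ nh → ⊥-elim (nh (still (witness i i≢0 ai))))
            where
            flat : ∀ x → LEG x ≢ 0 → b x ≡ b i → ¬ Upper x
            flat x lx eq u = proj₁ u (trans (sym (pv-const i x i≢0 lx eq)) z)
            still : HasEdge b (b i) → HasEdge b' (b' i)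
            still (e , x , y , jn , lx , ly , bx , by) = e , x , y , jn , lx , ly ,
              sym (both-lo i x bx (λ u → proj₁ u z) (flat x (leg1≢0 lx) bx)) , sym (both-lo i y by (λ u → proj₁ u z) (flat y (leg2≢0 ly) by))
          ... | no nz = go (dec-Upper i) (dec-Upper j)
            where
            cl = column i i≢0 ai
            j* = proj₁ cl
            col = proj₂ cl
            open Column col renaming (lj to lj*; bj to bj*)
            open Pivot (pivot i i≢0 nz)
            p = PV i
            pq-j : PQ j ≡ POS j*
            pq-j = trans (sym (pq-const i j i≢0 ai j≢0 (sym bij))) pq
            nz-j : PV j ≢ 0
            nz-j = pv-nz i j i≢0 j≢0 (sym bij) nz
            up-i : Upper i → p < POS i
            up-i (_ , inj₁ (_ , lt)) = lt
            up-i (_ , inj₂ (l2 , _)) = case trans (sym li) l2 of λ ()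
            lo-i : ¬ Upper i → POS i ≤ p
            lo-i nu = ≮⇒≥ (λ lt → nu (nz , inj₁ (li , lt)))
            up-j : Upper j → POS j* < POS j
            up-j (_ , inj₂ (_ , lt)) = subst (_< POS j) pq-j lt
            up-j (_ , inj₁ (l1 , _)) = case trans (sym lj) l1 of λ ()
            lo-j : ¬ Upper j → POS j ≤ POS j*
            lo-j nu = ≮⇒≥ (λ lt → nu (nz-j , inj₂ (lj , subst (_< POS j) (sym pq-j) lt)))
            beaten : W (POS i) (POS j) + W p (POS j*) ≤ W (POS i) (POS j*) + W p (POS j) → Below (λ v → best (s' v)) (C i j)
            beaten ex = i , i≢0 , ≤-trans (≤-reflexive (β≡ i)) (≤-trans (rec i li refl nz) (dominate p li lj lj* (opt j lj (sym bij)) ex))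
            live : a' i ≢ 0
            live y = ai (trans (sym (a'≡ i)) y)
            row-class : ∀ x → LEG x ≡ 1 → ∀ {lo hi} → LEG lo ≡ 1 → LEG hi ≡ 1 → b lo ≡ b i → b hi ≡ b i → POS lo ≤ POS x → POS x ≤ POS hi → b x ≡ b i
            row-class x lx {lo} {hi} l₁ l₂ e₁' e₂' le₁ le₂ = ≤-antisym (≤-trans (mono x hi (trans lx (sym l₂)) (leg1≢0 lx) le₂) (≤-reflexive e₂')) (≤-trans (≤-reflexive (sym e₁')) (mono lo x (trans l₁ (sym lx)) (leg1≢0 l₁) le₁))
            col-class : ∀ x → LEG x ≡ 2 → ∀ {lo hi} → LEG lo ≡ 2 → LEG hi ≡ 2 → b lo ≡ b i → b hi ≡ b i → POS lo ≤ POS x → POS x ≤ POS hi → b x ≡ b i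
            col-class x lx {lo} {hi} l₁ l₂ e₁' e₂' le₁ le₂ = ≤-antisym (≤-trans (mono x hi (trans lx (sym l₂)) (leg2≢0 lx) le₂) (≤-reflexive e₂')) (≤-trans (≤-reflexive (sym e₁')) (mono lo x (trans l₁ (sym lx)) (leg2≢0 l₁) le₁))
            go : Dec (Upper i) → Dec (Upper j) → Below (λ v → best (s' v)) (C i j) ⊎
              (b' i ≡ b' j × a' i ≢ 0 × (¬ HasEdge b' (b' i) → Below (λ v → best (s' v)) (C i j)))
            go (no ni) (yes uj) = inj₁ (beaten (≤-trans (m≤m+n _ (Box (POS i) p (POS j*) (POS j))) (≤-reflexive (trans (sym (monge (POS i) p (POS j*) (POS j) (lo-i ni) (<⇒≤ (up-j uj)))) (+-comm (W p (POS j)) _)))))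
            go (yes ui) (no nj) = inj₁ (beaten (≤-trans (≤-reflexive (+-comm (W (POS i) (POS j)) _)) (≤-trans (m≤m+n _ (Box p (POS i) (POS j) (POS j*))) (≤-reflexive (sym (monge p (POS i) (POS j) (POS j*) (<⇒≤ (up-i ui)) (lo-j nj)))))))
            go (yes ui) (yes uj) = inj₂ (both-up i j i≢0 j≢0 (sym bij) ui uj , live , λ nh → beaten (≤-reflexive
                (trans (monge p (POS i) (POS j*) (POS j) (<⇒≤ (up-i ui)) (<⇒≤ (up-j uj)))
                  (trans (cong ((W p (POS j) + W (POS i) (POS j*)) +_) (Box-zero p (POS i) (POS j*) (POS j) (λ e x y jn lx ly x₁ x₂ y₁ y₂ → nh (inside e x y jn lx ly x₁ x₂ y₁ y₂))))
                    (trans (+-identityʳ _) (+-comm (W p (POS j)) _))))))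
              where
              inside : ∀ e x y → Joins e x y → LEG x ≡ 1 → LEG y ≡ 2 → p < POS x → POS x ≤ POS i → POS j* < POS y → POS y ≤ POS j → HasEdge b' (b' i)
              inside e x y jn lx ly x₁ x₂ y₁ y₂ = e , x , y , jn , lx , ly , sym (both-up i x i≢0 (leg1≢0 lx) bx ui ux) , sym (both-up i y i≢0 (leg2≢0 ly) by ui uy)
                where
                bx : b x ≡ b i
                bx = row-class x lx l-mid li b-mid refl (≤-trans (≤-reflexive (sym p-mid)) (<⇒≤ x₁)) x₂
                by : b y ≡ b i
                by = col-class y ly lj* lj bj* (sym bij) (<⇒≤ y₁) y₂
                ux : Upper x
                ux = pv-nz i x i≢0 (leg1≢0 lx) bx nz , inj₁ (lx , subst (_< POS x) (pv-const i x i≢0 (leg1≢0 lx) bx) x₁)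
                uy : Upper y
                uy = pv-nz i y i≢0 (leg2≢0 ly) by nz , inj₂ (ly , subst (_< POS y) (trans (sym pq) (pq-const i y i≢0 ai (leg2≢0 ly) by)) y₁)
            go (no ni) (no nj) = inj₂ (both-lo i j (sym bij) ni nj , live , λ nh → beaten (≤-reflexive
                (trans (+-comm (W (POS i) (POS j)) _) (trans (monge (POS i) p (POS j) (POS j*) (lo-i ni) (lo-j nj))
                  (trans (cong ((W (POS i) (POS j*) + W p (POS j)) +_) (Box-zero (POS i) p (POS j) (POS j*) (λ e x y jn lx ly x₁ x₂ y₁ y₂ → nh (inside e x y jn lx ly x₁ x₂ y₁ y₂))))
                    (+-identityʳ _))))))
              where
              inside : ∀ e x y → Joins e x y → LEG x ≡ 1 → LEG y ≡ 2 → POS i < POS x → POS x ≤ p → POS j < POS y → POS y ≤ POS j* → HasEdge b' (b' i)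
              inside e x y jn lx ly x₁ x₂ y₁ y₂ = e , x , y , jn , lx , ly , sym (both-lo i x bx ni nx) , sym (both-lo i y by ni ny)
                where
                bx : b x ≡ b i
                bx = row-class x lx li l-mid refl b-mid (<⇒≤ x₁) (≤-trans x₂ (≤-reflexive p-mid))
                by : b y ≡ b i
                by = col-class y ly lj lj* (sym bij) bj* (<⇒≤ y₁) y₂
                nx : ¬ Upper x
                nx (_ , inj₁ (_ , lt)) = <-irrefl refl (<-≤-trans (subst (_< POS x) (sym (pv-const i x i≢0 (leg1≢0 lx) bx)) lt) x₂)
                nx (_ , inj₂ (l2 , _)) = case trans (sym lx) l2 of λ ()
                ny : ¬ Upper y
                ny (_ , inj₂ (_ , lt)) = <-irrefl refl (<-≤-trans (subst (_< POS y) (trans (sym (pq-const i y i≢0 ai (leg2≢0 ly) by)) pq) lt) y₂)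
                ny (_ , inj₁ (l1 , _)) = case trans (sym ly) l1 of λ ()

        pre : PreInv t s'
        pre = record
          { frame = record { capped = capped-by (MaxSpec.res spec) ; legs = λ v → trans (keep leg (λ _ _ → refl) v) (legS v) ; ids = λ v → trans (keep nid (λ _ _ → refl) v) (trans (r-nid v) (ids v))
              ; ranks = λ v → trans (keep rk (λ _ _ → refl) v) (trans (r-rk v) (ranks v)) ; poss = λ v → trans (keep pos (λ _ _ → refl) v) (posS v)
              ; cuts = λ v lv → trans (keep cut (λ _ _ → refl) v) (trans (r-cut v) (cuts v lv)) }
          ; labels = labels'
          ; bests = record { bestX = λ v lv → subst (_≤ X v) (sym (β≡ v)) (Bests.bestX bests' v lv) ; sound = λ v lv → subst IsCut (sym (β≡ v)) (Bests.sound bests' v lv) }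
          ; covered = covered' }

      level : ∀ {t s s'} → LInv (suc t) s → Run K (levelProg H T (suc t)) s s' → LInv t s'
      level {t} {s} {s'} inv r = aux (Run-++ (coreProg H T (suc t)) r)
        where
        aux : (∃ λ s₁ → Run K (coreProg H T (suc t)) s s₁ × Run K (splitI ∷ checkI ∷ []) s₁ s') → LInv t s'
        aux (s₁ , rc , (sp ∷ ch ∷ [])) = Check.inv' t (Split.pre t inv (core-result inv rc) sp) ch

      -- Running all levels.

      module Solving (i₀ : Fin n) (li₀ : LEG i₀ ≡ 1) where

        H<2^K : H < 2 ^ K
        H<2^K = <-≤-trans (m<m+n H (≤-<-trans z≤n Ω<H)) H<K

        W00 : W 0 0 ≡ 0
        W00 = trans (W≡ 0 0) (EW-zero {λ a b → inA 1 0 a ∧ inA 2 0 b} (λ e i j _ → ¬true⇒false (λ p → none' i (proj₁ (∧-true {inA 1 0 i} p)))))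
          where
          none' : ∀ i → ¬ (inA 1 0 i ≡ true)
          none' i p = let (x , y) = ∧-true {LEG i ≡ᵇ 1} p in <-irrefl refl (<-≤-trans (POS≥1 i (leg1≢0 (≡ᵇ-sound x))) (≤ᵇ-sound {POS i} y))

        levels-run : ∀ t {s s'} → LInv t s → Run K (levels H T t) s s' → LInv 0 s'
        levels-run zero inv [] = inv
        levels-run (suc t) {s} {s'} inv r = aux (Run-++ (levelProg H T (suc t)) r)
          where
          aux : (∃ λ s₁ → Run K (levelProg H T (suc t)) s s₁ × Run K (levels H T t) s₁ s') → LInv 0 s'
          aux (s₁ , r₁ , r₂) = levels-run t (level inv r₁) r₂

        record Prepared (s : State) : Set where
          field
            frame : Frame s
            best≡ : ∀ v → LEG v ≢ 0 → best (s v) ≡ X v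
            bP0 : ∀ v → bP (s v) ≡ 0
            bQ0 : ∀ v → bQ (s v) ≡ 0
            kap0 : ∀ v → kap (s v) ≡ 0

        -- At the start there is one rectangle, with label `0`. If no edge joins the legs, the value
        -- of a pair is the sum of two single cuts, so a single cut already does at least as well.
        initial : ∀ {s s'} → Prepared s → MaxSem K (localI activateU) s s' → PreInv T s'
        initial {s} {s'} pr sem = record
          { frame = record { capped = proj₁ l ; legs = λ v → trans (cong leg (sh v)) (legs v) ; ids = λ v → trans (cong nid (sh v)) (ids v)
              ; ranks = λ v → trans (cong rk (sh v)) (ranks v) ; poss = λ v → trans (cong pos (sh v)) (poss v) ; cuts = λ v lv → trans (cong cut (sh v)) (cuts v lv) }
          ; labels = record
              { mono = λ u v _ _ _ → ≤-reflexive (trans (b0 u) (sym (b0 v)))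
              ; b<P = λ u l → subst (_< POS u) (sym (b0 u)) (POS≥1 u (leg1≢0 l))
              ; gapP = λ u v _ _ lt → ⊥-elim (<-irrefl (trans (b0 v) (sym (b0 u))) lt)
              ; q<Q = λ u l → subst (_< POS u) (sym (q0 u)) (POS≥1 u (leg2≢0 l))
              ; gapQ = λ u v _ _ lt → ⊥-elim (<-irrefl (trans (b0 v) (sym (b0 u))) lt)
              ; shareQ = λ u v _ _ _ → trans (q0 u) (sym (q0 v))
              ; shareA = λ u v _ _ _ → trans (a1 u) (sym (a1 v))
              ; kapW = λ u _ → trans (trans (cong kap (sh u)) (kap0 u)) (sym (trans (cong₂ W (b0 u) (q0 u)) W00))
              ; coverQ = λ u _ → i₀ , li₀ , trans (b0 i₀) (sym (b0 u))
              ; rank→ = λ u _ _ _ _ _ → Ranked.bound rkd u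
              ; rank← = λ u p _ _ _ _ → trans (b0 p) (sym (b0 u)) }
          ; bests = record { bestX = λ v lv → ≤-reflexive (β v lv) ; sound = λ v lv → inj₁ (v , lv , β v lv) }
          ; covered = λ i j li lj → inj₂ (trans (b0 i) (sym (b0 j)) , (λ z → case trans (sym (a1 i)) z of λ ()) , λ nh → i , leg1≢0 li , apart i j li lj nh) }
          where
          open Prepared pr
          open Frame frame
          l : Capped s' × (∀ v → s' v ≡ record (s v) { act = 1 })
          l = local-set (λ m x → record m { act = x }) (λ _ _ → refl) {activateU} (λ _ → 1) sem capped (λ _ → refl) (λ _ → 1<K)
          sh = proj₂ l
          b0 : ∀ v → bP (s' v) ≡ 0
          b0 v = trans (cong bP (sh v)) (bP0 v)
          q0 : ∀ v → bQ (s' v) ≡ 0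
          q0 v = trans (cong bQ (sh v)) (bQ0 v)
          a1 : ∀ v → act (s' v) ≡ 1
          a1 v = cong act (sh v)
          β : ∀ v → LEG v ≢ 0 → best (s' v) ≡ X v
          β v lv = trans (cong best (sh v)) (best≡ v lv)
          apart : ∀ i j → LEG i ≡ 1 → LEG j ≡ 2 → ¬ HasEdge (λ v → bP (s' v)) (bP (s' i)) → best (s' i) ≤ C i j
          apart i j li lj nh = ≤-trans (≤-reflexive (β i (leg1≢0 li))) (≤-trans (m≤m+n (X i) (X j)) (≤-reflexive (sym (trans (sym (+-identityʳ _)) (trans (cong (λ x → C i j + 2 * x) (sym W0)) (C-split i j li lj))))))
            where
            W0 : W (POS i) (POS j) ≡ 0
            W0 = trans (W≡ (POS i) (POS j)) (EW-zero {λ a b → inA 1 (POS i) a ∧ inA 2 (POS j) b} (λ e x y jn → ¬true⇒false (λ p →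
              let (p₁ , p₂) = ∧-true {inA 1 (POS i) x} p
                  lx = ≡ᵇ-sound (proj₁ (∧-true {LEG x ≡ᵇ 1} p₁))
                  ly = ≡ᵇ-sound (proj₁ (∧-true {LEG y ≡ᵇ 2} p₂))
              in nh (e , x , y , jn , lx , ly , trans (b0 x) (sym (b0 i)) , trans (b0 y) (sym (b0 i))))))

        finish : ∀ {s s'} → Capped s → (∀ v → leg (s v) ≡ LEG v) → Bests (λ v → best (s v)) →
          (∀ i j → LEG i ≡ 1 → LEG j ≡ 2 → Below (λ v → best (s v)) (C i j)) → MaxSem K (finalI H) s s' → ∀ v → Best (tmp (s' v))
        finish {s} {s'} cp legs bs cov sem v = subst Best (sym tmp≡) record { one = λ x lx → ≤-trans (least x lx) (Bests.bestX bs x lx)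
            ; two = λ i j li lj → let (x , lx , le) = cov i j li lj in ≤-trans (least x lx) le ; hit = Bests.sound bs u lu }
          where
          f-leg : ∀ x → LEG x ≢ 0 → finalF H (s x) ≡ H ∸ best (s x)
          f-leg x lx = cong (_▷ (H ∸ best (s x))) (nonzero-true (λ z → lx (trans (sym (legs x)) z)))
          f< : ∀ x → finalF H (s x) < 2 ^ K
          f< x = aux (not (leg (s x) ≡ᵇ 0))
            where
            aux : ∀ b → (b ▷ (H ∸ best (s x))) < 2 ^ K
            aux true = ≤-<-trans (m∸n≤m H (best (s x))) H<2^K
            aux false = 1≤2^ K
          spec : MaxSpec (finalI H) s (finalU H) s'
          spec = max-spec {λ w tr a b → tr} {finalF H} {finalU H} sem f<
          open MaxSpec spec
          best<H : ∀ x → LEG x ≢ 0 → best (s x) < H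
          best<H x lx = ≤-<-trans (≤-trans (Bests.bestX bs x lx) (≤-trans (X≤Ω x) Ω≤4Ω)) Ω<H
          ub' : ∀ x → LEG x ≢ 0 → H ∸ best (s x) ≤ Y v
          ub' x lx = subst (_≤ Y v) (f-leg x lx) (ub v x (connected v x))
          found : ∃ λ u → LEG u ≢ 0 × Y v ≡ H ∸ best (s u)
          found = aux (at' v)
            where
            aux : (∃ λ u → Comp (finalI H) s v u × Y v ≡ finalF H (s u)) → ∃ λ u → LEG u ≢ 0 × Y v ≡ H ∸ best (s u)
            aux (u , _ , e) with LEG u ≟ 0
            ... | no ne = u , ne , trans e (f-leg u ne)
            ... | yes z = ⊥-elim (<-irrefl refl (<-≤-trans (m<n⇒0<n∸m (best<H i₀ (leg1≢0 li₀))) (≤-trans (ub' i₀ (leg1≢0 li₀)) (≤-reflexive (trans e (cong (λ l → not (l ≡ᵇ 0) ▷ (H ∸ best (s u))) (trans (legs u) z)))))))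
          u = proj₁ found
          lu = proj₁ (proj₂ found)
          tmp≡ : tmp (s' v) ≡ best (s u)
          tmp≡ = trans (cong tmp (res v)) (trans (cap-id K (≤-<-trans (m∸n≤m H (Y v)) H<2^K)) (trans (cong (H ∸_) (proj₂ (proj₂ found))) (m∸[m∸n]≡n (<⇒≤ (best<H u lu)))))
          least : ∀ x → LEG x ≢ 0 → best (s u) ≤ best (s x)
          least x lx = subst₂ _≤_ (m∸[m∸n]≡n (<⇒≤ (best<H u lu))) (m∸[m∸n]≡n (<⇒≤ (best<H x lx))) (∸-monoʳ-≤ H (≤-trans (ub' x lx) (≤-reflexive (proj₂ (proj₂ found)))))

        solve-run : ∀ {s s'} → Prepared s → Run K (solveProg H T) s s' → ∀ v → Best (tmp (s' v))
        solve-run {s} {s'} pr (_∷_ loc (_∷_ {s' = s₂} ch r)) = first (Run-++ (levels H T T) r)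
          where
          inv₂ : LInv T s₂
          inv₂ = Check.inv' T (initial pr loc) ch
          second : ∀ {s₃} → LInv 0 s₃ → (∃ λ s₄ → Run K (coreProg H T 0) s₃ s₄ × Run K (finalI H ∷ []) s₄ s') → ∀ v → Best (tmp (s' v))
          second inv₃ (s₄ , rc , (fin ∷ [])) = let cr = core-result inv₃ rc in
            finish (CoreResult.capd cr) (λ v → trans (CoreResult.r-leg cr v) (Frame.legs (LInv.frame inv₃) v)) (CoreResult.bests' cr) (final-pass inv₃ cr) fin
          first : (∃ λ s₃ → Run K (levels H T T) s₂ s₃ × Run K (coreProg H T 0 ++ finalI H ∷ []) s₃ s') → ∀ v → Best (tmp (s' v))
          first (s₃ , rl , r') = second (levels-run T inv₂ rl) (Run-++ (coreProg H T 0) r')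

    module Main (H : ℕ) (Ω<H : 4 * ∑ w < H) (H<K : H + H ≤ 2 ^ K) (ℓ : ℕ)
      (small-id : ∀ v → suc (ident v) < 2 ^ suc ℓ) (n<ℓ : n < 2 ^ suc ℓ) (ℓ≤K : 2 ^ suc ℓ ≤ 2 ^ K)
      (τ< : length (rankMS (suc ℓ) (suc ℓ) 0) + 0 < 2 ^ K) (i₀ : Fin n) (li₀ : LEG i₀ ≡ 1) where

      xs : List MS
      xs = rankMS (suc ℓ) (suc ℓ) 0
      τ : ℕ
      τ = length xs

      POS≤n : ∀ v → POS v ≤ n
      POS≤n v with LEG v ≟ 0
      ... | yes z = ≤-trans (≤-reflexive (trans (cong POS (root-LEG v z)) POS-root)) z≤n
      ... | no ne = ≤-trans (≤-reflexive (sym (count v ne))) (≤-trans (∑-≤ (λ u → aux ((LEG u ≡ᵇ LEG v) ∧ (POS u ≤ᵇ POS v)))) (≤-reflexive (trans (∑-const n 1) (*-identityʳ n))))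
        where
        aux : ∀ b → (b ▷ 1) ≤ 1
        aux true = ≤-refl
        aux false = z≤n

      record Ready (s : State) : Set where
        field
          basis : Base s
          rk0 : ∀ v → rk (s v) ≡ 0
          bP0 : ∀ v → bP (s v) ≡ 0
          bQ0 : ∀ v → bQ (s v) ≡ 0
          kap0 : ∀ v → kap (s v) ≡ 0

      prepared : ∀ {s s₁ s₂ R} (rkd : Ranked τ R) → Base s → (∀ v → rk (s v) ≡ R v) → (∀ v → bP (s v) ≡ 0) → (∀ v → bQ (s v) ≡ 0) → (∀ v → kap (s v) ≡ 0) →
        Run K (posProg τ) s s₁ → Run K (cutProg τ) s₁ s₂ → Levels.Solving.Prepared H Ω<H H<K τ R rkd i₀ li₀ s₂
      prepared {s} {s₁} {s₂} {R} rkd bs rks b0 q0 k0 r₁ r₂ = record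
        { frame = record { capped = proj₁ c ; legs = λ v → trans (cong leg (sh v)) (Base.legs bs v) ; ids = λ v → trans (cong nid (sh v)) (Base.ids bs v)
            ; ranks = λ v → trans (cong rk (sh v)) (rks v) ; poss = λ v → cong pos (sh v) ; cuts = λ v lv → trans (cong cut (sh v)) (val≡ v lv) }
        ; best≡ = λ v lv → trans (cong best (sh v)) (val≡ v lv)
        ; bP0 = λ v → trans (cong bP (sh v)) (b0 v) ; bQ0 = λ v → trans (cong bQ (sh v)) (q0 v) ; kap0 = λ v → trans (cong kap (sh v)) (k0 v) }
        where
        n<K : n < 2 ^ K
        n<K = <-≤-trans n<ℓ ℓ≤K
        Ω<K : 4 * ∑ w < 2 ^ K
        Ω<K = <-≤-trans Ω<H (≤-trans (m≤m+n H H) H<K)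
        p = Values.pos-spec n<K Ω<K τ R rkd bs rks b0 r₁
        sh₁ = proj₂ (proj₂ (proj₂ p))
        bs₁ : Base s₁
        bs₁ = record { capped = proj₁ p ; legs = λ v → trans (cong leg (sh₁ v)) (Base.legs bs v) ; ids = λ v → trans (cong nid (sh₁ v)) (Base.ids bs v) }
        c = Values.cut-spec n<K Ω<K τ R rkd bs₁ (λ v → trans (cong rk (sh₁ v)) (rks v)) (λ v → trans (cong bP (sh₁ v)) (b0 v)) (λ v → cong pos (sh₁ v)) r₂
        cv : Fin n → ℕ
        cv = proj₁ (proj₂ (proj₂ (proj₂ c)))
        val≡ : ∀ v → LEG v ≢ 0 → cv v ≡ X v
        val≡ = proj₂ (proj₂ (proj₂ (proj₂ (proj₂ c))))
        sh : ∀ v → s₂ v ≡ record (s v) { val = proj₁ (proj₂ (proj₂ c)) v ; acc = proj₁ (proj₂ c) v ; pos = POS v ; cut = cv v ; best = cv v }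
        sh v = trans (proj₁ (proj₂ (proj₂ (proj₂ (proj₂ c)))) v) (cong (λ m → record m { val = proj₁ (proj₂ (proj₂ c)) v ; acc = proj₁ (proj₂ c) v ; cut = cv v ; best = cv v }) (sh₁ v))

      main-run : ∀ {s s'} → Ready s → Run K (mainProg H xs) s s' → ∀ v → Best (tmp (s' v))
      main-run {s} {s'} rd r = first (Run-++ (mergeProg 0 xs) r)
        where
        open Ready rd
        third : ∀ {s₁ s₂} → Base s₁ × MRun 0 xs (λ v → rk (s v)) (λ v → rk (s₁ v)) × (∀ v → s₁ v ≡ record (s v) { rk = rk (s₁ v) }) →
          Run K (posProg τ) s₁ s₂ → (∃ λ s₃ → Run K (cutProg τ) s₂ s₃ × Run K (solveProg H τ) s₃ s') → ∀ v → Best (tmp (s' v))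
        third {s₁} (bs₁ , mr , sh) rp (s₃ , rc , rs) = Levels.Solving.solve-run H Ω<H H<K τ (λ v → rk (s₁ v)) rkd i₀ li₀
            (prepared rkd bs₁ (λ _ → refl) (λ v → trans (cong bP (sh v)) (bP0 v)) (λ v → trans (cong bQ (sh v)) (bQ0 v)) (λ v → trans (cong kap (sh v)) (kap0 v)) rp rc) rs
          where
          rkd : Ranked τ (λ v → rk (s₁ v))
          rkd = ranked {ℓ} {suc ℓ} (λ v → <-trans (n<1+n _) (small-id v)) (λ v → ≤-<-trans (POS≤n v) n<ℓ) rk0 mr
        second : ∀ {s₁} → Run K (mergeProg 0 xs) s s₁ → (∃ λ s₂ → Run K (posProg τ) s₁ s₂ × Run K (cutProg τ ++ solveProg H τ) s₂ s') → ∀ v → Best (tmp (s' v))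
        second rm (s₂ , rp , r') = third (merge-run xs 0 (λ v → <-≤-trans (small-id v) ℓ≤K) τ< basis rm) rp (Run-++ (cutProg τ) r')
        first : (∃ λ s₁ → Run K (mergeProg 0 xs) s s₁ × Run K (posProg τ ++ cutProg τ ++ solveProg H τ) s₁ s') → ∀ v → Best (tmp (s' v))
        first (s₁ , rm , r') = second rm (Run-++ (posProg τ) r')

-- From coordinates back to paths.

module Answer (I : Instance) (loopfree : ∀ e → InstanceDefs.e₁ I e ≢ InstanceDefs.e₂ I e) (r : Fin (Instance.n I)) (ps qs : List (Fin (Instance.n I)))
  (sp : InstanceDefs.Spider I r ps qs)
  (noPar : ∀ e f → e ≢ f → ¬ InstanceDefs.Joins I f (InstanceDefs.e₁ I e) (InstanceDefs.e₂ I e))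
  (ident-inj : ∀ {u v} → Instance.ident I u ≡ Instance.ident I v → u ≡ v) where
  open InstanceDefs I
  open FromSpider I r ps qs sp

  private
    X = Theory.X I loopfree legs noPar ident-inj
    C = Theory.C I loopfree legs noPar ident-inj
    cut₁≡ = Theory.cut₁≡ I loopfree legs noPar ident-inj
    cut₂≡ = Theory.cut₂≡ I loopfree legs noPar ident-inj
    cut₁! = Theory.cut₁! I loopfree legs noPar ident-inj
    cut₂! = Theory.cut₂! I loopfree legs noPar ident-inj

  answer : ∀ x → Theory.Best I loopfree legs noPar ident-inj x → IsAnswer r ps qs x
  answer x b = one' , two' , hit'
    where
    open Theory.Best b
    one' : ∀ e → PathEdge (r ∷ ps) e ⊎ PathEdge (r ∷ qs) e → ∀ y → Cut₁ e y → x ≤ y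
    one' e p y c = subst (x ≤_) (sym (cut₁≡ e te y c)) (one (e₂ e) (Legs.tree-child legs e te))
      where te = [ proj₁ , proj₁ ]′ p
    two' : ∀ e f → PathEdge (r ∷ ps) e → PathEdge (r ∷ qs) f → ∀ y → Cut₂ e f y → x ≤ y
    two' e f p q y c = subst (x ≤_) (sym (cut₂≡ e f (proj₁ p) (proj₁ q) y c)) (two (e₂ e) (e₂ f) (legP (childP e p)) (legQ (childQ f q)))
    hit' : (∃ λ e → (PathEdge (r ∷ ps) e ⊎ PathEdge (r ∷ qs) e) × Cut₁ e x)
       ⊎ (∃ λ e → ∃ λ f → PathEdge (r ∷ ps) e × PathEdge (r ∷ qs) f × Cut₂ e f x)
    hit' with hit
    ... | inj₁ (v , ne , refl) = let (e , te , eq) = Legs.up legs v ne in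
      inj₁ (e , onLegs e te , subst (λ v → Cut₁ e (X v)) eq (cut₁! e te))
    ... | inj₂ (u , v , lu , lv , refl) =
      let (e , te , eq) = Legs.up legs u (λ z → case trans (sym lu) z of λ ())
          (f , tf , eq') = Legs.up legs v (λ z → case trans (sym lv) z of λ ()) in
      inj₂ (e , f , leg1⇔ e te (trans (cong LEG eq) lu) , leg2⇔ f tf (trans (cong LEG eq') lv) ,
        subst₂ (λ a b → Cut₂ e f (C a b)) eq eq' (cut₂! e f te tf))

-- The numbering found by the nodes may exchange the two paths; the problem is symmetric in them.
IsAnswer-swap : ∀ I r ps qs x → InstanceDefs.IsAnswer I r qs ps x → InstanceDefs.IsAnswer I r ps qs x
IsAnswer-swap I r ps qs x (one , two , hit) =
  (λ e p → one e (swap p)) , (λ e f p q y c → two f e q p y (sym₂ c)) , hit' hit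
  where
  open InstanceDefs I
  swap : ∀ {A B : Set} → A ⊎ B → B ⊎ A
  swap (inj₁ a) = inj₂ a
  swap (inj₂ b) = inj₁ b
  Xor-sym : ∀ {A B : Set} → Xor A B → Xor B A
  Xor-sym (inj₁ (a , b)) = inj₂ (b , a)
  Xor-sym (inj₂ (a , b)) = inj₁ (b , a)
  sym₂ : ∀ {e f y} → Cut₂ e f y → Cut₂ f e y
  sym₂ (χ , eqv , eq) = χ , (λ g → mk⇔ (Xor-sym ∘ to (eqv g)) (from (eqv g) ∘ Xor-sym)) , eq
  hit' : _ → _
  hit' (inj₁ (e , p , c)) = inj₁ (e , swap p , c)
  hit' (inj₂ (e , f , p , q , c)) = inj₂ (f , e , q , p , sym₂ c)

Spider-swap : ∀ I r ps qs → InstanceDefs.Spider I r ps qs → InstanceDefs.Spider I r qs ps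
Spider-swap I r ps qs sp = descQ , descP , uniq' , cov , λ e t → [ inj₂ , inj₁ ]′ (onLegs e t)
  where
  open InstanceDefs I
  open FromSpider I r ps qs sp
  uniq' : Unique (r ∷ qs ++ ps)
  uniq' = All.tabulate (λ x∈ eq → r∉ (flip (subst (_∈ qs ++ ps) (sym eq) x∈))) AP.∷ UniqueP.++⁺ uQ uP (λ { (q , p) → disj p q })
    where
    flip : ∀ {v} → v ∈ qs ++ ps → v ∈ ps ++ qs
    flip p = [ ∈-++⁺ʳ ps , ∈-++⁺ˡ ]′ (∈-++⁻ qs p)
  cov : ∀ v → v ∈ r ∷ qs ++ ps
  cov v with locate v
  ... | atRoot eq = here eq
  ... | inP p = there (∈-++⁺ʳ qs p)
  ... | inQ p = there (∈-++⁺ˡ p)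

-- Number of rounds and length of messages.

rankOf : ℕ → List MS
rankOf M = rankMS (suc ⌊log₂ (suc M) ⌋) (suc ⌊log₂ (suc M) ⌋) 0

-- 2 ^ hOf d M exceeds all identifiers, ranks and sums of weights, if M is the maximal identifier.
hOf : ℕ → ℕ → ℕ
hOf d M = suc ⌊log₂ (suc M) ⌋ * (2 + d) + (length (rankOf M) + 4)

-- One bit more than needed for `H` itself, since measures may reach almost twice `H`.
Kof : ℕ → ℕ → ℕ
Kof d M = suc (hOf d M)

schedule : ℕ → ℕ → List Instr
schedule d M = wholeProg (2 ^ hOf d M) (rankOf M)

length-bits : ∀ ℓ → length (bitsMS ℓ) ≡ ℓ + ℓ
length-bits zero = refl
length-bits (suc ℓ) = cong suc (trans (cong suc (length-bits ℓ)) (sym (+-suc ℓ ℓ)))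

length-rank : ∀ ℓ s t → length (rankMS ℓ s t) ≡ s * (ℓ + ℓ + 2)
length-rank ℓ zero t = refl
length-rank ℓ (suc s) t = trans (length-++ (phaseMS ℓ t)) (cong₂ _+_ (trans (length-++ (bitsMS ℓ)) (cong (_+ 2) (length-bits ℓ))) (length-rank ℓ s _))

length-merge : ∀ t xs → length (mergeProg t xs) ≡ length xs
length-merge t [] = refl
length-merge t (x ∷ xs) = cong suc (length-merge (suc t) xs)

length-suf : ∀ T → length (sufProg T) ≡ suc T
length-suf T = cong suc (go 1 T)
  where
  go : ∀ t k → length (sufSteps t k) ≡ k
  go t zero = refl
  go t (suc k) = cong suc (go (suc t) k)

length-suf++ : ∀ T (ys : List Instr) → length (sufProg T ++ ys) ≡ suc T + length ys
length-suf++ T ys = trans (length-++ (sufProg T)) (cong (_+ length ys) (length-suf T))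

length-core : ∀ H T t → length (coreProg H T t) ≡ 2 + (suc T + (5 + (suc T + 1)))
length-core H T t = cong (2 +_) (trans (length-suf++ T (coreTail H T)) (cong (λ k → suc T + (5 + k)) (length-suf++ T (localI recU ∷ []))))

length-levels : ∀ H T t → length (levels H T t) ≡ t * ((2 + (suc T + (5 + (suc T + 1)))) + 2)
length-levels H T zero = refl
length-levels H T (suc t) = trans (length-++ (levelProg H T (suc t))) (cong₂ _+_
  (trans (length-++ (coreProg H T (suc t))) (cong (_+ 2) (length-core H T (suc t)))) (length-levels H T t))

-- The quadratic term comes from the levels: there are `length xs` of them, each with two suffix
-- sums of about that length.
length-whole : ∀ H xs → length (wholeProg H xs) ≡ 2 * (length xs * length xs) + 18 * length xs + 25
length-whole H xs = trans (cong (3 +_) (trans (length-++ (mergeProg 0 xs)) (cong₂ _+_ (length-merge 0 xs)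
    (trans (length-++ (posProg T)) (cong₂ _+_ (cong suc (length-suf++ T (localI (λ m → record m { pos = if leg m ≡ᵇ 0 then 0 else acc m }) ∷ [])))
    (trans (length-++ (cutProg T)) (cong₂ _+_ (cong suc (trans (length-suf++ T (localI (λ m → record m { cut = acc m }) ∷ edgeI innerZ setVal ∷ sufProg T
        ++ localI (λ m → record m { cut = cut m ∸ acc m ; best = cut m ∸ acc m }) ∷ [])) (cong (λ k → suc T + (2 + k)) (length-suf++ T (localI (λ m → record m { cut = cut m ∸ acc m ; best = cut m ∸ acc m }) ∷ [])))))
      (cong (2 +_) (trans (length-++ (levels H T T)) (cong₂ _+_ (length-levels H T T) (trans (length-++ (coreProg H T 0)) (cong (_+ 1) (length-core H T 0)))))))))))))
  (solve 1 (λ t → cst 3 :+ (t :+ ((cst 1 :+ ((cst 1 :+ t) :+ cst 1)) :+ ((cst 1 :+ ((cst 1 :+ t) :+ (cst 2 :+ ((cst 1 :+ t) :+ cst 1)))) :+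
      (cst 2 :+ (t :* ((cst 2 :+ ((cst 1 :+ t) :+ (cst 5 :+ ((cst 1 :+ t) :+ cst 1)))) :+ cst 2) :+ ((cst 2 :+ ((cst 1 :+ t) :+ (cst 5 :+ ((cst 1 :+ t) :+ cst 1)))) :+ cst 1))))))
      := cst 2 :* (t :* t) :+ cst 18 :* t :+ cst 25) refl T)
  where
  open +-*-Solver renaming (con to cst)
  T = length xs

module Sizes (d M : ℕ) where
  x u : ℕ
  x = suc ⌊log₂ (suc M) ⌋
  u = x * x

  T : ℕ
  T = length (rankOf M)

  x≤u : x ≤ u
  x≤u = m≤m*n x x

  1≤u : 1 ≤ u
  1≤u = ≤-trans (s≤s z≤n) x≤u

  u≤uu : u ≤ u * u
  u≤uu = ≤-trans (≤-reflexive (sym (*-identityʳ u))) (*-monoʳ-≤ u 1≤u)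

  1≤uu : 1 ≤ u * u
  1≤uu = ≤-trans 1≤u u≤uu

  T≤4u : T ≤ 4 * u
  T≤4u = ≤-trans (≤-reflexive (length-rank x x 0)) (≤-trans (*-monoʳ-≤ x (+-monoʳ-≤ (x + x) (+-mono-≤ {1} {x} {1} {x} (s≤s z≤n) (s≤s z≤n))))
    (≤-reflexive (solve 1 (λ x → x :* ((x :+ x) :+ (x :+ x)) := cst 4 :* (x :* x)) refl x)))
    where open +-*-Solver renaming (con to cst)

  -- After `T≤4u` the coefficients add up to `6 * 16 + 54 * 4 + 77`.
  rounds : 2 + 3 * length (schedule d M) ≤ 389 * (u * u)
  rounds = begin
    2 + 3 * length (schedule d M) ≡⟨ cong (λ k → 2 + 3 * k) (length-whole (2 ^ hOf d M) (rankOf M)) ⟩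
    2 + 3 * (2 * (T * T) + 18 * T + 25) ≡⟨ solve 1 (λ t → cst 2 :+ cst 3 :* (cst 2 :* (t :* t) :+ cst 18 :* t :+ cst 25) := cst 6 :* (t :* t) :+ cst 54 :* t :+ cst 77 :* cst 1) refl T ⟩
    6 * (T * T) + 54 * T + 77 * 1 ≤⟨ +-mono-≤ (+-mono-≤ (*-monoʳ-≤ 6 (*-mono-≤ T≤4u T≤4u)) (*-monoʳ-≤ 54 (≤-trans T≤4u (*-monoʳ-≤ 4 u≤uu)))) (*-monoʳ-≤ 77 1≤uu) ⟩
    6 * ((4 * u) * (4 * u)) + 54 * (4 * (u * u)) + 77 * (u * u) ≡⟨ solve 1 (λ u → cst 6 :* ((cst 4 :* u) :* (cst 4 :* u)) :+ cst 54 :* (cst 4 :* (u :* u)) :+ cst 77 :* (u :* u) := cst 389 :* (u :* u)) refl u ⟩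
    389 * (u * u) ∎
    where
    open ≤-Reasoning
    open +-*-Solver renaming (con to cst)

  -- The summand `11` collects `2` from the exponent of `n`, `4` from `T≤4u` and `5` from the
  -- additive constants of `hOf` and `Kof`.
  width : regs * Kof d M ≤ (17 * (d + 11)) * (u * u)
  width = begin
    17 * suc (x * (2 + d) + (T + 4)) ≡⟨ solve 3 (λ x d t → cst 17 :* (cst 1 :+ (x :* (cst 2 :+ d) :+ (t :+ cst 4))) := cst 17 :* (x :* (cst 2 :+ d) :+ t :+ cst 5 :* cst 1)) refl x d T ⟩
    17 * (x * (2 + d) + T + 5 * 1) ≤⟨ *-monoʳ-≤ 17 (+-mono-≤ (+-mono-≤ (*-monoˡ-≤ (2 + d) x≤u) T≤4u) (*-monoʳ-≤ 5 1≤u)) ⟩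
    17 * (u * (2 + d) + 4 * u + 5 * u) ≡⟨ solve 2 (λ u d → cst 17 :* (u :* (cst 2 :+ d) :+ cst 4 :* u :+ cst 5 :* u) := (cst 17 :* (d :+ cst 11)) :* u) refl u d ⟩
    (17 * (d + 11)) * u ≤⟨ *-monoʳ-≤ (17 * (d + 11)) u≤uu ⟩
    (17 * (d + 11)) * (u * u) ∎
    where
    open ≤-Reasoning
    open +-*-Solver renaming (con to cst)

-- `plog` uses one number both as coefficient and as exponent, so that number has to dominate both;
-- their sum does.
quartic : ∀ a e d L x .{{_ : NonZero L}} → x ≤ e * L ^ d →
  a * (x * x * (x * x)) ≤ (a * (e * e * (e * e)) + (d + d + (d + d))) * L ^ (a * (e * e * (e * e)) + (d + d + (d + d)))
quartic a e d L x x≤ = begin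
  a * (x * x * (x * x)) ≤⟨ *-monoʳ-≤ a (*-mono-≤ (*-mono-≤ x≤ x≤) (*-mono-≤ x≤ x≤)) ⟩
  a * (e * L ^ d * (e * L ^ d) * (e * L ^ d * (e * L ^ d))) ≡⟨ solve 3 (λ a e p → a :* ((e :* p) :* (e :* p) :* ((e :* p) :* (e :* p))) := (a :* (e :* e :* (e :* e))) :* (p :* p :* (p :* p))) refl a e (L ^ d) ⟩
  a * (e * e * (e * e)) * (L ^ d * L ^ d * (L ^ d * L ^ d)) ≡⟨ cong (a * (e * e * (e * e)) *_) (trans (cong (λ z → z * z) (sym (^-distribˡ-+-* L d d))) (sym (^-distribˡ-+-* L (d + d) (d + d)))) ⟩
  a * (e * e * (e * e)) * L ^ (d + d + (d + d)) ≤⟨ *-mono-≤ (m≤m+n (a * (e * e * (e * e))) (d + d + (d + d))) (^-monoʳ-≤ L (m≤n+m (d + d + (d + d)) (a * (e * e * (e * e))))) ⟩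
  (a * (e * e * (e * e)) + (d + d + (d + d))) * L ^ (a * (e * e * (e * e)) + (d + d + (d + d))) ∎
  where
  open ≤-Reasoning
  open +-*-Solver

slope : ℕ → ℕ
slope d = 389 + 17 * (d + 11)

constant : ℕ → ℕ
constant d = slope d * (suc d * suc d * (suc d * suc d)) + (d + d + (d + d))

module _ (d n M : ℕ) (M< : M < 2 ^ plog d n) where
  open Sizes d M using (x; u)
  private
    L c : ℕ
    L = suc ⌊log₂ n ⌋
    c = constant d
    4d≤c : d + d + (d + d) ≤ c
    4d≤c = m≤n+m _ (slope d * (suc d * suc d * (suc d * suc d)))
    1≤L^d : 1 ≤ L ^ d
    1≤L^d = m^n>0 L d
    -- `M` need not be polynomial in `n`, but its length is at most `plog d n`; the extra `1` in `x`
    -- is absorbed by a further `L ^ d`.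
    x≤ : x ≤ suc d * L ^ d
    x≤ = +-mono-≤ 1≤L^d (subst (⌊log₂ (suc M) ⌋ ≤_) (⌊log₂[2^n]⌋≡n (plog d n)) (⌊log₂⌋-mono-≤ {suc M} {2 ^ plog d n} M<))

  plog-mono : plog d n ≤ plog c n
  plog-mono = *-mono-≤ d≤c (^-monoʳ-≤ L d≤c)
    where
    d≤c : d ≤ c
    d≤c = ≤-trans (≤-trans (m≤m+n d d) (m≤m+n (d + d) (d + d))) 4d≤c

  slope-fits : ∀ {k} → k ≤ slope d * (u * u) → k ≤ plog c n
  slope-fits le = ≤-trans le (quartic (slope d) (suc d) d L x x≤)

  rounds-fit : 2 + 3 * length (schedule d M) ≤ plog c n
  rounds-fit = slope-fits (≤-trans (Sizes.rounds d M) (*-monoˡ-≤ (u * u) (m≤m+n 389 (17 * (d + 11)))))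

  width-fits : regs * Kof d M ≤ plog c n
  width-fits = slope-fits (≤-trans (Sizes.width d M) (*-monoˡ-≤ (u * u) (m≤n+m (17 * (d + 11)) 389)))

n<2^n : ∀ k → k < 2 ^ k
n<2^n zero = s≤s z≤n
n<2^n (suc k) = +-mono-≤ (1≤2^ k) (≤-trans (n<2^n k) (≤-reflexive (sym (+-identityʳ _))))

two-nodes : ∀ {n} → 2 ≤ n → ∃ λ (u : Fin n) → ∃ λ v → u ≢ v
two-nodes (s≤s (s≤s _)) = zero , suc zero , λ ()

-- Assembling the parameters and the run.

module Solve (d : ℕ) (I : Instance) (valid : InstanceDefs.Valid I d) (r : Fin (Instance.n I)) (ps qs : List (Fin (Instance.n I)))
  (sp : InstanceDefs.Spider I r ps qs) (tr : TraceDefs.Trace (Kof d) (schedule d) I) where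
  open InstanceDefs I
  open Semantics I

  2≤n = proj₁ valid
  ident-inj : ∀ {u v} → ident u ≡ ident v → u ≡ v
  ident-inj = proj₁ (proj₂ valid)
  ident< = proj₁ (proj₂ (proj₂ valid))
  loopfree : ∀ e → e₁ e ≢ e₂ e
  loopfree = proj₁ (proj₂ (proj₂ (proj₂ valid)))
  noPar : ∀ e f → e ≢ f → ¬ Joins f (e₁ e) (e₂ e)
  noPar = proj₁ (proj₂ (proj₂ (proj₂ (proj₂ valid))))
  weights = proj₂ (proj₂ (proj₂ (proj₂ (proj₂ valid))))

  lg : Legs I
  lg = FromSpider.legs I r ps qs sp
  open Legs lg using (LEG; root-LEG; connected)

  open Execute (Kof d) (schedule d) I loopfree connected r tr public

  M<2^ : M < 2 ^ plog d n
  M<2^ = let (v , e) = M-ident in subst (_< 2 ^ plog d n) (sym e) (ident< v)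

  ℓ : ℕ
  ℓ = ⌊log₂ (suc M) ⌋
  h = hOf d M

  -- Distinct identifiers, all at most `M`, inject the nodes into `suc M` values; this is how `M`
  -- replaces the unknown `n`.
  n≤M : n ≤ suc M
  n≤M = F.injective⇒≤ {f = λ v → fromℕ< (s≤s (ident≤M v))} (λ {u} {v} e → ident-inj (F.fromℕ<-injective (ident u) (ident v) _ _ e))

  n<2^ : n < 2 ^ suc ℓ
  n<2^ = ≤-<-trans n≤M (n<2^sL (suc M))

  -- Without parallel edges, an edge is determined by its ordered pair of ends.
  m≤n² : m ≤ n * n
  m≤n² = F.injective⇒≤ {f = λ e → combine (e₁ e) (e₂ e)} (λ {e} {f} eq → inj e f (F.combine-injective (e₁ e) (e₂ e) (e₁ f) (e₂ f) eq))
    where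
    inj : ∀ e f → e₁ e ≡ e₁ f × e₂ e ≡ e₂ f → e ≡ f
    inj e f (p , q) with e F.≟ f
    ... | yes eq = eq
    ... | no ne = ⊥-elim (noPar e f ne (inj₁ (sym p , sym q)))

  ℓ≤h : suc ℓ ≤ h
  ℓ≤h = ≤-trans (m≤m*n (suc ℓ) (2 + d)) (m≤m+n (suc ℓ * (2 + d)) _)

  -- At most `n * n` edges of weight at most `n ^ d` give the exponent `2 + d`. The factor `4` takes
  -- two of the four spare bits in `hOf`, and the others leave room for strictness.
  Ω<H : 4 * ∑ w < 2 ^ h
  Ω<H = begin-strict
    4 * ∑ w ≤⟨ *-monoʳ-≤ 4 (≤-trans (∑-≤ (λ e → proj₂ (weights e))) (≤-reflexive (∑-const m (n ^ d)))) ⟩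
    4 * (m * n ^ d) ≤⟨ *-monoʳ-≤ 4 (*-monoˡ-≤ (n ^ d) m≤n²) ⟩
    4 * (n * n * n ^ d) ≡⟨ cong (4 *_) (*-assoc n n (n ^ d)) ⟩
    4 * n ^ (2 + d) ≤⟨ *-monoʳ-≤ 4 (^-monoˡ-≤ (2 + d) (<⇒≤ n<2^)) ⟩
    4 * (2 ^ suc ℓ) ^ (2 + d) ≡⟨ cong (4 *_) (^-*-assoc 2 (suc ℓ) (2 + d)) ⟩
    4 * 2 ^ a ≡⟨ trans (*-comm 4 (2 ^ a)) (sym (^-distribˡ-+-* 2 a 2)) ⟩
    2 ^ (a + 2) <⟨ ^-monoʳ-< 2 (s≤s (s≤s z≤n)) (+-monoʳ-< a (<-≤-trans (s≤s (s≤s (s≤s z≤n))) (m≤n+m 4 (length (rankOf M))))) ⟩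
    2 ^ h ∎
    where
    open ≤-Reasoning
    a = suc ℓ * (2 + d)

  small-id : ∀ v → suc (ident v) < 2 ^ suc ℓ
  small-id v = ≤-<-trans (s≤s (ident≤M v)) (n<2^sL (suc M))

  T≤h : length (rankOf M) ≤ h
  T≤h = ≤-trans (m≤m+n (length (rankOf M)) 4) (m≤n+m _ (suc ℓ * (2 + d)))

  T<2^K : length (rankOf M) + 0 < 2 ^ K
  T<2^K = subst (_< 2 ^ K) (sym (+-identityʳ _)) (<-≤-trans (n<2^n (length (rankOf M))) (2^-mono (length (rankOf M)) K (m≤n⇒m≤1+n T≤h)))

  nonroot : ∃ λ v → LEG v ≢ 0
  nonroot with two-nodes 2≤n
  ... | u , v , ne with LEG u ≟ 0
  ... | no nz = u , nz
  ... | yes z = v , λ z' → ne (trans (root-LEG u z) (sym (root-LEG v z')))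

  K≥ : 2 < 2 ^ K
  K≥ = <-≤-trans (≤-<-trans (s≤s (s≤s (z≤n {0}))) (s≤s (s≤s (s≤s z≤n)))) (2^-mono 2 K (s≤s (≤-trans (s≤s z≤n) ℓ≤h)))

  answer : ∀ v → IsAnswer r ps qs (tmp (ms len v))
  answer v = go runAll
    where
    s₀ = ms 0
    sₙ = ms len
    go : Run K (wholeProg (2 ^ h) (rankOf M)) s₀ sₙ → IsAnswer r ps qs (tmp (sₙ v))
    go (_∷_ m₁ (_∷_ m₂ (_∷_ {s' = s₃} m₃ rest))) = decide (orient ms₀ m₁ m₂ m₃)
      where
      open Theory.AtWidth.FindLegs I loopfree lg noPar ident-inj K K≥ (λ v → <-≤-trans (<-trans (n<1+n _) (small-id v)) (2^-mono (suc ℓ) K (m≤n⇒m≤1+n ℓ≤h))) (proj₁ nonroot) (proj₂ nonroot)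
      Λ' : Fin n → ℕ
      Λ' = Λ ms₀ m₁ m₂ m₃
      st : ∀ v → s₃ v ≡ record (mem₀ (ident v)) { leg = Λ' v ; tmp = τ ms₀ m₁ m₂ m₃ v }
      st = state₃ ms₀ m₁ m₂ m₃
      run-with : ∀ (lg' : Legs I) → (∀ v → Λ' v ≡ Legs.LEG lg' v) → Theory.Best I loopfree lg' noPar ident-inj (tmp (sₙ v))
      run-with lg' eq = Theory.AtWidth.Main.main-run I loopfree lg' noPar ident-inj K (2 ^ h) Ω<H (≤-reflexive (cong (2 ^ h +_) (sym (+-identityʳ _)))) ℓ small-id n<2^ (2^-mono (suc ℓ) K (m≤n⇒m≤1+n ℓ≤h)) T<2^K v⁺ (trans (sym (eq v⁺)) (one ms₀ m₁ m₂ m₃))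
          record { basis = record { capped = λ v → subst (λ m → capM K m ≡ m) (sym (st v)) (capped₃ ms₀ m₁ m₂ m₃ v) ; legs = λ v → trans (cong leg (st v)) (eq v) ; ids = λ v → cong nid (st v) }
                 ; rk0 = λ v → cong rk (st v) ; bP0 = λ v → cong bP (st v) ; bQ0 = λ v → cong bQ (st v) ; kap0 = λ v → cong kap (st v) } rest v
        where v⁺ = v* ms₀ m₁ m₂ m₃
      decide : (∀ v → Λ' v ≡ LEG v) ⊎ (∀ v → Λ' v ≡ swapLeg (LEG v)) → IsAnswer r ps qs (tmp (sₙ v))
      decide (inj₁ same) = Answer.answer I loopfree r ps qs sp noPar ident-inj _ (run-with lg same)
      -- The same run is analysed once more in the coordinates in which the two paths are exchanged,
      -- and the answer is exchanged back.
      decide (inj₂ swapped) = IsAnswer-swap I r ps qs _ (Answer.answer I loopfree r qs ps sp' noPar ident-inj _ (run-with lg'' (λ v → trans (swapped v) (flip v))))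
        where
        sp' = Spider-swap I r ps qs sp
        lg'' = FromSpider.legs I r qs ps sp'
        module A = FromSpider I r ps qs sp
        module B = FromSpider I r qs ps sp'
        flip : ∀ v → swapLeg (LEG v) ≡ Legs.LEG lg'' v
        flip v with A.locate v
        ... | A.atRoot refl = trans (cong swapLeg A.leg0) (sym B.leg0)
        ... | A.inP p = trans (cong swapLeg (A.legP p)) (sym (B.legQ p))
        ... | A.inQ p = trans (cong swapLeg (A.legQ p)) (sym (B.legP p))

theorem6p1 : (d : ℕ) → Σ Algorithm λ A → Σ ℕ λ c →
    (I : Instance) → InstanceDefs.Valid I d →
    (r : Fin (Instance.n I)) → (ps qs : List (Fin (Instance.n I))) →
    InstanceDefs.Spider I r ps qs →
    (ex : ExecDefs.Execution A I) →
    ExecDefs.BitBounded A I (plog c (Instance.n I)) ex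
    × ExecDefs.Solves A I (InstanceDefs.IsAnswer I r ps qs) (plog c (Instance.n I)) ex
theorem6p1 d = Compile.algorithm (Kof d) (schedule d) , constant d , proof
  where
  proof : (I : Instance) → InstanceDefs.Valid I d →
    (r : Fin (Instance.n I)) → (ps qs : List (Fin (Instance.n I))) →
    InstanceDefs.Spider I r ps qs →
    (ex : ExecDefs.Execution (Compile.algorithm (Kof d) (schedule d)) I) →
    ExecDefs.BitBounded (Compile.algorithm (Kof d) (schedule d)) I (plog (constant d) (Instance.n I)) ex
    × ExecDefs.Solves (Compile.algorithm (Kof d) (schedule d)) I (InstanceDefs.IsAnswer I r ps qs) (plog (constant d) (Instance.n I)) ex
  proof I valid r ps qs sp ex =
      (consBound , (λ t e _ → aggBound t e) , λ t x y x< y< → opBound b (round t) x y x< y< , opBound b (round t) x y x< y<)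
    , (λ t v x e → subst (InstanceDefs.IsAnswer I r ps qs) (out-sound t v x e) (answer v))
    , base len , ≤-trans (≤-reflexive (base≡ len)) (rounds-fit d n M M<2^) , λ v → tmp (ms len v) , out-final v
    where
    open Solve d I valid r ps qs sp (TraceDefs.fromExecution (Kof d) (schedule d) I ex)
    n = Instance.n I
    b = plog (constant d) n
    17K≤b : regs * K ≤ b
    17K≤b = width-fits d n M M<2^
    open Bits b (<-≤-trans M<2^ (2^-mono (plog d n) b (plog-mono d n M M<2^))) 17K≤b
      (≤-trans (+-mono-≤ {1} {K} {K} {16 * K} (s≤s z≤n) (m≤m+n K (15 * K))) 17K≤b)
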